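{- Let $\lambda$ be a nonzero partition with $s$ distinct nonzero parts, let $(R_1,\dots,R_s)$ be its rectangular filtration, and put $f_i=Q_{R_i}$ ($1\le i\le s$), the dual Jack function of the rectangular partition $R_i$. Then there is $c'_\lambda(\alpha)\in\mathbb{Q}(\alpha)\setminus\{0\}$ such that $$Q_\lambda=c'_\lambda(\alpha)\,\Big(\cdots\big((f_s^{*}\cdot f_{s-1})^{*}\cdot f_{s-2}\big)^{*}\cdots\cdot f_2\Big)^{*}\cdot f_1 .$$ The right-hand side is computed from the inside out: first $g_{s-1}=f_s^*\cdot f_{s-1}$, then $g_{s-2}=g_{s-1}^*\cdot f_{s-2}$, and so on, ending with $g_1=g_2^*\cdot f_1$. For $s=1$ the expression is just $f_1$.
   Context: Let $\Lambda_F$ be the ring of symmetric functions over $F=\mathbb{Q}(\alpha)$, with $\alpha$ an indeterminate. It carries the scalar product $\langle p_\lambda,p_\mu\rangle=\delta_{\lambda\mu}z_\lambda\alpha^{l(\lambda)}$, where $p_\lambda$ are power sums and $z_\lambda=\prod_i i^{m_i}m_i!$. The Jack function $P_\lambda$ (parameter $\alpha$) is the unique symmetric function of the form $m_\lambda+\sum_{\mu<\lambda}c_{\lambda\mu}m_\mu$ (dominance order) such that the $P_\lambda$ are pairwise orthogonal. Set $Q_\lambda=\langle P_\lambda,P_\lambda\rangle^{ -1}P_\lambda$. For a symmetric function $f$, $f^*$ denotes the adjoint, with respect to this scalar product, of the operator of multiplication by $f$. We write $f^*\cdot g$ for $f^*$ applied to $g$. For partitions, $(r^s)$ denotes the rectangle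 with $s$ parts equal to $r$. If $\nu\subset(r^s)$, write $\nu=(\nu_1,\dots,\nu_s)$ padded with zeros and define the complement $(r^s)-'\nu=(r-\nu_s,r-\nu_{s-1},\dots,r-\nu_1)$, with zero parts dropped. For a nonzero partition $\lambda$ put $\mathfrak{R}(\lambda)=(\lambda_1^{\,l(\lambda)})$ and $\mathfrak{C}(\lambda)=\mathfrak{R}(\lambda)-'\lambda$. If $\lambda$ has $s$ distinct nonzero parts, its rectangular filtration is $(R_1,\dots,R_s)$, where $R_i=\mathfrak{R}(\mathfrak{C}^{i-1}(\lambda))$ and $\mathfrak{C}^0(\lambda)=\lambda$. -}

module Defs where

open import Data.Nat as ℕ using (ℕ; zero; suc; _≤ᵇ_; _∸_; _!; _^_)
open import Data.Rational as ℚ using (ℚ; 0ℚ; 1ℚ)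
import Data.Integer as ℤ
open import Data.Rational.Properties as ℚP using ()
open import Data.List using (List; []; _∷_; _++_; map; foldr; filter; length; reverse; replicate; take; deduplicate; concatMap)
open import Data.List.Properties using (≡-dec)
open import Data.Nat.ListAction using (sum)
open import Data.List.Relation.Unary.All using (All; all?)
open import Data.List.Relation.Unary.Linked using (Linked)
open import Data.Bool using (Bool; true; false; if_then_else_)
open import Data.Product using (Σ; _×_; _,_; proj₁; proj₂)
open import Data.Empty using (⊥)
open import Relation.Nullary using (¬_; yes; no; does)
open import Relation.Binary.PropositionalEquality using (_≡_; _≢_)

-- Polynomials in α over ℚ: coefficient lists, constant term first.
Poly : Set
Poly = List ℚ

ZeroP : Poly → Set
ZeroP p = All (_≡ 0ℚ) p

infixl 6 _+P_
infixl 7 _*P_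

_+P_ : Poly → Poly → Poly
[] +P q = q
(a ∷ p) +P [] = a ∷ p
(a ∷ p) +P (b ∷ q) = (a ℚ.+ b) ∷ (p +P q)

scaleP : ℚ → Poly → Poly
scaleP a = map (a ℚ.*_)

negP : Poly → Poly
negP = map (λ a → ℚ.- a)

_*P_ : Poly → Poly → Poly
[] *P q = []
(a ∷ p) *P q = scaleP a q +P (0ℚ ∷ (p *P q))

record RatFun : Set where
  constructor frac
  field
    num : Poly
    den : Poly
    den≢0 : ¬ ZeroP den
open RatFun public

constP : ℚ → Poly
constP a = a ∷ []

0F : RatFun
0F = frac [] (constP 1ℚ) λ { (px All.∷ _) → ℚP.1≢0 px }
  where import Data.List.Relation.Unary.All as All

1F : RatFun
1F = frac (constP 1ℚ) (constP 1ℚ) λ { (px All.∷ _) → ℚP.1≢0 px }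
  where import Data.List.Relation.Unary.All as All

αF : RatFun
αF = frac (0ℚ ∷ 1ℚ ∷ []) (constP 1ℚ) λ { (px All.∷ _) → ℚP.1≢0 px }
  where import Data.List.Relation.Unary.All as All

-- build n/d; the fallback branch (d = 0) is never reached by the
-- operations below, since ℚ[α] is an integral domain.
mkF : Poly → Poly → RatFun
mkF n d with all? (ℚP._≟ 0ℚ) d
... | yes _ = 0F
... | no d≢0 = frac n d d≢0

infix 4 _≈F_
_≈F_ : RatFun → RatFun → Set
x ≈F y = ZeroP (num x *P den y +P negP (num y *P den x))

infixl 6 _+F_
infixl 7 _*F_

_+F_ : RatFun → RatFun → RatFun
x +F y = mkF (num x *P den y +P num y *P den x) (den x *P den y)

_*F_ : RatFun → RatFun → RatFun
x *F y = mkF (num x *P num y) (den x *P den y)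

-- inverse (with the convention 0⁻¹ = 0)
invF : RatFun → RatFun
invF x with all? (ℚP._≟ 0ℚ) (num x)
... | yes _ = 0F
... | no n≢0 = frac (den x) (num x) n≢0

ℕtoF : ℕ → RatFun
ℕtoF n = frac (constP (ℤ.+ n ℚ./ 1)) (constP 1ℚ) λ { (px All.∷ _) → ℚP.1≢0 px }
  where import Data.List.Relation.Unary.All as All

powF : RatFun → ℕ → RatFun
powF x zero = 1F
powF x (suc n) = x *F powF x n

sumF : List RatFun → RatFun
sumF = foldr _+F_ 0F

IsPartition : List ℕ → Set
IsPartition μ = All (1 ℕ.≤_) μ × Linked ℕ._≥_ μ

insertD : ℕ → List ℕ → List ℕ
insertD x [] = x ∷ []
insertD x (y ∷ ys) = if y ≤ᵇ x then x ∷ y ∷ ys else y ∷ insertD x ys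

norm : List ℕ → List ℕ
norm μ = foldr insertD [] (filter (1 ℕ.≤?_) μ)

distinctParts : List ℕ → List ℕ
distinctParts μ = deduplicate ℕ._≟_ (norm μ)

mult : ℕ → List ℕ → ℕ
mult i μ = length (filter (i ℕ.≟_) μ)

zee : List ℕ → ℕ
zee μ = foldr (λ i r → (i ^ mult i μ) ℕ.* (mult i μ !) ℕ.* r) 1 (distinctParts μ)

Dominated : List ℕ → List ℕ → Set
Dominated μ la = (sum μ ≡ sum la) × (∀ k → sum (take k μ) ℕ.≤ sum (take k la))

-- Symmetric functions over F, as finite formal sums Σ c · p_μ
-- (power-sum expansions; the list μ is read through 'norm').

Sym : Set
Sym = List (RatFun × List ℕ)

pS : List ℕ → Sym
pS μ = (1F , μ) ∷ []

coeffP : List ℕ → Sym → RatFun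
coeffP ν f = sumF (map (λ t → if does (≡-dec ℕ._≟_ (norm (proj₂ t)) ν) then proj₁ t else 0F) f)

infix 4 _≈S_
_≈S_ : Sym → Sym → Set
f ≈S g = ∀ ν → coeffP ν f ≈F coeffP ν g

infixl 6 _+S_
_+S_ : Sym → Sym → Sym
_+S_ = _++_

infixl 7 _·S_
_·S_ : RatFun → Sym → Sym
c ·S f = map (λ t → (c *F proj₁ t , proj₂ t)) f

infixl 7 _*S_
_*S_ : Sym → Sym → Sym
f *S g = concatMap (λ t → map (λ u → (proj₁ t *F proj₁ u , proj₂ t ++ proj₂ u)) g) f

pairP : List ℕ → List ℕ → RatFun
pairP μ ν = if does (≡-dec ℕ._≟_ (norm μ) (norm ν))
            then ℕtoF (zee (norm μ)) *F powF αF (length (norm μ))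
            else 0F

⟨_,_⟩ : Sym → Sym → RatFun
⟨ f , g ⟩ = sumF (concatMap (λ t → map (λ u → proj₁ t *F proj₁ u *F pairP (proj₂ t) (proj₂ u)) g) f)

IsAdjointApp : Sym → Sym → Sym → Set
IsAdjointApp f g h = ∀ k → ⟨ f *S k , g ⟩ ≈F ⟨ k , h ⟩

-- number of maps φ from the parts of μ to the positions of the list caps
-- with Σ_{φ(j)=i} μ_j = caps_i, i.e. the coefficient of x^caps in p_μ
countFill : List ℕ → List ℕ → ℕ
countFill [] caps = if does (all? (ℕ._≟ 0) caps) then 1 else 0
countFill (m ∷ μ) caps = go caps []
  where
  go : List ℕ → List ℕ → ℕ
  go [] before = 0
  go (c ∷ after) before =
    (if m ≤ᵇ c then countFill μ (reverse before ++ (c ∸ m) ∷ after) else 0)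
    ℕ.+ go after (c ∷ before)

-- coefficient of m_λ in f (λ a partition) = coefficient of x^λ
coeffM : List ℕ → Sym → RatFun
coeffM la f = sumF (map (λ t → proj₁ t *F ℕtoF (countFill (norm (proj₂ t)) la)) f)

IsJackFamily : (List ℕ → Sym) → Set
IsJackFamily P =
  (∀ la → IsPartition la → coeffM la (P la) ≈F 1F) ×
  (∀ la μ → IsPartition la → IsPartition μ → μ ≢ la → ¬ Dominated μ la →
     coeffM μ (P la) ≈F 0F) ×
  (∀ la μ → IsPartition la → IsPartition μ → la ≢ μ → ⟨ P la , P μ ⟩ ≈F 0F)

Qof : (List ℕ → Sym) → List ℕ → Sym
Qof P la = invF ⟨ P la , P la ⟩ ·S P la

headOr0 : List ℕ → ℕ
headOr0 [] = 0
headOr0 (x ∷ _) = x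

padTo : ℕ → List ℕ → List ℕ
padTo s ν = ν ++ replicate (s ∸ length ν) 0

complementIn : ℕ → ℕ → List ℕ → List ℕ
complementIn r s ν = filter (1 ℕ.≤?_) (map (r ∸_) (reverse (padTo s ν)))

rectOf : List ℕ → List ℕ
rectOf la = replicate (length la) (headOr0 la)

compl : List ℕ → List ℕ
compl la = complementIn (headOr0 la) (length la) la

filtrationAux : ℕ → List ℕ → List (List ℕ)
filtrationAux zero la = []
filtrationAux (suc k) la = rectOf la ∷ filtrationAux k (compl la)

rectFiltration : List ℕ → List (List ℕ)
rectFiltration la = filtrationAux (length (distinctParts la)) la

-- Nested adjoint expression
-- NestedAdj (f_1 ∷ … ∷ f_s ∷ []) g  means
--   g ≈ (⋯((f_s* · f_{s-1})* · f_{s-2})* ⋯ · f_2)* · f_1 ,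
-- i.e. g_s = f_s, g_i = g_{i+1}* · f_i, g = g_1.
NestedAdj : List Sym → Sym → Set
NestedAdj [] g = ⊥
NestedAdj (f ∷ []) g = g ≈S f
NestedAdj (f ∷ f' ∷ fs) g = Σ Sym λ g' → NestedAdj (f' ∷ fs) g' × IsAdjointApp g' f g

{-# OPTIONS --safe #-}
-- P_λ is an eigenfunction of the Laplace–Beltrami operator D, because D is self-adjoint and triangular on monomial symmetric
-- functions. In finitely many variables, a table of coefficients satisfying the eigenvalue equation is determined by its
-- leading coefficient. Inverting the variables and multiplying by (x₁⋯x_s)^N, or extracting the coefficient of the highest
-- power of one variable, again gives such a table: the first turns P_λ into P of the complement of λ, the second into P of
-- λ without its first row. These two symmetries reduce ⟨ P_μ P_κ , P_R ⟩, for a rectangle R, to smaller rectangles, and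
-- show that it is nonzero exactly when κ is the complement of μ in R. Since the P_κ span, Q_{R-'λ}* · Q_R is a nonzero
-- multiple of Q_λ. The filtration of λ is its rectangle followed by the filtration of its complement, which has one
-- distinct part less, so the theorem follows by induction on the number of distinct parts.
module Submission where

open import Defs
open import Level using (0ℓ)
open import Algebra.Bundles using (CommutativeRing)
open import Algebra.Bundles.Raw using (RawRing)
import Algebra.Solver.Ring as RingSolver
open import Algebra.Solver.Ring.AlmostCommutativeRing using (fromCommutativeRing; _-Raw-AlmostCommutative⟶_)
import Algebra.Solver.Ring.NaturalCoefficients.Default as NatSolver
open import Data.Bool as Bool using (Bool; true; false; if_then_else_)
open import Data.Empty using (⊥; ⊥-elim)
open import Data.Fin as Fin using (Fin; zero; suc)
open import Data.Integer as ℤ using (ℤ; +_; -[1+_]; _⊖_; 0ℤ)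
import Data.Integer.Properties as ℤP
import Data.Integer.Solver as ℤSolver
open import Data.List as List using (List; []; _∷_; _++_; map; foldr; filter; length; take; replicate; reverse; deduplicate; concatMap)
import Data.List.Properties as ListP
open import Data.List.Membership.Propositional using (_∈_; _∉_)
import Data.List.Membership.Propositional.Properties as ∈P
import Data.List.Membership.Propositional.Properties.WithK as ∈K
import Data.List.Relation.Binary.BagAndSetEquality as Bag
open import Data.List.Relation.Binary.Permutation.Propositional as ↭ using (_↭_; ↭⇒↭ₛ)
import Data.List.Relation.Binary.Permutation.Propositional.Properties as ↭P
import Data.List.Relation.Binary.Pointwise as Pointwise
open import Data.List.Relation.Unary.All as All using (All; []; _∷_; all?)
import Data.List.Relation.Unary.All.Properties as AllP
open import Data.List.Relation.Unary.AllPairs as AllPairs using (AllPairs; []; _∷_)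
import Data.List.Relation.Unary.AllPairs.Properties as AllPairsP
open import Data.List.Relation.Unary.Any using (here; there)
open import Data.List.Relation.Unary.Linked as Linked using (Linked; []; [-]; _∷_)
import Data.List.Relation.Unary.Linked.Properties as LinkedP
import Data.List.Relation.Unary.Sorted.TotalOrder.Properties as Sorted
open import Data.List.Relation.Unary.Unique.Propositional using (Unique)
import Data.List.Relation.Unary.Unique.Propositional.Properties as UniqueP
open import Data.Maybe using (Maybe; just; nothing)
open import Data.Nat as ℕ using (ℕ; zero; suc; _∸_; _^_; _!; _≤ᵇ_)
import Data.Nat.Properties as ℕP
import Data.Nat.Solver as ℕSolver
open import Data.Nat.Induction using (<-wellFounded)
open import Data.Nat.ListAction using () renaming (sum to sumℕ)
import Data.Nat.ListAction.Properties as SumP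
open import Data.Product using (Σ; _×_; _,_; proj₁; proj₂)
open import Data.Rational as ℚ using (ℚ; 0ℚ; 1ℚ)
import Data.Rational.Properties as ℚP
import Data.Rational.Unnormalised as ℚᵘ
import Data.Rational.Unnormalised.Properties as ℚᵘP
open import Data.Sum as Sum using (_⊎_; inj₁; inj₂; [_,_]′)
open import Data.Unit using (⊤; tt)
open import Data.Vec as Vec using (Vec; []; _∷_; lookup; zipWith; toList; fromList)
import Data.Vec.Properties as VecP
open import Function using (_∘_; _∋_; mk⇔)
open import Induction.WellFounded using (Acc; acc)
open import Relation.Binary using (Setoid; IsEquivalence; DecidableEquality)
import Relation.Binary.Construct.Flip.EqAndOrd as Flip
open import Relation.Binary.PropositionalEquality as ≡ using (_≡_; _≢_; cong; cong₂; subst; module ≡-Reasoning)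
import Relation.Binary.Reasoning.Setoid as SetoidReasoning
open import Relation.Nullary using (¬_; yes; no; does; Dec)
import Relation.Nullary.Decidable as Dec
open import Relation.Nullary.Decidable using (_×-dec_; _⊎-dec_; ¬?)
open import Relation.Unary using (Decidable)
import Data.List.Relation.Unary.Unique.DecPropositional.Properties ℕ._≟_ as DecUnique

-- Two difficulties shape the proof. First, `D` contains divisions by x_a - x_b, which make no sense
-- for a table of coefficients not known to come from a symmetric function, such as one with
-- inverted or truncated exponents. So the quotient is carried along as data (`pairs`), tied to the
-- table by the equation with denominators cleared (`Relation`) and by vanishing at negative
-- exponents; exponents are integers, so that inversion needs no Laurent polynomials. Second,
-- eigenvalues are not compared by explicit formulas. They have the form `α * ι m + ι n`, with m the
-- value of `quad` at the leading exponent, and by `α-free` two of them differ as soon as these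
-- values do. For this, dominance matters only because `quad` is strictly monotone along it.
-- Partitions with equal `quad` are not separated in this way, so uniqueness asks for agreement on
-- that level as a separate hypothesis. Both symmetries live in a fixed number of variables, the
-- scalar product does not; Newton's identity and expansions supported on narrow or tall partitions
-- pass between the two.

module ℤS = ℤSolver.+-*-Solver
module ℕS = ℕSolver.+-*-Solver

-- Polynomials and rational functions

coe : Poly → ℕ → ℚ
coe [] n = 0ℚ
coe (a ∷ p) zero = a
coe (a ∷ p) (suc n) = coe p n

infix 4 _≋_
-- Lists that differ by trailing zeros denote the same polynomial, so equality is tested coefficient
-- by coefficient. The record lets unification recover `p` and `q`.
record _≋_ (p q : Poly) : Set where
  constructor mk≋
  field at : ∀ n → coe p n ≡ coe q n
open _≋_

ZeroP⇒coe : ∀ {p} → ZeroP p → ∀ n → coe p n ≡ 0ℚ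
ZeroP⇒coe [] n = ≡.refl
ZeroP⇒coe (e ∷ z) zero = e
ZeroP⇒coe (e ∷ z) (suc n) = ZeroP⇒coe z n

coe⇒ZeroP : ∀ p → (∀ n → coe p n ≡ 0ℚ) → ZeroP p
coe⇒ZeroP [] h = []
coe⇒ZeroP (a ∷ p) h = h 0 ∷ coe⇒ZeroP p (λ n → h (suc n))

coe-+P : ∀ p q n → coe (p +P q) n ≡ coe p n ℚ.+ coe q n
coe-+P [] q n = ≡.sym (ℚP.+-identityˡ _)
coe-+P (a ∷ p) [] n = ≡.sym (ℚP.+-identityʳ _)
coe-+P (a ∷ p) (b ∷ q) zero = ≡.refl
coe-+P (a ∷ p) (b ∷ q) (suc n) = coe-+P p q n

coe-scaleP : ∀ a p n → coe (scaleP a p) n ≡ a ℚ.* coe p n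
coe-scaleP a [] n = ≡.sym (ℚP.*-zeroʳ a)
coe-scaleP a (b ∷ p) zero = ≡.refl
coe-scaleP a (b ∷ p) (suc n) = coe-scaleP a p n

coe-negP : ∀ p n → coe (negP p) n ≡ ℚ.- coe p n
coe-negP [] n = ≡.refl
coe-negP (b ∷ p) zero = ≡.refl
coe-negP (b ∷ p) (suc n) = coe-negP p n

≋-refl : ∀ {p} → p ≋ p
≋-refl = mk≋ λ n → ≡.refl

≋-sym : ∀ {p q} → p ≋ q → q ≋ p
≋-sym e = mk≋ λ n → ≡.sym (at e n)

≋-trans : ∀ {p q r} → p ≋ q → q ≋ r → p ≋ r
≋-trans e f = mk≋ λ n → ≡.trans (at e n) (at f n)

≋-isEquivalence : IsEquivalence _≋_
≋-isEquivalence = record { refl = ≋-refl ; sym = ≋-sym ; trans = ≋-trans }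

≋-setoid : Setoid 0ℓ 0ℓ
≋-setoid = record { isEquivalence = ≋-isEquivalence }

module ≋R = SetoidReasoning ≋-setoid

cons-cong : ∀ {a b p q} → a ≡ b → p ≋ q → (a ∷ p) ≋ (b ∷ q)
cons-cong e f = mk≋ λ { zero → e ; (suc n) → at f n }

+P-cong : ∀ {p p' q q'} → p ≋ p' → q ≋ q' → (p +P q) ≋ (p' +P q')
+P-cong {p} {p'} {q} {q'} e f = mk≋ λ n →
  ≡.trans (coe-+P p q n) (≡.trans (cong₂ ℚ._+_ (at e n) (at f n)) (≡.sym (coe-+P p' q' n)))

scaleP-cong : ∀ a {p q} → p ≋ q → scaleP a p ≋ scaleP a q
scaleP-cong a {p} {q} e = mk≋ λ n →
  ≡.trans (coe-scaleP a p n) (≡.trans (cong (a ℚ.*_) (at e n)) (≡.sym (coe-scaleP a q n)))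

+P-comm : ∀ p q → (p +P q) ≋ (q +P p)
+P-comm p q = mk≋ λ n → ≡.trans (coe-+P p q n) (≡.trans (ℚP.+-comm (coe p n) (coe q n)) (≡.sym (coe-+P q p n)))

+P-assoc : ∀ p q r → ((p +P q) +P r) ≋ (p +P (q +P r))
+P-assoc p q r = mk≋ λ n → begin
  coe ((p +P q) +P r) n              ≡⟨ coe-+P (p +P q) r n ⟩
  coe (p +P q) n ℚ.+ coe r n         ≡⟨ cong (ℚ._+ coe r n) (coe-+P p q n) ⟩
  coe p n ℚ.+ coe q n ℚ.+ coe r n    ≡⟨ ℚP.+-assoc (coe p n) (coe q n) (coe r n) ⟩
  coe p n ℚ.+ (coe q n ℚ.+ coe r n)  ≡⟨ cong (coe p n ℚ.+_) (coe-+P q r n) ⟨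
  coe p n ℚ.+ coe (q +P r) n         ≡⟨ coe-+P p (q +P r) n ⟨
  coe (p +P (q +P r)) n              ∎
  where open ≡-Reasoning

+P-identityʳ : ∀ p → (p +P []) ≋ p
+P-identityʳ p = mk≋ λ n → ≡.trans (coe-+P p [] n) (ℚP.+-identityʳ _)

negP-inverseʳ : ∀ p → (p +P negP p) ≋ []
negP-inverseʳ p = mk≋ λ n → ≡.trans (coe-+P p (negP p) n)
  (≡.trans (cong (coe p n ℚ.+_) (coe-negP p n)) (ℚP.+-inverseʳ (coe p n)))

negP-cong : ∀ {p q} → p ≋ q → negP p ≋ negP q
negP-cong {p} {q} e = mk≋ λ n → ≡.trans (coe-negP p n) (≡.trans (cong ℚ.-_ (at e n)) (≡.sym (coe-negP q n)))

+P-interchange : ∀ p q r s → ((p +P q) +P (r +P s)) ≋ ((p +P r) +P (q +P s))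
+P-interchange p q r s = begin
  (p +P q) +P (r +P s)  ≈⟨ +P-assoc p q (r +P s) ⟩
  p +P (q +P (r +P s))  ≈⟨ +P-cong (≋-refl {p}) (+P-assoc q r s) ⟨
  p +P ((q +P r) +P s)  ≈⟨ +P-cong (≋-refl {p}) (+P-cong (+P-comm q r) ≋-refl) ⟩
  p +P ((r +P q) +P s)  ≈⟨ +P-cong (≋-refl {p}) (+P-assoc r q s) ⟩
  p +P (r +P (q +P s))  ≈⟨ +P-assoc p r (q +P s) ⟨
  (p +P r) +P (q +P s)  ∎
  where open ≋R

scaleP-distribˡ : ∀ a p q → scaleP a (p +P q) ≋ (scaleP a p +P scaleP a q)
scaleP-distribˡ a p q = mk≋ λ n → begin
  coe (scaleP a (p +P q)) n                  ≡⟨ coe-scaleP a (p +P q) n ⟩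
  a ℚ.* coe (p +P q) n                       ≡⟨ cong (a ℚ.*_) (coe-+P p q n) ⟩
  a ℚ.* (coe p n ℚ.+ coe q n)                ≡⟨ ℚP.*-distribˡ-+ a (coe p n) (coe q n) ⟩
  a ℚ.* coe p n ℚ.+ a ℚ.* coe q n            ≡⟨ cong₂ ℚ._+_ (coe-scaleP a p n) (coe-scaleP a q n) ⟨
  coe (scaleP a p) n ℚ.+ coe (scaleP a q) n  ≡⟨ coe-+P (scaleP a p) (scaleP a q) n ⟨
  coe (scaleP a p +P scaleP a q) n           ∎
  where open ≡-Reasoning

scaleP-distribʳ : ∀ a b p → scaleP (a ℚ.+ b) p ≋ (scaleP a p +P scaleP b p)
scaleP-distribʳ a b p = mk≋ λ n → begin
  coe (scaleP (a ℚ.+ b) p) n                 ≡⟨ coe-scaleP (a ℚ.+ b) p n ⟩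
  (a ℚ.+ b) ℚ.* coe p n                      ≡⟨ ℚP.*-distribʳ-+ (coe p n) a b ⟩
  a ℚ.* coe p n ℚ.+ b ℚ.* coe p n            ≡⟨ cong₂ ℚ._+_ (coe-scaleP a p n) (coe-scaleP b p n) ⟨
  coe (scaleP a p) n ℚ.+ coe (scaleP b p) n  ≡⟨ coe-+P (scaleP a p) (scaleP b p) n ⟨
  coe (scaleP a p +P scaleP b p) n           ∎
  where open ≡-Reasoning

scaleP-scaleP : ∀ a b p → scaleP a (scaleP b p) ≋ scaleP (a ℚ.* b) p
scaleP-scaleP a b p = mk≋ λ n →
  ≡.trans (coe-scaleP a (scaleP b p) n) (≡.trans (cong (a ℚ.*_) (coe-scaleP b p n))
  (≡.trans (≡.sym (ℚP.*-assoc a b (coe p n))) (≡.sym (coe-scaleP (a ℚ.* b) p n))))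

scaleP-0 : ∀ p → scaleP 0ℚ p ≋ []
scaleP-0 p = mk≋ λ n → ≡.trans (coe-scaleP 0ℚ p n) (ℚP.*-zeroˡ (coe p n))

scaleP-1 : ∀ p → scaleP 1ℚ p ≋ p
scaleP-1 p = mk≋ λ n → ≡.trans (coe-scaleP 1ℚ p n) (ℚP.*-identityˡ (coe p n))

0∷-+P : ∀ p q → (0ℚ ∷ (p +P q)) ≋ ((0ℚ ∷ p) +P (0ℚ ∷ q))
0∷-+P p q = cons-cong (≡.sym (ℚP.+-identityˡ 0ℚ)) ≋-refl

0∷[] : (0ℚ ∷ []) ≋ []
0∷[] = mk≋ λ { zero → ≡.refl ; (suc n) → ≡.refl }

*P-zeroʳ : ∀ p → (p *P []) ≋ []
*P-zeroʳ [] = ≋-refl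
*P-zeroʳ (a ∷ p) = ≋-trans (cons-cong ≡.refl (*P-zeroʳ p)) 0∷[]

*P-congʳ : ∀ p {q r} → q ≋ r → (p *P q) ≋ (p *P r)
*P-congʳ [] e = ≋-refl
*P-congʳ (a ∷ p) e = +P-cong (scaleP-cong a e) (cons-cong ≡.refl (*P-congʳ p e))

-- The product recurses on its left factor; this is the matching recursion on the right factor, from
-- which commutativity follows by induction.
*P-cons : ∀ p b q → (p *P (b ∷ q)) ≋ (scaleP b p +P (0ℚ ∷ (p *P q)))
*P-cons [] b q = ≋-sym 0∷[]
*P-cons (a ∷ p) b q = cons-cong (cong (ℚ._+ 0ℚ) (ℚP.*-comm a b)) (begin
  scaleP a q +P (p *P (b ∷ q))                     ≈⟨ +P-cong ≋-refl (*P-cons p b q) ⟩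
  scaleP a q +P (scaleP b p +P (0ℚ ∷ (p *P q)))    ≈⟨ +P-assoc (scaleP a q) (scaleP b p) _ ⟨
  (scaleP a q +P scaleP b p) +P (0ℚ ∷ (p *P q))    ≈⟨ +P-cong (+P-comm (scaleP a q) (scaleP b p)) ≋-refl ⟩
  (scaleP b p +P scaleP a q) +P (0ℚ ∷ (p *P q))    ≈⟨ +P-assoc (scaleP b p) (scaleP a q) _ ⟩
  scaleP b p +P (scaleP a q +P (0ℚ ∷ (p *P q)))    ∎)
  where open ≋R

*P-comm : ∀ p q → (p *P q) ≋ (q *P p)
*P-comm [] q = ≋-sym (*P-zeroʳ q)
*P-comm (a ∷ p) q = ≋-trans (+P-cong (≋-refl {scaleP a q}) (cons-cong ≡.refl (*P-comm p q))) (≋-sym (*P-cons q a p))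

*P-cong : ∀ {p p' q q'} → p ≋ p' → q ≋ q' → (p *P q) ≋ (p' *P q')
*P-cong {p} {p'} {q} {q'} e f = begin
  p *P q    ≈⟨ *P-congʳ p f ⟩
  p *P q'   ≈⟨ *P-comm p q' ⟩
  q' *P p   ≈⟨ *P-congʳ q' e ⟩
  q' *P p'  ≈⟨ *P-comm q' p' ⟩
  p' *P q'  ∎
  where open ≋R

*P-distribʳ : ∀ r p q → ((p +P q) *P r) ≋ (p *P r +P q *P r)
*P-distribʳ r [] q = ≋-refl
*P-distribʳ r (a ∷ p) [] = ≋-sym (+P-identityʳ _)
*P-distribʳ r (a ∷ p) (b ∷ q) = begin
  scaleP (a ℚ.+ b) r +P (0ℚ ∷ (p +P q) *P r)
    ≈⟨ +P-cong (scaleP-distribʳ a b r) (≋-trans (cons-cong ≡.refl (*P-distribʳ r p q)) (0∷-+P (p *P r) (q *P r))) ⟩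
  (scaleP a r +P scaleP b r) +P ((0ℚ ∷ p *P r) +P (0ℚ ∷ q *P r))
    ≈⟨ +P-interchange (scaleP a r) (scaleP b r) _ _ ⟩
  (scaleP a r +P (0ℚ ∷ p *P r)) +P (scaleP b r +P (0ℚ ∷ q *P r)) ∎
  where open ≋R

*P-distribˡ : ∀ r p q → (r *P (p +P q)) ≋ (r *P p +P r *P q)
*P-distribˡ r p q = begin
  r *P (p +P q)     ≈⟨ *P-comm r (p +P q) ⟩
  (p +P q) *P r     ≈⟨ *P-distribʳ r p q ⟩
  p *P r +P q *P r  ≈⟨ +P-cong (*P-comm p r) (*P-comm q r) ⟩
  r *P p +P r *P q  ∎
  where open ≋R

scaleP-*P : ∀ a p q → (scaleP a p *P q) ≋ scaleP a (p *P q)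
scaleP-*P a [] q = ≋-refl
scaleP-*P a (b ∷ p) q = begin
  scaleP (a ℚ.* b) q +P (0ℚ ∷ scaleP a p *P q)
    ≈⟨ +P-cong (≋-sym (scaleP-scaleP a b q)) (cons-cong (≡.sym (ℚP.*-zeroʳ a)) (scaleP-*P a p q)) ⟩
  scaleP a (scaleP b q) +P scaleP a (0ℚ ∷ p *P q)
    ≈⟨ scaleP-distribˡ a (scaleP b q) (0ℚ ∷ p *P q) ⟨
  scaleP a (scaleP b q +P (0ℚ ∷ p *P q)) ∎
  where open ≋R

*P-assoc : ∀ p q r → ((p *P q) *P r) ≋ (p *P (q *P r))
*P-assoc [] q r = ≋-refl
*P-assoc (a ∷ p) q r = begin
  (scaleP a q +P (0ℚ ∷ p *P q)) *P r
    ≈⟨ *P-distribʳ r (scaleP a q) (0ℚ ∷ p *P q) ⟩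
  scaleP a q *P r +P (scaleP 0ℚ r +P (0ℚ ∷ (p *P q) *P r))
    ≈⟨ +P-cong (scaleP-*P a q r) (+P-cong (scaleP-0 r) (cons-cong ≡.refl (*P-assoc p q r))) ⟩
  scaleP a (q *P r) +P (0ℚ ∷ p *P (q *P r)) ∎
  where open ≋R

*P-identityˡ : ∀ p → (constP 1ℚ *P p) ≋ p
*P-identityˡ p = ≋-trans (+P-cong (scaleP-1 p) 0∷[]) (+P-identityʳ p)

polyRing : CommutativeRing 0ℓ 0ℓ
polyRing = record
  { Carrier = Poly ; _≈_ = _≋_ ; _+_ = _+P_ ; _*_ = _*P_ ; -_ = negP ; 0# = [] ; 1# = constP 1ℚ
  ; isCommutativeRing = record
    { isRing = record
      { +-isAbelianGroup = record
        { isGroup = record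
          { isMonoid = record
            { isSemigroup = record
              { isMagma = record { isEquivalence = ≋-isEquivalence ; ∙-cong = +P-cong }
              ; assoc = +P-assoc }
            ; identity = (λ p → ≋-refl) , +P-identityʳ }
          ; inverse = (λ p → ≋-trans (+P-comm (negP p) p) (negP-inverseʳ p)) , negP-inverseʳ
          ; ⁻¹-cong = negP-cong }
        ; comm = +P-comm }
      ; *-cong = *P-cong
      ; *-assoc = *P-assoc
      ; *-identity = *P-identityˡ , (λ p → ≋-trans (*P-comm p _) (*P-identityˡ p))
      ; distrib = *P-distribˡ , *P-distribʳ }
    ; *-comm = *P-comm } }

module Pl = CommutativeRing polyRing
import Algebra.Properties.Ring Pl.ring as PlP
module PS = NatSolver Pl.commutativeSemiring

Zero⇒≋ : ∀ {p} → ZeroP p → p ≋ []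
Zero⇒≋ z = mk≋ (ZeroP⇒coe z)

≋⇒Zero : ∀ {p} → p ≋ [] → ZeroP p
≋⇒Zero {p} e = coe⇒ZeroP p (at e)

tail-Zero : ∀ {a p} → ZeroP (a ∷ p) → ZeroP p
tail-Zero (_ ∷ z) = z

-- The constant coefficients decide: a vanishing one is stripped, which shortens a list, and two
-- nonzero ones multiply to the constant coefficient of the product. The recursive calls are handed
-- to `cases` as functions so that termination stays visible.
*P-domain : ∀ p q → ZeroP (p *P q) → ZeroP p ⊎ ZeroP q
*P-domain [] q z = inj₁ []
*P-domain (a ∷ p) [] z = inj₂ []
*P-domain (a ∷ p) (b ∷ q) z = cases (*P-domain p (b ∷ q)) (*P-domain (a ∷ p) q) (a ℚP.≟ 0ℚ) (b ℚP.≟ 0ℚ)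
  where
  open ≋R
  dropˡ : a ≡ 0ℚ → (0ℚ ∷ p *P (b ∷ q)) ≋ []
  dropˡ a≡0 = begin
    0ℚ ∷ p *P (b ∷ q)                              ≈⟨ +P-cong (scaleP-0 (b ∷ q)) (≋-refl {0ℚ ∷ p *P (b ∷ q)}) ⟨
    scaleP 0ℚ (b ∷ q) +P (0ℚ ∷ p *P (b ∷ q))       ≡⟨ cong (λ c → scaleP c (b ∷ q) +P (0ℚ ∷ p *P (b ∷ q))) a≡0 ⟨
    (a ∷ p) *P (b ∷ q)                             ≈⟨ Zero⇒≋ z ⟩
    []                                             ∎
  dropʳ : b ≡ 0ℚ → (0ℚ ∷ (a ∷ p) *P q) ≋ []
  dropʳ b≡0 = begin
    0ℚ ∷ (a ∷ p) *P q                              ≈⟨ +P-cong (scaleP-0 (a ∷ p)) (≋-refl {0ℚ ∷ (a ∷ p) *P q}) ⟨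
    scaleP 0ℚ (a ∷ p) +P (0ℚ ∷ (a ∷ p) *P q)       ≡⟨ cong (λ c → scaleP c (a ∷ p) +P (0ℚ ∷ (a ∷ p) *P q)) b≡0 ⟨
    scaleP b (a ∷ p) +P (0ℚ ∷ (a ∷ p) *P q)        ≈⟨ *P-cons (a ∷ p) b q ⟨
    (a ∷ p) *P (b ∷ q)                             ≈⟨ Zero⇒≋ z ⟩
    []                                             ∎
  head0 : ¬ (a ≡ 0ℚ) → b ≡ 0ℚ
  head0 a≢0 = ≡.trans (≡.sym (ℚP.*-identityˡ b)) (≡.trans (cong (ℚ._* b) (≡.sym (ℚP.*-inverseˡ a)))
    (≡.trans (ℚP.*-assoc (ℚ.1/ a) a b) (≡.trans (cong (ℚ.1/ a ℚ.*_) (≡.trans (≡.sym (ℚP.+-identityʳ (a ℚ.* b))) (ZeroP⇒coe z 0)))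
    (ℚP.*-zeroʳ (ℚ.1/ a)))))
    where instance _ = ℚ.≢-nonZero a≢0
  cases : (ZeroP (p *P (b ∷ q)) → ZeroP p ⊎ ZeroP (b ∷ q)) → (ZeroP ((a ∷ p) *P q) → ZeroP (a ∷ p) ⊎ ZeroP q) →
          Dec (a ≡ 0ℚ) → Dec (b ≡ 0ℚ) → ZeroP (a ∷ p) ⊎ ZeroP (b ∷ q)
  cases recˡ _ (yes a≡0) _ = Sum.map₁ (a≡0 ∷_) (recˡ (tail-Zero (≋⇒Zero (dropˡ a≡0))))
  cases _ recʳ (no _) (yes b≡0) = Sum.map₂ (b≡0 ∷_) (recʳ (tail-Zero (≋⇒Zero (dropʳ b≡0))))
  cases _ _ (no a≢0) (no b≢0) = ⊥-elim (b≢0 (head0 a≢0))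

*P-nonzero : ∀ {p q} → ¬ ZeroP p → ¬ ZeroP q → ¬ ZeroP (p *P q)
*P-nonzero {p} {q} np nq z = [ np , nq ]′ (*P-domain p q z)

-- As a record, unlike _≈F_, it determines x and y by unification.
infix 4 _≈ᶜ_
record _≈ᶜ_ (x y : RatFun) : Set where
  constructor mkᶜ
  field cross : (num x *P den y) ≋ (num y *P den x)
open _≈ᶜ_

≈F⇒ᶜ : ∀ {x y} → x ≈F y → x ≈ᶜ y
≈F⇒ᶜ {x} {y} z = mkᶜ (PlP.x∙y⁻¹≈ε⇒x≈y _ _ (Zero⇒≋ z))

ᶜ⇒≈F : ∀ {x y} → x ≈ᶜ y → x ≈F y
ᶜ⇒≈F {x} {y} e = ≋⇒Zero (PlP.x≈y⇒x∙y⁻¹≈ε (cross e))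

*P-cancelʳ : ∀ {p q} r → ¬ ZeroP r → (p *P r) ≋ (q *P r) → p ≋ q
*P-cancelʳ {p} {q} r nr e with *P-domain (p +P negP q) r (≋⇒Zero (begin
    (p +P negP q) *P r        ≈⟨ *P-distribʳ r p (negP q) ⟩
    p *P r +P negP q *P r     ≈⟨ +P-cong e (≋-sym (PlP.-‿distribˡ-* q r)) ⟩
    q *P r +P negP (q *P r)   ≈⟨ negP-inverseʳ (q *P r) ⟩
    []                        ∎))
  where open ≋R
... | inj₁ z = PlP.x∙y⁻¹≈ε⇒x≈y _ _ (Zero⇒≋ z)
... | inj₂ z = ⊥-elim (nr z)

-- The proof of nonvanishing stored in the result is the one found by the decision procedure inside
-- `mkF`, not `nz`; hence the existential.
mkF-frac : ∀ n d (nz : ¬ ZeroP d) → Σ (¬ ZeroP d) λ nz' → mkF n d ≡ frac n d nz'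
mkF-frac n d nz with all? (ℚP._≟ 0ℚ) d
... | yes z = ⊥-elim (nz z)
... | no nz' = nz' , ≡.refl

num-+F : ∀ x y → num (x +F y) ≡ num x *P den y +P num y *P den x
num-+F x y = cong num (proj₂ (mkF-frac _ _ (*P-nonzero (den≢0 x) (den≢0 y))))

den-+F : ∀ x y → den (x +F y) ≡ den x *P den y
den-+F x y = cong den (proj₂ (mkF-frac (num x *P den y +P num y *P den x) _ (*P-nonzero (den≢0 x) (den≢0 y))))

num-*F : ∀ x y → num (x *F y) ≡ num x *P num y
num-*F x y = cong num (proj₂ (mkF-frac _ _ (*P-nonzero (den≢0 x) (den≢0 y))))

den-*F : ∀ x y → den (x *F y) ≡ den x *P den y
den-*F x y = cong den (proj₂ (mkF-frac (num x *P num y) _ (*P-nonzero (den≢0 x) (den≢0 y))))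

negF : RatFun → RatFun
negF x = frac (negP (num x)) (den x) (den≢0 x)

-- The intermediate denominator `den y` has to be cancelled; this is where ℚ[α] being an integral
-- domain enters.
ᶜ-trans : ∀ {x y z} → x ≈ᶜ y → y ≈ᶜ z → x ≈ᶜ z
ᶜ-trans {x} {y} {z} (mkᶜ e) (mkᶜ f) = mkᶜ (*P-cancelʳ (den y) (den≢0 y) (begin
  (nx *P dz) *P dy   ≈⟨ PS.solve 3 (λ a b c → (a PS.:* b) PS.:* c PS.:= (a PS.:* c) PS.:* b) Pl.refl nx dz dy ⟩
  (nx *P dy) *P dz   ≈⟨ *P-cong e (≋-refl {dz}) ⟩
  (ny *P dx) *P dz   ≈⟨ PS.solve 3 (λ a b c → (a PS.:* b) PS.:* c PS.:= (a PS.:* c) PS.:* b) Pl.refl ny dx dz ⟩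
  (ny *P dz) *P dx   ≈⟨ *P-cong f (≋-refl {dx}) ⟩
  (nz *P dy) *P dx   ≈⟨ PS.solve 3 (λ a b c → (a PS.:* b) PS.:* c PS.:= (a PS.:* c) PS.:* b) Pl.refl nz dy dx ⟩
  (nz *P dx) *P dy   ∎))
  where
  open ≋R
  nx = num x ; dx = den x ; ny = num y ; dy = den y ; nz = num z ; dz = den z

≈ᶜ-isEquivalence : IsEquivalence _≈ᶜ_
≈ᶜ-isEquivalence = record
  { refl = mkᶜ Pl.refl
  ; sym = λ e → mkᶜ (Pl.sym (cross e))
  ; trans = ᶜ-trans }

≈ᶜ-setoid : Setoid 0ℓ 0ℓ
≈ᶜ-setoid = record { isEquivalence = ≈ᶜ-isEquivalence }
module ≈ᶜ = Setoid ≈ᶜ-setoid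

-- `mkF` does not compute on open arguments, so numerators and denominators of sums and products are
-- known only up to propositional equality. Matching on these equations leaves a single polynomial
-- identity for the solver.
≈ᶜ-by : ∀ {x y nx dx ny dy} → num x ≡ nx → den x ≡ dx → num y ≡ ny → den y ≡ dy →
        (nx *P dy) ≋ (ny *P dx) → x ≈ᶜ y
≈ᶜ-by ≡.refl ≡.refl ≡.refl ≡.refl e = mkᶜ e

num-+F³ˡ : ∀ x y z → num ((x +F y) +F z) ≡ (num x *P den y +P num y *P den x) *P den z +P num z *P (den x *P den y)
num-+F³ˡ x y z = ≡.trans (num-+F (x +F y) z) (cong₂ (λ n d → n *P den z +P num z *P d) (num-+F x y) (den-+F x y))

+F-cong : ∀ {x x' y y'} → x ≈ᶜ x' → y ≈ᶜ y' → (x +F y) ≈ᶜ (x' +F y')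
+F-cong {x} {x'} {y} {y'} e f = ≈ᶜ-by (num-+F x y) (den-+F x y) (num-+F x' y') (den-+F x' y') (begin
  (nx *P dy +P ny *P dx) *P (dx' *P dy')
    ≈⟨ PS.solve 6 (λ a b c d e f → (a PS.:* b PS.:+ c PS.:* d) PS.:* (e PS.:* f) PS.:= (a PS.:* e) PS.:* (b PS.:* f) PS.:+ (c PS.:* f) PS.:* (d PS.:* e)) Pl.refl nx dy ny dx dx' dy' ⟩
  (nx *P dx') *P (dy *P dy') +P (ny *P dy') *P (dx *P dx')
    ≈⟨ +P-cong (*P-cong (cross e) Pl.refl) (*P-cong (cross f) Pl.refl) ⟩
  (nx' *P dx) *P (dy *P dy') +P (ny' *P dy) *P (dx *P dx')
    ≈⟨ PS.solve 6 (λ a' b c' d e f → (a' PS.:* d) PS.:* (b PS.:* f) PS.:+ (c' PS.:* b) PS.:* (d PS.:* e) PS.:= (a' PS.:* f PS.:+ c' PS.:* e) PS.:* (d PS.:* b)) Pl.refl nx' dy ny' dx dx' dy' ⟩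
  (nx' *P dy' +P ny' *P dx') *P (dx *P dy) ∎)
  where
  open ≋R
  nx = num x ; dx = den x ; ny = num y ; dy = den y
  nx' = num x' ; dx' = den x' ; ny' = num y' ; dy' = den y'

*F-cong : ∀ {x x' y y'} → x ≈ᶜ x' → y ≈ᶜ y' → (x *F y) ≈ᶜ (x' *F y')
*F-cong {x} {x'} {y} {y'} e f = ≈ᶜ-by (num-*F x y) (den-*F x y) (num-*F x' y') (den-*F x' y') (begin
  (nx *P ny) *P (dx' *P dy')
    ≈⟨ PS.solve 4 (λ a b c d → (a PS.:* b) PS.:* (c PS.:* d) PS.:= (a PS.:* c) PS.:* (b PS.:* d)) Pl.refl nx ny dx' dy' ⟩
  (nx *P dx') *P (ny *P dy')
    ≈⟨ *P-cong (cross e) (cross f) ⟩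
  (nx' *P dx) *P (ny' *P dy)
    ≈⟨ PS.solve 4 (λ a b c d → (a PS.:* b) PS.:* (c PS.:* d) PS.:= (a PS.:* c) PS.:* (b PS.:* d)) Pl.refl nx' dx ny' dy ⟩
  (nx' *P ny') *P (dx *P dy) ∎)
  where
  open ≋R
  nx = num x ; dx = den x ; ny = num y ; dy = den y
  nx' = num x' ; dx' = den x' ; ny' = num y' ; dy' = den y'

+F-assoc : ∀ x y z → ((x +F y) +F z) ≈ᶜ (x +F (y +F z))
+F-assoc x y z = ≈ᶜ-by
  (num-+F³ˡ x y z) (≡.trans (den-+F (x +F y) z) (cong (_*P den z) (den-+F x y)))
  (≡.trans (num-+F x (y +F z)) (cong₂ (λ n d → num x *P d +P n *P den x) (num-+F y z) (den-+F y z)))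
  (≡.trans (den-+F x (y +F z)) (cong (den x *P_) (den-+F y z)))
  (PS.solve 6 (λ a b c d e f →
    ((a PS.:* e PS.:+ b PS.:* d) PS.:* f PS.:+ c PS.:* (d PS.:* e)) PS.:* (d PS.:* (e PS.:* f))
    PS.:= (a PS.:* (e PS.:* f) PS.:+ (b PS.:* f PS.:+ c PS.:* e) PS.:* d) PS.:* ((d PS.:* e) PS.:* f))
    Pl.refl (num x) (num y) (num z) (den x) (den y) (den z))

+F-comm : ∀ x y → (x +F y) ≈ᶜ (y +F x)
+F-comm x y = ≈ᶜ-by (num-+F x y) (den-+F x y) (num-+F y x) (den-+F y x)
  (PS.solve 4 (λ a b c d → (a PS.:* d PS.:+ b PS.:* c) PS.:* (d PS.:* c) PS.:= (b PS.:* c PS.:+ a PS.:* d) PS.:* (c PS.:* d))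
    Pl.refl (num x) (num y) (den x) (den y))

+F-identityˡ : ∀ x → (0F +F x) ≈ᶜ x
+F-identityˡ x = ≈ᶜ-by (num-+F 0F x) (den-+F 0F x) ≡.refl ≡.refl
  (PS.solve 2 (λ n d → (n PS.:* PS.con 1) PS.:* d PS.:= n PS.:* (PS.con 1 PS.:* d)) Pl.refl (num x) (den x))

+F-inverseʳ : ∀ x → (x +F negF x) ≈ᶜ 0F
+F-inverseʳ x = ≈ᶜ-by (num-+F x (negF x)) (den-+F x (negF x)) ≡.refl ≡.refl (begin
  (num x *P den x +P negP (num x) *P den x) *P constP 1ℚ
    ≈⟨ *P-cong (Pl.trans (+P-cong Pl.refl (Pl.sym (PlP.-‿distribˡ-* (num x) (den x)))) (negP-inverseʳ (num x *P den x))) Pl.refl ⟩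
  [] ∎)
  where open ≋R

negF-cong : ∀ {x y} → x ≈ᶜ y → negF x ≈ᶜ negF y
negF-cong {x} {y} e = mkᶜ (begin
  negP (num x) *P den y    ≈⟨ PlP.-‿distribˡ-* (num x) (den y) ⟨
  negP (num x *P den y)    ≈⟨ negP-cong (cross e) ⟩
  negP (num y *P den x)    ≈⟨ PlP.-‿distribˡ-* (num y) (den x) ⟩
  negP (num y) *P den x    ∎)
  where open ≋R

*F-assoc : ∀ x y z → ((x *F y) *F z) ≈ᶜ (x *F (y *F z))
*F-assoc x y z = ≈ᶜ-by
  (≡.trans (num-*F (x *F y) z) (cong (_*P num z) (num-*F x y)))
  (≡.trans (den-*F (x *F y) z) (cong (_*P den z) (den-*F x y)))
  (≡.trans (num-*F x (y *F z)) (cong (num x *P_) (num-*F y z)))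
  (≡.trans (den-*F x (y *F z)) (cong (den x *P_) (den-*F y z)))
  (PS.solve 6 (λ a b c d e f →
    ((a PS.:* b) PS.:* c) PS.:* (d PS.:* (e PS.:* f)) PS.:= (a PS.:* (b PS.:* c)) PS.:* ((d PS.:* e) PS.:* f))
    Pl.refl (num x) (num y) (num z) (den x) (den y) (den z))

*F-comm : ∀ x y → (x *F y) ≈ᶜ (y *F x)
*F-comm x y = ≈ᶜ-by (num-*F x y) (den-*F x y) (num-*F y x) (den-*F y x)
  (PS.solve 4 (λ a b c d → (a PS.:* b) PS.:* (d PS.:* c) PS.:= (b PS.:* a) PS.:* (c PS.:* d))
    Pl.refl (num x) (num y) (den x) (den y))

*F-identityˡ : ∀ x → (1F *F x) ≈ᶜ x
*F-identityˡ x = ≈ᶜ-by (num-*F 1F x) (den-*F 1F x) ≡.refl ≡.refl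
  (PS.solve 2 (λ n d → (PS.con 1 PS.:* n) PS.:* d PS.:= n PS.:* (PS.con 1 PS.:* d)) Pl.refl (num x) (den x))

*F-distribˡ : ∀ x y z → (x *F (y +F z)) ≈ᶜ (x *F y +F x *F z)
*F-distribˡ x y z = ≈ᶜ-by
  (≡.trans (num-*F x (y +F z)) (cong (num x *P_) (num-+F y z)))
  (≡.trans (den-*F x (y +F z)) (cong (den x *P_) (den-+F y z)))
  (≡.trans (num-+F (x *F y) (x *F z)) (cong₂ _+P_ (cong₂ _*P_ (num-*F x y) (den-*F x z)) (cong₂ _*P_ (num-*F x z) (den-*F x y))))
  (≡.trans (den-+F (x *F y) (x *F z)) (cong₂ _*P_ (den-*F x y) (den-*F x z)))
  (PS.solve 6 (λ a b c d e f →
    (a PS.:* (b PS.:* f PS.:+ c PS.:* e)) PS.:* ((d PS.:* e) PS.:* (d PS.:* f))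
    PS.:= ((a PS.:* b) PS.:* (d PS.:* f) PS.:+ (a PS.:* c) PS.:* (d PS.:* e)) PS.:* (d PS.:* (e PS.:* f)))
    Pl.refl (num x) (num y) (num z) (den x) (den y) (den z))

ratFunRing : CommutativeRing 0ℓ 0ℓ
ratFunRing = record
  { Carrier = RatFun ; _≈_ = _≈ᶜ_ ; _+_ = _+F_ ; _*_ = _*F_ ; -_ = negF ; 0# = 0F ; 1# = 1F
  ; isCommutativeRing = record
    { isRing = record
      { +-isAbelianGroup = record
        { isGroup = record
          { isMonoid = record
            { isSemigroup = record
              { isMagma = record { isEquivalence = ≈ᶜ-isEquivalence ; ∙-cong = +F-cong }
              ; assoc = +F-assoc }
            ; identity = +F-identityˡ , (λ x → ≈ᶜ.trans (+F-comm x 0F) (+F-identityˡ x)) }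
          ; inverse = (λ x → ≈ᶜ.trans (+F-comm (negF x) x) (+F-inverseʳ x)) , +F-inverseʳ
          ; ⁻¹-cong = negF-cong }
        ; comm = +F-comm }
      ; *-cong = *F-cong
      ; *-assoc = *F-assoc
      ; *-identity = *F-identityˡ , (λ x → ≈ᶜ.trans (*F-comm x 1F) (*F-identityˡ x))
      ; distrib = *F-distribˡ , (λ x y z → ≈ᶜ.trans (*F-comm (y +F z) x)
                    (≈ᶜ.trans (*F-distribˡ x y z)
                      (+F-cong (*F-comm x y) (*F-comm x z)))) }
    ; *-comm = *F-comm } }

-- Integers in a commutative ring, and a ring solver with integer coefficients

module Integers (R : CommutativeRing 0ℓ 0ℓ) where
  open CommutativeRing R
  open import Algebra.Properties.Semiring.Mult semiring using (×-homo-+; ×1-homo-*) renaming (_×_ to _·_)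
  open import Algebra.Properties.Ring ring
  open import Relation.Binary.Reasoning.Setoid setoid

  ι : ℤ → Carrier
  ι (+ n) = n · 1#
  ι -[1+ n ] = - (suc n · 1#)

  ι-⊖ : ∀ m n → ι (m ⊖ n) ≈ m · 1# + - (n · 1#)
  ι-⊖ m zero = sym (trans (+-congˡ -0#≈0#) (+-identityʳ _))
  ι-⊖ zero (suc n) = sym (+-identityˡ _)
  ι-⊖ (suc m) (suc n) = begin
    ι (suc m ⊖ suc n)                           ≡⟨ ≡.cong ι (ℤP.[1+m]⊖[1+n]≡m⊖n m n) ⟩
    ι (m ⊖ n)                                   ≈⟨ ι-⊖ m n ⟩
    m · 1# + - (n · 1#)                         ≈⟨ +-congˡ (+-identityˡ _) ⟨
    m · 1# + (0# + - (n · 1#))                  ≈⟨ +-congˡ (+-congʳ (-‿inverseʳ 1#)) ⟨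
    m · 1# + ((1# + - 1#) + - (n · 1#))         ≈⟨ +-congˡ (+-assoc _ _ _) ⟩
    m · 1# + (1# + (- 1# + - (n · 1#)))         ≈⟨ +-assoc _ _ _ ⟨
    (m · 1# + 1#) + (- 1# + - (n · 1#))         ≈⟨ +-cong (+-comm _ _) (-‿+-comm 1# (n · 1#)) ⟩
    (1# + m · 1#) + - (1# + n · 1#)             ∎

  ι-neg : ∀ i → ι (ℤ.- i) ≈ - ι i
  ι-neg (+ zero) = sym -0#≈0#
  ι-neg (+ suc n) = refl
  ι-neg -[1+ n ] = sym (-‿involutive _)

  ι-+ : ∀ i j → ι (i ℤ.+ j) ≈ ι i + ι j
  ι-+ (+ m) (+ n) = ×-homo-+ 1# m n
  ι-+ (+ m) -[1+ n ] = ι-⊖ m (suc n)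
  ι-+ -[1+ m ] (+ n) = trans (ι-⊖ n (suc m)) (+-comm _ _)
  ι-+ -[1+ m ] -[1+ n ] = begin
    - (suc (suc (m ℕ.+ n)) · 1#)        ≡⟨ ≡.cong (λ k → - (suc k · 1#)) (≡.sym (+-suc′ m n)) ⟩
    - ((suc m ℕ.+ suc n) · 1#)          ≈⟨ -‿cong (×-homo-+ 1# (suc m) (suc n)) ⟩
    - (suc m · 1# + suc n · 1#)         ≈⟨ -‿+-comm _ _ ⟨
    - (suc m · 1#) + - (suc n · 1#)     ∎
    where
    open import Data.Nat.Properties using () renaming (+-suc to +-suc′)

  ι-pos-* : ∀ m j → ι (+ m ℤ.* j) ≈ ι (+ m) * ι j
  ι-pos-* m (+ n) = trans (reflexive (≡.cong ι (≡.sym (ℤP.pos-* m n)))) (×1-homo-* m n)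
  ι-pos-* m -[1+ n ] = begin
    ι (+ m ℤ.* (ℤ.- (+ suc n)))   ≡⟨ ≡.cong ι (ℤP.neg-distribʳ-* (+ m) (+ suc n)) ⟨
    ι (ℤ.- (+ m ℤ.* + suc n))     ≈⟨ ι-neg (+ m ℤ.* + suc n) ⟩
    - ι (+ m ℤ.* + suc n)         ≈⟨ -‿cong (ι-pos-* m (+ suc n)) ⟩
    - (ι (+ m) * ι (+ suc n))     ≈⟨ -‿distribʳ-* _ _ ⟩
    ι (+ m) * - ι (+ suc n)       ∎

  ι-* : ∀ i j → ι (i ℤ.* j) ≈ ι i * ι j
  ι-* (+ m) j = ι-pos-* m j
  ι-* -[1+ m ] j = begin
    ι ((ℤ.- (+ suc m)) ℤ.* j)     ≡⟨ ≡.cong ι (ℤP.neg-distribˡ-* (+ suc m) j) ⟨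
    ι (ℤ.- (+ suc m ℤ.* j))       ≈⟨ ι-neg (+ suc m ℤ.* j) ⟩
    - ι (+ suc m ℤ.* j)           ≈⟨ -‿cong (ι-pos-* (suc m) j) ⟩
    - (ι (+ suc m) * ι j)         ≈⟨ -‿distribˡ-* _ _ ⟩
    - ι (+ suc m) * ι j           ∎

  ι-1 : ι (+ 1) ≈ 1#
  ι-1 = +-identityʳ 1#

  ℤ-rawRing : RawRing 0ℓ 0ℓ
  ℤ-rawRing = record { Carrier = ℤ ; _≈_ = _≡_ ; _+_ = ℤ._+_ ; _*_ = ℤ._*_ ; -_ = ℤ.-_ ; 0# = + 0 ; 1# = + 1 }

  ι-morphism : ℤ-rawRing -Raw-AlmostCommutative⟶ fromCommutativeRing R
  ι-morphism = record
    { ⟦_⟧ = ι ; +-homo = ι-+ ; *-homo = ι-* ; -‿homo = ι-neg ; 0-homo = refl ; 1-homo = ι-1 }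

  ι-≟ : ∀ i j → Maybe (ι i ≈ ι j)
  ι-≟ i j with i ℤ.≟ j
  ... | yes e = just (reflexive (≡.cong ι e))
  ... | no _ = nothing

  module Solver = RingSolver ℤ-rawRing (fromCommutativeRing R) ι-morphism ι-≟

-- Of the transcendence of `α` only the absence of linear relations over ℤ is kept; with `b` equal
-- to 0 it also yields characteristic zero and `α` nonzero. The abstraction keeps the representation
-- by fractions out of everything that follows.
record JackField : Set₁ where
  field
    commutativeRing : CommutativeRing 0ℓ 0ℓ
  open CommutativeRing commutativeRing public
  open Integers commutativeRing public
  field
    α : Carrier
    ≈0? : ∀ x → Dec (x ≈ 0#)
    inverse : ∀ x → ¬ (x ≈ 0#) → Σ Carrier λ y → y * x ≈ 1#
    α-free : ∀ a b → a ≢ 0ℤ → ¬ (ι a * α + ι b ≈ 0#)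

-- ℚ(α) as a field

/1-+ : ∀ i j → (i ℤ.+ j) ℚ./ 1 ≡ (i ℚ./ 1) ℚ.+ (j ℚ./ 1)
/1-+ i j = ℚP.toℚᵘ-injective (begin
  ℚ.toℚᵘ ((i ℤ.+ j) ℚ./ 1)                    ≈⟨ ℚP.toℚᵘ-fromℚᵘ (ℚᵘ.mkℚᵘ (i ℤ.+ j) 0) ⟩
  ℚᵘ.mkℚᵘ (i ℤ.+ j) 0                         ≈⟨ ℚᵘ.*≡* (cong (ℤ._* + 1) (≡.sym (cong₂ ℤ._+_ (ℤP.*-identityʳ i) (ℤP.*-identityʳ j)))) ⟩
  ℚᵘ.mkℚᵘ i 0 ℚᵘ.+ ℚᵘ.mkℚᵘ j 0                ≈⟨ ℚᵘP.+-cong (ℚP.toℚᵘ-fromℚᵘ (ℚᵘ.mkℚᵘ i 0)) (ℚP.toℚᵘ-fromℚᵘ (ℚᵘ.mkℚᵘ j 0)) ⟨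
  ℚ.toℚᵘ (i ℚ./ 1) ℚᵘ.+ ℚ.toℚᵘ (j ℚ./ 1)      ≈⟨ ℚP.toℚᵘ-homo-+ (i ℚ./ 1) (j ℚ./ 1) ⟨
  ℚ.toℚᵘ ((i ℚ./ 1) ℚ.+ (j ℚ./ 1))            ∎)
  where open ℚᵘP.≃-Reasoning

/1-neg : ∀ i → (ℤ.- i) ℚ./ 1 ≡ ℚ.- (i ℚ./ 1)
/1-neg i = ℚP.toℚᵘ-injective (begin
  ℚ.toℚᵘ ((ℤ.- i) ℚ./ 1)      ≈⟨ ℚP.toℚᵘ-fromℚᵘ (ℚᵘ.mkℚᵘ (ℤ.- i) 0) ⟩
  ℚᵘ.- ℚᵘ.mkℚᵘ i 0            ≈⟨ ℚᵘP.-‿cong (ℚP.toℚᵘ-fromℚᵘ (ℚᵘ.mkℚᵘ i 0)) ⟨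
  ℚᵘ.- ℚ.toℚᵘ (i ℚ./ 1)       ≈⟨ ℚP.toℚᵘ-homo‿- (i ℚ./ 1) ⟨
  ℚ.toℚᵘ (ℚ.- (i ℚ./ 1))      ∎)
  where open ℚᵘP.≃-Reasoning

/1-injective : ∀ i → i ℚ./ 1 ≡ 0ℚ → i ≡ 0ℤ
/1-injective i e with ℚᵘP.≃-trans (ℚᵘP.≃-sym (ℚP.toℚᵘ-fromℚᵘ (ℚᵘ.mkℚᵘ i 0))) (ℚᵘP.≃-reflexive (cong ℚ.toℚᵘ e))
... | ℚᵘ.*≡* eq = ≡.trans (≡.sym (ℤP.*-identityʳ i)) eq

open Integers ratFunRing using () renaming (ι to ιF)

constF : ℚ → RatFun
constF a = frac (constP a) (constP 1ℚ) (den≢0 1F)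

constF-+ : ∀ a b → (constF a +F constF b) ≈ᶜ constF (a ℚ.+ b)
constF-+ a b = ≈ᶜ-by (num-+F (constF a) (constF b)) (den-+F (constF a) (constF b)) ≡.refl ≡.refl
  (Pl.trans (Pl.*-identityʳ (constP a *P one +P constP b *P one))
  (Pl.trans (+P-cong (Pl.*-identityʳ (constP a)) (Pl.*-identityʳ (constP b)))
  (Pl.sym (Pl.trans (*P-cong (Pl.refl {constP (a ℚ.+ b)}) (*P-identityˡ one)) (Pl.*-identityʳ (constP (a ℚ.+ b)))))))
  where
  one = constP 1ℚ

ι-ℕ : ∀ n → ιF (+ n) ≈ᶜ ℕtoF n
ι-ℕ zero = mkᶜ (Pl.sym (*P-cong {constP 0ℚ} {[]} {constP 1ℚ} 0∷[] Pl.refl))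
ι-ℕ (suc n) = ≈ᶜ.trans {ιF (+ suc n)} {1F +F ℕtoF n} {ℕtoF (suc n)}
  (+F-cong {1F} {1F} {ιF (+ n)} {ℕtoF n} (≈ᶜ.refl {1F}) (ι-ℕ n))
  (≈ᶜ.trans {1F +F ℕtoF n} {constF (1ℚ ℚ.+ (+ n ℚ./ 1))} {ℕtoF (suc n)} (constF-+ 1ℚ (+ n ℚ./ 1))
    (subst (λ q → constF (1ℚ ℚ.+ (+ n ℚ./ 1)) ≈ᶜ constF q) (≡.sym (/1-+ (+ 1) (+ n))) (≈ᶜ.refl {constF (1ℚ ℚ.+ (+ n ℚ./ 1))})))

ι-constF : ∀ i → ιF i ≈ᶜ constF (i ℚ./ 1)
ι-constF (+ n) = ι-ℕ n
ι-constF -[1+ n ] = ≈ᶜ.trans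
  (negF-cong (ι-ℕ (suc n)))
  (subst (λ q → constF (ℚ.- (+ suc n ℚ./ 1)) ≈ᶜ constF q) (≡.sym (/1-neg (+ suc n))) ≈ᶜ.refl)

-- The coefficient of α in the numerator of the linear expression is `a / 1`, so it vanishes only
-- with `a`.
αF-free : ∀ a b → a ≢ 0ℤ → ¬ (((ιF a *F αF) +F ιF b) ≈ᶜ 0F)
αF-free a b a≢0 e = a≢0 (/1-injective a (≡.trans (≡.sym coefficient) (at (cross e′) 1)))
  where
  p q : ℚ
  p = a ℚ./ 1
  q = b ℚ./ 1
  lin : RatFun
  lin = (constF p *F αF) +F constF q
  e′ : lin ≈ᶜ 0F
  e′ = ≈ᶜ.trans {lin} {(ιF a *F αF) +F ιF b} {0F}
    (≈ᶜ.sym {(ιF a *F αF) +F ιF b} {lin} (+F-cong {ιF a *F αF} {constF p *F αF} {ιF b} {constF q} (*F-cong {ιF a} {constF p} {αF} {αF} (ι-constF a) (≈ᶜ.refl {αF})) (ι-constF b))) e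
  numEq : num lin ≡ (constP p *P num αF) *P constP 1ℚ +P constP q *P (constP 1ℚ *P constP 1ℚ)
  numEq = ≡.trans (num-+F (constF p *F αF) (constF q)) (cong₂ (λ n d → n *P constP 1ℚ +P constP q *P d) (num-*F (constF p) αF) (den-*F (constF p) αF))
  open ≡-Reasoning
  coefficient : coe (num lin *P constP 1ℚ) 1 ≡ p
  coefficient = begin
    coe (num lin *P constP 1ℚ) 1   ≡⟨ at (Pl.*-identityʳ (num lin)) 1 ⟩
    coe (num lin) 1                ≡⟨ cong (λ n → coe n 1) numEq ⟩
    coe ((constP p *P num αF) *P constP 1ℚ +P constP q *P (constP 1ℚ *P constP 1ℚ)) 1
      ≡⟨ at (+P-cong (Pl.*-identityʳ (constP p *P num αF)) (Pl.trans (*P-cong (Pl.refl {constP q}) (*P-identityˡ (constP 1ℚ))) (Pl.*-identityʳ (constP q)))) 1 ⟩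
    coe (constP p *P num αF +P constP q) 1
      ≡⟨ coe-+P (constP p *P num αF) (constP q) 1 ⟩
    p ℚ.* 1ℚ ℚ.+ 0ℚ                 ≡⟨ ℚP.+-identityʳ _ ⟩
    p ℚ.* 1ℚ                        ≡⟨ ℚP.*-identityʳ p ⟩
    p                               ∎

≈0F-num : ∀ {x} → ZeroP (num x) → x ≈ᶜ 0F
≈0F-num z = mkᶜ (*P-cong (Zero⇒≋ z) Pl.refl)

num-≈0F : ∀ {x} → x ≈ᶜ 0F → ZeroP (num x)
num-≈0F {x} e = ≋⇒Zero (Pl.trans (Pl.sym (Pl.*-identityʳ (num x))) (cross e))

invF-inverse : ∀ x → ¬ (x ≈ᶜ 0F) → (invF x *F x) ≈ᶜ 1F
invF-inverse x x≉0 with all? (ℚP._≟ 0ℚ) (num x)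
... | yes z = ⊥-elim (x≉0 (≈0F-num z))
... | no nz = ≈ᶜ-by (num-*F (frac (den x) (num x) nz) x) (den-*F (frac (den x) (num x) nz) x) ≡.refl ≡.refl
  (PS.solve 2 (λ n d → (d PS.:* n) PS.:* PS.con 1 PS.:= PS.con 1 PS.:* (n PS.:* d)) Pl.refl (num x) (den x))

ratFunField : JackField
ratFunField = record
  { commutativeRing = ratFunRing
  ; α = αF
  ; ≈0? = λ x → Dec.map′ ≈0F-num num-≈0F (all? (ℚP._≟ 0ℚ) (num x))
  ; inverse = λ x x≉0 → invF x , invF-inverse x x≉0
  ; α-free = αF-free }

-- Partitions

Partition⇒AllPairs : ∀ {la} → IsPartition la → AllPairs ℕ._≥_ la
Partition⇒AllPairs p = LinkedP.Linked⇒AllPairs (λ x≥y y≥z → ℕP.≤-trans y≥z x≥y) (proj₂ p)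

partition-tail : ∀ {x la} → IsPartition (x ∷ la) → IsPartition la
partition-tail (_ ∷ ps , l) = ps , Linked.tail l

partition-head : ∀ {x la} → IsPartition (x ∷ la) → All (ℕ._≤ x) la
partition-head p with Partition⇒AllPairs p
... | a ∷ _ = a

insertD-↭ : ∀ x ys → insertD x ys ↭ x ∷ ys
insertD-↭ x [] = ↭.refl
insertD-↭ x (y ∷ ys) with y ≤ᵇ x
... | true = ↭.refl
... | false = ↭.trans (↭.prep y (insertD-↭ x ys)) (↭.swap y x ↭.refl)

insertD-sorted : ∀ x {ys} → AllPairs ℕ._≥_ ys → AllPairs ℕ._≥_ (insertD x ys)
insertD-sorted x [] = [] ∷ []
insertD-sorted x {y ∷ ys} (a ∷ s) with y ≤ᵇ x in eq
... | true = (y≤x ∷ All.map (λ z≤y → ℕP.≤-trans z≤y y≤x) a) ∷ a ∷ s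
  where y≤x = ℕP.≤ᵇ⇒≤ y x (subst Bool.T (≡.sym eq) _)
... | false = ↭P.All-resp-↭ (↭.↭-sym (insertD-↭ x ys)) (x≤y ∷ a) ∷ insertD-sorted x s
  where x≤y = ℕP.<⇒≤ (ℕP.≰⇒> λ y≤x → subst Bool.T eq (ℕP.≤⇒≤ᵇ y≤x))

sort-↭ : ∀ ys → foldr insertD [] ys ↭ ys
sort-↭ [] = ↭.refl
sort-↭ (y ∷ ys) = ↭.trans (insertD-↭ y _) (↭.prep y (sort-↭ ys))

sort-sorted : ∀ ys → AllPairs ℕ._≥_ (foldr insertD [] ys)
sort-sorted [] = []
sort-sorted (y ∷ ys) = insertD-sorted y (sort-sorted ys)

positive : List ℕ → List ℕ
positive = filter (1 ℕ.≤?_)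

norm-↭ : ∀ μ → norm μ ↭ positive μ
norm-↭ μ = sort-↭ (positive μ)

norm-partition : ∀ μ → IsPartition (norm μ)
norm-partition μ = ↭P.All-resp-↭ (↭.↭-sym (norm-↭ μ)) (AllP.all-filter (1 ℕ.≤?_) μ) , LinkedP.AllPairs⇒Linked (sort-sorted (positive μ))

≥-totalOrder = Flip.totalOrder ℕP.≤-totalOrder

-- Reduces every identity between normalised lists to a permutation, by uniqueness of the sorted
-- rearrangement.
partition-unique : ∀ {la mu} → IsPartition la → IsPartition mu → la ↭ mu → la ≡ mu
partition-unique p q e = Pointwise.Pointwise-≡⇒≡ (Sorted.↗↭↗⇒≋ ≥-totalOrder (proj₂ p) (proj₂ q) (↭⇒↭ₛ e))

positive-partition : ∀ {la} → IsPartition la → positive la ≡ la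
positive-partition p = ListP.filter-all (1 ℕ.≤?_) (proj₁ p)

norm-of-partition : ∀ {la} → IsPartition la → norm la ≡ la
norm-of-partition {la} p = partition-unique (norm-partition la) p (subst (norm la ↭_) (positive-partition p) (norm-↭ la))

positive-↭ : ∀ {μ ν} → μ ↭ ν → positive μ ↭ positive ν
positive-↭ = ↭P.filter-↭ (1 ℕ.≤?_)

norm-cong-↭ : ∀ {μ ν} → positive μ ↭ positive ν → norm μ ≡ norm ν
norm-cong-↭ {μ} {ν} e = partition-unique (norm-partition μ) (norm-partition ν) (↭.trans (norm-↭ μ) (↭.trans e (↭.↭-sym (norm-↭ ν))))

zeros-split : ∀ μ → Σ ℕ λ k → μ ↭ replicate k 0 ++ positive μ
zeros-split [] = 0 , ↭.refl
zeros-split (zero ∷ μ) with zeros-split μ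
... | k , e = suc k , ↭.prep 0 e
zeros-split (suc n ∷ μ) with zeros-split μ
... | k , e = k , ↭.trans (↭.prep (suc n) e) (↭.↭-sym (↭P.shift (suc n) (replicate k 0) (positive μ)))

-- The form in which `norm` is used: whatever is invariant under permutations and under prepending
-- zeros takes the same value at `μ` and `norm μ`.
zeros-norm : ∀ μ → Σ ℕ λ k → μ ↭ replicate k 0 ++ norm μ
zeros-norm μ with zeros-split μ
... | k , e = k , ↭.trans e (↭P.++⁺ˡ (replicate k 0) (↭.↭-sym (norm-↭ μ)))

-- Sums of squares along the dominance order

squares : List ℕ → ℤ
squares [] = 0ℤ
squares (x ∷ la) = (+ x) ℤ.* (+ x) ℤ.+ squares la

distance : List ℕ → List ℕ → ℤ
distance [] [] = 0ℤ
distance [] (a ∷ as) = (+ a) ℤ.* (+ a) ℤ.+ distance [] as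
distance (b ∷ bs) [] = (+ b) ℤ.* (+ b) ℤ.+ distance bs []
distance (b ∷ bs) (a ∷ as) = ((+ a) ℤ.- (+ b)) ℤ.* ((+ a) ℤ.- (+ b)) ℤ.+ distance bs as

distance-[] : ∀ as → distance [] as ≡ squares as
distance-[] [] = ≡.refl
distance-[] (a ∷ as) = cong (λ t → (+ a) ℤ.* (+ a) ℤ.+ t) (distance-[] as)

square-nonneg : ∀ z → 0ℤ ℤ.≤ z ℤ.* z
square-nonneg (+ n) = subst (0ℤ ℤ.≤_) (ℤP.pos-* n n) (ℤ.+≤+ ℕ.z≤n)
square-nonneg ℤ.-[1+ n ] = ℤ.+≤+ ℕ.z≤n

below-carry : ∀ {p b c : ℤ} → b ℤ.≤ p → 0ℤ ℤ.≤ c → b ℤ.* c ℤ.≤ p ℤ.* c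
below-carry {p} {b} {+ n} le _ = ℤP.*-monoʳ-≤-nonNeg (+ n) le
below-carry {c = ℤ.-[1+ n ]} le ()

double : ∀ {x y : ℤ} → x ℤ.≤ y → x ℤ.+ x ℤ.≤ y ℤ.+ y
double le = ℤP.+-mono-≤ le le

-- Abel summation: c is the surplus of a over b so far and p bounds the entries of b.
abel : ∀ p c bs as → All (ℕ._≤ p) bs → AllPairs ℕ._≥_ bs → 0ℤ ℤ.≤ c →
  (∀ k → + sumℕ (take k bs) ℤ.≤ c ℤ.+ (+ sumℕ (take k as))) →
  squares bs ℤ.+ distance bs as ℤ.≤ squares as ℤ.+ ((+ p) ℤ.* c ℤ.+ (+ p) ℤ.* c)
abel p c [] as b≤p s 0≤c h = subst₂′ (ℤP.+-monoʳ-≤ (squares as) (ℤP.+-mono-≤ pc pc))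
  where
  pc : 0ℤ ℤ.≤ (+ p) ℤ.* c
  pc = subst (ℤ._≤ (+ p) ℤ.* c) (ℤP.*-zeroʳ (+ p)) (ℤP.*-monoˡ-≤-nonNeg (+ p) 0≤c)
  subst₂′ : squares as ℤ.+ (0ℤ ℤ.+ 0ℤ) ℤ.≤ squares as ℤ.+ ((+ p) ℤ.* c ℤ.+ (+ p) ℤ.* c) → 0ℤ ℤ.+ distance [] as ℤ.≤ squares as ℤ.+ ((+ p) ℤ.* c ℤ.+ (+ p) ℤ.* c)
  subst₂′ = subst (ℤ._≤ squares as ℤ.+ ((+ p) ℤ.* c ℤ.+ (+ p) ℤ.* c)) (≡.trans (ℤP.+-identityʳ (squares as)) (≡.sym (≡.trans (ℤP.+-identityˡ _) (distance-[] as))))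
abel p c (b ∷ bs) as (b≤p ∷ bs≤p) (bs≤b ∷ s) 0≤c h = step as h
  where
  step : ∀ as → (∀ k → + sumℕ (take k (b ∷ bs)) ℤ.≤ c ℤ.+ (+ sumℕ (take k as))) →
    squares (b ∷ bs) ℤ.+ distance (b ∷ bs) as ℤ.≤ squares as ℤ.+ ((+ p) ℤ.* c ℤ.+ (+ p) ℤ.* c)
  step [] h = ℤP.≤-trans (ℤP.≤-reflexive (ℤS.solve 3 (λ b S d → (b ℤS.:* b ℤS.:+ S) ℤS.:+ (b ℤS.:* b ℤS.:+ d) ℤS.:= (b ℤS.:* b ℤS.:+ b ℤS.:* b) ℤS.:+ (S ℤS.:+ d)) ≡.refl (+ b) (squares bs) (distance bs [])))
    (ℤP.≤-trans (ℤP.+-monoʳ-≤ ((+ b) ℤ.* (+ b) ℤ.+ (+ b) ℤ.* (+ b)) (abel b (c ℤ.- (+ b)) bs [] bs≤b s carry rest))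
    (ℤP.≤-trans (ℤP.≤-reflexive (ℤS.solve 2 (λ b c → (b ℤS.:* b ℤS.:+ b ℤS.:* b) ℤS.:+ (ℤS.con 0ℤ ℤS.:+ (b ℤS.:* (c ℤS.:- b) ℤS.:+ b ℤS.:* (c ℤS.:- b))) ℤS.:= b ℤS.:* c ℤS.:+ b ℤS.:* c) ≡.refl (+ b) c))
    (subst ((+ b) ℤ.* c ℤ.+ (+ b) ℤ.* c ℤ.≤_) (≡.sym (ℤP.+-identityˡ _)) (double (below-carry (ℤ.+≤+ b≤p) 0≤c)))))
    where
    carry : 0ℤ ℤ.≤ c ℤ.- (+ b)
    carry = ℤP.i≤j⇒0≤j-i (subst₂ (h 1))
      where
      subst₂ : + (b ℕ.+ 0) ℤ.≤ c ℤ.+ (+ 0) → + b ℤ.≤ c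
      subst₂ = ≡.subst₂ ℤ._≤_ (cong +_ (ℕP.+-identityʳ b)) (ℤP.+-identityʳ c)
    rest : ∀ k → + sumℕ (take k bs) ℤ.≤ (c ℤ.- (+ b)) ℤ.+ (+ sumℕ (take k []))
    rest k = ≡.subst₂ ℤ._≤_ (ℤS.solve 2 (λ b x → (b ℤS.:+ x) ℤS.:- b ℤS.:= x) ≡.refl (+ b) (+ sumℕ (take k bs))) (ends k)
      (ℤP.+-monoˡ-≤ (ℤ.- (+ b)) (h (suc k)))
      where
      ends : ∀ k → c ℤ.+ (+ 0) ℤ.- (+ b) ≡ (c ℤ.- (+ b)) ℤ.+ (+ sumℕ (take k []))
      ends zero = ℤS.solve 2 (λ c b → c ℤS.:+ ℤS.con 0ℤ ℤS.:- b ℤS.:= c ℤS.:- b ℤS.:+ ℤS.con 0ℤ) ≡.refl c (+ b)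
      ends (suc k) = ends zero
  step (a ∷ as) h = ℤP.≤-trans (ℤP.≤-reflexive (ℤS.solve 4 (λ b S d a → (b ℤS.:* b ℤS.:+ S) ℤS.:+ ((a ℤS.:- b) ℤS.:* (a ℤS.:- b) ℤS.:+ d) ℤS.:= (b ℤS.:* b ℤS.:+ (a ℤS.:- b) ℤS.:* (a ℤS.:- b)) ℤS.:+ (S ℤS.:+ d)) ≡.refl (+ b) (squares bs) (distance bs as) (+ a)))
    (ℤP.≤-trans (ℤP.+-monoʳ-≤ ((+ b) ℤ.* (+ b) ℤ.+ ((+ a) ℤ.- (+ b)) ℤ.* ((+ a) ℤ.- (+ b))) (abel b (c ℤ.+ ((+ a) ℤ.- (+ b))) bs as bs≤b s carry rest))
    (ℤP.≤-trans (ℤP.≤-reflexive (ℤS.solve 4 (λ b c a S → (b ℤS.:* b ℤS.:+ (a ℤS.:- b) ℤS.:* (a ℤS.:- b)) ℤS.:+ (S ℤS.:+ (b ℤS.:* (c ℤS.:+ (a ℤS.:- b)) ℤS.:+ b ℤS.:* (c ℤS.:+ (a ℤS.:- b)))) ℤS.:= (a ℤS.:* a ℤS.:+ S) ℤS.:+ (b ℤS.:* c ℤS.:+ b ℤS.:* c)) ≡.refl (+ b) c (+ a) (squares as)))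
    (ℤP.+-monoʳ-≤ (squares (a ∷ as)) (double (below-carry (ℤ.+≤+ b≤p) 0≤c)))))
    where
    carry : 0ℤ ℤ.≤ c ℤ.+ ((+ a) ℤ.- (+ b))
    carry = subst (0ℤ ℤ.≤_) (ℤS.solve 3 (λ c a b → (c ℤS.:+ a) ℤS.:- b ℤS.:= c ℤS.:+ (a ℤS.:- b)) ≡.refl c (+ a) (+ b))
      (ℤP.i≤j⇒0≤j-i (≡.subst₂ ℤ._≤_ (cong +_ (ℕP.+-identityʳ b)) (cong (λ n → c ℤ.+ (+ n)) (ℕP.+-identityʳ a)) (h 1)))
    rest : ∀ k → + sumℕ (take k bs) ℤ.≤ (c ℤ.+ ((+ a) ℤ.- (+ b))) ℤ.+ (+ sumℕ (take k as))
    rest k = ≡.subst₂ ℤ._≤_ (ℤS.solve 2 (λ b x → (b ℤS.:+ x) ℤS.:- b ℤS.:= x) ≡.refl (+ b) (+ sumℕ (take k bs)))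
      (ℤS.solve 4 (λ c a b x → c ℤS.:+ (a ℤS.:+ x) ℤS.:- b ℤS.:= c ℤS.:+ (a ℤS.:- b) ℤS.:+ x) ≡.refl c (+ a) (+ b) (+ sumℕ (take k as)))
      (ℤP.+-monoˡ-≤ (ℤ.- (+ b)) (h (suc k)))

distance-nonneg : ∀ bs as → 0ℤ ℤ.≤ distance bs as
distance-nonneg [] [] = ℤP.≤-refl
distance-nonneg [] (a ∷ as) = ℤP.+-mono-≤ (square-nonneg (+ a)) (distance-nonneg [] as)
distance-nonneg (b ∷ bs) [] = ℤP.+-mono-≤ (square-nonneg (+ b)) (distance-nonneg bs [])
distance-nonneg (b ∷ bs) (a ∷ as) = ℤP.+-mono-≤ (square-nonneg ((+ a) ℤ.- (+ b))) (distance-nonneg bs as)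

nonneg-sum-zero : ∀ {x y} → 0ℤ ℤ.≤ x → 0ℤ ℤ.≤ y → x ℤ.+ y ≡ 0ℤ → (x ≡ 0ℤ) × (y ≡ 0ℤ)
nonneg-sum-zero {+ zero} {+ n} _ _ e = ≡.refl , e
nonneg-sum-zero {+ suc m} {+ n} _ _ ()
nonneg-sum-zero {ℤ.-[1+ n ]} () _ _
nonneg-sum-zero {+ n} {ℤ.-[1+ m ]} _ () _

square-zero : ∀ z → z ℤ.* z ≡ 0ℤ → z ≡ 0ℤ
square-zero z e with ℤP.i*j≡0⇒i≡0∨j≡0 z e
... | inj₁ r = r
... | inj₂ r = r

distance-zero : ∀ {bs as} → All (1 ℕ.≤_) bs → All (1 ℕ.≤_) as → distance bs as ≡ 0ℤ → bs ≡ as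
distance-zero {[]} {[]} _ _ e = ≡.refl
distance-zero {[]} {suc a ∷ as} _ _ e with square-zero (+ suc a) (proj₁ (nonneg-sum-zero (square-nonneg (+ suc a)) (distance-nonneg [] as) e))
... | ()
distance-zero {suc b ∷ bs} {[]} _ _ e with square-zero (+ suc b) (proj₁ (nonneg-sum-zero (square-nonneg (+ suc b)) (distance-nonneg bs []) e))
... | ()
distance-zero {zero ∷ bs} (() ∷ _)
distance-zero {[]} {zero ∷ as} _ (() ∷ _)
distance-zero {b ∷ bs} {a ∷ as} (_ ∷ pb) (_ ∷ pa) e with nonneg-sum-zero (square-nonneg ((+ a) ℤ.- (+ b))) (distance-nonneg bs as) e
... | e₁ , e₂ = cong₂ _∷_ (≡.sym (ℤP.+-injective (ℤP.i-j≡0⇒i≡j (+ a) (+ b) (square-zero ((+ a) ℤ.- (+ b)) e₁)))) (distance-zero pb pa e₂)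

-- With zero initial surplus, `abel` says that Σ b (a - b) is nonnegative for the decreasing b, so
-- the sum of squares grows by at least the squared distance, and this is positive for different
-- partitions.
dominated-squares : ∀ {mu la} → IsPartition mu → IsPartition la → Dominated mu la → mu ≢ la → squares mu ℤ.< squares la
dominated-squares {mu} {la} pm pl (_ , dom) ne = ℤP.<-≤-trans (subst (ℤ._< squares mu ℤ.+ distance mu la) (ℤP.+-identityʳ (squares mu))
    (ℤP.+-monoʳ-< (squares mu) (ℤP.≤∧≢⇒< (distance-nonneg mu la) λ e → ne (distance-zero (proj₁ pm) (proj₁ pl) (≡.sym e)))))
  (subst (squares mu ℤ.+ distance mu la ℤ.≤_) final (abel (headOr0 mu) 0ℤ mu la (bounded mu pm) (Partition⇒AllPairs pm) ℤP.≤-refl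
    (λ k → subst (+ sumℕ (take k mu) ℤ.≤_) (≡.sym (ℤP.+-identityˡ _)) (ℤ.+≤+ (dom k)))))
  where
  bounded : ∀ mu → IsPartition mu → All (ℕ._≤ headOr0 mu) mu
  bounded [] p = []
  bounded (x ∷ mu) p = ℕP.≤-refl ∷ partition-head p
  final : squares la ℤ.+ ((+ headOr0 mu) ℤ.* 0ℤ ℤ.+ (+ headOr0 mu) ℤ.* 0ℤ) ≡ squares la
  final = ℤS.solve 2 (λ S p → S ℤS.:+ (p ℤS.:* ℤS.con 0ℤ ℤS.:+ p ℤS.:* ℤS.con 0ℤ) ℤS.:= S) ≡.refl (squares la) (+ headOr0 mu)

dominated-head : ∀ {mu la} → Dominated mu la → headOr0 mu ℕ.≤ headOr0 la
dominated-head {[]} _ = ℕ.z≤n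
dominated-head {b ∷ mu} {[]} (_ , dom) = ℕP.≤-trans (ℕP.m≤m+n b 0) (dom 1)
dominated-head {b ∷ mu} {a ∷ la} (_ , dom) = ≡.subst₂ ℕ._≤_ (ℕP.+-identityʳ b) (ℕP.+-identityʳ a) (dom 1)

-- Were `la` longer, its first `length mu` parts would fall short of the common sum, while those of
-- `mu` already exhaust it.
dominated-length : ∀ {mu la} → All (1 ℕ.≤_) la → Dominated mu la → length la ℕ.≤ length mu
dominated-length {mu} {la} pl (e , dom) with length la ℕ.≤? length mu
... | yes le = le
... | no nle = ⊥-elim (ℕP.<-irrefl e (ℕP.≤-<-trans (subst (λ x → sumℕ x ℕ.≤ sumℕ (take (length mu) la)) (ListP.take-all (length mu) mu ℕP.≤-refl) (dom (length mu)))
    (shorter (length mu) pl (ℕP.≰⇒> nle))))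
  where
  shorter : ∀ k {la} → All (1 ℕ.≤_) la → k ℕ.< length la → sumℕ (take k la) ℕ.< sumℕ la
  shorter zero {x ∷ la} (p ∷ ps) lt = ℕP.<-≤-trans p (ℕP.m≤m+n x (sumℕ la))
  shorter (suc k) {x ∷ la} (p ∷ ps) (ℕ.s≤s lt) = ℕP.+-monoʳ-< x (shorter k ps lt)

-- Partitions with at most l parts, all at most k, in decreasing lexicographic order.
box : ℕ → ℕ → List (List ℕ)
box zero k = [] ∷ []
box (suc l) zero = [] ∷ []
box (suc l) (suc k) = map (suc k ∷_) (box l (suc k)) ++ box (suc l) k

-- By triangularity of the Jack functions this makes the coefficient of m_a in P_b vanish, which is
-- what an elimination that treats `a` before `b` requires.
Before : List ℕ → List ℕ → Set
Before a b = a ≢ b × ¬ Dominated a b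

box-partition : ∀ l k → All (λ la → IsPartition la × headOr0 la ℕ.≤ k) (box l k)
box-partition zero k = (([] , []) , ℕ.z≤n) ∷ []
box-partition (suc l) zero = (([] , []) , ℕ.z≤n) ∷ []
box-partition (suc l) (suc k) = AllP.++⁺ (AllP.map⁺ (All.map (λ { {la} (p , h) → extend la p h , ℕP.≤-refl }) (box-partition l (suc k))))
  (All.map (λ { (p , h) → p , ℕP.m≤n⇒m≤1+n h }) (box-partition (suc l) k))
  where
  extend : ∀ la → IsPartition la → headOr0 la ℕ.≤ suc k → IsPartition (suc k ∷ la)
  extend [] p h = ℕ.s≤s ℕ.z≤n ∷ [] , [-]
  extend (x ∷ la) (ps , l) h = ℕ.s≤s ℕ.z≤n ∷ ps , h ∷ l

dominated-cons : ∀ x {a b} → Dominated (x ∷ a) (x ∷ b) → Dominated a b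
dominated-cons x (e , dom) = ℕP.+-cancelˡ-≡ x _ _ e , λ k → ℕP.+-cancelˡ-≤ x _ _ (dom (suc k))

-- Lists with the same first part are compared after dropping it, and a list with first part `suc k`
-- is not dominated by one whose first part is at most `k`.
box-ordered : ∀ l k → AllPairs Before (box l k)
box-ordered zero k = [] ∷ []
box-ordered (suc l) zero = [] ∷ []
box-ordered (suc l) (suc k) = AllPairsP.++⁺
  (AllPairsP.map⁺ (AllPairs.map (λ { (ne , nd) → (λ e → ne (ListP.∷-injectiveʳ e)) , (λ d → nd (dominated-cons (suc k) d)) }) (box-ordered l (suc k))))
  (box-ordered (suc l) k)
  (AllP.map⁺ (All.map (λ _ → All.map (λ { {b} (p , h) → (λ { ≡.refl → ℕP.<-irrefl ≡.refl h }) , (λ d → ℕP.<-irrefl ≡.refl (ℕP.≤-trans (dominated-head d) h)) }) (box-partition (suc l) k)) (box-partition l (suc k))))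

box-complete : ∀ l k {la} → IsPartition la → length la ℕ.≤ l → headOr0 la ℕ.≤ k → la ∈ box l k
box-complete zero k {[]} p ll hk = here ≡.refl
box-complete (suc l) zero {[]} p ll hk = here ≡.refl
box-complete (suc l) zero {zero ∷ la} (() ∷ _ , _) ll hk
box-complete (suc l) (suc k) {[]} p ll hk = ∈P.∈-++⁺ʳ _ (box-complete (suc l) k p ll ℕ.z≤n)
box-complete (suc l) (suc k) {x ∷ la} p (ℕ.s≤s ll) hk with x ℕ.≟ suc k
... | yes ≡.refl = ∈P.∈-++⁺ˡ (∈P.∈-map⁺ (suc k ∷_) (box-complete l (suc k) (partition-tail p) ll (head≤ la (partition-head p))))
  where
  head≤ : ∀ la → All (ℕ._≤ suc k) la → headOr0 la ℕ.≤ suc k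
  head≤ [] _ = ℕ.z≤n
  head≤ (y ∷ _) (y≤ ∷ _) = y≤
... | no ne = ∈P.∈-++⁺ʳ (map (suc k ∷_) (box l (suc k))) (box-complete (suc l) k p (ℕ.s≤s ll) (ℕ.s≤s⁻¹ (ℕP.≤∧≢⇒< hk ne)))

length≤sum : ∀ {la} → All (1 ℕ.≤_) la → length la ℕ.≤ sumℕ la
length≤sum [] = ℕ.z≤n
length≤sum (p ∷ ps) = ℕP.+-mono-≤ p (length≤sum ps)

head≤sum : ∀ la → headOr0 la ℕ.≤ sumℕ la
head≤sum [] = ℕ.z≤n
head≤sum (x ∷ la) = ℕP.m≤m+n x (sumℕ la)

-- The factor z_λ

weight : List ℕ → ℕ → ℕ
weight la i = (i ^ mult i la) ℕ.* (mult i la !)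

weights : List ℕ → List ℕ → ℕ
weights la = foldr (λ i r → weight la i ℕ.* r) 1

others : ℕ → List ℕ → List ℕ
others x = filter (λ y → ¬? (x ℕ.≟ y))

distinct : List ℕ → List ℕ
distinct = deduplicate ℕ._≟_

weights-cong : ∀ la mu ds → All (λ i → weight la i ≡ weight mu i) ds → weights la ds ≡ weights mu ds
weights-cong la mu [] [] = ≡.refl
weights-cong la mu (i ∷ ds) (e ∷ es) = cong₂ ℕ._*_ e (weights-cong la mu ds es)

others-∉ : ∀ x ds → All (x ≢_) ds → others x ds ≡ ds
others-∉ x ds a = ListP.filter-all (λ y → ¬? (x ℕ.≟ y)) a

-- Allowing an absent `x` of weight 1 spares `zee-∷` the distinction whether the new part already
-- occurs: multiplicity zero gives `x ^ 0 * 0 !`.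
weights-extract : ∀ la x ds → Unique ds → (x ∉ ds → weight la x ≡ 1) → weights la ds ≡ weight la x ℕ.* weights la (others x ds)
weights-extract la x [] _ h = ≡.sym (≡.trans (ℕP.*-identityʳ _) (h λ ()))
weights-extract la x (d ∷ ds) (a ∷ u) h = cases (x ℕ.≟ d)
  where
  cases : Dec (x ≡ d) → weights la (d ∷ ds) ≡ weight la x ℕ.* weights la (others x (d ∷ ds))
  cases (yes ≡.refl) = cong (λ l → weight la x ℕ.* weights la l)
    (≡.sym (≡.trans (ListP.filter-reject (λ y → ¬? (x ℕ.≟ y)) (λ ne → ne ≡.refl)) (others-∉ x ds a)))
  cases (no ne) = ≡.trans (cong (weight la d ℕ.*_) (weights-extract la x ds u (λ x∉ → h λ { (here e) → ne e ; (there m) → x∉ m })))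
    (≡.trans (ℕS.solve 3 (λ a b c → a ℕS.:* (b ℕS.:* c) ℕS.:= b ℕS.:* (a ℕS.:* c)) ≡.refl (weight la d) (weight la x) (weights la (others x ds)))
      (cong (λ l → weight la x ℕ.* weights la l) (≡.sym (ListP.filter-accept (λ y → ¬? (x ℕ.≟ y)) ne))))

mult-∷-same : ∀ x la → mult x (x ∷ la) ≡ suc (mult x la)
mult-∷-same x la = cong length (ListP.filter-accept (x ℕ.≟_) ≡.refl)

mult-∷-other : ∀ {x i} la → i ≢ x → mult i (x ∷ la) ≡ mult i la
mult-∷-other {x} {i} la ne = cong length (ListP.filter-reject (i ℕ.≟_) ne)

mult-∉ : ∀ {x} la → x ∉ la → mult x la ≡ 0
mult-∉ [] _ = ≡.refl
mult-∉ {x} (y ∷ la) x∉ = ≡.trans (mult-∷-other la (x∉ ∘ here)) (mult-∉ la (x∉ ∘ there))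

-- Adjoining a part multiplies z by the part and by its new multiplicity. The scalar square of a
-- power-sum product obeys the same recursion, apart from a factor `α`; see `pair-diagonal`.
zee-∷ : ∀ x la → weights (x ∷ la) (distinct (x ∷ la)) ≡ x ℕ.* mult x (x ∷ la) ℕ.* weights la (distinct la)
zee-∷ x la = begin
  weight (x ∷ la) x ℕ.* weights (x ∷ la) (others x (distinct la))
    ≡⟨ cong₂ ℕ._*_ (cong (λ k → x ^ k ℕ.* k !) (mult-∷-same x la))
         (weights-cong (x ∷ la) la (others x (distinct la)) (All.map (λ {i} x≢i → cong (λ k → i ^ k ℕ.* k !) (mult-∷-other la (x≢i ∘ ≡.sym))) (AllP.all-filter (λ y → ¬? (x ℕ.≟ y)) (distinct la)))) ⟩
  (x ^ suc k ℕ.* suc k !) ℕ.* W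
    ≡⟨ ℕS.solve 5 (λ x p k f w → ((x ℕS.:* p) ℕS.:* ((ℕS.con 1 ℕS.:+ k) ℕS.:* f)) ℕS.:* w ℕS.:= x ℕS.:* (ℕS.con 1 ℕS.:+ k) ℕS.:* ((p ℕS.:* f) ℕS.:* w)) ≡.refl x (x ^ k) k (k !) W ⟩
  x ℕ.* suc k ℕ.* (weight la x ℕ.* W)
    ≡⟨ cong₂ ℕ._*_ (cong (x ℕ.*_) (≡.sym (mult-∷-same x la))) (≡.sym (weights-extract la x (distinct la) (DecUnique.deduplicate-! la) absent)) ⟩
  x ℕ.* mult x (x ∷ la) ℕ.* weights la (distinct la) ∎
  where
  open ≡.≡-Reasoning
  k = mult x la
  W = weights la (others x (distinct la))
  absent : x ∉ distinct la → weight la x ≡ 1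
  absent x∉ = cong (λ k → x ^ k ℕ.* k !) (mult-∉ la (x∉ ∘ ∈P.∈-deduplicate⁺ ℕ._≟_))

zee-partition : ∀ {la} → IsPartition la → zee la ≡ weights la (distinct la)
zee-partition {la} p = cong (λ l → weights la (distinct l)) (norm-of-partition p)

-- Complements in a rectangle and the number of distinct parts

reverse-AllPairs : ∀ {R : ℕ → ℕ → Set} {l} → AllPairs R l → AllPairs (λ x y → R y x) (reverse l)
reverse-AllPairs [] = []
reverse-AllPairs {R} {x ∷ l} (a ∷ as) = subst (AllPairs (λ x y → R y x)) (≡.sym (ListP.unfold-reverse x l))
  (AllPairsP.++⁺ (reverse-AllPairs as) ([] ∷ []) (↭P.All-resp-↭ (↭.↭-sym (↭P.↭-reverse l)) (All.map (λ r → r ∷ []) a)))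

complementIn-partition : ∀ r s {la} → IsPartition la → IsPartition (complementIn r s la)
complementIn-partition r s {la} p = AllP.all-filter (1 ℕ.≤?_) (map (r ∸_) (reverse (padTo s la))) ,
  LinkedP.AllPairs⇒Linked (AllPairsP.filter⁺ (1 ℕ.≤?_) (AllPairsP.map⁺ (AllPairs.map (ℕP.∸-monoʳ-≤ r) (reverse-AllPairs sorted))))
  where
  sorted : AllPairs ℕ._≥_ (padTo s la)
  sorted = AllPairsP.++⁺ (Partition⇒AllPairs p) (zeros (s ∸ length la)) (All.universal (λ _ → AllP.replicate⁺ (s ∸ length la) ℕ.z≤n) la)
    where
    zeros : ∀ k → AllPairs ℕ._≥_ (replicate k 0)
    zeros zero = []
    zeros (suc k) = AllP.replicate⁺ k ℕ.z≤n ∷ zeros k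

-- Trading the explicit reversal for sorting puts the complement into a form that commutes with
-- permutations of the parts.
complementIn-norm : ∀ r s {la} → IsPartition la → complementIn r s la ≡ norm (map (r ∸_) (padTo s la))
complementIn-norm r s {la} p = ≡.trans (≡.sym (norm-of-partition (complementIn-partition r s p)))
  (norm-cong-↭ {complementIn r s la} {map (r ∸_) (padTo s la)}
    (subst (_↭ positive (map (r ∸_) (padTo s la))) (≡.sym (positive-partition (complementIn-partition r s p)))
      (positive-↭ (↭P.map⁺ (r ∸_) (↭P.↭-reverse (padTo s la))))))

unique-set-length : ∀ {as bs : List ℕ} → Unique as → Unique bs → (∀ {x} → x ∈ as → x ∈ bs) → (∀ {x} → x ∈ bs → x ∈ as) → length as ≡ length bs
unique-set-length u v f g = ↭P.↭-length (Bag.∼bag⇒↭ (∈K.unique∧set⇒bag u v (mk⇔ f g)))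

distinctParts-∷ : ∀ {r la} → IsPartition (r ∷ la) → distinctParts (r ∷ la) ≡ r ∷ others r (distinct la)
distinctParts-∷ p = cong distinct (norm-of-partition p)

compl-∈ : ∀ {r la x} → IsPartition (r ∷ la) → x ∈ compl (r ∷ la) → Σ ℕ λ y → (y ∈ r ∷ la) × (x ≡ r ∸ y) × (1 ℕ.≤ x)
compl-∈ {r} {la} {x} p m with ∈P.∈-filter⁻ (1 ℕ.≤?_) {xs = map (r ∸_) (reverse (padTo (length (r ∷ la)) (r ∷ la)))} m
... | m′ , 1≤x with ∈P.∈-map⁻ (r ∸_) m′
... | y , my , e = y , subst (y ∈_) full (↭P.∈-resp-↭ (↭P.↭-reverse (padTo (length (r ∷ la)) (r ∷ la))) my) , e , 1≤x
  where
  full : padTo (length (r ∷ la)) (r ∷ la) ≡ r ∷ la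
  full = ≡.trans (cong (λ k → r ∷ la ++ replicate k 0) (ℕP.n∸n≡0 (length la))) (cong (r ∷_) (ListP.++-identityʳ la))

∈-compl : ∀ {r la y} → y ∈ r ∷ la → 1 ℕ.≤ r ∸ y → r ∸ y ∈ compl (r ∷ la)
∈-compl {r} {la} {y} m le = ∈P.∈-filter⁺ (1 ℕ.≤?_) (∈P.∈-map⁺ (r ∸_) (↭P.∈-resp-↭ (↭.↭-sym (↭P.↭-reverse (padTo (length (r ∷ la)) (r ∷ la)))) (∈P.∈-++⁺ˡ m))) le

-- Subtraction from the largest part `r` maps the distinct parts other than `r` bijectively onto the
-- distinct parts of the complement, while `r` itself becomes a dropped zero. Lengths are compared
-- through equality of the underlying sets of duplicate-free lists.
distinctParts-compl : ∀ {r la} → IsPartition (r ∷ la) → length (distinctParts (compl (r ∷ la))) ≡ length (others r (distinct la))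
distinctParts-compl {r} {la} p = ≡.trans (unique-set-length (DecUnique.deduplicate-! (norm (compl (r ∷ la)))) (unique-map (others-unique) bounded) to from)
  (ListP.length-map (r ∸_) (others r (distinct la)))
  where
  q : IsPartition (compl (r ∷ la))
  q = complementIn-partition r (length (r ∷ la)) p
  others-unique : Unique (others r (distinct la))
  others-unique = UniqueP.filter⁺ (λ y → ¬? (r ℕ.≟ y)) (DecUnique.deduplicate-! la)
  bounded : All (ℕ._≤ r) (others r (distinct la))
  bounded = AllP.filter⁺ (λ y → ¬? (r ℕ.≟ y)) (AllP.deduplicate⁺ ℕ._≟_ (partition-head p))
  unique-map : ∀ {l} → Unique l → All (ℕ._≤ r) l → Unique (map (r ∸_) l)
  unique-map [] [] = []
  unique-map {x ∷ l} (a ∷ u) (b ∷ bs) = AllP.map⁺ (All.zipWith (λ { (ne , y≤) e → ne (ℕP.∸-cancelˡ-≡ b y≤ e) }) (a , bs)) ∷ unique-map u bs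
  image : ∀ {x} → (Σ ℕ λ y → (y ∈ r ∷ la) × (x ≡ r ∸ y) × (1 ℕ.≤ x)) → x ∈ map (r ∸_) (others r (distinct la))
  image (y , here ≡.refl , ≡.refl , 1≤x) = ⊥-elim (ℕP.<-irrefl (≡.sym (ℕP.n∸n≡0 r)) 1≤x)
  image (y , there my , ≡.refl , 1≤x) = ∈P.∈-map⁺ (r ∸_) (∈P.∈-filter⁺ (λ y → ¬? (r ℕ.≟ y)) (∈P.∈-deduplicate⁺ ℕ._≟_ my) λ { ≡.refl → ℕP.<-irrefl (≡.sym (ℕP.n∸n≡0 r)) 1≤x })
  to : ∀ {x} → x ∈ distinctParts (compl (r ∷ la)) → x ∈ map (r ∸_) (others r (distinct la))
  to {x} m = image (compl-∈ p (subst (x ∈_) (norm-of-partition q) (∈P.∈-deduplicate⁻ ℕ._≟_ (norm (compl (r ∷ la))) m)))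
  preimage : ∀ {y} → y ∈ la → r ≢ y → r ∸ y ∈ distinctParts (compl (r ∷ la))
  preimage {y} y∈la r≢y = ∈P.∈-deduplicate⁺ ℕ._≟_ {norm (compl (r ∷ la))} (subst (r ∸ y ∈_) (≡.sym (norm-of-partition q))
      (∈-compl (there y∈la) (ℕP.m<n⇒0<n∸m (ℕP.≤∧≢⇒< (All.lookup (partition-head p) y∈la) (r≢y ∘ ≡.sym)))))
  preimage-filter : ∀ {y} → y ∈ distinct la × ¬ (r ≡ y) → r ∸ y ∈ distinctParts (compl (r ∷ la))
  preimage-filter (my , r≢y) = preimage (∈P.∈-deduplicate⁻ ℕ._≟_ la my) r≢y
  preimage-map : ∀ {x} → (Σ ℕ λ y → (y ∈ others r (distinct la)) × (x ≡ r ∸ y)) → x ∈ distinctParts (compl (r ∷ la))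
  preimage-map (y , my , e) = subst (_∈ distinctParts (compl (r ∷ la))) (≡.sym e) (preimage-filter (∈P.∈-filter⁻ (λ y → ¬? (r ℕ.≟ y)) {xs = distinct la} my))
  from : ∀ {x} → x ∈ map (r ∸_) (others r (distinct la)) → x ∈ distinctParts (compl (r ∷ la))
  from m = preimage-map (∈P.∈-map⁻ (r ∸_) m)

one-distinct-part : ∀ {r la} → others r (distinct la) ≡ [] → r ∷ la ≡ rectOf (r ∷ la)
one-distinct-part {r} {la} e = cong (r ∷_) (constant la λ {x} m → equal m)
  where
  equal : ∀ {x} → x ∈ la → x ≡ r
  equal {x} m with r ℕ.≟ x
  ... | yes ≡.refl = ≡.refl
  ... | no ne with subst (x ∈_) e (∈P.∈-filter⁺ (λ y → ¬? (r ℕ.≟ y)) (∈P.∈-deduplicate⁺ ℕ._≟_ m) ne)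
  ...   | ()
  constant : ∀ l → (∀ {x} → x ∈ l → x ≡ r) → l ≡ replicate (length l) r
  constant [] h = ≡.refl
  constant (x ∷ l) h = cong₂ _∷_ (h (here ≡.refl)) (constant l (h ∘ there))

distinctParts-compl-suc : ∀ {r la} → IsPartition (r ∷ la) →
  length (distinctParts (r ∷ la)) ≡ suc (length (distinctParts (compl (r ∷ la))))
distinctParts-compl-suc p = ≡.trans (cong length (distinctParts-∷ p)) (cong suc (≡.sym (distinctParts-compl p)))

one-distinctPart⇒rectangle : ∀ {r la} → IsPartition (r ∷ la) → length (distinctParts (r ∷ la)) ≡ 1 → r ∷ la ≡ rectOf (r ∷ la)
one-distinctPart⇒rectangle {r} {la} p e = one-distinct-part (length≡0 (others r (distinct la))
  (ℕP.suc-injective (≡.trans (cong length (≡.sym (distinctParts-∷ p))) e)))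
  where
  length≡0 : ∀ (l : List ℕ) → length l ≡ 0 → l ≡ []
  length≡0 [] _ = ≡.refl

module JackFunctions (F : JackField) where

  open JackField F hiding (zero; _-_; _≉_)
  open import Algebra.Properties.Ring ring using (-‿distribˡ-*; -0#≈0#; x∙y⁻¹≈ε⇒x≈y; x≈y⇒x∙y⁻¹≈ε)
  open Solver using (solve; _:=_; _:+_; _:*_; _:-_; :-_; con)
  open import Relation.Binary.Reasoning.Setoid setoid

  private variable
    I J : Set

  -- Power sums and the Laplace–Beltrami operator

  -- Formal sums are never normalised. A linear functional is given by its values on generators
  -- through `ev`, and identities between operators are stated for every functional `φ`.
  Lin : Set → Set
  Lin I = List (Carrier × I)

  ev : (I → Carrier) → Lin I → Carrier
  ev φ [] = 0#
  ev φ ((c , a) ∷ f) = c * φ a + ev φ f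

  infixr 8 _⋆_
  _⋆_ : Carrier → Lin I → Lin I
  c ⋆ f = map (λ t → c * proj₁ t , proj₂ t) f

  mapL : (I → J) → Lin I → Lin J
  mapL h = map (λ t → proj₁ t , h (proj₂ t))

  infixl 5 _>>=_
  _>>=_ : Lin I → (I → Lin J) → Lin J
  [] >>= h = []
  ((c , a) ∷ f) >>= h = c ⋆ h a ++ (f >>= h)

  single : I → Lin I
  single a = (1# , a) ∷ []

  ev-cong : ∀ {φ ψ : I → Carrier} → (∀ a → φ a ≈ ψ a) → ∀ f → ev φ f ≈ ev ψ f
  ev-cong e [] = refl
  ev-cong e ((c , a) ∷ f) = +-cong (*-congˡ (e a)) (ev-cong e f)

  ev-++ : ∀ (φ : I → Carrier) f g → ev φ (f ++ g) ≈ ev φ f + ev φ g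
  ev-++ φ [] g = sym (+-identityˡ _)
  ev-++ φ ((c , a) ∷ f) g = trans (+-congˡ (ev-++ φ f g)) (sym (+-assoc _ _ _))

  ev-⋆ : ∀ (φ : I → Carrier) c f → ev φ (c ⋆ f) ≈ c * ev φ f
  ev-⋆ φ c [] = sym (zeroʳ c)
  ev-⋆ φ c ((d , a) ∷ f) = trans (+-cong (*-assoc c d _) (ev-⋆ φ c f)) (sym (distribˡ c _ _))

  ev-map : ∀ (φ : J → Carrier) (h : I → J) f → ev φ (mapL h f) ≈ ev (φ ∘ h) f
  ev-map φ h [] = refl
  ev-map φ h ((c , a) ∷ f) = +-congˡ (ev-map φ h f)

  ev->>= : ∀ (φ : J → Carrier) f (h : I → Lin J) → ev φ (f >>= h) ≈ ev (λ a → ev φ (h a)) f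
  ev->>= φ [] h = refl
  ev->>= φ ((c , a) ∷ f) h = trans (ev-++ φ (c ⋆ h a) (f >>= h)) (+-cong (ev-⋆ φ c (h a)) (ev->>= φ f h))

  ev-single : ∀ (φ : I → Carrier) a → ev φ (single a) ≈ φ a
  ev-single φ a = trans (+-identityʳ _) (*-identityˡ _)

  ev-0 : ∀ (f : Lin I) → ev (λ _ → 0#) f ≈ 0#
  ev-0 [] = refl
  ev-0 ((c , a) ∷ f) = trans (+-cong (zeroʳ c) (ev-0 f)) (+-identityʳ 0#)

  ev-zero : ∀ {φ : I → Carrier} → (∀ a → φ a ≈ 0#) → ∀ f → ev φ f ≈ 0#
  ev-zero e f = trans (ev-cong e f) (ev-0 f)

  ev-+ : ∀ (φ ψ : I → Carrier) f → ev (λ a → φ a + ψ a) f ≈ ev φ f + ev ψ f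
  ev-+ φ ψ [] = sym (+-identityʳ 0#)
  ev-+ φ ψ ((c , a) ∷ f) = trans (+-congˡ (ev-+ φ ψ f))
    (solve 5 (λ c p q x y → c :* (p :+ q) :+ (x :+ y) := (c :* p :+ x) :+ (c :* q :+ y)) refl c (φ a) (ψ a) (ev φ f) (ev ψ f))

  ev-* : ∀ d (φ : I → Carrier) f → ev (λ a → d * φ a) f ≈ d * ev φ f
  ev-* d φ [] = sym (zeroʳ d)
  ev-* d φ ((c , a) ∷ f) = trans (+-congˡ (ev-* d φ f))
    (solve 4 (λ c d p x → c :* (d :* p) :+ d :* x := d :* (c :* p :+ x)) refl c d (φ a) (ev φ f))

  ev-*ʳ : ∀ d (φ : I → Carrier) f → ev (λ a → φ a * d) f ≈ ev φ f * d
  ev-*ʳ d φ f = trans (ev-cong (λ a → *-comm (φ a) d) f) (trans (ev-* d φ f) (*-comm d _))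

  ev-neg : ∀ (φ : I → Carrier) f → ev (λ a → - φ a) f ≈ - ev φ f
  ev-neg φ [] = sym -0#≈0#
  ev-neg φ ((c , a) ∷ f) = trans (+-congˡ (ev-neg φ f))
    (solve 3 (λ c p x → c :* (:- p) :+ (:- x) := :- (c :* p :+ x)) refl c (φ a) (ev φ f))

  ev-swap : ∀ (φ : I → J → Carrier) f g → ev (λ a → ev (φ a) g) f ≈ ev (λ b → ev (λ a → φ a b) f) g
  ev-swap φ [] g = sym (ev-0 g)
  ev-swap φ ((c , a) ∷ f) g = trans (+-cong (sym (ev-* c (φ a) g)) (ev-swap φ f g))
    (sym (ev-+ (λ b → c * φ a b) (λ b → ev (λ a → φ a b) f) g))

  ⟦_⟧ : ℕ → Carrier
  ⟦ n ⟧ = ι (+ suc n)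

  δ : ℕ → ℕ → Carrier
  δ m n = if m ℕ.≡ᵇ n then 1# else 0#

  δ-subst : ∀ (h : ℕ → Carrier) m n → δ m n * h m ≈ δ m n * h n
  δ-subst h zero zero = refl
  δ-subst h zero (suc n) = trans (zeroˡ _) (sym (zeroˡ _))
  δ-subst h (suc m) zero = trans (zeroˡ _) (sym (zeroˡ _))
  δ-subst h (suc m) (suc n) = δ-subst (h ∘ suc) m n

  δ-sym : ∀ m n → δ m n ≈ δ n m
  δ-sym zero zero = refl
  δ-sym zero (suc n) = refl
  δ-sym (suc m) zero = refl
  δ-sym (suc m) (suc n) = δ-sym m n

  -- Pairs (i , j) with i + j + 1 = n.
  splits : ℕ → Lin (ℕ × ℕ)
  splits zero = []
  splits (suc n) = (1# , (0 , n)) ∷ mapL (λ s → suc (proj₁ s) , proj₂ s) (splits n)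

  splits-snoc : ∀ (φ : ℕ × ℕ → Carrier) n →
    ev φ (splits (suc n)) ≈ ev (λ s → φ (proj₁ s , suc (proj₂ s))) (splits n) + φ (n , 0)
  splits-snoc φ zero = trans (+-identityʳ _) (trans (*-identityˡ _) (sym (+-identityˡ _)))
  splits-snoc φ (suc n) = begin
    1# * φ (0 , suc n) + ev φ (mapL σ (splits (suc n)))
      ≈⟨ +-congˡ (trans (ev-map φ σ (splits (suc n))) (splits-snoc (φ ∘ σ) n)) ⟩
    1# * φ (0 , suc n) + (ev (λ s → φ (suc (proj₁ s) , suc (proj₂ s))) (splits n) + φ (suc n , 0))
      ≈⟨ +-assoc _ _ _ ⟨
    (1# * φ (0 , suc n) + ev (λ s → φ (suc (proj₁ s) , suc (proj₂ s))) (splits n)) + φ (suc n , 0)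
      ≈⟨ +-congʳ (+-congˡ (sym (ev-map (λ s → φ (proj₁ s , suc (proj₂ s))) σ (splits n)))) ⟩
    ev (λ s → φ (proj₁ s , suc (proj₂ s))) (splits (suc n)) + φ (suc n , 0) ∎
    where
    σ : ℕ × ℕ → ℕ × ℕ
    σ s = suc (proj₁ s) , proj₂ s

  splits-sym : ∀ (φ : ℕ × ℕ → Carrier) n → ev φ (splits n) ≈ ev (λ s → φ (proj₂ s , proj₁ s)) (splits n)
  splits-sym φ zero = refl
  splits-sym φ (suc n) = begin
    ev φ (splits (suc n))
      ≈⟨ splits-snoc φ n ⟩
    ev (λ s → φ (proj₁ s , suc (proj₂ s))) (splits n) + φ (n , 0)
      ≈⟨ +-cong (splits-sym (λ s → φ (proj₁ s , suc (proj₂ s))) n) (sym (*-identityˡ _)) ⟩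
    ev (λ s → φ (proj₂ s , suc (proj₁ s))) (splits n) + 1# * φ (n , 0)
      ≈⟨ +-comm _ _ ⟩
    1# * φ (n , 0) + ev (λ s → φ (proj₂ s , suc (proj₁ s))) (splits n)
      ≈⟨ +-congˡ (ev-map (λ s → φ (proj₂ s , proj₁ s)) (λ s → suc (proj₁ s) , proj₂ s) (splits n)) ⟨
    ev (λ s → φ (proj₂ s , proj₁ s)) (splits (suc n)) ∎

  splits-δδ : ∀ i j n → ev (λ s → δ i (proj₁ s) * δ j (proj₂ s)) (splits n) ≈ δ (suc (i ℕ.+ j)) n
  splits-δδ i j zero = refl
  splits-δδ zero j (suc n) = begin
    1# * (1# * δ j n) + ev (λ s → δ 0 (proj₁ s) * δ j (proj₂ s)) (mapL _ (splits n))
      ≈⟨ +-cong (trans (*-identityˡ _) (*-identityˡ _)) (trans (ev-map _ _ (splits n)) (ev-zero (λ s → zeroˡ _) (splits n))) ⟩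
    δ j n + 0#  ≈⟨ +-identityʳ _ ⟩
    δ j n       ∎
  splits-δδ (suc i) j (suc n) = begin
    1# * (0# * δ j n) + ev (λ s → δ (suc i) (proj₁ s) * δ j (proj₂ s)) (mapL _ (splits n))
      ≈⟨ +-cong (trans (*-identityˡ _) (zeroˡ _)) (trans (ev-map _ _ (splits n)) refl) ⟩
    0# + ev (λ s → δ i (proj₁ s) * δ j (proj₂ s)) (splits n)  ≈⟨ +-identityˡ _ ⟩
    ev (λ s → δ i (proj₁ s) * δ j (proj₂ s)) (splits n)       ≈⟨ splits-δδ i j n ⟩
    δ (suc (i ℕ.+ j)) n                                       ∎

  -- The monomial n₁ ∷ n₂ ∷ … stands for the power-sum product p_{n₁+1} p_{n₂+1} ⋯ .
  Mono : Set
  Mono = List ℕ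

  Λ : Set
  Λ = Lin Mono

  ∂ : ℕ → Mono → Λ
  ∂ n [] = []
  ∂ n (k ∷ μ) = (δ n k , μ) ∷ mapL (k ∷_) (∂ n μ)

  -- Σᵢ i p_{m+i} ∂/∂pᵢ and its adjoint Σᵢ (m+i) pᵢ ∂/∂p_{m+i}.
  join : ℕ → Mono → Λ
  join m [] = []
  join m (k ∷ μ) = (⟦ k ⟧ , suc (m ℕ.+ k) ∷ μ) ∷ mapL (k ∷_) (join m μ)

  trim : ℕ → Mono → Λ
  trim m [] = []
  trim m (k ∷ μ) = (⟦ k ⟧ ⋆ (splits k >>= λ s → (δ m (proj₁ s) , proj₂ s ∷ μ) ∷ [])) ++ mapL (k ∷_) (trim m μ)

  diag : ℕ → Carrier
  diag m = (α + - 1#) * ⟦ m ⟧ * ι (+ m)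

  2α : Carrier
  2α = ι (+ 2) * α

  -- Twice the Laplace–Beltrami operator
  -- α/2 Σ ij p_{i+j} ∂ᵢ∂ⱼ + ½ Σ (i+j) pᵢpⱼ ∂_{i+j} + (α-1)/2 Σ i(i-1) pᵢ∂ᵢ.
  D : Mono → Λ
  D [] = []
  D (m ∷ μ) = (⟦ m ⟧ ⋆ mapL (λ s → proj₁ s ∷ proj₂ s ∷ μ) (splits m)) ++
              ((diag m , m ∷ μ) ∷ ((2α * ⟦ m ⟧) ⋆ join m μ) ++ mapL (m ∷_) (D μ))

  ev-∂ : ∀ φ n k μ → ev φ (∂ n (k ∷ μ)) ≈ δ n k * φ μ + ev (φ ∘ (k ∷_)) (∂ n μ)
  ev-∂ φ n k μ = +-congˡ (ev-map φ (k ∷_) (∂ n μ))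

  ev-join : ∀ φ m k μ → ev φ (join m (k ∷ μ)) ≈ ⟦ k ⟧ * φ (suc (m ℕ.+ k) ∷ μ) + ev (φ ∘ (k ∷_)) (join m μ)
  ev-join φ m k μ = +-congˡ (ev-map φ (k ∷_) (join m μ))

  ev-trim : ∀ φ m k μ → ev φ (trim m (k ∷ μ)) ≈
    ⟦ k ⟧ * ev (λ s → δ m (proj₁ s) * φ (proj₂ s ∷ μ)) (splits k) + ev (φ ∘ (k ∷_)) (trim m μ)
  ev-trim φ m k μ = trans (ev-++ φ (⟦ k ⟧ ⋆ f) (mapL (k ∷_) (trim m μ)))
    (+-cong (trans (ev-⋆ φ ⟦ k ⟧ f) (*-congˡ (trans (ev->>= φ (splits k) h) (ev-cong (λ s → +-identityʳ _) (splits k)))))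
            (ev-map φ (k ∷_) (trim m μ)))
    where
    h : ℕ × ℕ → Λ
    h s = (δ m (proj₁ s) , proj₂ s ∷ μ) ∷ []
    f = splits k >>= h

  ev-D : ∀ φ m μ → ev φ (D (m ∷ μ)) ≈
    ⟦ m ⟧ * ev (λ s → φ (proj₁ s ∷ proj₂ s ∷ μ)) (splits m) +
    (diag m * φ (m ∷ μ) + (2α * ⟦ m ⟧ * ev φ (join m μ) + ev (φ ∘ (m ∷_)) (D μ)))
  ev-D φ m μ = trans (ev-++ φ (⟦ m ⟧ ⋆ mapL h (splits m)) _)
    (+-cong (trans (ev-⋆ φ ⟦ m ⟧ (mapL h (splits m))) (*-congˡ (ev-map φ h (splits m))))
      (+-congˡ (trans (ev-++ φ ((2α * ⟦ m ⟧) ⋆ join m μ) _)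
        (+-cong (ev-⋆ φ (2α * ⟦ m ⟧) (join m μ)) (ev-map φ (m ∷_) (D μ))))))
    where
    h : ℕ × ℕ → Mono
    h s = proj₁ s ∷ proj₂ s ∷ μ

  -- The commutator of `∂ m` with `join n` is `⟦ j ⟧` times `∂ j` if m = n + j + 1, and zero if
  -- there is no such j. The sum over `splits m` with a `δ` finds this j without subtraction.
  ∂-join : ∀ φ m n ν → ev (λ x → ev φ (∂ m x)) (join n ν) ≈
    ev (λ x → ev φ (join n x)) (∂ m ν) + ev (λ s → δ (proj₁ s) n * ⟦ proj₂ s ⟧ * ev φ (∂ (proj₂ s) ν)) (splits m)
  ∂-join φ m n [] = sym (trans (+-identityˡ _) (ev-zero (λ s → zeroʳ _) (splits m)))
  ∂-join φ m n (k ∷ ν) = begin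
    ev (λ x → ev φ (∂ m x)) (join n (k ∷ ν))
      ≈⟨ ev-join _ n k ν ⟩
    ⟦ k ⟧ * ev φ (∂ m (suc (n ℕ.+ k) ∷ ν)) + ev (λ x → ev φ (∂ m (k ∷ x))) (join n ν)
      ≈⟨ +-cong (*-congˡ (ev-∂ φ m (suc (n ℕ.+ k)) ν))
          (trans (ev-cong (λ x → ev-∂ φ m k x) (join n ν)) (trans (ev-+ _ _ (join n ν)) (+-cong (ev-* (δ m k) φ (join n ν)) (∂-join φk m n ν)))) ⟩
    ⟦ k ⟧ * (δ m (suc (n ℕ.+ k)) * φ ν + a) + (δ m k * b + (c + d))
      ≈⟨ solve 7 (λ K D P a x c d → K :* (D :* P :+ a) :+ (x :+ (c :+ d)) := (x :+ (K :* a :+ c)) :+ ((K :* D) :* P :+ d)) refl ⟦ k ⟧ (δ m (suc (n ℕ.+ k))) (φ ν) a (δ m k * b) c d ⟩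
    (δ m k * b + (⟦ k ⟧ * a + c)) + (⟦ k ⟧ * δ m (suc (n ℕ.+ k)) * φ ν + d)
      ≈⟨ +-cong
          (sym (trans (ev-∂ _ m k ν) (+-congˡ (trans (ev-cong (λ x → ev-join φ n k x) (∂ m ν)) (trans (ev-+ _ _ (∂ m ν)) (+-congʳ (ev-* ⟦ k ⟧ _ (∂ m ν))))))))
          (sym (trans (ev-cong (λ s → trans (*-congˡ (ev-∂ φ (proj₂ s) k ν)) (distribˡ _ _ _)) (splits m)) (trans (ev-+ _ _ (splits m)) (+-congʳ key)))) ⟩
    ev (λ x → ev φ (join n x)) (∂ m (k ∷ ν)) + ev (λ s → δ (proj₁ s) n * ⟦ proj₂ s ⟧ * ev φ (∂ (proj₂ s) (k ∷ ν))) (splits m) ∎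
    where
    φk = φ ∘ (k ∷_)
    a = ev (φ ∘ (suc (n ℕ.+ k) ∷_)) (∂ m ν)
    b = ev φ (join n ν)
    c = ev (λ x → ev φk (join n x)) (∂ m ν)
    d = ev (λ s → δ (proj₁ s) n * ⟦ proj₂ s ⟧ * ev φk (∂ (proj₂ s) ν)) (splits m)
    key : ev (λ s → δ (proj₁ s) n * ⟦ proj₂ s ⟧ * (δ (proj₂ s) k * φ ν)) (splits m) ≈ ⟦ k ⟧ * δ m (suc (n ℕ.+ k)) * φ ν
    key = begin
      ev (λ s → δ (proj₁ s) n * ⟦ proj₂ s ⟧ * (δ (proj₂ s) k * φ ν)) (splits m)
        ≈⟨ ev-cong (λ s → trans
             (solve 4 (λ D J E P → D :* J :* (E :* P) := D :* (E :* J) :* P) refl (δ (proj₁ s) n) ⟦ proj₂ s ⟧ (δ (proj₂ s) k) (φ ν))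
             (trans (*-congʳ (*-cong (δ-sym (proj₁ s) n) (trans (δ-subst ⟦_⟧ (proj₂ s) k) (*-congʳ (δ-sym (proj₂ s) k)))))
             (solve 4 (λ D K E P → D :* (E :* K) :* P := (D :* E) :* (K :* P)) refl (δ n (proj₁ s)) ⟦ k ⟧ (δ k (proj₂ s)) (φ ν)))) (splits m) ⟩
      ev (λ s → (δ n (proj₁ s) * δ k (proj₂ s)) * (⟦ k ⟧ * φ ν)) (splits m)
        ≈⟨ ev-*ʳ (⟦ k ⟧ * φ ν) _ (splits m) ⟩
      ev (λ s → δ n (proj₁ s) * δ k (proj₂ s)) (splits m) * (⟦ k ⟧ * φ ν)
        ≈⟨ *-congʳ (trans (splits-δδ n k m) (δ-sym _ m)) ⟩
      δ m (suc (n ℕ.+ k)) * (⟦ k ⟧ * φ ν)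
        ≈⟨ solve 3 (λ D K P → D :* (K :* P) := K :* D :* P) refl _ _ _ ⟩
      ⟦ k ⟧ * δ m (suc (n ℕ.+ k)) * φ ν ∎

  -- The commutator arises where the derivative hits the factor that `trim m` has just created from
  -- a part m + k + 1; `splits-δδ` locates that part.
  ∂-trim : ∀ φ k m ν → ev (λ x → ev φ (∂ k x)) (trim m ν) ≈
    ev (λ x → ev φ (trim m x)) (∂ k ν) + ⟦ suc (m ℕ.+ k) ⟧ * ev φ (∂ (suc (m ℕ.+ k)) ν)
  ∂-trim φ k m [] = sym (trans (+-identityˡ _) (zeroʳ _))
  ∂-trim φ k m (n ∷ ν) = begin
    ev (λ x → ev φ (∂ k x)) (trim m (n ∷ ν))
      ≈⟨ ev-trim _ m n ν ⟩
    ⟦ n ⟧ * ev (λ s → δ m (proj₁ s) * ev φ (∂ k (proj₂ s ∷ ν))) (splits n) + ev (λ x → ev φ (∂ k (n ∷ x))) (trim m ν)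
      ≈⟨ +-cong
          (*-congˡ (trans (ev-cong (λ s → trans (*-congˡ (ev-∂ φ k (proj₂ s) ν)) (distribˡ _ _ _)) (splits n)) (trans (ev-+ _ _ (splits n)) (+-congʳ key))))
          (trans (ev-cong (λ x → ev-∂ φ k n x) (trim m ν)) (trans (ev-+ _ _ (trim m ν)) (+-cong (ev-* (δ k n) φ (trim m ν)) (∂-trim φn k m ν)))) ⟩
    ⟦ n ⟧ * (δ mk n * φ ν + a) + (δ k n * b + (c + ⟦ mk ⟧ * d))
      ≈⟨ solve 8 (λ N E P a x c M d → N :* (E :* P :+ a) :+ (x :+ (c :+ M :* d)) := (x :+ (N :* a :+ c)) :+ ((E :* N) :* P :+ M :* d)) refl ⟦ n ⟧ (δ mk n) (φ ν) a (δ k n * b) c ⟦ mk ⟧ d ⟩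
    (δ k n * b + (⟦ n ⟧ * a + c)) + ((δ mk n * ⟦ n ⟧) * φ ν + ⟦ mk ⟧ * d)
      ≈⟨ +-cong
          (sym (trans (ev-∂ _ k n ν) (+-congˡ (trans (ev-cong (λ x → ev-trim φ m n x) (∂ k ν)) (trans (ev-+ _ _ (∂ k ν)) (+-congʳ (trans (ev-* ⟦ n ⟧ _ (∂ k ν)) (*-congˡ exchange))))))))
          (trans (+-congʳ (trans (*-congʳ (sym (δ-subst ⟦_⟧ mk n))) (solve 3 (λ E M P → E :* M :* P := M :* (E :* P)) refl _ _ _))) (trans (sym (distribˡ _ _ _)) (*-congˡ (sym (ev-∂ φ mk n ν))))) ⟩
    ev (λ x → ev φ (trim m x)) (∂ k (n ∷ ν)) + ⟦ mk ⟧ * ev φ (∂ mk (n ∷ ν)) ∎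
    where
    φn = φ ∘ (n ∷_)
    mk = suc (m ℕ.+ k)
    a = ev (λ s → δ m (proj₁ s) * ev (φ ∘ (proj₂ s ∷_)) (∂ k ν)) (splits n)
    b = ev φ (trim m ν)
    c = ev (λ x → ev φn (trim m x)) (∂ k ν)
    d = ev φn (∂ mk ν)
    exchange : ev (λ x → ev (λ s → δ m (proj₁ s) * φ (proj₂ s ∷ x)) (splits n)) (∂ k ν) ≈ a
    exchange = trans (ev-swap _ (∂ k ν) (splits n)) (ev-cong (λ s → ev-* (δ m (proj₁ s)) _ (∂ k ν)) (splits n))
    key : ev (λ s → δ m (proj₁ s) * (δ k (proj₂ s) * φ ν)) (splits n) ≈ δ mk n * φ ν
    key = trans (ev-cong (λ s → sym (*-assoc _ _ _)) (splits n)) (trans (ev-*ʳ (φ ν) _ (splits n)) (*-congʳ (splits-δδ m k n)))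

  -- The commutator of `∂ m` with `D`. Its three terms mirror the cut, diagonal and join terms by
  -- which `D` fails to commute with multiplication by a power sum (`ev-D`); under the pairing each
  -- goes over into its counterpart.
  ∂-D : ∀ φ m ν → ev (λ x → ev φ (∂ m x)) (D ν) ≈
    ev (λ x → ev φ (D x)) (∂ m ν) +
    (α * ev (λ s → ⟦ proj₁ s ⟧ * ⟦ proj₂ s ⟧ * ev (λ x → ev φ (∂ (proj₂ s) x)) (∂ (proj₁ s) ν)) (splits m) +
    (diag m * ev φ (∂ m ν) + ι (+ 2) * ev φ (trim m ν)))
  ∂-D φ m [] = sym (trans (+-identityˡ _) (trans (+-cong (trans (*-congˡ (ev-zero (λ s → zeroʳ _) (splits m))) (zeroʳ α))
    (trans (+-cong (zeroʳ _) (zeroʳ _)) (+-identityʳ 0#))) (+-identityʳ 0#)))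
  ∂-D φ m (n ∷ ν) = begin
    ev ψ (D (n ∷ ν))
      ≈⟨ ev-D ψ n ν ⟩
    ⟦ n ⟧ * ev (λ s → ψ (proj₁ s ∷ proj₂ s ∷ ν)) (splits n) +
      (diag n * ψ (n ∷ ν) + (2α * ⟦ n ⟧ * ev ψ (join n ν) + ev (ψ ∘ (n ∷_)) (D ν)))
      ≈⟨ +-cong (*-congˡ cut) (+-cong (*-congˡ (ev-∂ φ m n ν)) (+-cong (*-congˡ (∂-join φ m n ν)) rest)) ⟩
    ⟦ n ⟧ * (S + (S + C)) + (diag n * (δ m n * φ ν + a) + (2α * ⟦ n ⟧ * (b + e) +
      (δ m n * g + (c + (α * H + (diag m * a + ι (+ 2) * t))))))
      ≈⟨ solve 15 (λ N S C dn E P a A b e g c H dm t →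
           N :* (S :+ (S :+ C)) :+ (dn :* (E :* P :+ a) :+ (con (+ 2) :* A :* N :* (b :+ e) :+ (E :* g :+ (c :+ (A :* H :+ (dm :* a :+ con (+ 2) :* t))))))
           := (E :* g :+ (N :* C :+ (dn :* a :+ (con (+ 2) :* A :* N :* b :+ c)))) :+
              (A :* (N :* e :+ (N :* e :+ H)) :+ (((E :* dn) :* P :+ dm :* a) :+ con (+ 2) :* (N :* S :+ t))))
           refl ⟦ n ⟧ S C (diag n) (δ m n) (φ ν) a α b e g c H (diag m) t ⟩
    (δ m n * g + (⟦ n ⟧ * C + (diag n * a + (2α * ⟦ n ⟧ * b + c)))) +
    (α * (⟦ n ⟧ * e + (⟦ n ⟧ * e + H)) + ((δ m n * diag n * φ ν + diag m * a) + ι (+ 2) * (⟦ n ⟧ * S + t)))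
      ≈⟨ +-cong (sym first) (+-cong (*-congˡ (sym second))
          (+-cong (trans (+-congʳ (trans (*-congʳ (sym (δ-subst diag m n))) (solve 3 (λ E M P → E :* M :* P := M :* (E :* P)) refl _ _ _)))
                         (trans (sym (distribˡ _ _ _)) (*-congˡ (sym (ev-∂ φ m n ν)))))
                  (*-congˡ (sym (ev-trim φ m n ν))))) ⟩
    ev (λ x → ev φ (D x)) (∂ m (n ∷ ν)) +
    (α * ev (λ s → ⟦ proj₁ s ⟧ * ⟦ proj₂ s ⟧ * ev (λ x → ev φ (∂ (proj₂ s) x)) (∂ (proj₁ s) (n ∷ ν))) (splits m) +
    (diag m * ev φ (∂ m (n ∷ ν)) + ι (+ 2) * ev φ (trim m (n ∷ ν)))) ∎
    where
    ψ φn : Mono → Carrier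
    ψ = λ x → ev φ (∂ m x)
    φn = φ ∘ (n ∷_)
    S C a b e g c H t : Carrier
    S = ev (λ s → δ m (proj₁ s) * φ (proj₂ s ∷ ν)) (splits n)
    C = ev (λ s → ev (λ x → φ (proj₁ s ∷ proj₂ s ∷ x)) (∂ m ν)) (splits n)
    a = ev φn (∂ m ν)
    b = ev (λ x → ev φ (join n x)) (∂ m ν)
    e = ev (λ s → δ (proj₁ s) n * ⟦ proj₂ s ⟧ * ev φ (∂ (proj₂ s) ν)) (splits m)
    g = ev φ (D ν)
    c = ev (λ x → ev φn (D x)) (∂ m ν)
    H = ev (λ s → ⟦ proj₁ s ⟧ * ⟦ proj₂ s ⟧ * ev (λ x → ev φn (∂ (proj₂ s) x)) (∂ (proj₁ s) ν)) (splits m)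
    t = ev φn (trim m ν)
    cut : ev (λ s → ψ (proj₁ s ∷ proj₂ s ∷ ν)) (splits n) ≈ S + (S + C)
    cut = begin
      ev (λ s → ψ (proj₁ s ∷ proj₂ s ∷ ν)) (splits n)
        ≈⟨ ev-cong (λ s → trans (ev-∂ φ m (proj₁ s) (proj₂ s ∷ ν)) (+-congˡ (ev-∂ (φ ∘ (proj₁ s ∷_)) m (proj₂ s) ν))) (splits n) ⟩
      ev (λ s → δ m (proj₁ s) * φ (proj₂ s ∷ ν) + (δ m (proj₂ s) * φ (proj₁ s ∷ ν) + ev (λ x → φ (proj₁ s ∷ proj₂ s ∷ x)) (∂ m ν))) (splits n)
        ≈⟨ trans (ev-+ _ _ (splits n)) (+-congˡ (ev-+ _ _ (splits n))) ⟩
      S + (ev (λ s → δ m (proj₂ s) * φ (proj₁ s ∷ ν)) (splits n) + C)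
        ≈⟨ +-congˡ (+-congʳ (splits-sym _ n)) ⟩
      S + (S + C) ∎
    rest : ev (ψ ∘ (n ∷_)) (D ν) ≈ δ m n * g + (c + (α * H + (diag m * a + ι (+ 2) * t)))
    rest = trans (ev-cong (λ x → ev-∂ φ m n x) (D ν)) (trans (ev-+ _ _ (D ν)) (+-cong (ev-* (δ m n) φ (D ν)) (∂-D φn m ν)))
    first : ev (λ x → ev φ (D x)) (∂ m (n ∷ ν)) ≈ δ m n * g + (⟦ n ⟧ * C + (diag n * a + (2α * ⟦ n ⟧ * b + c)))
    first = begin
      ev (λ x → ev φ (D x)) (∂ m (n ∷ ν))
        ≈⟨ ev-∂ _ m n ν ⟩
      δ m n * g + ev (λ x → ev φ (D (n ∷ x))) (∂ m ν)
        ≈⟨ +-congˡ (ev-cong (λ x → ev-D φ n x) (∂ m ν)) ⟩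
      δ m n * g + ev (λ x → ⟦ n ⟧ * ev (λ s → φ (proj₁ s ∷ proj₂ s ∷ x)) (splits n) + (diag n * φn x + (2α * ⟦ n ⟧ * ev φ (join n x) + ev φn (D x)))) (∂ m ν)
        ≈⟨ +-congˡ (trans (ev-+ _ _ (∂ m ν)) (+-cong (trans (ev-* ⟦ n ⟧ _ (∂ m ν)) (*-congˡ (ev-swap _ (∂ m ν) (splits n))))
             (trans (ev-+ _ _ (∂ m ν)) (+-cong (ev-* (diag n) φn (∂ m ν)) (trans (ev-+ _ _ (∂ m ν)) (+-congʳ (ev-* _ _ (∂ m ν)))))))) ⟩
      δ m n * g + (⟦ n ⟧ * C + (diag n * a + (2α * ⟦ n ⟧ * b + c))) ∎
    second : ev (λ s → ⟦ proj₁ s ⟧ * ⟦ proj₂ s ⟧ * ev (λ x → ev φ (∂ (proj₂ s) x)) (∂ (proj₁ s) (n ∷ ν))) (splits m) ≈ ⟦ n ⟧ * e + (⟦ n ⟧ * e + H)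
    second = begin
      ev (λ s → ⟦ proj₁ s ⟧ * ⟦ proj₂ s ⟧ * ev (λ x → ev φ (∂ (proj₂ s) x)) (∂ (proj₁ s) (n ∷ ν))) (splits m)
        ≈⟨ ev-cong (λ s → trans (*-congˡ (trans (ev-∂ _ (proj₁ s) n ν) (+-congˡ (trans (ev-cong (λ x → ev-∂ φ (proj₂ s) n x) (∂ (proj₁ s) ν))
             (trans (ev-+ _ _ (∂ (proj₁ s) ν)) (+-congʳ (ev-* _ φ (∂ (proj₁ s) ν))))))))
             (solve 7 (λ I J d p d' p' h → I :* J :* (d :* p :+ (d' :* p' :+ h)) := (d :* I) :* (J :* p) :+ ((d' :* J) :* (I :* p') :+ I :* J :* h))
               refl ⟦ proj₁ s ⟧ ⟦ proj₂ s ⟧ (δ (proj₁ s) n) (ev φ (∂ (proj₂ s) ν)) (δ (proj₂ s) n) (ev φ (∂ (proj₁ s) ν)) _)) (splits m) ⟩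
      ev (λ s → (δ (proj₁ s) n * ⟦ proj₁ s ⟧) * (⟦ proj₂ s ⟧ * ev φ (∂ (proj₂ s) ν)) +
               ((δ (proj₂ s) n * ⟦ proj₂ s ⟧) * (⟦ proj₁ s ⟧ * ev φ (∂ (proj₁ s) ν)) +
               ⟦ proj₁ s ⟧ * ⟦ proj₂ s ⟧ * ev (λ x → ev φn (∂ (proj₂ s) x)) (∂ (proj₁ s) ν))) (splits m)
        ≈⟨ trans (ev-+ _ _ (splits m)) (+-cong part (trans (ev-+ _ _ (splits m)) (+-congʳ (trans (splits-sym _ m) part)))) ⟩
      ⟦ n ⟧ * e + (⟦ n ⟧ * e + H) ∎
      where
      part : ev (λ s → (δ (proj₁ s) n * ⟦ proj₁ s ⟧) * (⟦ proj₂ s ⟧ * ev φ (∂ (proj₂ s) ν))) (splits m) ≈ ⟦ n ⟧ * e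
      part = trans (ev-cong (λ s → trans (*-congʳ (δ-subst ⟦_⟧ (proj₁ s) n)) (solve 4 (λ d N J p → d :* N :* (J :* p) := N :* (d :* J :* p)) refl _ _ _ _)) (splits m))
                   (ev-* ⟦ n ⟧ _ (splits m))

  -- Multiplication by p_n is adjoint to n α ∂/∂p_n. Taken as a recursion, this defines the scalar
  -- product without mentioning z_λ, and adjointness statements become commutator identities;
  -- `pair-diagonal` and `pair-off` recover the usual formula.
  pair : Mono → Mono → Carrier
  pair [] [] = 1#
  pair [] (n ∷ ν) = 0#
  pair (m ∷ μ) ν = ⟦ m ⟧ * α * ev (pair μ) (∂ m ν)

  join-trim-adjoint : ∀ m μ ν → ev (λ x → pair x ν) (join m μ) ≈ ev (pair μ) (trim m ν)
  join-trim-adjoint m [] ν = sym (empty ν)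
    where
    empty : ∀ ν → ev (pair []) (trim m ν) ≈ 0#
    empty [] = refl
    empty (k ∷ ν) = trans (ev-trim (pair []) m k ν) (trans (+-cong (trans (*-congˡ (ev-zero (λ s → zeroʳ _) (splits k))) (zeroʳ _)) (ev-0 (trim m ν))) (+-identityʳ 0#))
  join-trim-adjoint m (k ∷ μ) ν = begin
    ev (λ x → pair x ν) (join m (k ∷ μ))
      ≈⟨ ev-join _ m k μ ⟩
    ⟦ k ⟧ * (⟦ mk ⟧ * α * ev (pair μ) (∂ mk ν)) + ev (λ x → ⟦ k ⟧ * α * ev (pair x) (∂ k ν)) (join m μ)
      ≈⟨ +-congˡ (trans (ev-* _ _ (join m μ)) (*-congˡ (trans (ev-swap _ (join m μ) (∂ k ν)) (ev-cong (λ x → join-trim-adjoint m μ x) (∂ k ν))))) ⟩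
    ⟦ k ⟧ * (⟦ mk ⟧ * α * ev (pair μ) (∂ mk ν)) + ⟦ k ⟧ * α * ev (λ x → ev (pair μ) (trim m x)) (∂ k ν)
      ≈⟨ solve 5 (λ K M A x y → K :* (M :* A :* x) :+ K :* A :* y := K :* A :* (y :+ M :* x)) refl _ _ _ _ _ ⟩
    ⟦ k ⟧ * α * (ev (λ x → ev (pair μ) (trim m x)) (∂ k ν) + ⟦ mk ⟧ * ev (pair μ) (∂ mk ν))
      ≈⟨ *-congˡ (∂-trim (pair μ) k m ν) ⟨
    ⟦ k ⟧ * α * ev (λ x → ev (pair μ) (∂ k x)) (trim m ν)
      ≈⟨ ev-* _ _ (trim m ν) ⟨
    ev (pair (k ∷ μ)) (trim m ν) ∎
    where mk = suc (m ℕ.+ k)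

  -- Induction on `μ`: moving the first factor to the other side turns it into a derivative, and the
  -- terms by which `D` treats that factor become the commutator `∂-D`.
  D-self-adjoint : ∀ μ ν → ev (λ x → pair x ν) (D μ) ≈ ev (pair μ) (D ν)
  D-self-adjoint [] ν = sym (empty ν)
    where
    empty : ∀ ν → ev (pair []) (D ν) ≈ 0#
    empty [] = refl
    empty (n ∷ ν) = begin
      ev (pair []) (D (n ∷ ν))
        ≈⟨ ev-D (pair []) n ν ⟩
      _ ≈⟨ +-cong (trans (*-congˡ (ev-0 (splits n))) (zeroʳ _)) (+-cong (zeroʳ _) (+-cong (trans (*-congˡ (joined ν)) (zeroʳ _)) (ev-0 (D ν)))) ⟩
      0# + (0# + (0# + 0#))
        ≈⟨ trans (+-identityˡ _) (trans (+-identityˡ _) (+-identityˡ _)) ⟩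
      0# ∎
      where
      joined : ∀ ν → ev (pair []) (join n ν) ≈ 0#
      joined [] = refl
      joined (k ∷ ν) = trans (ev-join (pair []) n k ν) (trans (+-cong (zeroʳ _) (ev-0 (join n ν))) (+-identityʳ 0#))
  D-self-adjoint (m ∷ μ) ν = begin
    ev (λ x → pair x ν) (D (m ∷ μ))
      ≈⟨ ev-D _ m μ ⟩
    ⟦ m ⟧ * ev (λ s → pair (proj₁ s ∷ proj₂ s ∷ μ) ν) (splits m) + (diag m * (⟦ m ⟧ * α * b) + (2α * ⟦ m ⟧ * ev (λ x → pair x ν) (join m μ) + ev (λ x → ⟦ m ⟧ * α * ev (pair x) (∂ m ν)) (D μ)))
      ≈⟨ +-cong (*-congˡ cut) (+-congˡ (+-cong (*-congˡ (join-trim-adjoint m μ ν)) (trans (ev-* _ _ (D μ)) (*-congˡ (trans (ev-swap _ (D μ) (∂ m ν)) (ev-cong (D-self-adjoint μ) (∂ m ν))))))) ⟩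
    ⟦ m ⟧ * (α * (α * h)) + (diag m * (⟦ m ⟧ * α * b) + (2α * ⟦ m ⟧ * t + ⟦ m ⟧ * α * d))
      ≈⟨ solve 7 (λ M A h dm b t d → M :* (A :* (A :* h)) :+ (dm :* (M :* A :* b) :+ (con (+ 2) :* A :* M :* t :+ M :* A :* d))
           := M :* A :* (d :+ (A :* h :+ (dm :* b :+ con (+ 2) :* t)))) refl ⟦ m ⟧ α h (diag m) b t d ⟩
    ⟦ m ⟧ * α * (d + (α * h + (diag m * b + ι (+ 2) * t)))
      ≈⟨ *-congˡ (∂-D (pair μ) m ν) ⟨
    ⟦ m ⟧ * α * ev (λ x → ev (pair μ) (∂ m x)) (D ν)
      ≈⟨ ev-* _ _ (D ν) ⟨
    ev (pair (m ∷ μ)) (D ν) ∎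
    where
    b t d h : Carrier
    b = ev (pair μ) (∂ m ν)
    t = ev (pair μ) (trim m ν)
    d = ev (λ x → ev (pair μ) (D x)) (∂ m ν)
    h = ev (λ s → ⟦ proj₁ s ⟧ * ⟦ proj₂ s ⟧ * ev (λ x → ev (pair μ) (∂ (proj₂ s) x)) (∂ (proj₁ s) ν)) (splits m)
    cut : ev (λ s → pair (proj₁ s ∷ proj₂ s ∷ μ) ν) (splits m) ≈ α * (α * h)
    cut = trans (ev-cong (λ s → trans (*-congˡ (ev-* _ _ (∂ (proj₁ s) ν))) (solve 4 (λ I J A x → I :* A :* (J :* A :* x) := A :* (A :* (I :* J :* x))) refl _ _ _ _)) (splits m))
          (trans (ev-* α _ (splits m)) (*-congˡ (ev-* α _ (splits m))))

  -- `pair` peels its left argument. The same rule on the right comes from commuting the two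
  -- derivatives, and it gives symmetry.
  pair-∂ʳ : ∀ n μ ν → pair μ (n ∷ ν) ≈ ⟦ n ⟧ * α * ev (λ x → pair x ν) (∂ n μ)
  pair-∂ʳ n [] ν = sym (zeroʳ _)
  pair-∂ʳ n (m ∷ μ) ν = begin
    ⟦ m ⟧ * α * ev (pair μ) (∂ m (n ∷ ν))
      ≈⟨ *-congˡ (trans (ev-∂ (pair μ) m n ν) (+-congˡ (trans (ev-cong (λ x → pair-∂ʳ n μ x) (∂ m ν)) (ev-* _ _ (∂ m ν))))) ⟩
    ⟦ m ⟧ * α * (δ m n * pair μ ν + ⟦ n ⟧ * α * ev (λ y → ev (λ x → pair x y) (∂ n μ)) (∂ m ν))
      ≈⟨ *-congˡ (+-congˡ (*-congˡ (ev-swap _ (∂ m ν) (∂ n μ)))) ⟩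
    ⟦ m ⟧ * α * (δ m n * pair μ ν + ⟦ n ⟧ * α * E)
      ≈⟨ solve 6 (λ M A d p N e → M :* A :* (d :* p :+ N :* A :* e) := A :* p :* (d :* M) :+ N :* A :* (M :* A :* e)) refl ⟦ m ⟧ α (δ m n) (pair μ ν) ⟦ n ⟧ E ⟩
    α * pair μ ν * (δ m n * ⟦ m ⟧) + ⟦ n ⟧ * α * (⟦ m ⟧ * α * E)
      ≈⟨ +-cong (*-congˡ (trans (δ-subst ⟦_⟧ m n) (*-congʳ (δ-sym m n)))) (*-congˡ (sym (ev-* _ _ (∂ n μ)))) ⟩
    α * pair μ ν * (δ n m * ⟦ n ⟧) + ⟦ n ⟧ * α * ev (λ x → pair (m ∷ x) ν) (∂ n μ)
      ≈⟨ solve 5 (λ A p d N e → A :* p :* (d :* N) :+ N :* A :* e := N :* A :* (d :* p :+ e)) refl _ _ _ _ _ ⟩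
    ⟦ n ⟧ * α * (δ n m * pair μ ν + ev (λ x → pair (m ∷ x) ν) (∂ n μ))
      ≈⟨ *-congˡ (ev-∂ (λ x → pair x ν) n m μ) ⟨
    ⟦ n ⟧ * α * ev (λ x → pair x ν) (∂ n (m ∷ μ)) ∎
    where E = ev (λ x → ev (pair x) (∂ m ν)) (∂ n μ)

  pair-sym : ∀ μ ν → pair μ ν ≈ pair ν μ
  pair-sym [] [] = refl
  pair-sym [] (n ∷ ν) = sym (zeroʳ _)
  pair-sym (m ∷ μ) ν = trans (*-congˡ (ev-cong (pair-sym μ) (∂ m ν))) (sym (pair-∂ʳ m ν μ))

  -- The operator adjoint to multiplication by a monomial.
  star : Mono → Mono → Λ
  star [] ν = single ν
  star (m ∷ μ) ν = (⟦ m ⟧ * α) ⋆ (∂ m ν >>= star μ)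

  pair-star : ∀ μ κ ν → pair (μ ++ κ) ν ≈ ev (pair κ) (star μ ν)
  pair-star [] κ ν = sym (ev-single (pair κ) ν)
  pair-star (m ∷ μ) κ ν = trans (*-congˡ (trans (ev-cong (pair-star μ κ) (∂ m ν)) (sym (ev->>= (pair κ) (∂ m ν) (star μ)))))
    (sym (ev-⋆ (pair κ) _ (∂ m ν >>= star μ)))

  private variable
    s t : ℕ

  -- Coefficients of monomials in finitely many variables

  sum : ∀ {n} → (Fin n → Carrier) → Carrier
  sum {zero} f = 0#
  sum {suc n} f = f zero + sum (λ i → f (suc i))

  sum-cong : ∀ {n} {f g : Fin n → Carrier} → (∀ i → f i ≈ g i) → sum f ≈ sum g
  sum-cong {zero} e = refl
  sum-cong {suc n} e = +-cong (e zero) (sum-cong (e ∘ suc))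

  sum-0 : ∀ n → sum {n} (λ _ → 0#) ≈ 0#
  sum-0 zero = refl
  sum-0 (suc n) = trans (+-identityˡ _) (sum-0 n)

  sum-zero : ∀ {n} {f : Fin n → Carrier} → (∀ i → f i ≈ 0#) → sum f ≈ 0#
  sum-zero {n} e = trans (sum-cong e) (sum-0 n)

  sum-* : ∀ {n} c (f : Fin n → Carrier) → sum (λ i → c * f i) ≈ c * sum f
  sum-* {zero} c f = sym (zeroʳ c)
  sum-* {suc n} c f = trans (+-congˡ (sum-* c (f ∘ suc))) (sym (distribˡ c _ _))

  sum-+ : ∀ {n} (f g : Fin n → Carrier) → sum (λ i → f i + g i) ≈ sum f + sum g
  sum-+ {zero} f g = sym (+-identityʳ 0#)
  sum-+ {suc n} f g = trans (+-congˡ (sum-+ (f ∘ suc) (g ∘ suc)))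
    (solve 4 (λ x y p q → (x :+ y) :+ (p :+ q) := (x :+ p) :+ (y :+ q)) refl (f zero) (g zero) (sum (f ∘ suc)) (sum (g ∘ suc)))

  sum-comm : ∀ {m n} (f : Fin m → Fin n → Carrier) → sum (λ i → sum (f i)) ≈ sum (λ j → sum (λ i → f i j))
  sum-comm {zero} {n} f = sym (sum-0 n)
  sum-comm {suc m} f = trans (+-congˡ (sum-comm (f ∘ suc))) (sym (sum-+ (f zero) (λ j → sum (λ i → f (suc i) j))))

  sum-neg : ∀ {n} (f : Fin n → Carrier) → sum (λ i → - f i) ≈ - sum f
  sum-neg {zero} f = sym -0#≈0#
  sum-neg {suc n} f = trans (+-congˡ (sum-neg (f ∘ suc))) (solve 2 (λ x y → :- x :+ :- y := :- (x :+ y)) refl (f zero) (sum (f ∘ suc)))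

  ev-sum : ∀ {A : Set} {n} (φ : Fin n → A → Carrier) f → ev (λ a → sum (λ i → φ i a)) f ≈ sum (λ i → ev (φ i) f)
  ev-sum {n = n} φ [] = sym (sum-0 n)
  ev-sum φ ((c , a) ∷ f) = trans (+-cong (sym (sum-* c (λ i → φ i a))) (ev-sum φ f)) (sym (sum-+ (λ i → c * φ i a) (λ i → ev (φ i) f)))

  off : ∀ {n} → Fin n → Fin n → Carrier → Carrier
  off a b x = if does (a Fin.≟ b) then 0# else x

  off-cong : ∀ {n} (a b : Fin n) {x y} → (a ≢ b → x ≈ y) → off a b x ≈ off a b y
  off-cong a b e with a Fin.≟ b
  ... | yes _ = refl
  ... | no ne = e ne

  off-+ : ∀ {n} (a b : Fin n) x y → off a b (x + y) ≈ off a b x + off a b y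
  off-+ a b x y with a Fin.≟ b
  ... | yes _ = sym (+-identityʳ 0#)
  ... | no ne = refl

  off-* : ∀ {n} (a b : Fin n) c x → off a b (c * x) ≈ c * off a b x
  off-* a b c x with a Fin.≟ b
  ... | yes _ = sym (zeroʳ c)
  ... | no ne = refl

  off-0 : ∀ {n} (a b : Fin n) → off a b 0# ≈ 0#
  off-0 a b with a Fin.≟ b
  ... | yes _ = refl
  ... | no ne = refl

  off-sum : ∀ {n m} (a b : Fin n) (f : Fin m → Carrier) → off a b (sum f) ≈ sum (λ i → off a b (f i))
  off-sum {m = m} a b f with a Fin.≟ b
  ... | yes _ = sym (sum-0 m)
  ... | no ne = refl

  off-ev : ∀ {n} {A : Set} (a b : Fin n) (φ : A → Carrier) f → off a b (ev φ f) ≈ ev (λ x → off a b (φ x)) f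
  off-ev a b φ f with a Fin.≟ b
  ... | yes _ = sym (ev-0 f)
  ... | no ne = refl

  sum-off : ∀ {n} (a : Fin n) (y : Fin n → Carrier) → sum y ≈ y a + sum (λ b → off a b (y b))
  sum-off zero y = +-congˡ (sym (+-identityˡ _))
  sum-off (suc a) y = trans (+-congˡ (sum-off a (y ∘ suc))) (solve 3 (λ p q r → p :+ (q :+ r) := q :+ (p :+ r)) refl _ _ _)

  ∑off : ∀ {n} → (Fin n → Fin n → Carrier) → Carrier
  ∑off y = sum λ a → sum λ b → off a b (y a b)

  ∑off-cong : ∀ {n} {y z : Fin n → Fin n → Carrier} → (∀ a b → a ≢ b → y a b ≈ z a b) → ∑off y ≈ ∑off z
  ∑off-cong e = sum-cong λ a → sum-cong λ b → off-cong a b (e a b)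

  ∑off-+ : ∀ {n} (y z : Fin n → Fin n → Carrier) → ∑off (λ a b → y a b + z a b) ≈ ∑off y + ∑off z
  ∑off-+ y z = trans (sum-cong λ a → trans (sum-cong λ b → off-+ a b (y a b) (z a b)) (sum-+ (λ b → off a b (y a b)) (λ b → off a b (z a b))))
    (sum-+ (λ a → sum λ b → off a b (y a b)) (λ a → sum λ b → off a b (z a b)))

  ∑off-* : ∀ {n} c (y : Fin n → Fin n → Carrier) → ∑off (λ a b → c * y a b) ≈ c * ∑off y
  ∑off-* c y = trans (sum-cong λ a → trans (sum-cong λ b → off-* a b c (y a b)) (sum-* c (λ b → off a b (y a b)))) (sum-* c (λ a → sum λ b → off a b (y a b)))

  ∑off-sum : ∀ {n m} (y : Fin m → Fin n → Fin n → Carrier) → ∑off (λ a b → sum (λ i → y i a b)) ≈ sum (λ i → ∑off (y i))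
  ∑off-sum y = trans (sum-cong λ a → trans (sum-cong λ b → off-sum a b (λ i → y i a b)) (sum-comm (λ b i → off a b (y i a b)))) (sum-comm (λ a i → sum λ b → off a b (y i a b)))

  ∑off-ev : ∀ {n} {A : Set} (y : Fin n → Fin n → A → Carrier) f → ∑off (λ a b → ev (y a b) f) ≈ ev (λ x → ∑off (λ a b → y a b x)) f
  ∑off-ev y f = trans (sum-cong λ a → trans (sum-cong λ b → off-ev a b (y a b) f) (sym (ev-sum (λ b x → off a b (y a b x)) f)))
    (sym (ev-sum (λ a x → sum λ b → off a b (y a b x)) f))

  infixl 6 _⊕_
  _⊕_ : Vec ℤ s → Vec ℤ s → Vec ℤ s
  _⊕_ = zipWith ℤ._+_

  unit : Fin s → ℤ → Vec ℤ s
  unit zero z = z ∷ Vec.replicate _ 0ℤ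
  unit (suc i) z = 0ℤ ∷ unit i z

  ⊕-identityʳ : (ν : Vec ℤ s) → ν ⊕ Vec.replicate s 0ℤ ≡ ν
  ⊕-identityʳ [] = ≡.refl
  ⊕-identityʳ (z ∷ ν) = ≡.cong₂ _∷_ (ℤP.+-identityʳ z) (⊕-identityʳ ν)

  ⊕-assoc : (ν ξ ζ : Vec ℤ s) → (ν ⊕ ξ) ⊕ ζ ≡ ν ⊕ (ξ ⊕ ζ)
  ⊕-assoc = VecP.zipWith-assoc ℤP.+-assoc

  ⊕-comm : (ν ξ : Vec ℤ s) → ν ⊕ ξ ≡ ξ ⊕ ν
  ⊕-comm = VecP.zipWith-comm ℤP.+-comm

  ⊕-swap : (ν ξ ζ : Vec ℤ s) → (ν ⊕ ξ) ⊕ ζ ≡ (ν ⊕ ζ) ⊕ ξ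
  ⊕-swap ν ξ ζ = ≡.trans (⊕-assoc ν ξ ζ) (≡.trans (≡.cong (ν ⊕_) (⊕-comm ξ ζ)) (≡.sym (⊕-assoc ν ζ ξ)))

  unit-+ : (i : Fin s) (x y : ℤ) → unit i x ⊕ unit i y ≡ unit i (x ℤ.+ y)
  unit-+ zero x y = ≡.cong (_ ∷_) (⊕-identityʳ _)
  unit-+ (suc i) x y = ≡.cong (0ℤ ∷_) (unit-+ i x y)

  ⊕-unit-+ : (ν : Vec ℤ s) (i : Fin s) (x y : ℤ) → ν ⊕ unit i x ⊕ unit i y ≡ ν ⊕ unit i (x ℤ.+ y)
  ⊕-unit-+ ν i x y = ≡.trans (⊕-assoc ν _ _) (≡.cong (ν ⊕_) (unit-+ i x y))

  lookup-⊕ : (i : Fin s) (ν ξ : Vec ℤ s) → lookup (ν ⊕ ξ) i ≡ lookup ν i ℤ.+ lookup ξ i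
  lookup-⊕ = VecP.lookup-zipWith ℤ._+_

  lookup-unit : (i : Fin s) (z : ℤ) → lookup (unit i z) i ≡ z
  lookup-unit zero z = ≡.refl
  lookup-unit (suc i) z = lookup-unit i z

  lookup-unit-≢ : (i j : Fin s) (z : ℤ) → i ≢ j → lookup (unit i z) j ≡ 0ℤ
  lookup-unit-≢ zero zero z ne = ⊥-elim (ne ≡.refl)
  lookup-unit-≢ zero (suc j) z ne = VecP.lookup-replicate j 0ℤ
  lookup-unit-≢ (suc i) zero z ne = ≡.refl
  lookup-unit-≢ (suc i) (suc j) z ne = lookup-unit-≢ i j z (ne ∘ ≡.cong suc)

  lookup-⊕-unit : (ν : Vec ℤ s) (i : Fin s) (z : ℤ) → lookup (ν ⊕ unit i z) i ≡ lookup ν i ℤ.+ z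
  lookup-⊕-unit ν i z = ≡.trans (lookup-⊕ i ν _) (≡.cong (λ x → lookup ν i ℤ.+ x) (lookup-unit i z))

  lookup-⊕-unit-≢ : (ν : Vec ℤ s) (i j : Fin s) (z : ℤ) → i ≢ j → lookup (ν ⊕ unit i z) j ≡ lookup ν j
  lookup-⊕-unit-≢ ν i j z ne = ≡.trans (lookup-⊕ j ν _) (≡.trans (≡.cong (λ x → lookup ν j ℤ.+ x) (lookup-unit-≢ i j z ne)) (ℤP.+-identityʳ _))

  sum-unit : (a : Fin s) (z : ℤ) (g : Fin s → Carrier) → sum (λ i → ι (lookup (unit i z) a) * g i) ≈ ι z * g a
  sum-unit {suc s} zero z g = trans (+-congˡ (sum-zero {s} λ i → zeroˡ _)) (+-identityʳ _)
  sum-unit (suc a) z g = trans (+-cong (trans (*-congʳ (reflexive (≡.cong ι (VecP.lookup-replicate a 0ℤ)))) (zeroˡ _)) (sum-unit a z (g ∘ suc))) (+-identityˡ _)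

  part : ℕ → ℤ
  part m = + suc m

  δ₀ : ℤ → Carrier
  δ₀ (+ zero) = 1#
  δ₀ (+ suc n) = 0#
  δ₀ -[1+ n ] = 0#

  -- M μ ν is the coefficient of x^ν in the monomial μ, in s variables.
  M : Mono → Vec ℤ s → Carrier
  M [] [] = 1#
  M [] (z ∷ ν) = δ₀ z * M [] ν
  M (m ∷ μ) ν = sum λ i → M μ (ν ⊕ unit i (ℤ.- part m))

  M-cong : ∀ μ {ν ξ : Vec ℤ s} → ν ≡ ξ → M μ ν ≈ M μ ξ
  M-cong μ e = reflexive (≡.cong (M μ) e)

  record Negative (ν : Vec ℤ s) : Set where
    constructor negative
    field
      index : Fin s
      below : lookup ν index ℤ.< 0ℤ

  neg-shift : ∀ {ν : Vec ℤ s} (j : Fin s) m → Negative ν → Negative (ν ⊕ unit j (ℤ.- part m))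
  neg-shift {ν = ν} j m (negative i lt) with j Fin.≟ i
  ... | yes ≡.refl = negative j (≡.subst (ℤ._< 0ℤ) (≡.sym (lookup-⊕-unit ν j _)) (ℤP.≤-<-trans (≡.subst (lookup ν j ℤ.+ (ℤ.- part m) ℤ.≤_) (ℤP.+-identityʳ _) (ℤP.+-monoʳ-≤ (lookup ν j) {ℤ.- part m} {0ℤ} ℤ.-≤+)) lt))
  ... | no ne = negative i (≡.subst (ℤ._< 0ℤ) (≡.sym (lookup-⊕-unit-≢ ν j i _ ne)) lt)

  M-[]-lookup : (ν : Vec ℤ s) (a : Fin s) → M [] ν * ι (lookup ν a) ≈ 0#
  M-[]-lookup (+ zero ∷ ν) zero = zeroʳ _
  M-[]-lookup (+ suc n ∷ ν) zero = trans (*-congʳ (zeroˡ _)) (zeroˡ _)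
  M-[]-lookup (-[1+ n ] ∷ ν) zero = trans (*-congʳ (zeroˡ _)) (zeroˡ _)
  M-[]-lookup (z ∷ ν) (suc a) = trans (*-assoc _ _ _) (trans (*-congˡ (M-[]-lookup ν a)) (zeroʳ _))

  M-neg : ∀ μ {ν : Vec ℤ s} → Negative ν → M μ ν ≈ 0#
  M-neg [] {z ∷ ν} (negative (suc i) lt) = trans (*-congˡ (M-neg [] {ν} (negative i lt))) (zeroʳ _)
  M-neg [] { -[1+ n ] ∷ ν} (negative zero lt) = zeroˡ _
  M-neg [] {(+ n) ∷ ν} (negative zero (ℤ.+<+ ()))
  M-neg (m ∷ μ) {ν} neg = sum-zero λ i → M-neg μ (neg-shift i m neg)

  M-∷ : ∀ μ m (ν : Vec ℤ s) k → M (m ∷ μ) (k ∷ ν) ≈ M μ (k ℤ.+ (ℤ.- part m) ∷ ν) + sum (λ i → M μ (k ∷ ν ⊕ unit i (ℤ.- part m)))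
  M-∷ {s} μ m ν k = +-cong (M-cong μ (≡.cong (_ ∷_) (⊕-identityʳ ν))) (sum-cong {s} λ i → M-cong μ (≡.cong (_∷ (ν ⊕ unit i (ℤ.- part m))) (ℤP.+-identityʳ k)))

  M-0∷ : ∀ μ (ν : Vec ℤ s) → M μ (0ℤ ∷ ν) ≈ M μ ν
  M-0∷ [] ν = *-identityˡ _
  M-0∷ {s} (m ∷ μ) ν = trans (M-∷ μ m ν 0ℤ) (trans (+-cong (M-neg μ {_ ∷ ν} (negative zero ℤ.-<+)) (sum-cong {s} λ i → M-0∷ μ (ν ⊕ unit i (ℤ.- part m)))) (+-identityˡ _))

  -- The contribution to D of a pair of variables.
  Z : Fin s → Fin s → Mono → Vec ℤ s → Carrier
  Z a b [] ν = 0#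
  Z a b (m ∷ μ) ν = sum (λ i → Z a b μ (ν ⊕ unit i (ℤ.- part m))) +
    ⟦ m ⟧ * ev (λ t → M μ (ν ⊕ unit a (ℤ.- part (proj₁ t)) ⊕ unit b (ℤ.- part (proj₂ t)))) (splits m)

  Z-neg : ∀ a b μ {ν : Vec ℤ s} → Negative ν → Z a b μ ν ≈ 0#
  Z-neg a b [] neg = refl
  Z-neg a b (m ∷ μ) neg = trans (+-cong (sum-zero λ i → Z-neg a b μ (neg-shift i m neg))
    (trans (*-congˡ (ev-zero (λ t → M-neg μ (neg-shift b _ (neg-shift a _ neg))) (splits m))) (zeroʳ _))) (+-identityʳ 0#)

  splits-telescope : ∀ (φ : ℕ × ℕ → Carrier) n →
    ev (λ t → φ (suc (proj₁ t) , proj₂ t) + - φ (proj₁ t , suc (proj₂ t))) (splits n) ≈ φ (n , 0) + - φ (0 , n)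
  splits-telescope φ n = begin
    ev (λ t → φ (suc (proj₁ t) , proj₂ t) + - φ (proj₁ t , suc (proj₂ t))) (splits n)
      ≈⟨ trans (ev-+ _ _ (splits n)) (+-congˡ (ev-neg _ (splits n))) ⟩
    x + - y
      ≈⟨ solve 4 (λ x y p q → x :- y := ((p :+ x) :- (y :+ q)) :+ (q :- p)) refl x y p q ⟩
    ((p + x) + - (y + q)) + (q + - p)
      ≈⟨ +-congʳ (trans (+-congʳ both) (-‿inverseʳ _)) ⟩
    0# + (q + - p)
      ≈⟨ +-identityˡ _ ⟩
    q + - p ∎
    where
    x = ev (λ t → φ (suc (proj₁ t) , proj₂ t)) (splits n)
    y = ev (λ t → φ (proj₁ t , suc (proj₂ t))) (splits n)
    p = φ (0 , n)
    q = φ (n , 0)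
    both : p + x ≈ y + q
    both = trans (sym (+-cong (*-identityˡ _) (ev-map φ _ (splits n)))) (splits-snoc φ n)

  splits-const : ∀ (g : ℤ → Carrier) n → ev (λ t → g (part (proj₁ t) ℤ.+ part (proj₂ t))) (splits n) ≈ ι (+ n) * g (part n)
  splits-const g zero = sym (zeroˡ _)
  splits-const g (suc n) = begin
    1# * g (+ 1 ℤ.+ part n) + ev (λ t → g (part (proj₁ t) ℤ.+ part (proj₂ t))) (mapL _ (splits n))
      ≈⟨ +-congˡ (trans (ev-map _ _ (splits n)) (splits-const (λ z → g (+ 1 ℤ.+ z)) n)) ⟩
    1# * g (part (suc n)) + ι (+ n) * g (part (suc n))
      ≈⟨ sym (distribʳ _ _ _) ⟩
    ι (+ suc n) * g (part (suc n)) ∎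

  -- `Z a b` is the derivation x_a x_b (∂_a - ∂_b) / (x_a - x_b). Multiplying by x_a - x_b and
  -- taking the coefficient of x^ν gives this relation: on one power sum the geometric sum
  -- telescopes, and the remaining factors follow the product rule.
  Z-relation : ∀ {a b : Fin s} → a ≢ b → ∀ μ ν →
    Z a b μ (ν ⊕ unit a (ℤ.- (+ 1))) + - Z a b μ (ν ⊕ unit b (ℤ.- (+ 1))) ≈
    ι (lookup ν a) * M μ (ν ⊕ unit b (ℤ.- (+ 1))) + - (ι (lookup ν b) * M μ (ν ⊕ unit a (ℤ.- (+ 1))))
  Z-relation {a = a} {b} a≢b [] ν = trans (+-congˡ -0#≈0#) (sym (+-cong (vanish a b a≢b) (trans (-‿cong (vanish b a (a≢b ∘ ≡.sym))) -0#≈0#)))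
    where
    vanish : ∀ a b → a ≢ b → ι (lookup ν a) * M [] (ν ⊕ unit b (ℤ.- (+ 1))) ≈ 0#
    vanish a b a≢b = trans (*-comm _ _) (trans (*-congˡ (reflexive (≡.cong ι (≡.sym (lookup-⊕-unit-≢ ν b a (ℤ.- (+ 1)) (a≢b ∘ ≡.sym)))))) (M-[]-lookup (ν ⊕ unit b (ℤ.- (+ 1))) a))
  Z-relation {s} {a} {b} a≢b (m ∷ μ) ν = begin
    (sum (λ i → Z a b μ (ν ⊕ unit a -1ℤ ⊕ u i)) + ⟦ m ⟧ * ev (λ t → M μ (ν ⊕ unit a -1ℤ ⊕ unit a (ℤ.- part (proj₁ t)) ⊕ unit b (ℤ.- part (proj₂ t)))) (splits m)) +
    - (sum (λ i → Z a b μ (ν ⊕ unit b -1ℤ ⊕ u i)) + ⟦ m ⟧ * ev (λ t → M μ (ν ⊕ unit b -1ℤ ⊕ unit a (ℤ.- part (proj₁ t)) ⊕ unit b (ℤ.- part (proj₂ t)))) (splits m))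
      ≈⟨ +-cong (+-congˡ (*-congˡ (ev-cong (λ t → M-cong μ (eq₁ t)) (splits m))))
                (-‿cong (+-congˡ (*-congˡ (ev-cong (λ t → M-cong μ (eq₂ t)) (splits m))))) ⟩
    (ΣZa + ⟦ m ⟧ * p) + - (ΣZb + ⟦ m ⟧ * q)
      ≈⟨ solve 5 (λ x y m p q → (x :+ m :* p) :- (y :+ m :* q) := (x :- y) :+ m :* (p :- q)) refl ΣZa ΣZb ⟦ m ⟧ p q ⟩
    (ΣZa + - ΣZb) + ⟦ m ⟧ * (p + - q)
      ≈⟨ +-cong (trans (+-congˡ (sym (sum-neg (λ i → Z a b μ (ν ⊕ unit b -1ℤ ⊕ u i))))) (sym (sum-+ (λ i → Z a b μ (ν ⊕ unit a -1ℤ ⊕ u i)) (λ i → - Z a b μ (ν ⊕ unit b -1ℤ ⊕ u i)))))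
           (*-congˡ (trans (+-congˡ (sym (ev-neg _ (splits m)))) (trans (sym (ev-+ _ _ (splits m))) (splits-telescope φ m)))) ⟩
    sum (λ i → Z a b μ (ν ⊕ unit a -1ℤ ⊕ u i) + - Z a b μ (ν ⊕ unit b -1ℤ ⊕ u i)) + ⟦ m ⟧ * (φ (m , 0) + - φ (0 , m))
      ≈⟨ +-congʳ (sum-cong each) ⟩
    sum (λ i → (ι (lookup ν a) * B i + ι (lookup (unit i (ℤ.- part m)) a) * B i) + - (ι (lookup ν b) * A i + ι (lookup (unit i (ℤ.- part m)) b) * A i)) + ⟦ m ⟧ * (φ (m , 0) + - φ (0 , m))
      ≈⟨ +-congʳ (trans (sum-+ (λ i → ka * B i + kA i * B i) (λ i → - (kb * A i + kB i * A i))) (+-cong (trans (sum-+ (λ i → ka * B i) (λ i → kA i * B i)) (+-cong (sum-* ka B) (sum-unit a _ B))) (trans (sum-neg (λ i → kb * A i + kB i * A i)) (-‿cong (trans (sum-+ (λ i → kb * A i) (λ i → kB i * A i)) (+-cong (sum-* kb A) (sum-unit b _ A))))))) ⟩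
    ((ι (lookup ν a) * sum B + ι (ℤ.- part m) * B a) + - (ι (lookup ν b) * sum A + ι (ℤ.- part m) * A b)) + ⟦ m ⟧ * (φ (m , 0) + - φ (0 , m))
      ≈⟨ +-congˡ (*-congˡ (+-congʳ (M-cong μ (⊕-swap ν _ _)))) ⟩
    ((ι (lookup ν a) * sum B + ι (ℤ.- part m) * B a) + - (ι (lookup ν b) * sum A + ι (ℤ.- part m) * A b)) + ⟦ m ⟧ * (B a + - A b)
      ≈⟨ +-congʳ (+-cong (+-congˡ (*-congʳ (ι-neg (part m)))) (-‿cong (+-congˡ (*-congʳ (ι-neg (part m)))))) ⟩
    ((ι (lookup ν a) * sum B + (- ⟦ m ⟧) * B a) + - (ι (lookup ν b) * sum A + (- ⟦ m ⟧) * A b)) + ⟦ m ⟧ * (B a + - A b)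
      ≈⟨ solve 7 (λ x B y A m p q → ((x :* B :+ :- m :* p) :- (y :* A :+ :- m :* q)) :+ m :* (p :- q) := x :* B :- y :* A) refl _ _ _ _ _ _ _ ⟩
    ι (lookup ν a) * sum B + - (ι (lookup ν b) * sum A) ∎
    where
    -1ℤ = ℤ.- (+ 1)
    u : Fin s → Vec ℤ s
    u i = unit i (ℤ.- part m)
    A B : Fin s → Carrier
    A i = M μ (ν ⊕ unit a -1ℤ ⊕ u i)
    B i = M μ (ν ⊕ unit b -1ℤ ⊕ u i)
    ka kb : Carrier
    ka = ι (lookup ν a)
    kb = ι (lookup ν b)
    kA kB : Fin s → Carrier
    kA i = ι (lookup (unit i (ℤ.- part m)) a)
    kB i = ι (lookup (unit i (ℤ.- part m)) b)
    ΣZa = sum (λ i → Z a b μ (ν ⊕ unit a -1ℤ ⊕ u i))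
    ΣZb = sum (λ i → Z a b μ (ν ⊕ unit b -1ℤ ⊕ u i))
    φ : ℕ × ℕ → Carrier
    φ t = M μ (ν ⊕ unit a (ℤ.- part (proj₁ t)) ⊕ unit b (ℤ.- part (proj₂ t)))
    p = ev (λ t → φ (suc (proj₁ t) , proj₂ t)) (splits m)
    q = ev (λ t → φ (proj₁ t , suc (proj₂ t))) (splits m)
    eq₁ : ∀ t → ν ⊕ unit a -1ℤ ⊕ unit a (ℤ.- part (proj₁ t)) ⊕ unit b (ℤ.- part (proj₂ t)) ≡ ν ⊕ unit a (ℤ.- part (suc (proj₁ t))) ⊕ unit b (ℤ.- part (proj₂ t))
    eq₁ t = ≡.cong (_⊕ unit b _) (⊕-unit-+ ν a _ _)
    eq₂ : ∀ t → ν ⊕ unit b -1ℤ ⊕ unit a (ℤ.- part (proj₁ t)) ⊕ unit b (ℤ.- part (proj₂ t)) ≡ ν ⊕ unit a (ℤ.- part (proj₁ t)) ⊕ unit b (ℤ.- part (suc (proj₂ t)))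
    eq₂ t = ≡.trans (≡.cong (_⊕ unit b _) (⊕-swap ν _ _)) (⊕-unit-+ (ν ⊕ unit a _) b _ _)
    each : ∀ i → Z a b μ (ν ⊕ unit a -1ℤ ⊕ u i) + - Z a b μ (ν ⊕ unit b -1ℤ ⊕ u i) ≈
      (ι (lookup ν a) * B i + ι (lookup (u i) a) * B i) + - (ι (lookup ν b) * A i + ι (lookup (u i) b) * A i)
    each i = begin
      Z a b μ (ν ⊕ unit a -1ℤ ⊕ u i) + - Z a b μ (ν ⊕ unit b -1ℤ ⊕ u i)
        ≡⟨ ≡.cong₂ (λ x y → Z a b μ x + - Z a b μ y) (⊕-swap ν _ _) (⊕-swap ν _ _) ⟩
      Z a b μ (ν ⊕ u i ⊕ unit a -1ℤ) + - Z a b μ (ν ⊕ u i ⊕ unit b -1ℤ)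
        ≈⟨ Z-relation a≢b μ (ν ⊕ u i) ⟩
      ι (lookup (ν ⊕ u i) a) * M μ (ν ⊕ u i ⊕ unit b -1ℤ) + - (ι (lookup (ν ⊕ u i) b) * M μ (ν ⊕ u i ⊕ unit a -1ℤ))
        ≈⟨ +-cong (*-cong (trans (reflexive (≡.cong ι (lookup-⊕ a ν (u i)))) (ι-+ (lookup ν a) (lookup (u i) a))) (M-cong μ (⊕-swap ν _ _)))
                  (-‿cong (*-cong (trans (reflexive (≡.cong ι (lookup-⊕ b ν (u i)))) (ι-+ (lookup ν b) (lookup (u i) b))) (M-cong μ (⊕-swap ν _ _)))) ⟩
      (ι (lookup ν a) + ι (lookup (u i) a)) * B i + - ((ι (lookup ν b) + ι (lookup (u i) b)) * A i)
        ≈⟨ +-cong (distribʳ _ _ _) (-‿cong (distribʳ _ _ _)) ⟩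
      (ι (lookup ν a) * B i + ι (lookup (u i) a) * B i) + - (ι (lookup ν b) * A i + ι (lookup (u i) b) * A i) ∎

  -- In the variables `join m` acts as Σ xᵢ^(m+1) · xᵢ ∂/∂xᵢ. The Euler operator contributes the
  -- exponent as a factor, and the power of xᵢ the shift.
  M-join : ∀ m μ (ν : Vec ℤ s) → ev (λ x → M x ν) (join m μ) ≈
    sum λ i → ι (lookup (ν ⊕ unit i (ℤ.- part m)) i) * M μ (ν ⊕ unit i (ℤ.- part m))
  M-join m [] ν = sym (sum-zero λ i → trans (*-comm _ _) (M-[]-lookup (ν ⊕ unit i (ℤ.- part m)) i))
  M-join {s} m (k ∷ μ) ν = begin
    ev (λ x → M x ν) (join m (k ∷ μ))
      ≈⟨ ev-join (λ x → M x ν) m k μ ⟩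
    ⟦ k ⟧ * sum (λ i → M μ (ν ⊕ unit i (ℤ.- part (suc (m ℕ.+ k))))) + ev (λ x → sum (λ i → M x (ν ⊕ u k i))) (join m μ)
      ≈⟨ +-cong (*-congˡ (sum-cong λ i → M-cong μ (merge i)))
          (trans (ev-sum (λ i x → M x (ν ⊕ u k i)) (join m μ)) (trans (sum-cong λ i → M-join m μ (ν ⊕ u k i)) (sum-comm g))) ⟩
    ⟦ k ⟧ * sum (λ i → M μ (ν ⊕ u m i ⊕ u k i)) + sum (λ l → sum (λ i → g i l))
      ≈⟨ trans (+-congʳ (sym (sum-* ⟦ k ⟧ (λ i → M μ (ν ⊕ u m i ⊕ u k i))))) (sym (sum-+ (λ l → ⟦ k ⟧ * M μ (ν ⊕ u m l ⊕ u k l)) (λ l → sum (λ i → g i l)))) ⟩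
    sum (λ l → ⟦ k ⟧ * M μ (ν ⊕ u m l ⊕ u k l) + sum (λ i → g i l))
      ≈⟨ sum-cong each ⟩
    sum (λ l → ι (lookup (ν ⊕ u m l) l) * sum (λ i → M μ (ν ⊕ u m l ⊕ u k i))) ∎
    where
    u : ℕ → Fin s → Vec ℤ s
    u n i = unit i (ℤ.- part n)
    g : Fin s → Fin s → Carrier
    g i l = ι (lookup (ν ⊕ u k i ⊕ u m l) l) * M μ (ν ⊕ u k i ⊕ u m l)
    merge : ∀ i → ν ⊕ unit i (ℤ.- part (suc (m ℕ.+ k))) ≡ ν ⊕ u m i ⊕ u k i
    merge i = ≡.sym (⊕-unit-+ ν i _ _)
    each : ∀ l → ⟦ k ⟧ * M μ (ν ⊕ u m l ⊕ u k l) + sum (λ i → g i l) ≈ ι (lookup (ν ⊕ u m l) l) * sum (λ i → M μ (ν ⊕ u m l ⊕ u k i))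
    each l = begin
      ⟦ k ⟧ * h l + sum (λ i → g i l)
        ≈⟨ +-congˡ (sum-cong λ i → trans (*-cong (trans (reflexive (≡.cong ι (≡.trans (≡.cong (λ ξ → lookup ξ l) (⊕-swap ν (u k i) (u m l))) (lookup-⊕ l (ν ⊕ u m l) (u k i))))) (ι-+ (lookup (ν ⊕ u m l) l) (lookup (u k i) l))) (M-cong μ (⊕-swap ν (u k i) (u m l)))) (distribʳ (h i) c (ι (lookup (u k i) l)))) ⟩
      ⟦ k ⟧ * h l + sum (λ i → c * h i + ι (lookup (u k i) l) * h i)
        ≈⟨ +-congˡ (trans (sum-+ (λ i → c * h i) (λ i → ι (lookup (u k i) l) * h i)) (+-cong (sum-* c h) (trans (sum-unit l _ h) (*-congʳ (ι-neg (part k)))))) ⟩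
      ⟦ k ⟧ * h l + (c * sum h + - ⟦ k ⟧ * h l)
        ≈⟨ solve 3 (λ k h x → k :* h :+ (x :+ :- k :* h) := x) refl ⟦ k ⟧ (h l) (c * sum h) ⟩
      c * sum h ∎
      where
      c = ι (lookup (ν ⊕ u m l) l)
      h : Fin s → Carrier
      h i = M μ (ν ⊕ u m l ⊕ u k i)

  -- The eigenvalue of Σ xᵢ² ∂²/∂xᵢ² on the monomial x^ν.
  quad : Vec ℤ s → ℤ
  quad [] = 0ℤ
  quad (z ∷ ν) = z ℤ.* (z ℤ.- (+ 1)) ℤ.+ quad ν

  quad-shift : ∀ (ν : Vec ℤ s) i x → quad (ν ⊕ unit i x) ≡ quad ν ℤ.+ x ℤ.* ((lookup ν i ℤ.+ lookup ν i) ℤ.+ (x ℤ.- (+ 1)))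
  quad-shift (z ∷ ν) zero x = ≡.trans (≡.cong (λ ξ → (z ℤ.+ x) ℤ.* ((z ℤ.+ x) ℤ.- (+ 1)) ℤ.+ quad ξ) (⊕-identityʳ ν))
    (ℤS.solve 3 (λ z x q → (z ℤS.:+ x) ℤS.:* ((z ℤS.:+ x) ℤS.:- ℤS.con (+ 1)) ℤS.:+ q ℤS.:= z ℤS.:* (z ℤS.:- ℤS.con (+ 1)) ℤS.:+ q ℤS.:+ x ℤS.:* ((z ℤS.:+ z) ℤS.:+ (x ℤS.:- ℤS.con (+ 1)))) ≡.refl z x (quad ν))
  quad-shift (z ∷ ν) (suc i) x = ≡.trans (≡.cong₂ ℤ._+_ (≡.cong (λ y → y ℤ.* (y ℤ.- (+ 1))) (ℤP.+-identityʳ z)) (quad-shift ν i x)) (≡.sym (ℤP.+-assoc (z ℤ.* (z ℤ.- (+ 1))) (quad ν) _))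

  -- In s variables `D` is α Σ xᵢ² ∂²/∂xᵢ² plus the sum of the derivations `Z a b` over ordered
  -- pairs a ≠ b. The cut term of a power sum runs over all pairs; its diagonal a = b cancels the -1
  -- in `diag` and leaves the factor `α`.
  M-D : ∀ μ (ν : Vec ℤ s) → ev (λ x → M x ν) (D μ) ≈ α * ι (quad ν) * M μ ν + ∑off (λ a b → Z a b μ ν)
  M-D {s} [] ν = sym (trans (+-cong (trans (*-assoc _ _ _) (trans (*-congˡ (base ν)) (zeroʳ α))) (sum-zero {s} λ a → sum-zero {s} λ b → off-0 a b)) (+-identityʳ 0#))
    where
    base : ∀ {s} (ν : Vec ℤ s) → ι (quad ν) * M [] ν ≈ 0#
    base [] = zeroˡ _
    base (z ∷ ν) = begin
      ι (z ℤ.* (z ℤ.- (+ 1)) ℤ.+ quad ν) * (δ₀ z * M [] ν)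
        ≈⟨ *-congʳ (trans (ι-+ (z ℤ.* (z ℤ.- (+ 1))) (quad ν)) (+-congʳ (ι-* z (z ℤ.- (+ 1))))) ⟩
      (ι z * ι (z ℤ.- (+ 1)) + ι (quad ν)) * (δ₀ z * M [] ν)
        ≈⟨ solve 5 (λ z y q d m → (z :* y :+ q) :* (d :* m) := y :* m :* (d :* z) :+ d :* (q :* m)) refl _ _ _ _ _ ⟩
      ι (z ℤ.- (+ 1)) * M [] ν * (δ₀ z * ι z) + δ₀ z * (ι (quad ν) * M [] ν)
        ≈⟨ +-cong (trans (*-congˡ (δ₀-* z)) (zeroʳ _)) (trans (*-congˡ (base ν)) (zeroʳ _)) ⟩
      0# + 0# ≈⟨ +-identityʳ 0# ⟩
      0# ∎
      where
      δ₀-* : ∀ z → δ₀ z * ι z ≈ 0#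
      δ₀-* (+ zero) = zeroʳ _
      δ₀-* (+ suc n) = zeroˡ _
      δ₀-* -[1+ n ] = zeroˡ _
  M-D {s} (m ∷ μ) ν = begin
    ev (λ x → M x ν) (D (m ∷ μ))
      ≈⟨ ev-D (λ x → M x ν) m μ ⟩
    ⟦ m ⟧ * ev (λ t → M (proj₁ t ∷ proj₂ t ∷ μ) ν) (splits m) +
      (diag m * sum X + (2α * ⟦ m ⟧ * ev (λ x → M x ν) (join m μ) + ev (λ x → sum (λ i → M x (ν ⊕ u i))) (D μ)))
      ≈⟨ +-cong (*-congˡ cut) (+-congˡ (+-cong (*-congˡ (M-join m μ ν)) rest)) ⟩
    ⟦ m ⟧ * (ι (+ m) * sum X + Y) + (diag m * sum X + (2α * ⟦ m ⟧ * sum (λ i → l i * X i) + (sum (λ i → α * q i * X i) + W)))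
      -- `1#` is passed as the variable `c`, because the solver's numeral 1 is read as `ι (+ 1)`;
      -- the leftover difference of the two vanishes in the next step.
      ≈⟨ solve 9 (λ A N M X Y L Q W c → M :* (N :* X :+ Y) :+ ((A :- c) :* M :* N :* X :+ (con (+ 2) :* A :* M :* L :+ (Q :+ W)))
           := ((A :* M :* N :* X :+ con (+ 2) :* A :* M :* L :+ Q) :+ (W :+ M :* Y)) :+ (con (+ 1) :- c) :* M :* N :* X) refl
           α (ι (+ m)) ⟦ m ⟧ (sum X) Y (sum (λ i → l i * X i)) (sum (λ i → α * q i * X i)) W 1# ⟩
    ((α * ⟦ m ⟧ * ι (+ m) * sum X + 2α * ⟦ m ⟧ * sum (λ i → l i * X i) + sum (λ i → α * q i * X i)) + (W + ⟦ m ⟧ * Y)) + (ι (+ 1) + - 1#) * ⟦ m ⟧ * ι (+ m) * sum X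
      ≈⟨ +-cong (+-congʳ quadratic) (trans (*-congʳ (*-congʳ (trans (*-congʳ (trans (+-congʳ ι-1) (-‿inverseʳ 1#))) (zeroˡ _)))) (trans (*-congʳ (zeroˡ _)) (zeroˡ _))) ⟩
    (α * ι (quad ν) * sum X + (W + ⟦ m ⟧ * Y)) + 0#
      ≈⟨ +-identityʳ _ ⟩
    α * ι (quad ν) * sum X + (W + ⟦ m ⟧ * Y)
      ≈⟨ +-congˡ (sym (trans (∑off-+ (λ a b → sum (λ i → Z a b μ (ν ⊕ u i))) (λ a b → ⟦ m ⟧ * y a b)) (+-cong (∑off-sum (λ i a b → Z a b μ (ν ⊕ u i))) (∑off-* ⟦ m ⟧ y)))) ⟩
    α * ι (quad ν) * M (m ∷ μ) ν + ∑off (λ a b → Z a b (m ∷ μ) ν) ∎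
    where
    u : Fin s → Vec ℤ s
    u i = unit i (ℤ.- part m)
    X l q : Fin s → Carrier
    X i = M μ (ν ⊕ u i)
    l i = ι (lookup (ν ⊕ u i) i)
    q i = ι (quad (ν ⊕ u i))
    y : Fin s → Fin s → Carrier
    y a b = ev (λ t → M μ (ν ⊕ unit a (ℤ.- part (proj₁ t)) ⊕ unit b (ℤ.- part (proj₂ t)))) (splits m)
    Y W : Carrier
    Y = ∑off y
    W = sum (λ i → ∑off (λ a b → Z a b μ (ν ⊕ u i)))
    rest : ev (λ x → sum (λ i → M x (ν ⊕ u i))) (D μ) ≈ sum (λ i → α * q i * X i) + W
    rest = trans (ev-sum (λ i x → M x (ν ⊕ u i)) (D μ)) (trans (sum-cong λ i → M-D μ (ν ⊕ u i)) (sum-+ (λ i → α * q i * X i) (λ i → ∑off (λ a b → Z a b μ (ν ⊕ u i)))))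
    cut : ev (λ t → M (proj₁ t ∷ proj₂ t ∷ μ) ν) (splits m) ≈ ι (+ m) * sum X + Y
    cut = begin
      ev (λ t → sum (λ a → sum (λ b → G a b t))) (splits m)
        ≈⟨ trans (ev-sum (λ a t → sum (λ b → G a b t)) (splits m)) (sum-cong λ a → ev-sum (λ b t → G a b t) (splits m)) ⟩
      sum (λ a → sum (λ b → y a b))
        ≈⟨ sum-cong (λ a → sum-off a (y a)) ⟩
      sum (λ a → y a a + sum (λ b → off a b (y a b)))
        ≈⟨ trans (sum-+ (λ a → y a a) (λ a → sum (λ b → off a b (y a b)))) (+-congʳ (trans (sum-cong same) (sum-* (ι (+ m)) X))) ⟩
      ι (+ m) * sum X + Y ∎
      where
      G : Fin s → Fin s → ℕ × ℕ → Carrier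
      G a b t = M μ (ν ⊕ unit a (ℤ.- part (proj₁ t)) ⊕ unit b (ℤ.- part (proj₂ t)))
      same : ∀ a → y a a ≈ ι (+ m) * X a
      same a = trans (ev-cong (λ t → M-cong μ (≡.trans (⊕-unit-+ ν a _ _) (≡.cong (λ z → ν ⊕ unit a z) (≡.sym (ℤP.neg-distrib-+ (part (proj₁ t)) (part (proj₂ t))))))) (splits m))
        (splits-const (λ z → M μ (ν ⊕ unit a (ℤ.- z))) m)
    quadratic : α * ⟦ m ⟧ * ι (+ m) * sum X + 2α * ⟦ m ⟧ * sum (λ i → l i * X i) + sum (λ i → α * q i * X i) ≈ α * ι (quad ν) * sum X
    quadratic = begin
      α * ⟦ m ⟧ * ι (+ m) * sum X + 2α * ⟦ m ⟧ * sum (λ i → l i * X i) + sum (λ i → α * q i * X i)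
        ≈⟨ +-congʳ (+-cong (sym (sum-* _ X)) (sym (sum-* _ (λ i → l i * X i)))) ⟩
      sum (λ i → α * ⟦ m ⟧ * ι (+ m) * X i) + sum (λ i → 2α * ⟦ m ⟧ * (l i * X i)) + sum (λ i → α * q i * X i)
        ≈⟨ trans (+-congʳ (sym (sum-+ (λ i → α * ⟦ m ⟧ * ι (+ m) * X i) (λ i → 2α * ⟦ m ⟧ * (l i * X i))))) (sym (sum-+ (λ i → α * ⟦ m ⟧ * ι (+ m) * X i + 2α * ⟦ m ⟧ * (l i * X i)) (λ i → α * q i * X i))) ⟩
      sum (λ i → α * ⟦ m ⟧ * ι (+ m) * X i + 2α * ⟦ m ⟧ * (l i * X i) + α * q i * X i)
        ≈⟨ sum-cong (λ i → trans (solve 6 (λ A M N X L Q → A :* M :* N :* X :+ con (+ 2) :* A :* M :* (L :* X) :+ A :* Q :* X := A :* (Q :+ M :* ((L :+ L) :+ N)) :* X) refl α ⟦ m ⟧ (ι (+ m)) (X i) (l i) (q i))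
             (*-congʳ (*-congˡ (shift i)))) ⟩
      sum (λ i → α * ι (quad ν) * X i)
        ≈⟨ sum-* _ X ⟩
      α * ι (quad ν) * sum X ∎
      where
      quad≡ : ∀ i → quad ν ≡ quad (ν ⊕ u i) ℤ.+ part m ℤ.* ((lookup (ν ⊕ u i) i ℤ.+ lookup (ν ⊕ u i) i) ℤ.+ (part m ℤ.- (+ 1)))
      quad≡ i = ≡.trans (≡.cong quad (≡.sym (≡.trans (⊕-unit-+ ν i _ _) (≡.trans (≡.cong (λ z → ν ⊕ unit i z) (ℤP.+-inverseˡ (part m))) (zero-shift i))))) (quad-shift (ν ⊕ u i) i (part m))
        where
        zero-shift : ∀ {s} {ν : Vec ℤ s} i → ν ⊕ unit i 0ℤ ≡ ν
        zero-shift {ν = ν} i = ≡.trans (≡.cong (ν ⊕_) (zero-unit i)) (⊕-identityʳ ν)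
          where
          zero-unit : ∀ {s} (i : Fin s) → unit i 0ℤ ≡ Vec.replicate s 0ℤ
          zero-unit zero = ≡.refl
          zero-unit (suc i) = ≡.cong (0ℤ ∷_) (zero-unit i)
      shift : ∀ i → q i + ⟦ m ⟧ * ((l i + l i) + ι (+ m)) ≈ ι (quad ν)
      shift i = sym (begin
        ι (quad ν)
          ≡⟨ ≡.cong ι (quad≡ i) ⟩
        ι (quad (ν ⊕ u i) ℤ.+ part m ℤ.* ((ℓ ℤ.+ ℓ) ℤ.+ (part m ℤ.- (+ 1))))
          ≈⟨ ι-+ (quad (ν ⊕ u i)) _ ⟩
        q i + ι (part m ℤ.* ((ℓ ℤ.+ ℓ) ℤ.+ (part m ℤ.- (+ 1))))
          ≈⟨ +-congˡ (trans (ι-* (part m) ((ℓ ℤ.+ ℓ) ℤ.+ (+ m))) (*-congˡ (trans (ι-+ (ℓ ℤ.+ ℓ) (+ m)) (+-congʳ (ι-+ ℓ ℓ))))) ⟩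
        q i + ⟦ m ⟧ * ((l i + l i) + ι (+ m)) ∎)
        where
        ℓ = lookup (ν ⊕ u i) i

  -- Eigenfunctions in finitely many variables

  cancel-nonzero : ∀ {c y} → ¬ (c ≈ 0#) → c * y ≈ 0# → y ≈ 0#
  cancel-nonzero {c} {y} c≉0 e with inverse c c≉0
  ... | d , dc = begin
    y            ≈⟨ *-identityˡ y ⟨
    1# * y       ≈⟨ *-congʳ dc ⟨
    d * c * y    ≈⟨ *-assoc d c y ⟩
    d * (c * y)  ≈⟨ *-congˡ e ⟩
    d * 0#       ≈⟨ zeroʳ d ⟩
    0#           ∎

  total : Vec ℤ s → ℤ
  total [] = 0ℤ
  total (z ∷ ν) = z ℤ.+ total ν

  total-shift : ∀ (ν : Vec ℤ s) i x → total (ν ⊕ unit i x) ≡ total ν ℤ.+ x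
  total-shift (z ∷ ν) zero x = ≡.trans (≡.cong (λ ξ → z ℤ.+ x ℤ.+ total ξ) (⊕-identityʳ ν))
    (ℤS.solve 3 (λ z x t → z ℤS.:+ x ℤS.:+ t ℤS.:= z ℤS.:+ t ℤS.:+ x) ≡.refl z x (total ν))
  total-shift (z ∷ ν) (suc i) x = ≡.trans (≡.cong₂ ℤ._+_ (ℤP.+-identityʳ z) (total-shift ν i x)) (≡.sym (ℤP.+-assoc z (total ν) x))

  -1ℤ : ℤ
  -1ℤ = ℤ.- (+ 1)

  -- The coefficient of x^ν in (x_a - x_b) z = x_a x_b (∂_a - ∂_b) X. It stands in for a division
  -- that an arbitrary table does not admit.
  Relation : Fin s → Fin s → (z X : Vec ℤ s → Carrier) → Set
  Relation a b z X = ∀ ν → z (ν ⊕ unit a -1ℤ) + - z (ν ⊕ unit b -1ℤ) ≈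
    ι (lookup ν a) * X (ν ⊕ unit b -1ℤ) + - (ι (lookup ν b) * X (ν ⊕ unit a -1ℤ))

  Relation-swap : ∀ {a b : Fin s} {z X} → Relation a b z X → Relation b a z X
  Relation-swap {z = z} {X} rel ν = trans
    (solve 2 (λ p q → q :- p := :- (p :- q)) refl _ _)
    (trans (-‿cong (rel ν)) (solve 2 (λ p q → :- (p :- q) := q :- p) refl _ _))

  -- The pair contributions to D on a coefficient table X.
  record PairTable (X : Vec ℤ s → Carrier) : Set where
    field
      pairs : Fin s → Fin s → Vec ℤ s → Carrier
      relation : ∀ {a b} → a ≢ b → Relation a b (pairs a b) X
      pairs-negˡ : ∀ {a b} ν → a ≢ b → lookup ν a ℤ.< 0ℤ → pairs a b ν ≈ 0#
      pairs-negʳ : ∀ {a b} ν → a ≢ b → lookup ν b ℤ.< 0ℤ → pairs a b ν ≈ 0#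
      table-neg : ∀ {ν} → Negative ν → X ν ≈ 0#

    applyD : Vec ℤ s → Carrier
    applyD ν = α * ι (quad ν) * X ν + ∑off (λ a b → pairs a b ν)

  -- The equation is asked in the single degree `n`, because inverting the variables changes the
  -- eigenvalue by an amount that depends on the degree.
  record Eigentable (X : Vec ℤ s → Carrier) (n : ℤ) (e : Carrier) : Set where
    field
      pairTable : PairTable X
    open PairTable pairTable public
    field
      eigen : ∀ ν → total ν ≡ n → e * X ν ≈ applyD ν

  slide : Fin s → Fin s → Vec ℤ s → ℕ → Vec ℤ s
  slide a b ν j = ν ⊕ unit a (+ j) ⊕ unit b (ℤ.- (+ j))

  ⊕-unit-0 : (ν : Vec ℤ s) (i : Fin s) → ν ⊕ unit i 0ℤ ≡ ν
  ⊕-unit-0 ν i = ≡.trans (≡.cong (ν ⊕_) (zero-unit i)) (⊕-identityʳ ν)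
    where
    zero-unit : ∀ {s} (i : Fin s) → unit i 0ℤ ≡ Vec.replicate s 0ℤ
    zero-unit zero = ≡.refl
    zero-unit (suc i) = ≡.cong (0ℤ ∷_) (zero-unit i)

  slide-0 : (a b : Fin s) (ν : Vec ℤ s) → slide a b ν 0 ≡ ν
  slide-0 a b ν = ≡.trans (⊕-unit-0 (ν ⊕ unit a 0ℤ) b) (⊕-unit-0 ν a)

  slide-slide : (a b : Fin s) (ν : Vec ℤ s) (j : ℕ) → slide a b (slide a b ν 1) j ≡ slide a b ν (suc j)
  slide-slide a b ν j = ≡.trans (≡.cong (_⊕ unit b (ℤ.- (+ j))) (⊕-swap (ν ⊕ unit a (+ 1)) (unit b -1ℤ) (unit a (+ j))))
    (≡.trans (⊕-unit-+ (ν ⊕ unit a (+ 1) ⊕ unit a (+ j)) b -1ℤ (ℤ.- (+ j))) (≡.cong₂ (λ x y → x ⊕ unit b y) (⊕-unit-+ ν a (+ 1) (+ j)) (neg-suc j)))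
    where
    neg-suc : ∀ j → -1ℤ ℤ.+ (ℤ.- (+ j)) ≡ ℤ.- (+ suc j)
    neg-suc zero = ≡.refl
    neg-suc (suc j) = ≡.refl

  lookup-slideʳ : (a b : Fin s) (ν : Vec ℤ s) (j : ℕ) → a ≢ b → lookup (slide a b ν j) b ≡ lookup ν b ℤ.- (+ j)
  lookup-slideʳ a b ν j a≢b = ≡.trans (lookup-⊕-unit (ν ⊕ unit a (+ j)) b (ℤ.- (+ j))) (≡.cong (ℤ._- (+ j)) (lookup-⊕-unit-≢ ν a b (+ j) a≢b))

  lookup-slideˡ : (a b : Fin s) (ν : Vec ℤ s) (j : ℕ) → a ≢ b → lookup (slide a b ν j) a ≡ lookup ν a ℤ.+ (+ j)
  lookup-slideˡ a b ν j a≢b = ≡.trans (lookup-⊕-unit-≢ (ν ⊕ unit a (+ j)) b a (ℤ.- (+ j)) (a≢b ∘ ≡.sym)) (lookup-⊕-unit ν a (+ j))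

  module _ {a b : Fin s} {z X : Vec ℤ s → Carrier} (a≢b : a ≢ b)
           (rel : Relation a b z X) (z-neg : ∀ ν → lookup ν b ℤ.< 0ℤ → z ν ≈ 0#) where

    slide-step : ∀ ν → z ν ≈ z (slide a b ν 1) + ((ι (lookup ν a) + 1#) * X (slide a b ν 1) + - (ι (lookup ν b) * X ν))
    slide-step ν = begin
      z ν
        ≈⟨ solve 2 (λ p q → p := q :+ (p :- q)) refl _ _ ⟩
      z (slide a b ν 1) + (z ν + - z (slide a b ν 1))
        ≡⟨ ≡.cong (λ ξ → z (slide a b ν 1) + (z ξ + - z (slide a b ν 1))) (≡.sym back) ⟩
      z (slide a b ν 1) + (z (ν ⊕ unit a (+ 1) ⊕ unit a -1ℤ) + - z (slide a b ν 1))
        ≈⟨ +-congˡ (rel (ν ⊕ unit a (+ 1))) ⟩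
      z (slide a b ν 1) + (ι (lookup (ν ⊕ unit a (+ 1)) a) * X (slide a b ν 1) + - (ι (lookup (ν ⊕ unit a (+ 1)) b) * X (ν ⊕ unit a (+ 1) ⊕ unit a -1ℤ)))
        ≈⟨ +-congˡ (+-cong (*-congʳ (trans (reflexive (≡.cong ι (lookup-⊕-unit ν a (+ 1)))) (trans (ι-+ (lookup ν a) (+ 1)) (+-congˡ ι-1))))
             (-‿cong (*-cong (reflexive (≡.cong ι (lookup-⊕-unit-≢ ν a b (+ 1) a≢b))) (reflexive (≡.cong X back))))) ⟩
      z (slide a b ν 1) + ((ι (lookup ν a) + 1#) * X (slide a b ν 1) + - (ι (lookup ν b) * X ν)) ∎
      where
      back : ν ⊕ unit a (+ 1) ⊕ unit a -1ℤ ≡ ν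
      back = ≡.trans (⊕-unit-+ ν a (+ 1) -1ℤ) (⊕-unit-0 ν a)

    -- Each slide lowers the entry at `b`, so after finitely many steps it is negative and the
    -- boundary condition on `z` applies; `k` bounds the number of steps. Together with the relation
    -- this boundary condition determines `z` from `X`.
    slide-vanish : ∀ k ν → lookup ν b ℤ.< (+ k) → (∀ j → X (slide a b ν j) ≈ 0#) → z ν ≈ 0#
    slide-vanish zero ν lt h = z-neg ν lt
    slide-vanish (suc k) ν lt h = trans (slide-step ν) (trans (+-cong
      (slide-vanish k (slide a b ν 1) (≡.subst (ℤ._< (+ k)) (≡.sym (lookup-slideʳ a b ν 1 a≢b)) (ℤP.<-≤-trans (ℤP.+-monoˡ-< -1ℤ lt) ℤP.≤-refl))
        (λ j → trans (reflexive (≡.cong X (slide-slide a b ν j))) (h (suc j))))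
      (+-cong (trans (*-congˡ (h 1)) (zeroʳ _)) (trans (-‿cong (trans (*-congˡ (trans (reflexive (≡.cong X (≡.sym (slide-0 a b ν)))) (h 0))) (zeroʳ _))) -0#≈0#)))
      (trans (+-congˡ (+-identityʳ 0#)) (+-identityʳ 0#)))

    -- In the sum obtained by iterating `slide-step`, all terms but the one with `X ν` involve
    -- vectors slid at least once.
    slide-value : ∀ ν → (∀ j → X (slide a b ν (suc j)) ≈ 0#) → z ν ≈ - (ι (lookup ν b) * X ν)
    slide-value ν h = trans (slide-step ν) (trans (+-cong
      (slide-vanish (suc ℤ.∣ lookup ν b ∣) (slide a b ν 1)
        (≡.subst (ℤ._< (+ suc ℤ.∣ lookup ν b ∣)) (≡.sym (lookup-slideʳ a b ν 1 a≢b))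
          (ℤP.≤-<-trans (ℤP.+-monoʳ-≤ (lookup ν b) { -1ℤ} {0ℤ} ℤ.-≤+) (≡.subst (ℤ._< (+ suc ℤ.∣ lookup ν b ∣)) (≡.sym (ℤP.+-identityʳ (lookup ν b))) (below (lookup ν b)))))
        (λ j → trans (reflexive (≡.cong X (slide-slide a b ν j))) (h j)))
      (+-congʳ (trans (*-congˡ (h 0)) (zeroʳ _))))
      (trans (+-identityˡ _) (+-identityˡ _)))
      where
      import Data.Nat.Properties as ℕP
      below : ∀ z → z ℤ.< + suc ℤ.∣ z ∣
      below (+ n) = ℤ.+<+ (ℕP.n<1+n n)
      below -[1+ n ] = ℤ.-<+

  quad-slide : (a b : Fin s) (ν : Vec ℤ s) → a ≢ b → ∀ j →
    quad (slide a b ν j) ≡ quad ν ℤ.+ ((+ 2) ℤ.* (+ j) ℤ.* (lookup ν a ℤ.- lookup ν b) ℤ.+ (+ 2) ℤ.* (+ j) ℤ.* (+ j))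
  quad-slide a b ν a≢b j = ≡.trans (quad-shift (ν ⊕ unit a (+ j)) b (ℤ.- (+ j)))
    (≡.trans (≡.cong₂ (λ q y → q ℤ.+ (ℤ.- (+ j)) ℤ.* ((y ℤ.+ y) ℤ.+ ((ℤ.- (+ j)) ℤ.- (+ 1)))) (quad-shift ν a (+ j)) (lookup-⊕-unit-≢ ν a b (+ j) a≢b))
    (ℤS.solve 4 (λ q x y j → q ℤS.:+ j ℤS.:* ((x ℤS.:+ x) ℤS.:+ (j ℤS.:- ℤS.con (+ 1))) ℤS.:+ ℤS.:- j ℤS.:* ((y ℤS.:+ y) ℤS.:+ (ℤS.:- j ℤS.:- ℤS.con (+ 1)))
       ℤS.:= q ℤS.:+ (ℤS.con (+ 2) ℤS.:* j ℤS.:* (x ℤS.:- y) ℤS.:+ ℤS.con (+ 2) ℤS.:* j ℤS.:* j)) ≡.refl (quad ν) (lookup ν a) (lookup ν b) (+ j)))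

  quad-slide-< : (a b : Fin s) (ν : Vec ℤ s) → a ≢ b → lookup ν b ℤ.≤ lookup ν a → ∀ j → quad ν ℤ.< quad (slide a b ν (suc j))
  quad-slide-< a b ν a≢b le j = ≡.subst₂ ℤ._<_ (ℤP.+-identityʳ (quad ν)) (≡.sym (quad-slide a b ν a≢b (suc j)))
    (ℤP.+-monoʳ-< (quad ν) (ℤP.+-mono-≤-< {0ℤ} nonneg (ℤ.+<+ (ℕ.s≤s ℕ.z≤n))))
    where
    nonneg : 0ℤ ℤ.≤ (+ 2) ℤ.* (+ suc j) ℤ.* (lookup ν a ℤ.- lookup ν b)
    nonneg = ≡.subst (ℤ._≤ (+ 2) ℤ.* (+ suc j) ℤ.* (lookup ν a ℤ.- lookup ν b)) (ℤP.*-zeroʳ ((+ 2) ℤ.* (+ suc j)))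
      (ℤP.*-monoˡ-≤-nonNeg ((+ 2) ℤ.* (+ suc j)) (ℤP.i≤j⇒0≤j-i le))

  total-slide : (a b : Fin s) (ν : Vec ℤ s) (j : ℕ) → total (slide a b ν j) ≡ total ν
  total-slide a b ν j = ≡.trans (total-shift (ν ⊕ unit a (+ j)) b _) (≡.trans (≡.cong (ℤ._+ (ℤ.- (+ j))) (total-shift ν a (+ j)))
    (ℤS.solve 2 (λ t j → t ℤS.:+ j ℤS.:+ ℤS.:- j ℤS.:= t) ≡.refl (total ν) (+ j)))

  ι-sum : ∀ {n} (f : Fin n → ℤ) → Σ ℤ λ B → sum (λ i → ι (f i)) ≈ ι B
  ι-sum {zero} f = 0ℤ , refl
  ι-sum {suc n} f with ι-sum (f ∘ suc)
  ... | B , e = f zero ℤ.+ B , trans (+-congˡ e) (sym (ι-+ (f zero) B))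

  ι-∑off : ∀ {n} (f : Fin n → Fin n → ℤ) → Σ ℤ λ B → ∑off (λ a b → ι (f a b)) ≈ ι B
  ι-∑off {n} f = proj₁ (ι-sum rows) , trans (sum-cong λ a → trans (sum-cong λ b → offι a b (f a b)) (proj₂ (ι-sum (row a)))) (proj₂ (ι-sum rows))
    where
    row : Fin n → Fin n → ℤ
    row a b with a Fin.≟ b
    ... | yes _ = 0ℤ
    ... | no _ = f a b
    rows : Fin n → ℤ
    rows a = proj₁ (ι-sum (row a))
    offι : ∀ a b z → off a b (ι (f a b)) ≈ ι (row a b)
    offι a b z with a Fin.≟ b
    ... | yes _ = refl
    ... | no _ = refl

  pairEnergy : Vec ℤ s → ℤ
  pairEnergy ν = proj₁ (ι-∑off λ a b → ℤ.- (lookup ν a ℤ.⊓ lookup ν b))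

  module _ {X : Vec ℤ s → Carrier} (T : PairTable X) where
    open PairTable T

    pairs-slide : ∀ {a b} ν → a ≢ b → (∀ j → X (slide a b ν (suc j)) ≈ 0#) → pairs a b ν ≈ - (ι (lookup ν b) * X ν)
    pairs-slide ν a≢b = slide-value a≢b (relation a≢b) (λ ξ → pairs-negʳ ξ a≢b) ν

    pairs-slide′ : ∀ {a b} ν → a ≢ b → (∀ j → X (slide b a ν (suc j)) ≈ 0#) → pairs a b ν ≈ - (ι (lookup ν a) * X ν)
    pairs-slide′ {a} {b} ν a≢b = slide-value {a = b} {b = a} {z = pairs a b} {X = X} (a≢b ∘ ≡.sym)
      (Relation-swap {a = a} {b = b} {z = pairs a b} {X = X} (relation a≢b)) (λ ξ → pairs-negˡ ξ a≢b) ν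

    -- Sliding apart two entries strictly increases quad, so it is a well-founded leading order.
    applyD-leading : ∀ ν → (∀ ξ → total ξ ≡ total ν → quad ν ℤ.< quad ξ → X ξ ≈ 0#) →
      applyD ν ≈ (α * ι (quad ν) + ι (pairEnergy ν)) * X ν
    applyD-leading ν above = begin
      α * ι (quad ν) * X ν + ∑off (λ a b → pairs a b ν)
        ≈⟨ +-congˡ (trans (∑off-cong min-value) (∑off-* (X ν) (λ a b → ι (ℤ.- (lookup ν a ℤ.⊓ lookup ν b))))) ⟩
      α * ι (quad ν) * X ν + X ν * ∑off (λ a b → ι (ℤ.- (lookup ν a ℤ.⊓ lookup ν b)))
        ≈⟨ +-congˡ (trans (*-congˡ (proj₂ (ι-∑off λ a b → ℤ.- (lookup ν a ℤ.⊓ lookup ν b)))) (*-comm _ _)) ⟩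
      α * ι (quad ν) * X ν + ι (pairEnergy ν) * X ν
        ≈⟨ distribʳ _ _ _ ⟨
      (α * ι (quad ν) + ι (pairEnergy ν)) * X ν ∎
      where
      min-value : ∀ a b → a ≢ b → pairs a b ν ≈ X ν * ι (ℤ.- (lookup ν a ℤ.⊓ lookup ν b))
      min-value a b a≢b with ℤP.≤-total (lookup ν b) (lookup ν a)
      ... | inj₁ b≤a = trans (pairs-slide ν a≢b λ j → above _ (total-slide a b ν (suc j)) (quad-slide-< a b ν a≢b b≤a j))
        (trans (solve 2 (λ k x → :- (k :* x) := x :* :- k) refl _ _) (*-congˡ (sym (trans (reflexive (≡.cong (λ z → ι (ℤ.- z)) (ℤP.i≥j⇒i⊓j≡j b≤a))) (ι-neg (lookup ν b))))))
      ... | inj₂ a≤b = trans (pairs-slide′ ν a≢b λ j → above _ (total-slide b a ν (suc j)) (quad-slide-< b a ν (a≢b ∘ ≡.sym) a≤b j))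
        (trans (solve 2 (λ k x → :- (k :* x) := x :* :- k) refl _ _) (*-congˡ (sym (trans (reflexive (≡.cong (λ z → ι (ℤ.- z)) (ℤP.i≤j⇒i⊓j≡i a≤b))) (ι-neg (lookup ν a))))))

  leading : ∀ {X : Vec ℤ s → Carrier} {n e} (T : Eigentable X n e) ν → total ν ≡ n →
    (∀ ξ → total ξ ≡ n → quad ν ℤ.< quad ξ → X ξ ≈ 0#) → e * X ν ≈ (α * ι (quad ν) + ι (pairEnergy ν)) * X ν
  leading T ν tν above = trans (eigen ν tν) (applyD-leading pairTable ν λ ξ tξ → above ξ (≡.trans tξ tν))
    where open Eigentable T

  Eigentable-resp : ∀ {X : Vec ℤ s → Carrier} {n e e′} → e ≈ e′ → Eigentable X n e → Eigentable X n e′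
  Eigentable-resp e≈ T = record
    { pairTable = pairTable
    ; eigen = λ ν t → trans (*-congʳ (sym e≈)) (eigen ν t) }
    where open Eigentable T

  Eigentable-− : ∀ {X Y : Vec ℤ s → Carrier} {n e} → Eigentable X n e → Eigentable Y n e → Eigentable (λ ν → X ν + - Y ν) n e
  Eigentable-− {X = X} {Y} T U = record
    { pairTable = record
    { pairs = λ a b ν → T.pairs a b ν + - U.pairs a b ν
    ; relation = λ {a} {b} a≢b ν → trans
        (solve 4 (λ p q r t → (p :- q) :- (r :- t) := (p :- r) :- (q :- t)) refl _ _ _ _)
        (trans (+-cong (T.relation a≢b ν) (-‿cong (U.relation a≢b ν)))
        (solve 6 (λ x y p q r t → (x :* p :- y :* q) :- (x :* r :- y :* t) := x :* (p :- r) :- y :* (q :- t)) refl _ _ _ _ _ _))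
    ; pairs-negˡ = λ ν a≢b lt → zero- (T.pairs-negˡ ν a≢b lt) (U.pairs-negˡ ν a≢b lt)
    ; pairs-negʳ = λ ν a≢b lt → zero- (T.pairs-negʳ ν a≢b lt) (U.pairs-negʳ ν a≢b lt)
    ; table-neg = λ neg → zero- (T.table-neg neg) (U.table-neg neg) }
    ; eigen = λ ν t → trans (solve 3 (λ e x y → e :* (x :- y) := e :* x :- e :* y) refl _ _ _)
        (trans (+-cong (T.eigen ν t) (-‿cong (U.eigen ν t)))
        (trans (solve 5 (λ c x y p r → (c :* x :+ p) :- (c :* y :+ r) := c :* (x :- y) :+ (p :+ con (ℤ.- (+ 1)) :* r)) refl _ _ _ _ _)
        (+-congˡ (trans (+-congˡ (sym (∑off-* (ι -1ℤ) (λ a b → U.pairs a b ν))))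
          (trans (sym (∑off-+ (λ a b → T.pairs a b ν) (λ a b → ι -1ℤ * U.pairs a b ν)))
            (∑off-cong {y = λ a b → T.pairs a b ν + ι -1ℤ * U.pairs a b ν} {z = λ a b → T.pairs a b ν + - U.pairs a b ν} λ a b _ → +-congˡ (solve 1 (λ x → con (ℤ.- (+ 1)) :* x := :- x) refl (U.pairs a b ν)))))))) }
    where
    module T = Eigentable T
    module U = Eigentable U
    zero- : ∀ {x y} → x ≈ 0# → y ≈ 0# → x + - y ≈ 0#
    zero- x0 y0 = trans (+-cong x0 (trans (-‿cong y0) -0#≈0#)) (+-identityʳ 0#)

  -- Both tables have the eigenvalue determined by `la`, so their difference is an eigentable. Where
  -- all vectors of larger `quad` already give zero, the difference is multiplied by its own leading
  -- eigenvalue too, and the two eigenvalues differ by a nonzero integer multiple of `α` plus an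
  -- integer. The hypothesis on equal `quad` covers the vectors where this multiple is zero.
  leading-unique : ∀ {X Y : Vec ℤ s → Carrier} {n e e′} → Eigentable X n e → Eigentable Y n e′ → ∀ la → total la ≡ n →
    X la ≈ 1# → Y la ≈ 1# →
    (∀ ν → total ν ≡ n → quad la ℤ.< quad ν → X ν ≈ 0#) → (∀ ν → total ν ≡ n → quad la ℤ.< quad ν → Y ν ≈ 0#) →
    (∀ ν → total ν ≡ n → quad ν ≡ quad la → X ν ≈ Y ν) →
    ∀ ν → total ν ≡ n → X ν ≈ Y ν
  leading-unique {X = X} {Y} {n} {e} {e′} T U la tla Xla Yla Xabove Yabove level ν tν =
    descend (ℤ.∣ quad la ℤ.- quad ν ∣) ν tν (bound (quad la) (quad ν))
    where
    eigenvalue = α * ι (quad la) + ι (pairEnergy la)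
    -- The eigenvalue is read off at `la`, where the table is 1, so neither `e` nor `e′` has to be
    -- known in advance.
    eT : e ≈ eigenvalue
    eT = trans (sym (*-identityʳ e)) (trans (*-congˡ (sym Xla)) (trans (leading T la tla Xabove) (trans (*-congˡ Xla) (*-identityʳ _))))
    eU : e′ ≈ eigenvalue
    eU = trans (sym (*-identityʳ e′)) (trans (*-congˡ (sym Yla)) (trans (leading U la tla Yabove) (trans (*-congˡ Yla) (*-identityʳ _))))
    V = Eigentable-− (Eigentable-resp eT T) (Eigentable-resp eU U)
    bound : ∀ x y → x ℤ.≤ y ℤ.+ (+ ℤ.∣ x ℤ.- y ∣)
    bound x y = ≡.subst (ℤ._≤ y ℤ.+ (+ ℤ.∣ x ℤ.- y ∣)) (ℤS.solve 2 (λ x y → y ℤS.:+ (x ℤS.:- y) ℤS.:= x) ≡.refl x y) (ℤP.+-monoʳ-≤ y (≤∣∣ (x ℤ.- y)))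
      where
      ≤∣∣ : ∀ z → z ℤ.≤ + ℤ.∣ z ∣
      ≤∣∣ (+ n) = ℤP.≤-refl
      ≤∣∣ -[1+ n ] = ℤ.-≤+
    top : ∀ ν → total ν ≡ n → quad la ℤ.≤ quad ν → X ν ≈ Y ν
    top ν tν le with quad ν ℤP.≟ quad la
    ... | yes eq = level ν tν eq
    ... | no neq = trans (Xabove ν tν lt) (sym (Yabove ν tν lt))
      where lt = ℤP.≤∧≢⇒< le (neq ∘ ≡.sym)
    -- `k` bounds how far `quad ν` lies below `quad la`; vectors of larger `quad` are reached with a
    -- smaller bound.
    descend : ∀ k ν → total ν ≡ n → quad la ℤ.≤ quad ν ℤ.+ (+ k) → X ν ≈ Y ν
    descend zero ν tν le = top ν tν (≡.subst (quad la ℤ.≤_) (ℤP.+-identityʳ (quad ν)) le)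
    descend (suc k) ν tν le with quad la ℤP.≤? quad ν
    ... | yes le′ = top ν tν le′
    ... | no nle = x∙y⁻¹≈ε⇒x≈y (X ν) (Y ν) (cancel-nonzero (α-free (quad la ℤ.- quad ν) (pairEnergy la ℤ.- pairEnergy ν) different) (begin
      (ι (quad la ℤ.- quad ν) * α + ι (pairEnergy la ℤ.- pairEnergy ν)) * y
        ≈⟨ *-congʳ (+-cong (*-congʳ (trans (ι-+ (quad la) (ℤ.- quad ν)) (+-congˡ (ι-neg (quad ν))))) (trans (ι-+ (pairEnergy la) (ℤ.- pairEnergy ν)) (+-congˡ (ι-neg (pairEnergy ν))))) ⟩
      ((ι (quad la) + - ι (quad ν)) * α + (ι (pairEnergy la) + - ι (pairEnergy ν))) * y
        ≈⟨ solve 6 (λ q r a p t y → ((q :- r) :* a :+ (p :- t)) :* y := (a :* q :+ p) :* y :- (a :* r :+ t) :* y) refl _ _ _ _ _ _ ⟩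
      eigenvalue * y + - ((α * ι (quad ν) + ι (pairEnergy ν)) * y)
        ≈⟨ x≈y⇒x∙y⁻¹≈ε (leading V ν tν λ ξ tξ lt → x≈y⇒x∙y⁻¹≈ε (descend k ξ tξ (raise ξ lt))) ⟩
      0# ∎))
      where
      y = X ν + - Y ν
      different : quad la ℤ.- quad ν ≢ 0ℤ
      different eq = nle (ℤP.≤-reflexive (ℤP.i-j≡0⇒i≡j (quad la) (quad ν) eq))
      raise : ∀ ξ → quad ν ℤ.< quad ξ → quad la ℤ.≤ quad ξ ℤ.+ (+ k)
      raise ξ lt = ℤP.≤-trans le (≡.subst (ℤ._≤ quad ξ ℤ.+ (+ k)) (ℤS.solve 2 (λ q k → (ℤS.con (+ 1) ℤS.:+ q) ℤS.:+ k ℤS.:= q ℤS.:+ (ℤS.con (+ 1) ℤS.:+ k)) ≡.refl (quad ν) (+ k)) (ℤP.+-monoˡ-≤ (+ k) (ℤP.i<j⇒suc[i]≤j lt)))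

  -- Inverting the variables and splitting off a first row

  flip : ℤ → Vec ℤ s → Vec ℤ s
  flip N = Vec.map (λ z → N ℤ.- z)

  flip-flip : ∀ N (ν : Vec ℤ s) → flip N (flip N ν) ≡ ν
  flip-flip N [] = ≡.refl
  flip-flip N (z ∷ ν) = ≡.cong₂ _∷_ (ℤS.solve 2 (λ n z → n ℤS.:- (n ℤS.:- z) ℤS.:= z) ≡.refl N z) (flip-flip N ν)

  flip-⊕-unit : ∀ N (ν : Vec ℤ s) i x → flip N (ν ⊕ unit i x) ≡ flip N ν ⊕ unit i (ℤ.- x)
  flip-⊕-unit N (z ∷ ν) zero x = ≡.cong₂ _∷_ (ℤS.solve 3 (λ n z x → n ℤS.:- (z ℤS.:+ x) ℤS.:= n ℤS.:- z ℤS.:+ ℤS.:- x) ≡.refl N z x)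
    (≡.trans (≡.cong (flip N) (⊕-identityʳ ν)) (≡.sym (⊕-identityʳ (flip N ν))))
  flip-⊕-unit N (z ∷ ν) (suc i) x = ≡.cong₂ _∷_ (≡.trans (≡.cong (λ y → N ℤ.- y) (ℤP.+-identityʳ z)) (≡.sym (ℤP.+-identityʳ (N ℤ.- z)))) (flip-⊕-unit N ν i x)

  lookup-flip : ∀ N (ν : Vec ℤ s) i → lookup (flip N ν) i ≡ N ℤ.- lookup ν i
  lookup-flip N ν i = VecP.lookup-map i _ ν

  total-flip : ∀ N (ν : Vec ℤ s) → total (flip N ν) ≡ (+ s) ℤ.* N ℤ.- total ν
  total-flip N [] = ≡.refl
  total-flip {suc s} N (z ∷ ν) = ≡.trans (≡.cong (λ t → (N ℤ.- z) ℤ.+ t) (total-flip N ν))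
    (≡.trans (ℤS.solve 4 (λ n z s t → (n ℤS.:- z) ℤS.:+ (s ℤS.:* n ℤS.:- t) ℤS.:= (ℤS.con (+ 1) ℤS.:+ s) ℤS.:* n ℤS.:- (z ℤS.:+ t)) ≡.refl N z (+ s) (total ν)) ≡.refl)

  -- The change depends on `ν` only through `total ν`, so among vectors of equal total `flip`
  -- preserves the order by `quad`.
  quad-flip : ∀ N (ν : Vec ℤ s) → quad (flip N ν) ≡ quad ν ℤ.+ ((+ s) ℤ.* (N ℤ.* N ℤ.- N) ℤ.- ((N ℤ.- (+ 1)) ℤ.+ (N ℤ.- (+ 1))) ℤ.* total ν)
  quad-flip N [] = ≡.sym (≡.trans (ℤP.+-identityˡ _) (ℤS.solve 1 (λ n → ℤS.con 0ℤ ℤS.:* (n ℤS.:* n ℤS.:- n) ℤS.:- ((n ℤS.:- ℤS.con (+ 1)) ℤS.:+ (n ℤS.:- ℤS.con (+ 1))) ℤS.:* ℤS.con 0ℤ ℤS.:= ℤS.con 0ℤ) ≡.refl N))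
  quad-flip {suc s} N (z ∷ ν) = ≡.trans (≡.cong (λ t → (N ℤ.- z) ℤ.* ((N ℤ.- z) ℤ.- (+ 1)) ℤ.+ t) (quad-flip N ν))
    (ℤS.solve 5 (λ n z s q t → (n ℤS.:- z) ℤS.:* ((n ℤS.:- z) ℤS.:- ℤS.con (+ 1)) ℤS.:+ (q ℤS.:+ (s ℤS.:* (n ℤS.:* n ℤS.:- n) ℤS.:- ((n ℤS.:- ℤS.con (+ 1)) ℤS.:+ (n ℤS.:- ℤS.con (+ 1))) ℤS.:* t))
       ℤS.:= (z ℤS.:* (z ℤS.:- ℤS.con (+ 1)) ℤS.:+ q) ℤS.:+ ((ℤS.con (+ 1) ℤS.:+ s) ℤS.:* (n ℤS.:* n ℤS.:- n) ℤS.:- ((n ℤS.:- ℤS.con (+ 1)) ℤS.:+ (n ℤS.:- ℤS.con (+ 1))) ℤS.:* (z ℤS.:+ t)))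
      ≡.refl N z (+ s) (quad ν) (total ν))

  quad-flip-< : ∀ N (ν ξ : Vec ℤ s) → total ν ≡ total ξ → quad ν ℤ.< quad ξ → quad (flip N ν) ℤ.< quad (flip N ξ)
  quad-flip-< {s} N ν ξ t lt = ≡.subst₂ ℤ._<_ (≡.sym (≡.trans (quad-flip N ν) (≡.cong shift t))) (≡.sym (quad-flip N ξ)) (ℤP.+-monoˡ-< _ lt)
    where
    shift : ℤ → ℤ
    shift t = quad ν ℤ.+ ((+ s) ℤ.* (N ℤ.* N ℤ.- N) ℤ.- ((N ℤ.- (+ 1)) ℤ.+ (N ℤ.- (+ 1))) ℤ.* t)

  quad-flip-≡ : ∀ N (ν ξ : Vec ℤ s) → total ν ≡ total ξ → quad ν ≡ quad ξ → quad (flip N ν) ≡ quad (flip N ξ)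
  quad-flip-≡ {s} N ν ξ t q = ≡.trans (quad-flip N ν) (≡.trans (≡.cong₂ shift q t) (≡.sym (quad-flip N ξ)))
    where
    shift : ℤ → ℤ → ℤ
    shift q t = q ℤ.+ ((+ s) ℤ.* (N ℤ.* N ℤ.- N) ℤ.- ((N ℤ.- (+ 1)) ℤ.+ (N ℤ.- (+ 1))) ℤ.* t)

  sum-const : ∀ n c → sum {n} (λ _ → c) ≈ ι (+ n) * c
  sum-const zero c = sym (zeroˡ c)
  sum-const (suc n) c = trans (+-cong (sym (*-identityˡ c)) (sum-const n c)) (sym (distribʳ c 1# (ι (+ n))))

  sum-lookup : (ν : Vec ℤ s) → sum (λ i → ι (lookup ν i)) ≈ ι (total ν)
  sum-lookup [] = refl
  sum-lookup (z ∷ ν) = trans (+-congˡ (sum-lookup ν)) (sym (ι-+ z (total ν)))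

  -- The corrections of all pairs under inversion add up to a function of `total ν`, hence to a
  -- constant within one degree, which the eigenvalue absorbs.
  ∑off-linear : ∀ N (ν : Vec ℤ s) → ∑off (λ a b → ι N + - (ι (lookup ν a) + ι (lookup ν b))) ≈
    (ι (+ s) * ι (+ s) * ι N + - ι (+ 2) * ι (+ s) * ι (total ν)) + - (ι (+ s) * ι N + - ι (+ 2) * ι (total ν))
  ∑off-linear {s} N ν = begin
    sum (λ a → sum (λ b → off a b (y a b)))
      ≈⟨ sum-cong (λ a → trans (solve 2 (λ p q → p := (q :+ p) :- q) refl (sum (λ b → off a b (y a b))) (y a a)) (+-congʳ (sym (sum-off a (y a))))) ⟩
    sum (λ a → sum (y a) + - y a a)
      ≈⟨ trans (sum-+ (λ a → sum (y a)) (λ a → - y a a)) (+-cong full (trans (sum-neg (λ a → y a a)) (-‿cong diagonal))) ⟩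
    (S * S * n + - ι (+ 2) * S * T) + - (S * n + - ι (+ 2) * T) ∎
    where
    n = ι N
    S = ι (+ s)
    T = ι (total ν)
    x : Fin s → Carrier
    x i = ι (lookup ν i)
    y : Fin s → Fin s → Carrier
    y a b = n + - (x a + x b)
    row : ∀ a → sum (y a) ≈ (S * n + - T) + - S * x a
    row a = begin
      sum (λ b → n + - (x a + x b))
        ≈⟨ sum-cong (λ b → solve 3 (λ n p q → n :- (p :+ q) := (n :+ :- p) :+ :- q) refl n (x a) (x b)) ⟩
      sum (λ b → (n + - x a) + - x b)
        ≈⟨ trans (sum-+ (λ b → n + - x a) (λ b → - x b)) (+-cong (sum-const s (n + - x a)) (trans (sum-neg x) (-‿cong (sum-lookup ν)))) ⟩
      S * (n + - x a) + - T
        ≈⟨ solve 4 (λ S n x T → S :* (n :+ :- x) :+ :- T := (S :* n :+ :- T) :+ :- S :* x) refl S n (x a) T ⟩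
      (S * n + - T) + - S * x a ∎
    full : sum (λ a → sum (y a)) ≈ S * S * n + - ι (+ 2) * S * T
    full = begin
      sum (λ a → sum (y a))
        ≈⟨ trans (sum-cong row) (sum-+ (λ a → S * n + - T) (λ a → - S * x a)) ⟩
      sum {s} (λ a → S * n + - T) + sum (λ a → - S * x a)
        ≈⟨ +-cong (sum-const s (S * n + - T)) (trans (sum-* (- S) x) (*-congˡ (sum-lookup ν))) ⟩
      S * (S * n + - T) + - S * T
        ≈⟨ solve 3 (λ S n T → S :* (S :* n :+ :- T) :+ :- S :* T := S :* S :* n :+ :- con (+ 2) :* S :* T) refl S n T ⟩
      S * S * n + - ι (+ 2) * S * T ∎
    diagonal : sum (λ a → y a a) ≈ S * n + - ι (+ 2) * T
    diagonal = begin
      sum (λ a → n + - (x a + x a))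
        ≈⟨ sum-cong (λ a → solve 2 (λ n p → n :- (p :+ p) := n :+ :- con (+ 2) :* p) refl n (x a)) ⟩
      sum (λ a → n + - ι (+ 2) * x a)
        ≈⟨ trans (sum-+ (λ a → n) (λ a → - ι (+ 2) * x a)) (+-cong (sum-const s n) (trans (sum-* _ x) (*-congˡ (sum-lookup ν)))) ⟩
      S * n + - ι (+ 2) * T ∎

  -- Inverting the variables and multiplying by (x₁ ⋯ x_s)^N preserves the eigenvalue equation up to a constant.
  module _ {X : Vec ℤ s → Carrier} {n e} (T : Eigentable X n e) (N : ℤ)
           (X-above : ∀ {ν} i → N ℤ.< lookup ν i → X ν ≈ 0#) where
    open Eigentable T

    private
      over : ∀ z → z ℤ.< 0ℤ → N ℤ.< N ℤ.- z
      over z lt = ≡.subst (ℤ._< N ℤ.- z) (ℤP.+-identityʳ N) (ℤP.+-monoʳ-< N (ℤP.neg-mono-< lt))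

      over-+ : ∀ z j → z ℤ.< 0ℤ → N ℤ.< (N ℤ.- z) ℤ.+ (+ j)
      over-+ z j lt = ℤP.<-≤-trans (over z lt) (≡.subst (ℤ._≤ (N ℤ.- z) ℤ.+ (+ j)) (ℤP.+-identityʳ (N ℤ.- z)) (ℤP.+-monoʳ-≤ (N ℤ.- z) {0ℤ} {+ j} (ℤ.+≤+ ℕ.z≤n)))

      flip-above : ∀ ν i → lookup ν i ℤ.< 0ℤ → X (flip N ν) ≈ 0#
      flip-above ν i lt = X-above i (≡.subst (N ℤ.<_) (≡.sym (lookup-flip N ν i)) (over _ lt))

      -- Inversion turns x_a x_b (∂_a - ∂_b) / (x_a - x_b) into (x_a² ∂_a - x_b² ∂_b) / (x_a - x_b),
      -- which exceeds it by the Euler operators x_a ∂_a + x_b ∂_b. Read at the flipped exponent and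
      -- with the factor (x₁ ⋯ x_s)^N, this excess becomes the correction `k`.
      k : Vec ℤ s → Fin s → Fin s → Carrier
      k ν a b = ι N + - (ι (lookup ν a) + ι (lookup ν b))

      pairsᶜ : Fin s → Fin s → Vec ℤ s → Carrier
      pairsᶜ a b ν = pairs a b (flip N ν) + k ν a b * X (flip N ν)

      -- κ collects the constants picked up by quad and by the pair terms in degree n′.
      n′ : ℤ
      n′ = (+ s) ℤ.* N ℤ.- n

      κ₁ : ℤ
      κ₁ = (+ s) ℤ.* (N ℤ.* N ℤ.- N) ℤ.- ((N ℤ.- (+ 1)) ℤ.+ (N ℤ.- (+ 1))) ℤ.* n′

      κ₂ : Carrier
      κ₂ = (ι (+ s) * ι (+ s) * ι N + - ι (+ 2) * ι (+ s) * ι n′) + - (ι (+ s) * ι N + - ι (+ 2) * ι n′)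

    Eigentable-flip : Eigentable (λ ν → X (flip N ν)) n′ (e + - (α * ι κ₁) + κ₂)
    Eigentable-flip = record
      { pairTable = record
      { pairs = pairsᶜ
      ; relation = λ {a} {b} → rel a b
      -- A negative entry of `ν` is an entry above `N` after the flip, and sliding towards it only
      -- raises it, so the table vanishes along the whole slide.
      ; pairs-negˡ = λ {a} {b} ν a≢b lt → vanish (trans (pairs-slide pairTable (flip N ν) a≢b (λ j → X-above a (≡.subst (N ℤ.<_) (≡.sym (≡.trans (lookup-slideˡ a b (flip N ν) (suc j) a≢b) (≡.cong (ℤ._+ (+ suc j)) (lookup-flip N ν a)))) (over-+ _ _ lt))))
          (trans (-‿cong (trans (*-congˡ (flip-above ν a lt)) (zeroʳ _))) -0#≈0#)) (flip-above ν a lt)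
      ; pairs-negʳ = λ {a} {b} ν a≢b lt → vanish (trans (pairs-slide′ pairTable (flip N ν) a≢b (λ j → X-above b (≡.subst (N ℤ.<_) (≡.sym (≡.trans (lookup-slideˡ b a (flip N ν) (suc j) (a≢b ∘ ≡.sym)) (≡.cong (ℤ._+ (+ suc j)) (lookup-flip N ν b)))) (over-+ _ _ lt))))
          (trans (-‿cong (trans (*-congˡ (flip-above ν b lt)) (zeroʳ _))) -0#≈0#)) (flip-above ν b lt)
      ; table-neg = λ { {ν} (negative i lt) → flip-above ν i lt } }
      ; eigen = eigenᶜ }
      where
      vanish : ∀ {p x c} → p ≈ 0# → x ≈ 0# → p + c * x ≈ 0#
      vanish p0 x0 = trans (+-cong p0 (trans (*-congˡ x0) (zeroʳ _))) (+-identityʳ 0#)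
      rel : ∀ a b → a ≢ b → Relation a b (pairsᶜ a b) (λ ν → X (flip N ν))
      rel a b a≢b ν = begin
        pairsᶜ a b (ν ⊕ unit a -1ℤ) + - pairsᶜ a b (ν ⊕ unit b -1ℤ)
          ≈⟨ +-cong (+-cong (reflexive (≡.cong (pairs a b) atA)) (*-congʳ (+-congˡ (-‿cong (+-cong shiftedA (unshifted a b a≢b))))))
               (-‿cong (+-cong (reflexive (≡.cong (pairs a b) atB)) (*-congʳ (+-congˡ (-‿cong (+-cong (unshifted b a (a≢b ∘ ≡.sym)) shiftedB)))))) ⟩
        (pairs a b (ζ ⊕ unit b -1ℤ) + (ι N + - ((x + - 1#) + y)) * X (flip N (ν ⊕ unit a -1ℤ))) +
        - (pairs a b (ζ ⊕ unit a -1ℤ) + (ι N + - (x + (y + - 1#))) * X (flip N (ν ⊕ unit b -1ℤ)))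
          ≈⟨ solve 8 (λ p q n x y A B o → (p :+ (n :- ((x :- o) :+ y)) :* A) :- (q :+ (n :- (x :+ (y :- o))) :* B)
               := (n :- ((x :- o) :+ y)) :* A :- (n :- (x :+ (y :- o))) :* B :- (q :- p)) refl _ _ (ι N) x y A B 1# ⟩
        (ι N + - ((x + - 1#) + y)) * A + - ((ι N + - (x + (y + - 1#))) * B) + - (pairs a b (ζ ⊕ unit a -1ℤ) + - pairs a b (ζ ⊕ unit b -1ℤ))
          ≈⟨ +-congˡ (-‿cong (trans (relation a≢b ζ) (+-cong (*-cong ζa (reflexive (≡.cong X (≡.sym atA)))) (-‿cong (*-cong ζb (reflexive (≡.cong X (≡.sym atB)))))))) ⟩
        (ι N + - ((x + - 1#) + y)) * A + - ((ι N + - (x + (y + - 1#))) * B) + - (((ι N + - x) + 1#) * A + - (((ι N + - y) + 1#) * B))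
          ≈⟨ final ⟩
        x * B + - (y * A) ∎
        where
        x = ι (lookup ν a)
        y = ι (lookup ν b)
        A = X (flip N (ν ⊕ unit a -1ℤ))
        B = X (flip N (ν ⊕ unit b -1ℤ))
        ζ = flip N ν ⊕ unit a (+ 1) ⊕ unit b (+ 1)
        atA : flip N (ν ⊕ unit a -1ℤ) ≡ ζ ⊕ unit b -1ℤ
        atA = ≡.trans (flip-⊕-unit N ν a -1ℤ) (≡.sym (≡.trans (⊕-unit-+ (flip N ν ⊕ unit a (+ 1)) b (+ 1) -1ℤ) (⊕-unit-0 _ b)))
        atB : flip N (ν ⊕ unit b -1ℤ) ≡ ζ ⊕ unit a -1ℤ
        atB = ≡.trans (flip-⊕-unit N ν b -1ℤ) (≡.sym (≡.trans (⊕-swap (flip N ν ⊕ unit a (+ 1)) (unit b (+ 1)) (unit a -1ℤ))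
          (≡.cong (_⊕ unit b (+ 1)) (≡.trans (⊕-unit-+ (flip N ν) a (+ 1) -1ℤ) (⊕-unit-0 _ a)))))
        minus-1 : ∀ z → ι (z ℤ.+ -1ℤ) ≈ ι z + - 1#
        minus-1 z = trans (ι-+ z -1ℤ) (+-congˡ (trans (ι-neg (+ 1)) (-‿cong ι-1)))
        shiftedA : ι (lookup (ν ⊕ unit a -1ℤ) a) ≈ x + - 1#
        shiftedA = trans (reflexive (≡.cong ι (lookup-⊕-unit ν a -1ℤ))) (minus-1 (lookup ν a))
        shiftedB : ι (lookup (ν ⊕ unit b -1ℤ) b) ≈ y + - 1#
        shiftedB = trans (reflexive (≡.cong ι (lookup-⊕-unit ν b -1ℤ))) (minus-1 (lookup ν b))
        unshifted : ∀ a b → a ≢ b → ι (lookup (ν ⊕ unit a -1ℤ) b) ≈ ι (lookup ν b)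
        unshifted a b a≢b = reflexive (≡.cong ι (lookup-⊕-unit-≢ ν a b -1ℤ a≢b))
        raised : ∀ z → ι (N ℤ.- z ℤ.+ (+ 1)) ≈ (ι N + - ι z) + 1#
        raised z = trans (ι-+ (N ℤ.- z) (+ 1)) (+-cong (trans (ι-+ N (ℤ.- z)) (+-congˡ (ι-neg z))) ι-1)
        ζa : ι (lookup ζ a) ≈ (ι N + - x) + 1#
        ζa = trans (reflexive (≡.cong ι (≡.trans (lookup-⊕-unit-≢ (flip N ν ⊕ unit a (+ 1)) b a (+ 1) (a≢b ∘ ≡.sym))
          (≡.trans (lookup-⊕-unit (flip N ν) a (+ 1)) (≡.cong (ℤ._+ (+ 1)) (lookup-flip N ν a)))))) (raised (lookup ν a))
        ζb : ι (lookup ζ b) ≈ (ι N + - y) + 1#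
        ζb = trans (reflexive (≡.cong ι (≡.trans (lookup-⊕-unit (flip N ν ⊕ unit a (+ 1)) b (+ 1))
          (≡.cong (ℤ._+ (+ 1)) (≡.trans (lookup-⊕-unit-≢ (flip N ν) a b (+ 1) a≢b) (lookup-flip N ν b)))))) (raised (lookup ν b))
        final : (ι N + - ((x + - 1#) + y)) * A + - ((ι N + - (x + (y + - 1#))) * B) + - (((ι N + - x) + 1#) * A + - (((ι N + - y) + 1#) * B)) ≈ x * B + - (y * A)
        final = solve 6 (λ n x y A B o → (n :- ((x :- o) :+ y)) :* A :- (n :- (x :+ (y :- o))) :* B :- (((n :- x) :+ o) :* A :- ((n :- y) :+ o) :* B)
          := x :* B :- y :* A) refl (ι N) x y A B 1#
      eigenᶜ : ∀ ν → total ν ≡ n′ → (e + - (α * ι κ₁) + κ₂) * X (flip N ν) ≈ α * ι (quad ν) * X (flip N ν) + ∑off (λ a b → pairsᶜ a b ν)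
      eigenᶜ ν tν = begin
        (e + - (α * ι κ₁) + κ₂) * x
          ≈⟨ solve 4 (λ e a k x → (e :- a :+ k) :* x := e :* x :+ (k :- a) :* x) refl e (α * ι κ₁) κ₂ x ⟩
        e * x + (κ₂ + - (α * ι κ₁)) * x
          ≈⟨ +-congʳ (trans (eigen (flip N ν) tflip) (+-congʳ (*-congʳ (*-congˡ (trans (reflexive (≡.cong ι (≡.trans (quad-flip N ν) (≡.cong (λ t → quad ν ℤ.+ ((+ s) ℤ.* (N ℤ.* N ℤ.- N) ℤ.- ((N ℤ.- (+ 1)) ℤ.+ (N ℤ.- (+ 1))) ℤ.* t)) tν)))) (ι-+ (quad ν) κ₁)))))) ⟩
        (α * (ι (quad ν) + ι κ₁) * x + P) + (κ₂ + - (α * ι κ₁)) * x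
          ≈⟨ solve 6 (λ a q c x P k → (a :* (q :+ c) :* x :+ P) :+ (k :- a :* c) :* x := a :* q :* x :+ (P :+ x :* k)) refl α (ι (quad ν)) (ι κ₁) x P κ₂ ⟩
        α * ι (quad ν) * x + (P + x * κ₂)
          ≈⟨ +-congˡ (sym (trans (∑off-cong {z = λ a b → pairs a b (flip N ν) + x * k ν a b} (λ a b _ → +-congˡ (*-comm _ _)))
               (trans (∑off-+ (λ a b → pairs a b (flip N ν)) (λ a b → x * k ν a b)) (+-congˡ (trans (∑off-* x (k ν)) (*-congˡ (trans (∑off-linear N ν) κ≈))))))) ⟩
        α * ι (quad ν) * x + ∑off (λ a b → pairsᶜ a b ν) ∎
        where
        x = X (flip N ν)
        P = ∑off (λ a b → pairs a b (flip N ν))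
        tflip : total (flip N ν) ≡ n
        tflip = ≡.trans (total-flip N ν) (≡.trans (≡.cong (λ t → (+ s) ℤ.* N ℤ.- t) tν) (ℤS.solve 2 (λ c n → c ℤS.:- (c ℤS.:- n) ℤS.:= n) ≡.refl ((+ s) ℤ.* N) n))
        κ≈ : (ι (+ s) * ι (+ s) * ι N + - ι (+ 2) * ι (+ s) * ι (total ν)) + - (ι (+ s) * ι N + - ι (+ 2) * ι (total ν)) ≈ κ₂
        κ≈ = reflexive (≡.cong (λ t → (ι (+ s) * ι (+ s) * ι N + - ι (+ 2) * ι (+ s) * ι t) + - (ι (+ s) * ι N + - ι (+ 2) * ι t)) tν)

  module _ {X : Vec ℤ (suc s) → Carrier} {n e} (T : Eigentable X n e) (r : ℤ)
           (X-above : ∀ {ν} i → r ℤ.< lookup ν i → X ν ≈ 0#) where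
    open Eigentable T

    private
      r+0 : ∀ (ν : Vec ℤ s) a x → (r ∷ ν) ⊕ unit (suc a) x ≡ r ∷ (ν ⊕ unit a x)
      r+0 ν a x = ≡.cong (_∷ (ν ⊕ unit a x)) (ℤP.+-identityʳ r)

      raise : ∀ j → r ℤ.< r ℤ.+ (+ suc j)
      raise j = ≡.subst (ℤ._< r ℤ.+ (+ suc j)) (ℤP.+-identityʳ r) (ℤP.+-monoʳ-< r {0ℤ} {+ suc j} (ℤ.+<+ (ℕ.s≤s ℕ.z≤n)))

      n′ : ℤ
      n′ = n ℤ.- r

      suc≢ : ∀ {a b : Fin s} → a ≢ b → Fin.suc a ≢ suc b
      suc≢ a≢b ≡.refl = a≢b ≡.refl

      first : ∀ ν (b : Fin s) → pairs zero (suc b) (r ∷ ν) ≈ - (ι (lookup ν b) * X (r ∷ ν))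
      first ν b = pairs-slide pairTable (r ∷ ν) (λ ()) λ j → X-above zero (≡.subst (r ℤ.<_) (≡.sym (lookup-slideˡ zero (suc b) (r ∷ ν) (suc j) (λ ()))) (raise j))

      second : ∀ ν (a : Fin s) → pairs (suc a) zero (r ∷ ν) ≈ - (ι (lookup ν a) * X (r ∷ ν))
      second ν a = pairs-slide′ pairTable (r ∷ ν) (λ ()) λ j → X-above zero (≡.subst (r ℤ.<_) (≡.sym (lookup-slideˡ zero (suc a) (r ∷ ν) (suc j) (λ ()))) (raise j))

    -- The first entry `r` is the largest allowed, so sliding towards it leaves the support and each
    -- pair term with the first variable collapses to minus the other entry times `X`. Over both
    -- orders of the pair these add up to -2 n′ times `X`, and the first variable contributes r (r -
    -- 1) to `quad`; both go into the eigenvalue.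
    Eigentable-∷ : Eigentable (λ ν → X (r ∷ ν)) n′ (e + - (α * ι (r ℤ.* (r ℤ.- (+ 1)))) + ι (+ 2) * ι n′)
    Eigentable-∷ = record
      { pairTable = record
      { pairs = λ a b ν → pairs (suc a) (suc b) (r ∷ ν)
      ; relation = λ {a} {b} a≢b ν → ≡.subst₂ (λ p q → pairs (suc a) (suc b) p + - pairs (suc a) (suc b) q ≈ ι (lookup ν a) * X q + - (ι (lookup ν b) * X p))
          (r+0 ν a -1ℤ) (r+0 ν b -1ℤ) (relation (suc≢ a≢b) (r ∷ ν))
      ; pairs-negˡ = λ ν a≢b lt → pairs-negˡ (r ∷ ν) (suc≢ a≢b) lt
      ; pairs-negʳ = λ ν a≢b lt → pairs-negʳ (r ∷ ν) (suc≢ a≢b) lt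
      ; table-neg = λ { (negative i lt) → table-neg (negative (suc i) lt) } }
      ; eigen = eigen∷ }
      where
      eigen∷ : ∀ ν → total ν ≡ n′ → (e + - (α * ι (r ℤ.* (r ℤ.- (+ 1)))) + ι (+ 2) * ι n′) * X (r ∷ ν) ≈
        α * ι (quad ν) * X (r ∷ ν) + ∑off (λ a b → pairs (suc a) (suc b) (r ∷ ν))
      eigen∷ ν tν = begin
        (e + - (α * ρ) + ι (+ 2) * ι n′) * x
          ≈⟨ solve 4 (λ e a k x → (e :- a :+ k) :* x := e :* x :+ (k :- a) :* x) refl e (α * ρ) (ι (+ 2) * ι n′) x ⟩
        e * x + (ι (+ 2) * ι n′ + - (α * ρ)) * x
          ≈⟨ +-congʳ (trans (eigen (r ∷ ν) (≡.trans (≡.cong (λ t → r ℤ.+ t) tν) (ℤS.solve 2 (λ r n → r ℤS.:+ (n ℤS.:- r) ℤS.:= n) ≡.refl r n)))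
               (+-cong (*-congʳ (*-congˡ (ι-+ (r ℤ.* (r ℤ.- (+ 1))) (quad ν)))) split)) ⟩
        (α * (ρ + ι (quad ν)) * x + (- (ι n′ * x) + (- (ι n′ * x) + P))) + (ι (+ 2) * ι n′ + - (α * ρ)) * x
          ≈⟨ solve 6 (λ a r q x m P → (a :* (r :+ q) :* x :+ (:- (m :* x) :+ (:- (m :* x) :+ P))) :+ (con (+ 2) :* m :- a :* r) :* x := a :* q :* x :+ P) refl α ρ (ι (quad ν)) x (ι n′) P ⟩
        α * ι (quad ν) * x + P ∎
        where
        ρ = ι (r ℤ.* (r ℤ.- (+ 1)))
        x = X (r ∷ ν)
        P = ∑off (λ a b → pairs (suc a) (suc b) (r ∷ ν))
        minus : sum (λ b → - (ι (lookup ν b) * x)) ≈ - (ι n′ * x)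
        minus = trans (sum-neg (λ b → ι (lookup ν b) * x)) (-‿cong (trans (sum-cong {s} λ b → *-comm (ι (lookup ν b)) x) (trans (sum-* x (λ b → ι (lookup ν b))) (trans (*-congˡ (trans (sum-lookup ν) (reflexive (≡.cong ι tν)))) (*-comm x _)))))
        split : ∑off (λ a b → pairs a b (r ∷ ν)) ≈ - (ι n′ * x) + (- (ι n′ * x) + P)
        split = +-cong
          (trans (+-identityˡ _) (trans (sum-cong λ b → first ν b) minus))
          (trans (sum-+ (λ a → pairs (suc a) zero (r ∷ ν)) (λ a → sum (λ b → off a b (pairs (suc a) (suc b) (r ∷ ν))))) (+-congʳ (trans (sum-cong λ a → second ν a) minus)))

  -- Newton's identity and equality of symmetric functions

  -- The same tables indexed by lists, where symmetry in the variables is easiest to state.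
  shifts : ℤ → List ℤ → Lin (List ℤ)
  shifts x [] = []
  shifts x (z ∷ ν) = (1# , z ℤ.+ x ∷ ν) ∷ mapL (z ∷_) (shifts x ν)

  ML : Mono → List ℤ → Carrier
  ML [] [] = 1#
  ML [] (z ∷ ν) = δ₀ z * ML [] ν
  ML (m ∷ μ) ν = ev (ML μ) (shifts (ℤ.- part m) ν)

  sum-shifts : ∀ (G : List ℤ → Carrier) x (ν : Vec ℤ s) → sum (λ i → G (toList (ν ⊕ unit i x))) ≈ ev G (shifts x (toList ν))
  sum-shifts G x [] = refl
  sum-shifts {suc s} G x (z ∷ ν) = +-cong
    (trans (reflexive (≡.cong (λ ξ → G (z ℤ.+ x ∷ toList ξ)) (⊕-identityʳ ν))) (sym (*-identityˡ _)))
    (trans (sum-cong {s} λ i → reflexive (≡.cong (λ y → G (y ∷ toList (ν ⊕ unit i x))) (ℤP.+-identityʳ z)))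
      (trans (sum-shifts (λ ξ → G (z ∷ ξ)) x ν) (sym (ev-map G (z ∷_) (shifts x (toList ν))))))

  M-toList : ∀ μ (ν : Vec ℤ s) → M μ ν ≈ ML μ (toList ν)
  M-toList [] [] = refl
  M-toList [] (z ∷ ν) = *-congˡ (M-toList [] ν)
  M-toList {s} (m ∷ μ) ν = trans (sum-cong {s} λ i → M-toList μ (ν ⊕ unit i (ℤ.- part m))) (sum-shifts (ML μ) (ℤ.- part m) ν)

  shifts-↭ : ∀ (G : List ℤ → Carrier) → (∀ {ν ξ} → ν ↭ ξ → G ν ≈ G ξ) → ∀ x {ν ξ} → ν ↭ ξ → ev G (shifts x ν) ≈ ev G (shifts x ξ)
  shifts-↭ G inv x ↭.refl = refl
  shifts-↭ G inv x (↭.prep {ν} {ξ} z p) = +-cong (*-congˡ (inv (↭.prep _ p)))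
    (trans (ev-map G (z ∷_) (shifts x ν)) (trans (shifts-↭ (G ∘ (z ∷_)) (inv ∘ ↭.prep z) x p) (sym (ev-map G (z ∷_) (shifts x ξ)))))
  shifts-↭ G inv x (↭.swap {ν} {ξ} y z p) = begin
    1# * G (y ℤ.+ x ∷ z ∷ ν) + (1# * G (y ∷ z ℤ.+ x ∷ ν) + ev G (mapL (y ∷_) (mapL (z ∷_) (shifts x ν))))
      ≈⟨ +-cong (*-congˡ (inv (↭.swap _ _ p))) (+-cong (*-congˡ (inv (↭.swap _ _ p))) rest) ⟩
    1# * G (z ∷ y ℤ.+ x ∷ ξ) + (1# * G (z ℤ.+ x ∷ y ∷ ξ) + ev G (mapL (z ∷_) (mapL (y ∷_) (shifts x ξ))))
      ≈⟨ solve 3 (λ a b c → a :+ (b :+ c) := b :+ (a :+ c)) refl _ _ _ ⟩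
    1# * G (z ℤ.+ x ∷ y ∷ ξ) + (1# * G (z ∷ y ℤ.+ x ∷ ξ) + ev G (mapL (z ∷_) (mapL (y ∷_) (shifts x ξ)))) ∎
    where
    rest : ev G (mapL (y ∷_) (mapL (z ∷_) (shifts x ν))) ≈ ev G (mapL (z ∷_) (mapL (y ∷_) (shifts x ξ)))
    rest = trans (trans (ev-map G (y ∷_) (mapL (z ∷_) (shifts x ν))) (ev-map (G ∘ (y ∷_)) (z ∷_) (shifts x ν)))
      (trans (ev-cong (λ ζ → inv (↭.swap y z ↭.refl)) (shifts x ν))
      (trans (shifts-↭ (λ ζ → G (z ∷ y ∷ ζ)) (λ q → inv (↭.prep z (↭.prep y q))) x p)
      (sym (trans (ev-map G (z ∷_) (mapL (y ∷_) (shifts x ξ))) (ev-map (G ∘ (z ∷_)) (y ∷_) (shifts x ξ))))))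
  shifts-↭ G inv x (↭.trans p q) = trans (shifts-↭ G inv x p) (shifts-↭ G inv x q)

  ML-↭ : ∀ μ {ν ξ} → ν ↭ ξ → ML μ ν ≈ ML μ ξ
  ML-↭ [] ↭.refl = refl
  ML-↭ [] (↭.prep z p) = *-congˡ (ML-↭ [] p)
  ML-↭ [] (↭.swap y z p) = trans (*-congˡ (*-congˡ (ML-↭ [] p))) (solve 3 (λ a b c → a :* (b :* c) := b :* (a :* c)) refl _ _ _)
  ML-↭ [] (↭.trans p q) = trans (ML-↭ [] p) (ML-↭ [] q)
  ML-↭ (m ∷ μ) p = shifts-↭ (ML μ) (ML-↭ μ) (ℤ.- part m) p

  M-↭ : ∀ μ {ν : Vec ℤ s} {ξ : Vec ℤ t} → toList ν ↭ toList ξ → M μ ν ≈ M μ ξ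
  M-↭ μ {ν} {ξ} p = trans (M-toList μ ν) (trans (ML-↭ μ p) (sym (M-toList μ ξ)))

  coeff : Λ → Vec ℤ s → Carrier
  coeff f ν = ev (λ x → M x ν) f

  coeff-↭ : ∀ f {ν : Vec ℤ s} {ξ : Vec ℤ t} → toList ν ↭ toList ξ → coeff f ν ≈ coeff f ξ
  coeff-↭ f p = ev-cong (λ x → M-↭ x p) f

  coeff-neg : ∀ f {ν : Vec ℤ s} → Negative ν → coeff f ν ≈ 0#
  coeff-neg f neg = ev-zero (λ x → M-neg x neg) f

  ⟦_⟧≉0 : ∀ n → ¬ (⟦ n ⟧ ≈ 0#)
  ⟦ n ⟧≉0 e = α-free (+ suc n) 0ℤ (λ ()) (trans (+-identityʳ _) (trans (*-congʳ e) (zeroˡ α)))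

  *-cancelˡ : ∀ {c x y} → ¬ (c ≈ 0#) → c * x ≈ c * y → x ≈ y
  *-cancelˡ {c} {x} {y} c≉0 e = x∙y⁻¹≈ε⇒x≈y x y (cancel-nonzero c≉0
    (trans (solve 3 (λ c x y → c :* (x :- y) := c :* x :- c :* y) refl c x y) (x≈y⇒x∙y⁻¹≈ε e)))

  α≉0 : ¬ (α ≈ 0#)
  α≉0 e = α-free (+ 1) 0ℤ (λ ()) (trans (+-identityʳ _) (trans (*-congˡ e) (zeroʳ _)))

  *-nonzero : ∀ {x y} → ¬ (x ≈ 0#) → ¬ (y ≈ 0#) → ¬ (x * y ≈ 0#)
  *-nonzero x≉0 y≉0 e = y≉0 (cancel-nonzero x≉0 e)

  sumTo : ℕ → (ℕ → Carrier) → Carrier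
  sumTo zero f = 0#
  sumTo (suc n) f = sumTo n f + f n

  sumTo-cong : ∀ n {f g : ℕ → Carrier} → (∀ i → i ℕ.< n → f i ≈ g i) → sumTo n f ≈ sumTo n g
  sumTo-cong zero e = refl
  sumTo-cong (suc n) e = +-cong (sumTo-cong n λ i lt → e i (ℕP.m<n⇒m<1+n lt)) (e n ℕP.≤-refl)

  sumTo-0 : ∀ n → sumTo n (λ _ → 0#) ≈ 0#
  sumTo-0 zero = refl
  sumTo-0 (suc n) = trans (+-identityʳ _) (sumTo-0 n)

  sumTo-+ : ∀ n (f g : ℕ → Carrier) → sumTo n (λ i → f i + g i) ≈ sumTo n f + sumTo n g
  sumTo-+ zero f g = sym (+-identityʳ 0#)
  sumTo-+ (suc n) f g = trans (+-congʳ (sumTo-+ n f g)) (solve 4 (λ x y p q → (x :+ y) :+ (p :+ q) := (x :+ p) :+ (y :+ q)) refl (sumTo n f) (sumTo n g) (f n) (g n))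

  sumTo-sum : ∀ n (f : ℕ → Fin s → Carrier) → sumTo n (λ i → sum (f i)) ≈ sum (λ j → sumTo n (λ i → f i j))
  sumTo-sum {s} zero f = sym (sum-0 s)
  sumTo-sum (suc n) f = trans (+-congʳ (sumTo-sum n f)) (sym (sum-+ (λ j → sumTo n (λ i → f i j)) (f n)))

  δ-refl : ∀ n → δ n n ≈ 1#
  δ-refl zero = refl
  δ-refl (suc n) = δ-refl n

  δ-≢ : ∀ {m n} → m ≢ n → δ m n ≈ 0#
  δ-≢ {zero} {zero} ne = ⊥-elim (ne ≡.refl)
  δ-≢ {zero} {suc n} ne = refl
  δ-≢ {suc m} {zero} ne = refl
  δ-≢ {suc m} {suc n} ne = δ-≢ (ne ∘ ≡.cong suc)

  sumTo-δ-out : ∀ n (g : ℕ → Carrier) {m} → n ℕ.≤ m → sumTo n (λ i → δ i m * g i) ≈ 0#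
  sumTo-δ-out n g n≤m = trans (sumTo-cong n λ i lt → trans (*-congʳ (δ-≢ (ℕP.<⇒≢ (ℕP.<-≤-trans lt n≤m)))) (zeroˡ _)) (sumTo-0 n)

  sumTo-δ : ∀ n (g : ℕ → Carrier) {m} → m ℕ.< n → sumTo n (λ i → δ i m * g i) ≈ g m
  sumTo-δ (suc n) g {m} lt with m ℕ.≟ n
  ... | yes ≡.refl = trans (+-cong (sumTo-δ-out n g ℕP.≤-refl) (trans (*-congʳ (δ-refl n)) (*-identityˡ _))) (+-identityˡ _)
  ... | no ne = trans (+-cong (sumTo-δ n g (ℕP.≤∧≢⇒< (ℕ.s≤s⁻¹ lt) ne)) (trans (*-congʳ (δ-≢ (ne ∘ ≡.sym))) (zeroˡ _))) (+-identityʳ _)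

  -- Newton's identity k h_k = Σ pᵢ h_{k-i}, in adjoint form.
  newton : ∀ n μ k (ν : Vec ℤ s) → k ℤ.≤ + n →
    sumTo n (λ i → ⟦ i ⟧ * ev (λ x → M x (k ℤ.- part i ∷ ν)) (∂ i μ)) ≈ ι k * M μ (k ∷ ν)
  newton n [] k ν le = trans (trans (sumTo-cong n λ i _ → zeroʳ _) (sumTo-0 n))
    (sym (trans (*-comm _ _) (M-[]-lookup (k ∷ ν) zero)))
  newton {s} n (m ∷ μ) k ν le = begin
    sumTo n (λ i → ⟦ i ⟧ * ev (λ x → M x (k ℤ.- part i ∷ ν)) (∂ i (m ∷ μ)))
      ≈⟨ sumTo-cong n (λ i _ → each i) ⟩
    sumTo n (λ i → δ i m * (⟦ i ⟧ * M μ (k ℤ.- part i ∷ ν)) + (P i + sum (Q i)))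
      ≈⟨ trans (sumTo-+ n _ (λ i → P i + sum (Q i))) (+-congˡ (trans (sumTo-+ n P (λ i → sum (Q i))) (+-congˡ (sumTo-sum n Q)))) ⟩
    sumTo n (λ i → δ i m * (⟦ i ⟧ * M μ (k ℤ.- part i ∷ ν))) + (sumTo n P + sum (λ j → sumTo n (λ i → Q i j)))
      ≈⟨ +-cong delta (+-cong (newton n μ (k ℤ.- part m) ν below) (trans (sum-cong {s} λ j → newton n μ k (ν ⊕ unit j (ℤ.- part m)) le) (sum-* (ι k) (λ j → M μ (k ∷ ν ⊕ unit j (ℤ.- part m)))))) ⟩
    ⟦ m ⟧ * x + (ι (k ℤ.- part m) * x + ι k * y)
      ≈⟨ +-congˡ (+-congʳ (*-congʳ (trans (ι-+ k (ℤ.- part m)) (+-congˡ (ι-neg (part m)))))) ⟩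
    ⟦ m ⟧ * x + ((ι k + - ⟦ m ⟧) * x + ι k * y)
      ≈⟨ solve 4 (λ m k x y → m :* x :+ ((k :- m) :* x :+ k :* y) := k :* (x :+ y)) refl ⟦ m ⟧ (ι k) x y ⟩
    ι k * (x + y)
      ≈⟨ *-congˡ (M-∷ μ m ν k) ⟨
    ι k * M (m ∷ μ) (k ∷ ν) ∎
    where
    x = M μ (k ℤ.- part m ∷ ν)
    y = sum (λ j → M μ (k ∷ ν ⊕ unit j (ℤ.- part m)))
    P : ℕ → Carrier
    P i = ⟦ i ⟧ * ev (λ x → M x (k ℤ.- part m ℤ.- part i ∷ ν)) (∂ i μ)
    Q : ℕ → Fin s → Carrier
    Q i j = ⟦ i ⟧ * ev (λ x → M x (k ℤ.- part i ∷ ν ⊕ unit j (ℤ.- part m))) (∂ i μ)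
    below : k ℤ.- part m ℤ.≤ + n
    below = ℤP.≤-trans (≡.subst (k ℤ.- part m ℤ.≤_) (ℤP.+-identityʳ k) (ℤP.+-monoʳ-≤ k {ℤ.- part m} {0ℤ} ℤ.-≤+)) le
    delta : sumTo n (λ i → δ i m * (⟦ i ⟧ * M μ (k ℤ.- part i ∷ ν))) ≈ ⟦ m ⟧ * x
    delta with m ℕ.<? n
    ... | yes lt = sumTo-δ n (λ i → ⟦ i ⟧ * M μ (k ℤ.- part i ∷ ν)) lt
    ... | no nlt = trans (sumTo-δ-out n (λ i → ⟦ i ⟧ * M μ (k ℤ.- part i ∷ ν)) (ℕP.≮⇒≥ nlt))
      (sym (trans (*-congˡ (M-neg μ {k ℤ.- part m ∷ ν} (negative zero (ℤP.≤-<-trans (ℤP.+-monoˡ-≤ (ℤ.- part m) (ℤP.≤-trans le (ℤ.+≤+ (ℕP.≮⇒≥ nlt)))) (≡.subst (ℤ._< 0ℤ) (≡.sym (ℤP.m-n≡m⊖n m (suc m))) (minus m)))))) (zeroʳ _)))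
      where
      minus : ∀ m → m ℤ.⊖ suc m ℤ.< 0ℤ
      minus zero = ℤ.-<+
      minus (suc m) = ≡.subst (ℤ._< 0ℤ) (≡.sym (ℤP.[1+m]⊖[1+n]≡m⊖n m (suc m))) (minus m)
    each : ∀ i → ⟦ i ⟧ * ev (λ x → M x (k ℤ.- part i ∷ ν)) (∂ i (m ∷ μ)) ≈ δ i m * (⟦ i ⟧ * M μ (k ℤ.- part i ∷ ν)) + (P i + sum (Q i))
    each i = begin
      ⟦ i ⟧ * ev (λ x → M x (k ℤ.- part i ∷ ν)) (∂ i (m ∷ μ))
        ≈⟨ *-congˡ (trans (ev-∂ _ i m μ) (+-congˡ (trans (ev-cong (λ x → trans (M-∷ x m ν (k ℤ.- part i)) (+-congʳ (M-cong x (≡.cong (_∷ ν) (commute i))))) (∂ i μ))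
             (trans (ev-+ _ _ (∂ i μ)) (+-congˡ (ev-sum (λ j x → M x (k ℤ.- part i ∷ ν ⊕ unit j (ℤ.- part m))) (∂ i μ))))))) ⟩
      ⟦ i ⟧ * (δ i m * M μ (k ℤ.- part i ∷ ν) + (p + sum q))
        ≈⟨ solve 5 (λ I d x p q → I :* (d :* x :+ (p :+ q)) := d :* (I :* x) :+ (I :* p :+ I :* q)) refl _ _ _ _ _ ⟩
      δ i m * (⟦ i ⟧ * M μ (k ℤ.- part i ∷ ν)) + (P i + ⟦ i ⟧ * sum q)
        ≈⟨ +-congˡ (+-congˡ (sym (sum-* ⟦ i ⟧ q))) ⟩
      δ i m * (⟦ i ⟧ * M μ (k ℤ.- part i ∷ ν)) + (P i + sum (Q i)) ∎
      where
      p = ev (λ x → M x (k ℤ.- part m ℤ.- part i ∷ ν)) (∂ i μ)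
      q : Fin s → Carrier
      q j = ev (λ x → M x (k ℤ.- part i ∷ ν ⊕ unit j (ℤ.- part m))) (∂ i μ)
      commute : ∀ i → k ℤ.- part i ℤ.- part m ≡ k ℤ.- part m ℤ.- part i
      commute i = ℤS.solve 3 (λ k i m → k ℤS.:- i ℤS.:- m ℤS.:= k ℤS.:- m ℤS.:- i) ≡.refl k (part i) (part m)

  ∂Λ : ℕ → Λ → Λ
  ∂Λ n f = f >>= ∂ n

  ev-sumTo : ∀ {A : Set} n (φ : ℕ → A → Carrier) f → ev (λ a → sumTo n (λ i → φ i a)) f ≈ sumTo n (λ i → ev (φ i) f)
  ev-sumTo zero φ f = ev-0 f
  ev-sumTo (suc n) φ f = trans (ev-+ _ _ f) (+-congʳ (ev-sumTo n φ f))

  newtonΛ : ∀ n f (ν : Vec ℤ s) →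
    sumTo (suc n) (λ i → ⟦ i ⟧ * coeff (∂Λ i f) (part n ℤ.- part i ∷ ν)) ≈ ⟦ n ⟧ * coeff f (part n ∷ ν)
  newtonΛ n f ν = begin
    sumTo (suc n) (λ i → ⟦ i ⟧ * coeff (∂Λ i f) (part n ℤ.- part i ∷ ν))
      ≈⟨ sumTo-cong (suc n) (λ i _ → trans (*-congˡ (ev->>= _ f (∂ i))) (sym (ev-* ⟦ i ⟧ (λ y → ev (λ x → M x (part n ℤ.- part i ∷ ν)) (∂ i y)) f))) ⟩
    sumTo (suc n) (λ i → ev (λ y → ⟦ i ⟧ * ev (λ x → M x (part n ℤ.- part i ∷ ν)) (∂ i y)) f)
      ≈⟨ ev-sumTo (suc n) (λ i y → ⟦ i ⟧ * ev (λ x → M x (part n ℤ.- part i ∷ ν)) (∂ i y)) f ⟨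
    ev (λ y → sumTo (suc n) (λ i → ⟦ i ⟧ * ev (λ x → M x (part n ℤ.- part i ∷ ν)) (∂ i y))) f
      ≈⟨ ev-cong (λ y → newton (suc n) y (part n) ν ℤP.≤-refl) f ⟩
    ev (λ y → ⟦ n ⟧ * M y (part n ∷ ν)) f
      ≈⟨ ev-* ⟦ n ⟧ _ f ⟩
    ⟦ n ⟧ * coeff f (part n ∷ ν) ∎

  -- By Newton's identity the coefficients of ∂f are determined by those of f, variable by variable.
  module Transfer (S : ∀ {s t} → Vec ℤ s → Vec ℤ t → Set)
                  (S-∷ : ∀ {s t} {ν : Vec ℤ s} {ξ : Vec ℤ t} k → S ν ξ → S (k ∷ ν) (k ∷ ξ)) where

    Agree : Λ → Λ → Set
    Agree f g = ∀ {s t} (ν : Vec ℤ s) (ξ : Vec ℤ t) → S ν ξ → coeff f ν ≈ coeff g ξ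

    -- In Newton's identity for an extra variable with exponent n + 1, the last summand has exponent
    -- 0 in that variable and is the wanted coefficient of the derivative. The other summands
    -- involve derivatives of smaller index, known by strong induction.
    Agree-∂ : ∀ {f g} n → Agree f g → Agree (∂Λ n f) (∂Λ n g)
    Agree-∂ {f} {g} n a = go n (<-wellFounded n)
      where
      go : ∀ n → Acc ℕ._<_ n → Agree (∂Λ n f) (∂Λ n g)
      go n (acc rec) {s} {t} ν ξ sνξ = *-cancelˡ ⟦ n ⟧≉0 (begin
        ⟦ n ⟧ * coeff (∂Λ n f) ν
          ≈⟨ top f ν ⟩
        ⟦ n ⟧ * coeff f (part n ∷ ν) + - sumTo n (λ i → ⟦ i ⟧ * coeff (∂Λ i f) (part n ℤ.- part i ∷ ν))
          ≈⟨ +-cong (*-congˡ (a _ _ (S-∷ (part n) sνξ))) (-‿cong (sumTo-cong n λ i lt → *-congˡ (go i (rec lt) _ _ (S-∷ (part n ℤ.- part i) sνξ)))) ⟩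
        ⟦ n ⟧ * coeff g (part n ∷ ξ) + - sumTo n (λ i → ⟦ i ⟧ * coeff (∂Λ i g) (part n ℤ.- part i ∷ ξ))
          ≈⟨ top g ξ ⟨
        ⟦ n ⟧ * coeff (∂Λ n g) ξ ∎)
        where
        top : ∀ {s} h (ν : Vec ℤ s) → ⟦ n ⟧ * coeff (∂Λ n h) ν ≈ ⟦ n ⟧ * coeff h (part n ∷ ν) + - sumTo n (λ i → ⟦ i ⟧ * coeff (∂Λ i h) (part n ℤ.- part i ∷ ν))
        top h ν = begin
          ⟦ n ⟧ * coeff (∂Λ n h) ν
            ≈⟨ *-congˡ (ev-cong (λ x → trans (sym (M-0∷ x ν)) (M-cong x (≡.cong (_∷ ν) (≡.sym (ℤP.+-inverseʳ (part n)))))) (∂Λ n h)) ⟩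
          ⟦ n ⟧ * coeff (∂Λ n h) (part n ℤ.- part n ∷ ν)
            ≈⟨ solve 2 (λ x y → x := (y :+ x) :- y) refl _ (sumTo n (λ i → ⟦ i ⟧ * coeff (∂Λ i h) (part n ℤ.- part i ∷ ν))) ⟩
          sumTo (suc n) (λ i → ⟦ i ⟧ * coeff (∂Λ i h) (part n ℤ.- part i ∷ ν)) + - sumTo n (λ i → ⟦ i ⟧ * coeff (∂Λ i h) (part n ℤ.- part i ∷ ν))
            ≈⟨ +-congʳ (newtonΛ n h ν) ⟩
          ⟦ n ⟧ * coeff h (part n ∷ ν) + - sumTo n (λ i → ⟦ i ⟧ * coeff (∂Λ i h) (part n ℤ.- part i ∷ ν)) ∎

    coeff-star : ∀ m μ f {s} (ν : Vec ℤ s) → coeff (f >>= star (m ∷ μ)) ν ≈ ⟦ m ⟧ * α * coeff (∂Λ m f >>= star μ) ν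
    coeff-star m μ f ν = begin
      coeff (f >>= star (m ∷ μ)) ν
        ≈⟨ trans (ev->>= _ f (star (m ∷ μ))) (ev-cong (λ x → trans (ev-⋆ _ _ (∂ m x >>= star μ)) (*-congˡ (ev->>= _ (∂ m x) (star μ)))) f) ⟩
      ev (λ x → ⟦ m ⟧ * α * ev (λ y → coeff (star μ y) ν) (∂ m x)) f
        ≈⟨ ev-* _ _ f ⟩
      ⟦ m ⟧ * α * ev (λ x → ev (λ y → coeff (star μ y) ν) (∂ m x)) f
        ≈⟨ *-congˡ (sym (trans (ev->>= _ (∂Λ m f) (star μ)) (ev->>= _ f (∂ m)))) ⟩
      ⟦ m ⟧ * α * coeff (∂Λ m f >>= star μ) ν ∎

    Agree-star : ∀ μ {f g} → Agree f g → Agree (f >>= star μ) (g >>= star μ)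
    Agree-star [] {f} {g} a ν ξ sνξ = trans (trans (ev->>= _ f single) (ev-cong (λ x → ev-single (λ y → M y ν) x) f))
      (trans (a ν ξ sνξ) (sym (trans (ev->>= _ g single) (ev-cong (λ x → ev-single (λ y → M y ξ) x) g))))
    Agree-star (m ∷ μ) {f} {g} a ν ξ sνξ = trans (coeff-star m μ f ν)
      (trans (*-congˡ (Agree-star μ {∂Λ m f} {∂Λ m g} (Agree-∂ {f} {g} m a) ν ξ sνξ)) (sym (coeff-star m μ g ξ)))

  infix 4 _≃_
  record _≃_ (f g : Λ) : Set where
    constructor mk≃
    field same : ∀ {s} (ν : Vec ℤ s) → coeff f ν ≈ coeff g ν
  open _≃_ public

  -- `Transfer` relates vectors whose lengths need not agree, so equality goes through lists.
  record SameVec {s t} (ν : Vec ℤ s) (ξ : Vec ℤ t) : Set where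
    constructor same-list
    field lists : toList ν ≡ toList ξ

  module Tr≡ = Transfer SameVec (λ k e → same-list (≡.cong (k ∷_) (SameVec.lists e)))

  ≃⇒Agree : ∀ {f g} → f ≃ g → Tr≡.Agree f g
  ≃⇒Agree {f} {g} e ν ξ p = trans (same e ν) (coeff-↭ g (↭.↭-reflexive (SameVec.lists p)))

  Agree⇒≃ : ∀ {f g} → Tr≡.Agree f g → f ≃ g
  Agree⇒≃ a = mk≃ λ ν → a ν ν (same-list ≡.refl)

  -- The scalar product is defined on power-sum expansions, whereas functions are compared by their
  -- coefficients. Pairing with a power-sum product amounts to iterated derivatives followed by the
  -- coefficient in zero variables, and derivatives respect `_≃_`.
  pair-≃ : ∀ κ {f g} → f ≃ g → ev (pair κ) f ≈ ev (pair κ) g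
  pair-≃ [] {f} {g} e = trans (ev-cong constant f) (trans (same e []) (sym (ev-cong constant g)))
    where
    constant : ∀ x → pair [] x ≈ M x []
    constant [] = refl
    constant (n ∷ x) = refl
  pair-≃ (m ∷ κ) {f} {g} e = trans (ev-* _ _ f) (trans (*-congˡ (trans (sym (ev->>= (pair κ) f (∂ m)))
    (trans (pair-≃ κ (Agree⇒≃ {∂Λ m f} {∂Λ m g} (Tr≡.Agree-∂ {f} {g} m (≃⇒Agree e)))) (ev->>= (pair κ) g (∂ m))))) (sym (ev-* _ _ g)))

  -- A formal sum is determined by coordinates dual to its generators. Two instances are used:
  -- exponent vectors, with coordinates read by `M []`, and partitions, with coordinates given by
  -- normalised pairings of Jack functions.
  module FormalSums {A : Set} (Ok : A → Set) (_≟_ : DecidableEquality A) (d : A → A → Carrier)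
                    (d-refl : ∀ a → Ok a → d a a ≈ 1#) (d-≢ : ∀ a b → Ok a → Ok b → a ≢ b → d a b ≈ 0#) where

    remove : A → Lin A → Lin A
    remove a [] = []
    remove a ((c , b) ∷ f) with a ≟ b
    ... | yes _ = remove a f
    ... | no _ = (c , b) ∷ remove a f

    remove-length : ∀ a f → length (remove a f) ℕ.≤ length f
    remove-length a [] = ℕ.z≤n
    remove-length a ((c , b) ∷ f) with a ≟ b
    ... | yes _ = ℕP.m≤n⇒m≤1+n (remove-length a f)
    ... | no _ = ℕ.s≤s (remove-length a f)

    AllOk : Lin A → Set
    AllOk = All (λ t → Ok (proj₂ t))

    remove-ok : ∀ a {f} → AllOk f → AllOk (remove a f)
    remove-ok a [] = []
    remove-ok a {(c , b) ∷ f} (o ∷ os) with a ≟ b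
    ... | yes _ = remove-ok a os
    ... | no _ = o ∷ remove-ok a os

    remove-ev : ∀ φ {a} → Ok a → ∀ f → AllOk f → ev φ f ≈ ev (d a) f * φ a + ev φ (remove a f)
    remove-ev φ oa [] _ = sym (trans (+-identityʳ _) (zeroˡ _))
    remove-ev φ {a} oa ((c , b) ∷ f) (ob ∷ os) with a ≟ b
    ... | yes ≡.refl = trans (+-congˡ (remove-ev φ oa f os)) (trans
      (solve 4 (λ c p e r → c :* p :+ (e :* p :+ r) := (c :+ e) :* p :+ r) refl _ _ _ _)
      (+-congʳ (*-congʳ (+-congʳ (trans (sym (*-identityʳ c)) (*-congˡ (sym (d-refl _ oa))))))))
    ... | no ne = trans (+-congˡ (remove-ev φ oa f os)) (trans
      (solve 5 (λ c q p e r → c :* q :+ (e :* p :+ r) := e :* p :+ (c :* q :+ r)) refl c (φ b) (φ a) (ev (d a) f) (ev φ (remove a f)))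
      (+-congʳ (*-congʳ (sym (trans (+-congʳ (trans (*-congˡ (d-≢ _ _ oa ob ne)) (zeroʳ c))) (+-identityˡ _))))))

    remove-head : ∀ c a f → remove a ((c , a) ∷ f) ≡ remove a f
    remove-head c a f with a ≟ a
    ... | yes _ = ≡.refl
    ... | no ne = ⊥-elim (ne ≡.refl)

    -- All occurrences of the first generator are removed at once: their joint coefficient is a
    -- coordinate, hence zero, and the shorter rest has the same coordinates.
    ev-vanish : ∀ f → AllOk f → (∀ a → Ok a → ev (d a) f ≈ 0#) → ∀ φ → ev φ f ≈ 0#
    ev-vanish f os h φ = go (length f) f ℕP.≤-refl os h
      where
      go : ∀ n f → length f ℕ.≤ n → AllOk f → (∀ a → Ok a → ev (d a) f ≈ 0#) → ev φ f ≈ 0#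
      go n [] le _ h = refl
      go (suc n) ((c , a) ∷ f) le (oa ∷ os) h = trans (remove-ev φ oa ((c , a) ∷ f) (oa ∷ os)) (trans (+-cong (trans (*-congʳ (h a oa)) (zeroˡ _))
        (trans (reflexive (≡.cong (ev φ) (remove-head c a f)))
          (go n (remove a f) (ℕP.≤-trans (remove-length a f) (ℕ.s≤s⁻¹ le)) (remove-ok a os) (λ b ob → trans (sym (reflexive (≡.cong (ev (d b)) (remove-head c a f)))) (rest b ob))))) (+-identityʳ 0#))
        where
        rest : ∀ b → Ok b → ev (d b) (remove a ((c , a) ∷ f)) ≈ 0#
        rest b ob = begin
          ev (d b) (remove a ((c , a) ∷ f))                                      ≈⟨ +-identityˡ _ ⟨
          0# + ev (d b) (remove a ((c , a) ∷ f))                                 ≈⟨ +-congʳ (trans (*-congʳ (h a oa)) (zeroˡ _)) ⟨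
          ev (d a) ((c , a) ∷ f) * d b a + ev (d b) (remove a ((c , a) ∷ f))     ≈⟨ remove-ev (d b) oa ((c , a) ∷ f) (oa ∷ os) ⟨
          ev (d b) ((c , a) ∷ f)                                                 ≈⟨ h b ob ⟩
          0#                                                                     ∎

    ev-agree : ∀ f g → AllOk f → AllOk g → (∀ a → Ok a → ev (d a) f ≈ ev (d a) g) → ∀ φ → ev φ f ≈ ev φ g
    ev-agree f g of og h φ = x∙y⁻¹≈ε⇒x≈y _ _ (trans (sym (difference φ))
        (ev-vanish (f ++ (- 1#) ⋆ g) (AllP.++⁺ of (AllP.map⁺ og)) (λ a oa → trans (difference (d a)) (x≈y⇒x∙y⁻¹≈ε (h a oa))) φ))
      where
      difference : ∀ φ → ev φ (f ++ (- 1#) ⋆ g) ≈ ev φ f + - ev φ g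
      difference φ = trans (ev-++ φ f _) (+-congˡ (trans (ev-⋆ φ (- 1#) g) (trans (sym (-‿distribˡ-* 1# _)) (-‿cong (*-identityˡ _)))))

  -- Products and their expansion into monomials

  infixl 7 _⊛_
  _⊛_ : Λ → Λ → Λ
  f ⊛ g = f >>= λ μ → mapL (μ ++_) g

  ev-⊛ : ∀ φ f g → ev φ (f ⊛ g) ≈ ev (λ μ → ev (λ κ → φ (μ ++ κ)) g) f
  ev-⊛ φ f g = trans (ev->>= φ f _) (ev-cong (λ μ → ev-map φ (μ ++_) g) f)

  concatL : {A : Set} {n : ℕ} → (Fin n → Lin A) → Lin A
  concatL {n = zero} f = []
  concatL {n = suc n} f = f zero ++ concatL (f ∘ suc)

  ev-concatL : {A : Set} (φ : A → Carrier) {n : ℕ} (f : Fin n → Lin A) → ev φ (concatL f) ≈ sum (λ i → ev φ (f i))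
  ev-concatL φ {zero} f = refl
  ev-concatL φ {suc n} f = trans (ev-++ φ (f zero) _) (+-congˡ (ev-concatL φ (f ∘ suc)))

  -- The monomials x^β of a power-sum product, stored as shifts by -β.
  expand : Mono → Lin (Vec ℤ s)
  expand [] = single (Vec.replicate _ 0ℤ)
  expand (m ∷ μ) = concatL λ i → mapL (unit i (ℤ.- part m) ⊕_) (expand μ)

  M-++ : ∀ μ κ (ν : Vec ℤ s) → M (μ ++ κ) ν ≈ ev (λ β → M κ (ν ⊕ β)) (expand μ)
  M-++ [] κ ν = sym (trans (ev-single (λ β → M κ (ν ⊕ β)) _) (M-cong κ (⊕-identityʳ ν)))
  M-++ {s} (m ∷ μ) κ ν = trans (sum-cong {s} λ i → trans (M-++ μ κ (ν ⊕ unit i (ℤ.- part m)))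
      (trans (ev-cong (λ β → M-cong κ (⊕-assoc ν _ β)) (expand μ)) (sym (ev-map (λ β → M κ (ν ⊕ β)) (unit i (ℤ.- part m) ⊕_) (expand μ)))))
    (sym (ev-concatL (λ β → M κ (ν ⊕ β)) (λ i → mapL (unit i (ℤ.- part m) ⊕_) (expand μ))))

  M-expand : ∀ μ (ν : Vec ℤ s) → M μ ν ≈ ev (λ β → M [] (ν ⊕ β)) (expand μ)
  M-expand [] ν = M-++ [] [] ν
  M-expand {s} (m ∷ μ) ν = trans (sum-cong {s} λ i → trans (M-expand μ (ν ⊕ unit i (ℤ.- part m)))
      (trans (ev-cong (λ β → M-cong [] (⊕-assoc ν _ β)) (expand μ)) (sym (ev-map (λ β → M [] (ν ⊕ β)) (unit i (ℤ.- part m) ⊕_) (expand μ)))))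
    (sym (ev-concatL (λ β → M [] (ν ⊕ β)) (λ i → mapL (unit i (ℤ.- part m) ⊕_) (expand μ))))

  coeff-expand : ∀ f (ν : Vec ℤ s) → coeff f ν ≈ ev (λ β → M [] (ν ⊕ β)) (f >>= expand)
  coeff-expand f ν = trans (ev-cong (λ μ → M-expand μ ν) f) (sym (ev->>= _ f expand))

  coeff-⊛ : ∀ f g (ν : Vec ℤ s) → coeff (f ⊛ g) ν ≈ ev (λ β → coeff g (ν ⊕ β)) (f >>= expand)
  coeff-⊛ f g ν = trans (ev-⊛ (λ x → M x ν) f g) (trans (ev-cong each f) (sym (ev->>= _ f expand)))
    where
    each : ∀ μ → ev (λ κ → M (μ ++ κ) ν) g ≈ ev (λ β → coeff g (ν ⊕ β)) (expand μ)
    each μ = trans (ev-cong (λ κ → M-++ μ κ ν) g) (ev-swap (λ κ β → M κ (ν ⊕ β)) g (expand μ))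

  ⊖ : Vec ℤ s → Vec ℤ s
  ⊖ = flip 0ℤ

  δ₀-sub-refl : ∀ z → δ₀ ((0ℤ ℤ.- z) ℤ.+ z) ≈ 1#
  δ₀-sub-refl z = reflexive (≡.cong δ₀ (ℤS.solve 1 (λ z → (ℤS.con 0ℤ ℤS.:- z) ℤS.:+ z ℤS.:= ℤS.con 0ℤ) ≡.refl z))

  M-[]-refl : (ν : Vec ℤ s) → M [] (⊖ ν ⊕ ν) ≈ 1#
  M-[]-refl [] = refl
  M-[]-refl (z ∷ ν) = trans (*-cong (δ₀-sub-refl z) (M-[]-refl ν)) (*-identityˡ 1#)

  δ₀-≢ : ∀ {z} → z ≢ 0ℤ → δ₀ z ≈ 0#
  δ₀-≢ {+ zero} ne = ⊥-elim (ne ≡.refl)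
  δ₀-≢ {+ suc n} ne = refl
  δ₀-≢ { -[1+ n ]} ne = refl

  M-[]-≢ : {ν ξ : Vec ℤ s} → ν ≢ ξ → M [] (⊖ ν ⊕ ξ) ≈ 0#
  M-[]-≢ {ν = []} {[]} ne = ⊥-elim (ne ≡.refl)
  M-[]-≢ {ν = z ∷ ν} {y ∷ ξ} ne with z ℤ.≟ y
  ... | yes ≡.refl = trans (*-congˡ (M-[]-≢ (ne ∘ ≡.cong (z ∷_)))) (zeroʳ _)
  ... | no z≢y = trans (*-congʳ (δ₀-≢ (λ e → z≢y (≡.sym (ℤP.i-j≡0⇒i≡j y z (≡.trans (ℤS.solve 2 (λ y z → y ℤS.:- z ℤS.:= (ℤS.con 0ℤ ℤS.:- z) ℤS.:+ y) ≡.refl y z) e)))))) (zeroˡ _)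

  M-[]-⊖ : (ν : Vec ℤ s) → M [] (⊖ ν) ≈ M [] ν
  M-[]-⊖ [] = refl
  M-[]-⊖ (z ∷ ν) = *-cong (δ₀-neg z) (M-[]-⊖ ν)
    where
    δ₀-neg : ∀ z → δ₀ (0ℤ ℤ.- z) ≈ δ₀ z
    δ₀-neg (+ zero) = refl
    δ₀-neg (+ suc n) = refl
    δ₀-neg -[1+ n ] = refl

  -- The coefficient of a product sums the coefficients of one factor over the exponents of the
  -- other. Equal coefficients force the exponents of `f′` to be the flipped exponents of `f` as
  -- formal sums, so the sum can be reindexed by `τ`; the shift is `- N₁` since exponents are stored
  -- negated.
  coeff-⊛-flip : ∀ N₁ N₂ f f′ g g′ →
    (∀ (ν : Vec ℤ s) → coeff f′ ν ≈ coeff f (flip N₁ ν)) → (∀ (ν : Vec ℤ s) → coeff g′ ν ≈ coeff g (flip N₂ ν)) →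
    ∀ (ν : Vec ℤ s) → coeff (f′ ⊛ g′) ν ≈ coeff (f ⊛ g) (flip (N₁ ℤ.+ N₂) ν)
  coeff-⊛-flip {s} N₁ N₂ f f′ g g′ hf hg ν = begin
    coeff (f′ ⊛ g′) ν
      ≈⟨ coeff-⊛ f′ g′ ν ⟩
    ev (λ β → coeff g′ (ν ⊕ β)) (f′ >>= expand)
      ≈⟨ ev-agree (f′ >>= expand) (mapL τ (f >>= expand)) (All.universal (λ _ → tt) _) (All.universal (λ _ → tt) _) (λ a _ → agree a) (λ β → coeff g′ (ν ⊕ β)) ⟩
    ev (λ β → coeff g′ (ν ⊕ β)) (mapL τ (f >>= expand))
      ≈⟨ ev-map _ τ (f >>= expand) ⟩
    ev (λ β → coeff g′ (ν ⊕ τ β)) (f >>= expand)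
      ≈⟨ ev-cong (λ β → trans (hg (ν ⊕ τ β)) (reflexive (≡.cong (coeff g) (target ν β)))) (f >>= expand) ⟩
    ev (λ β → coeff g (flip (N₁ ℤ.+ N₂) ν ⊕ β)) (f >>= expand)
      ≈⟨ coeff-⊛ f g (flip (N₁ ℤ.+ N₂) ν) ⟨
    coeff (f ⊛ g) (flip (N₁ ℤ.+ N₂) ν) ∎
    where
    Ok : Vec ℤ s → Set
    Ok _ = ⊤
    coordinate : Vec ℤ s → Vec ℤ s → Carrier
    coordinate a b = M [] (⊖ a ⊕ b)
    coordinate-refl : ∀ a → Ok a → coordinate a a ≈ 1#
    coordinate-refl a _ = M-[]-refl a
    coordinate-≢ : ∀ a b → Ok a → Ok b → a ≢ b → coordinate a b ≈ 0#
    coordinate-≢ a b _ _ = M-[]-≢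
    _≟V_ : (a b : Vec ℤ s) → Dec (a ≡ b)
    _≟V_ = VecP.≡-dec ℤ._≟_
    open FormalSums Ok _≟V_ coordinate coordinate-refl coordinate-≢
    τ : Vec ℤ s → Vec ℤ s
    τ = flip (ℤ.- N₁)
    target : ∀ {s} (ν β : Vec ℤ s) → flip N₂ (ν ⊕ flip (ℤ.- N₁) β) ≡ flip (N₁ ℤ.+ N₂) ν ⊕ β
    target [] [] = ≡.refl
    target (z ∷ ν) (y ∷ β) = ≡.cong₂ _∷_ (ℤS.solve 4 (λ a b z y → b ℤS.:- (z ℤS.:+ (ℤS.:- a ℤS.:- y)) ℤS.:= (a ℤS.:+ b) ℤS.:- z ℤS.:+ y) ≡.refl N₁ N₂ z y) (target ν β)
    opposite : ∀ {s} (ν β : Vec ℤ s) → ⊖ (flip N₁ (⊖ ν) ⊕ β) ≡ ⊖ ν ⊕ flip (ℤ.- N₁) β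
    opposite [] [] = ≡.refl
    opposite (z ∷ ν) (y ∷ β) = ≡.cong₂ _∷_ (ℤS.solve 3 (λ a z y → ℤS.con 0ℤ ℤS.:- ((a ℤS.:- (ℤS.con 0ℤ ℤS.:- z)) ℤS.:+ y) ℤS.:= (ℤS.con 0ℤ ℤS.:- z) ℤS.:+ (ℤS.:- a ℤS.:- y)) ≡.refl N₁ z y) (opposite ν β)
    agree : ∀ a → ev (λ b → M [] (⊖ a ⊕ b)) (f′ >>= expand) ≈ ev (λ b → M [] (⊖ a ⊕ b)) (mapL τ (f >>= expand))
    agree a = begin
      ev (λ b → M [] (⊖ a ⊕ b)) (f′ >>= expand)
        ≈⟨ trans (sym (coeff-expand f′ (⊖ a))) (trans (hf (⊖ a)) (coeff-expand f (flip N₁ (⊖ a)))) ⟩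
      ev (λ b → M [] (flip N₁ (⊖ a) ⊕ b)) (f >>= expand)
        ≈⟨ ev-cong (λ b → trans (sym (M-[]-⊖ (flip N₁ (⊖ a) ⊕ b))) (M-cong [] (opposite a b))) (f >>= expand) ⟩
      ev (λ b → M [] (⊖ a ⊕ τ b)) (f >>= expand)
        ≈⟨ ev-map _ τ (f >>= expand) ⟨
      ev (λ b → M [] (⊖ a ⊕ b)) (mapL τ (f >>= expand)) ∎

  -- Jack functions

  ints : List ℕ → List ℤ
  ints = map (λ n → + n)

  -- The coefficient of x₁^la₁ x₂^la₂ ⋯ .
  coeffL : Λ → List ℤ → Carrier
  coeffL f l = ev (λ x → ML x l) f

  cf : Λ → List ℕ → Carrier
  cf f la = coeffL f (ints la)

  coeff-toList : ∀ f (ν : Vec ℤ s) → coeff f ν ≈ coeffL f (toList ν)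
  coeff-toList f ν = ev-cong (λ x → M-toList x ν) f

  coeffL-↭ : ∀ f {k l} → k ↭ l → coeffL f k ≈ coeffL f l
  coeffL-↭ f p = ev-cong (λ x → ML-↭ x p) f

  coeffL-0∷ : ∀ f l → coeffL f (0ℤ ∷ l) ≈ coeffL f l
  coeffL-0∷ f l = ev-cong (λ x → ≡.subst (λ k → ML x (0ℤ ∷ k) ≈ ML x k) (VecP.toList∘fromList l)
    (trans (sym (M-toList x (0ℤ ∷ fromList l))) (trans (M-0∷ x (fromList l)) (M-toList x (fromList l))))) f

  cf-zeros : ∀ f k la → cf f (List.replicate k 0 ++ la) ≈ cf f la
  cf-zeros f zero la = refl
  cf-zeros f (suc k) la = trans (coeffL-0∷ f _) (cf-zeros f k la)

  cf-↭ : ∀ f {mu la} → mu ↭ la → cf f mu ≈ cf f la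
  cf-↭ f p = coeffL-↭ f (↭P.map⁺ (λ n → + n) p)

  cf-norm : ∀ f mu → cf f mu ≈ cf f (norm mu)
  cf-norm f mu with zeros-norm mu
  ... | k , p = trans (cf-↭ f p) (cf-zeros f k (norm mu))

  data Sign (ν : Vec ℤ s) : Set where
    neg : Negative ν → Sign ν
    nonneg : (n : List ℕ) → toList ν ≡ ints n → Sign ν

  sign : (ν : Vec ℤ s) → Sign ν
  sign [] = nonneg [] ≡.refl
  sign (-[1+ n ] ∷ ν) = neg (negative zero ℤ.-<+)
  sign (+ n ∷ ν) with sign ν
  ... | neg (negative i lt) = neg (negative (suc i) lt)
  ... | nonneg l e = nonneg (n ∷ l) (≡.cong (+ n ∷_) e)

  coeff-nonneg : ∀ f (ν : Vec ℤ s) n → toList ν ≡ ints n → coeff f ν ≈ cf f (norm n)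
  coeff-nonneg f ν n e = trans (coeff-toList f ν) (trans (reflexive (≡.cong (coeffL f) e)) (cf-norm f n))

  -- A negative exponent has coefficient zero, and by symmetry any other exponent vector may be
  -- sorted and stripped of zeros.
  ≃-by-partitions : ∀ {f g} → (∀ la → IsPartition la → cf f la ≈ cf g la) → f ≃ g
  ≃-by-partitions {f} {g} h = mk≃ go
    where
    go : ∀ {s} (ν : Vec ℤ s) → coeff f ν ≈ coeff g ν
    go ν with sign ν
    ... | neg n = trans (coeff-neg f n) (sym (coeff-neg g n))
    ... | nonneg n e = trans (coeff-nonneg f ν n e) (trans (h (norm n) (norm-partition n)) (sym (coeff-nonneg g ν n e)))

  vec : (la : List ℕ) → Vec ℤ (length la)
  vec [] = []
  vec (x ∷ la) = + x ∷ vec la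

  toList-vec : ∀ la → toList (vec la) ≡ ints la
  toList-vec [] = ≡.refl
  toList-vec (x ∷ la) = ≡.cong (+ x ∷_) (toList-vec la)

  coeff-vec : ∀ f la → coeff f (vec la) ≈ cf f la
  coeff-vec f la = trans (coeff-toList f (vec la)) (reflexive (≡.cong (coeffL f) (toList-vec la)))

  ≃⇒cf : ∀ {f g} → f ≃ g → ∀ la → cf f la ≈ cf g la
  ≃⇒cf {f} {g} e la = trans (sym (coeff-vec f la)) (trans (same e (vec la)) (coeff-vec g la))

  ≃-sym : ∀ {f g} → f ≃ g → g ≃ f
  ≃-sym e = mk≃ λ ν → sym (same e ν)

  ≃-trans : ∀ {f g h} → f ≃ g → g ≃ h → f ≃ h
  ≃-trans e e′ = mk≃ λ ν → trans (same e ν) (same e′ ν)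

  degree : Mono → ℕ
  degree [] = 0
  degree (m ∷ μ) = suc m ℕ.+ degree μ

  M-degree : ∀ μ (ν : Vec ℤ s) → total ν ≢ + degree μ → M μ ν ≈ 0#
  M-degree [] [] ne = ⊥-elim (ne ≡.refl)
  M-degree [] (z ∷ ν) ne with z ℤ.≟ 0ℤ
  ... | yes ≡.refl = trans (*-congˡ (M-degree [] ν λ e → ne (≡.trans (ℤP.+-identityˡ _) e))) (zeroʳ _)
  ... | no nz = trans (*-congʳ (δ₀-≢ nz)) (zeroˡ _)
  M-degree {s} (m ∷ μ) ν ne = sum-zero {s} λ i → M-degree μ (ν ⊕ unit i (ℤ.- part m)) λ e → ne
    (≡.trans (ℤS.solve 2 (λ t m → t ℤS.:= m ℤS.:+ (t ℤS.:- m)) ≡.refl (total ν) (part m)) (≡.cong (λ t → part m ℤ.+ t) (≡.trans (≡.sym (total-shift ν i _)) e)))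

  -- Beyond this degree all coefficients vanish, which leaves finitely many partitions to eliminate.
  bound : Λ → ℕ
  bound [] = 0
  bound ((c , x) ∷ f) = degree x ℕ.⊔ bound f

  coeff-bound : ∀ f (ν : Vec ℤ s) → + bound f ℤ.< total ν → coeff f ν ≈ 0#
  coeff-bound [] ν lt = refl
  coeff-bound ((c , x) ∷ f) ν lt = trans (+-cong (trans (*-congˡ (M-degree x ν λ e → ℤP.<-irrefl ≡.refl (ℤP.<-≤-trans (≡.subst (+ bound ((c , x) ∷ f) ℤ.<_) e lt) (ℤ.+≤+ (ℕP.m≤m⊔n (degree x) (bound f)))))) (zeroʳ c))
    (coeff-bound f ν (ℤP.≤-<-trans (ℤ.+≤+ (ℕP.m≤n⊔m (degree x) (bound f))) lt))) (+-identityʳ 0#)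

  total-vec : ∀ la → total (vec la) ≡ + sumℕ la
  total-vec [] = ≡.refl
  total-vec (x ∷ la) = ≡.cong (λ t → + x ℤ.+ t) (total-vec la)

  cf-bound : ∀ f la → bound f ℕ.< sumℕ la → cf f la ≈ 0#
  cf-bound f la lt = trans (sym (coeff-vec f la)) (coeff-bound f (vec la) (≡.subst (+ bound f ℤ.<_) (≡.sym (total-vec la)) (ℤ.+<+ lt)))

  ⟨_∣_⟩ : Λ → Λ → Carrier
  ⟨ f ∣ g ⟩ = ev (λ x → ev (pair x) g) f

  pairing-sym : ∀ f g → ⟨ f ∣ g ⟩ ≈ ⟨ g ∣ f ⟩
  pairing-sym f g = trans (ev-swap pair f g) (ev-cong (λ y → ev-cong (λ x → pair-sym x y) f) g)

  pairing-congʳ : ∀ f {g h} → g ≃ h → ⟨ f ∣ g ⟩ ≈ ⟨ f ∣ h ⟩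
  pairing-congʳ f e = ev-cong (λ x → pair-≃ x e) f

  pairing-congˡ : ∀ g {f h} → f ≃ h → ⟨ f ∣ g ⟩ ≈ ⟨ h ∣ g ⟩
  pairing-congˡ g {f} {h} e = trans (pairing-sym f g) (trans (pairing-congʳ g e) (pairing-sym g h))

  pairing->>=ˡ : ∀ {A : Set} g (L : Lin A) (h : A → Λ) → ⟨ L >>= h ∣ g ⟩ ≈ ev (λ a → ⟨ h a ∣ g ⟩) L
  pairing->>=ˡ g L h = ev->>= (λ x → ev (pair x) g) L h

  1≉0 : ¬ (1# ≈ 0#)
  1≉0 e = ⟦ 0 ⟧≉0 (trans ι-1 e)

  -- Nondegeneracy: Newton's identity recovers the coefficients of f from its pairings.
  nondegenerate : ∀ {f} → (∀ κ → ev (pair κ) f ≈ 0#) → f ≃ []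
  nondegenerate {f} h = mk≃ λ ν → go ν f h
    where
    Null : Λ → Set
    Null f = ∀ κ → ev (pair κ) f ≈ 0#
    Null-∂ : ∀ i f → Null f → Null (∂Λ i f)
    Null-∂ i f h κ = cancel-nonzero (*-nonzero ⟦ i ⟧≉0 α≉0) (trans (*-congˡ (ev->>= (pair κ) f (∂ i))) (trans (sym (ev-* _ _ f)) (h (i ∷ κ))))
    go : ∀ {s} (ν : Vec ℤ s) f → Null f → coeff f ν ≈ 0#
    go [] f h = trans (ev-cong constant f) (h [])
      where
      constant : ∀ x → M x [] ≈ pair [] x
      constant [] = refl
      constant (n ∷ x) = refl
    go (-[1+ n ] ∷ ν) f h = coeff-neg f (negative zero ℤ.-<+)
    go (+ k ∷ ν) f h = inner k f h (<-wellFounded k)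
      where
      inner : ∀ k f → Null f → Acc ℕ._<_ k → coeff f (+ k ∷ ν) ≈ 0#
      inner zero f h _ = trans (ev-cong (λ x → M-0∷ x ν) f) (go ν f h)
      inner (suc n) f h (acc rec) = cancel-nonzero ⟦ n ⟧≉0 (trans (sym (newtonΛ n f ν)) (trans (sumTo-cong (suc n) each) (sumTo-0 (suc n))))
        where
        each : ∀ i → i ℕ.< suc n → ⟦ i ⟧ * coeff (∂Λ i f) (part n ℤ.- part i ∷ ν) ≈ 0#
        each i lt = trans (*-congˡ (trans (reflexive (≡.cong (λ z → coeff (∂Λ i f) (z ∷ ν)) smaller))
          (inner (n ℕ.∸ i) (∂Λ i f) (Null-∂ i f h) (rec (ℕ.s≤s (ℕP.m∸n≤m n i)))))) (zeroʳ _)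
          where
          smaller : part n ℤ.- part i ≡ + (n ℕ.∸ i)
          smaller = ≡.trans (ℤP.m-n≡m⊖n (suc n) (suc i)) (≡.trans (ℤP.[1+m]⊖[1+n]≡m⊖n n i) (ℤP.⊖-≥ (ℕ.s≤s⁻¹ lt)))

  record IsJack (P : List ℕ → Λ) : Set where
    field
      monic : ∀ {la} → IsPartition la → cf (P la) la ≈ 1#
      lower : ∀ {la mu} → IsPartition la → IsPartition mu → mu ≢ la → ¬ Dominated mu la → cf (P la) mu ≈ 0#
      orthogonal : ∀ {la mu} → IsPartition la → IsPartition mu → la ≢ mu → ⟨ P la ∣ P mu ⟩ ≈ 0#

  _≟L_ : (a b : List ℕ) → Dec (a ≡ b)
  _≟L_ = ListP.≡-dec ℕ._≟_

  module Jack {P : List ℕ → Λ} (isJack : IsJack P) where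
    open IsJack isJack

    subtract : Λ → Carrier → List ℕ → Λ
    subtract f c la = f ++ (- c) ⋆ P la

    ev-subtract : ∀ φ f c la → ev φ (subtract f c la) ≈ ev φ f + - (c * ev φ (P la))
    ev-subtract φ f c la = trans (ev-++ φ f _) (+-congˡ (trans (ev-⋆ φ (- c) (P la)) (sym (-‿distribˡ-* c _))))

    -- Gaussian elimination: each step clears the coefficient at one partition by subtracting a
    -- multiple of its monic P. In the order of `box` later steps do not disturb coefficients
    -- already cleared.
    residue : List (List ℕ) → Λ → Λ
    residue [] f = f
    residue (la ∷ ls) f = residue ls (subtract f (cf f la) la)

    expansion : List (List ℕ) → Λ → Lin (List ℕ)
    expansion [] f = []
    expansion (la ∷ ls) f = (cf f la , la) ∷ expansion ls (subtract f (cf f la) la)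

    expansion-names : ∀ {Q : List ℕ → Set} {ls} → All Q ls → ∀ f → All (λ t → Q (proj₂ t)) (expansion ls f)
    expansion-names [] f = []
    expansion-names (q ∷ qs) f = q ∷ expansion-names qs _

    ev-expansion : ∀ φ ls f → ev φ f ≈ ev φ (residue ls f) + ev (λ la → ev φ (P la)) (expansion ls f)
    ev-expansion φ [] f = sym (+-identityʳ _)
    ev-expansion φ (la ∷ ls) f = begin
      ev φ f
        ≈⟨ solve 2 (λ x y → x := (x :- y) :+ y) refl (ev φ f) (cf f la * ev φ (P la)) ⟩
      (ev φ f + - (cf f la * ev φ (P la))) + cf f la * ev φ (P la)
        ≈⟨ +-congʳ (trans (sym (ev-subtract φ f (cf f la) la)) (ev-expansion φ ls _)) ⟩
      (ev φ (residue (la ∷ ls) f) + ev (λ la → ev φ (P la)) (expansion ls _)) + cf f la * ev φ (P la)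
        ≈⟨ solve 3 (λ x y z → (x :+ y) :+ z := x :+ (z :+ y)) refl _ _ _ ⟩
      ev φ (residue (la ∷ ls) f) + ev (λ la → ev φ (P la)) (expansion (la ∷ ls) f) ∎

    residue-keep : ∀ {ka} ls → All (λ la → cf (P la) ka ≈ 0#) ls → ∀ f → cf f ka ≈ 0# → cf (residue ls f) ka ≈ 0#
    residue-keep [] _ f e = e
    residue-keep {ka} (la ∷ ls) (z ∷ zs) f e = residue-keep ls zs _ (trans (ev-subtract _ f (cf f la) la)
      (trans (+-cong e (trans (-‿cong (trans (*-congˡ z) (zeroʳ _))) -0#≈0#)) (+-identityʳ 0#)))

    residue-zero : ∀ {ls} → All IsPartition ls → AllPairs (λ a b → cf (P b) a ≈ 0#) ls → ∀ f {ka} → ka ∈ ls → cf (residue ls f) ka ≈ 0#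
    residue-zero {la ∷ ls} (p ∷ ps) (z ∷ zs) f (here ≡.refl) = residue-keep ls z _ (trans (ev-subtract _ f (cf f la) la)
      (trans (+-congˡ (-‿cong (trans (*-congˡ (monic p)) (*-identityʳ _)))) (-‿inverseʳ _)))
    residue-zero {la ∷ ls} (p ∷ ps) (z ∷ zs) f (there m) = residue-zero ps zs _ m

    lower-sum : ∀ {la mu} → IsPartition la → IsPartition mu → sumℕ mu ≢ sumℕ la → cf (P la) mu ≈ 0#
    lower-sum pl pm ne = lower pl pm (λ { ≡.refl → ne ≡.refl }) (λ d → ne (proj₁ d))

    -- In the instances `U` is closed downwards under dominance: bounded first part, large length,
    -- bounded energy in fixed degree.
    record Closed (U : List ℕ → Set) : Set where
      field
        U? : Decidable U
        closed : ∀ {la ka} → IsPartition la → IsPartition ka → U la → ¬ U ka → cf (P la) ka ≈ 0#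

    record Expanded (U : List ℕ → Set) (f : Λ) : Set where
      field
        terms : Lin (List ℕ)
        names : All (λ t → IsPartition (proj₂ t) × U (proj₂ t)) terms
        expanded : f ≃ (terms >>= P)

    -- Only partitions in `U` of degree at most `bound f` are eliminated. At all others the
    -- coefficient of `f` is zero and stays zero, since the subtracted functions have no coefficient
    -- there either.
    expand-in : ∀ {U} → Closed U → ∀ f → (∀ {ka} → IsPartition ka → ¬ U ka → cf f ka ≈ 0#) → Expanded U f
    expand-in {U} cl f off-U = record
      { terms = expansion ls f
      ; names = expansion-names (All.map (λ { (p , u , _) → p , u }) ls-good) f
      ; expanded = mk≃ λ ν → trans (ev-expansion (λ x → M x ν) ls f)
          (trans (+-congʳ (same rest ν)) (trans (+-identityˡ _) (sym (ev->>= _ (expansion ls f) P)))) }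
      where
      open Closed cl
      N = bound f
      U′? : Decidable (λ la → U la × sumℕ la ℕ.≤ N)
      U′? la = U? la ×-dec (sumℕ la ℕ.≤? N)
      ls = filter U′? (box N N)
      ls-good : All (λ la → IsPartition la × U la × sumℕ la ℕ.≤ N) ls
      ls-good = All.zipWith (λ { ((p , _) , u , b) → p , u , b }) (AllP.filter⁺ U′? (box-partition N N) , AllP.all-filter U′? (box N N))
      ls-ordered : AllPairs (λ a b → cf (P b) a ≈ 0#) ls
      ls-ordered = combine ls-good (AllPairsP.filter⁺ U′? (box-ordered N N))
        where
        combine : ∀ {ls} → All (λ la → IsPartition la × U la × sumℕ la ℕ.≤ N) ls → AllPairs Before ls → AllPairs (λ a b → cf (P b) a ≈ 0#) ls
        combine [] [] = []
        combine ((p , _) ∷ ps) (b ∷ bs) = All.zipWith (λ { ((q , _) , ne , nd) → lower q p ne nd }) (ps , b) ∷ combine ps bs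
      rest : residue ls f ≃ []
      rest = ≃-by-partitions zero-at
        where
        keep : ∀ {ka} → (∀ {la} → IsPartition la × U la × sumℕ la ℕ.≤ N → cf (P la) ka ≈ 0#) → cf f ka ≈ 0# → cf (residue ls f) ka ≈ 0#
        keep h e = residue-keep ls (All.map h ls-good) f e
        zero-at : ∀ ka → IsPartition ka → cf (residue ls f) ka ≈ 0#
        zero-at ka p with U? ka | sumℕ ka ℕ.≤? N
        ... | no nu | _ = keep (λ { (q , u , _) → closed q p u nu }) (off-U p nu)
        ... | yes u | no gt = keep (λ { (q , _ , le) → lower-sum q p (λ e → gt (ℕP.≤-trans (ℕP.≤-reflexive e) le)) }) (cf-bound f ka (ℕP.≰⇒> gt))
        ... | yes u | yes le = residue-zero (All.map proj₁ ls-good) ls-ordered f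
          (∈P.∈-filter⁺ U′? (box-complete N N p (ℕP.≤-trans (length≤sum (proj₁ p)) le) (ℕP.≤-trans (head≤sum ka) le)) (u , le))

    ev-names : ∀ {Q : List ℕ → Set} {L : Lin (List ℕ)} → All (λ t → Q (proj₂ t)) L → ∀ {φ} → (∀ {la} → Q la → φ la ≈ 0#) → ev φ L ≈ 0#
    ev-names [] h = refl
    ev-names {L = (c , la) ∷ L} (q ∷ qs) h = trans (+-cong (trans (*-congˡ (h q)) (zeroʳ c)) (ev-names qs h)) (+-identityʳ 0#)

    expand-all : ∀ f → Expanded (λ _ → ⊤) f
    expand-all f = expand-in (record { U? = λ _ → yes tt ; closed = λ _ _ _ nu → ⊥-elim (nu tt) }) f (λ _ nu → ⊥-elim (nu tt))

    pairing-outside : ∀ {U f la} → Expanded U f → IsPartition la → ¬ U la → ⟨ f ∣ P la ⟩ ≈ 0#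
    pairing-outside {U} {f} {la} E p nu = trans (pairing-congˡ (P la) expanded) (trans (pairing->>=ˡ (P la) terms P)
      (ev-names {Q = λ ka → IsPartition ka × U ka} names λ { {ka} (q , u) → orthogonal q p λ { ≡.refl → nu u } }))
      where open Expanded E

    -- A Jack function of norm zero would be orthogonal to all Jack functions; as these span,
    -- nondegeneracy would make it zero, against its leading coefficient 1. Positivity is no help
    -- over ℚ(α).
    norm≉0 : ∀ {la} → IsPartition la → ¬ (⟨ P la ∣ P la ⟩ ≈ 0#)
    norm≉0 {la} p e = 1≉0 (trans (sym (monic p)) (≃⇒cf null la))
      where
      self : ∀ {ka} → IsPartition ka → ⟨ P ka ∣ P la ⟩ ≈ 0#
      self {ka} q with ka ≟L la
      ... | yes ≡.refl = e
      ... | no ne = orthogonal q p ne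
      null : P la ≃ []
      null = nondegenerate λ κ → trans (sym (ev-single (λ x → ev (pair x) (P la)) κ))
        (trans (pairing-congˡ (P la) (Expanded.expanded (expand-all (single κ)))) (trans (pairing->>=ˡ (P la) (Expanded.terms (expand-all (single κ))) P)
          (ev-names {Q = λ ka → IsPartition ka × ⊤} (Expanded.names (expand-all (single κ))) λ { (q , _) → self q })))

    terms-vanish : ∀ (U : List ℕ → Set) (L : Lin (List ℕ)) → All (λ t → IsPartition (proj₂ t) × U (proj₂ t)) L →
      (∀ {la} → IsPartition la → U la → ⟨ L >>= P ∣ P la ⟩ ≈ 0#) → ∀ φ → ev φ L ≈ 0#
    terms-vanish U L names h = ev-vanish L names λ a (p , u) → trans (ev-* _ (λ b → ⟨ P b ∣ P a ⟩) L)
        (trans (*-congˡ (trans (sym (pairing->>=ˡ (P a) L P)) (h p u))) (zeroʳ _))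
      where
      inv : List ℕ → Carrier
      inv a with ≈0? ⟨ P a ∣ P a ⟩
      ... | yes _ = 0#
      ... | no ne = proj₁ (inverse _ ne)
      inv-norm : ∀ {a} → IsPartition a → inv a * ⟨ P a ∣ P a ⟩ ≈ 1#
      inv-norm {a} p with ≈0? ⟨ P a ∣ P a ⟩
      ... | yes e = ⊥-elim (norm≉0 p e)
      ... | no ne = proj₂ (inverse _ ne)
      Ok : List ℕ → Set
      Ok la = IsPartition la × U la
      coordinate : List ℕ → List ℕ → Carrier
      coordinate a b = inv a * ⟨ P b ∣ P a ⟩
      coordinate-refl : ∀ a → Ok a → coordinate a a ≈ 1#
      coordinate-refl a (p , _) = inv-norm p
      coordinate-≢ : ∀ a b → Ok a → Ok b → a ≢ b → coordinate a b ≈ 0#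
      coordinate-≢ a b (p , _) (q , _) ne = trans (*-congˡ (orthogonal q p (ne ∘ ≡.sym))) (zeroʳ _)
      open FormalSums Ok _≟L_ coordinate coordinate-refl coordinate-≢

    orthogonal⇒≃[] : ∀ {U f} → Expanded U f → (∀ {la} → IsPartition la → U la → ⟨ f ∣ P la ⟩ ≈ 0#) → f ≃ []
    orthogonal⇒≃[] {U} {f} E h = ≃-trans expanded (mk≃ λ ν → trans (ev->>= _ terms P)
        (terms-vanish U terms names (λ {la} p u → trans (pairing-congˡ (P la) (≃-sym expanded)) (h p u)) _))
      where open Expanded E

  -- Jack functions as eigenfunctions of the Laplace-Beltrami operator

  energy : List ℕ → ℤ
  energy [] = 0ℤ
  energy (x ∷ la) = (+ x) ℤ.* ((+ x) ℤ.- (+ 1)) ℤ.+ energy la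

  energy-squares : ∀ la → energy la ≡ squares la ℤ.- (+ sumℕ la)
  energy-squares [] = ≡.refl
  energy-squares (x ∷ la) = ≡.trans (≡.cong (λ t → (+ x) ℤ.* ((+ x) ℤ.- (+ 1)) ℤ.+ t) (energy-squares la))
    (ℤS.solve 3 (λ x q t → x ℤS.:* (x ℤS.:- ℤS.con (+ 1)) ℤS.:+ (q ℤS.:- t) ℤS.:= (x ℤS.:* x ℤS.:+ q) ℤS.:- (x ℤS.:+ t)) ≡.refl (+ x) (squares la) (+ sumℕ la))

  energy-↭ : ∀ {mu la} → mu ↭ la → energy mu ≡ energy la
  energy-↭ ↭.refl = ≡.refl
  energy-↭ (↭.prep x p) = ≡.cong (λ t → (+ x) ℤ.* ((+ x) ℤ.- (+ 1)) ℤ.+ t) (energy-↭ p)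
  energy-↭ (↭.swap x y p) = ≡.trans (≡.cong (λ t → (+ x) ℤ.* ((+ x) ℤ.- (+ 1)) ℤ.+ ((+ y) ℤ.* ((+ y) ℤ.- (+ 1)) ℤ.+ t)) (energy-↭ p))
    (ℤS.solve 3 (λ x y t → x ℤS.:+ (y ℤS.:+ t) ℤS.:= y ℤS.:+ (x ℤS.:+ t)) ≡.refl ((+ x) ℤ.* ((+ x) ℤ.- (+ 1))) ((+ y) ℤ.* ((+ y) ℤ.- (+ 1))) _)
  energy-↭ (↭.trans p q) = ≡.trans (energy-↭ p) (energy-↭ q)

  energy-zeros : ∀ k la → energy (List.replicate k 0 ++ la) ≡ energy la
  energy-zeros zero la = ≡.refl
  energy-zeros (suc k) la = ≡.trans (ℤP.+-identityˡ _) (energy-zeros k la)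

  energy-norm : ∀ mu → energy mu ≡ energy (norm mu)
  energy-norm mu with zeros-norm mu
  ... | k , p = ≡.trans (energy-↭ p) (energy-zeros k (norm mu))

  sum-zeros : ∀ k la → sumℕ (List.replicate k 0 ++ la) ≡ sumℕ la
  sum-zeros zero la = ≡.refl
  sum-zeros (suc k) la = sum-zeros k la

  sum-norm : ∀ mu → sumℕ mu ≡ sumℕ (norm mu)
  sum-norm mu with zeros-norm mu
  ... | k , p = ≡.trans (SumP.sum-↭ p) (sum-zeros k (norm mu))

  quad-ints : ∀ (ν : Vec ℤ s) n → toList ν ≡ ints n → quad ν ≡ energy n
  quad-ints [] [] e = ≡.refl
  quad-ints (z ∷ ν) (x ∷ n) e with ListP.∷-injective e
  ... | ≡.refl , e′ = ≡.cong (λ t → (+ x) ℤ.* ((+ x) ℤ.- (+ 1)) ℤ.+ t) (quad-ints ν n e′)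

  total-ints : ∀ (ν : Vec ℤ s) n → toList ν ≡ ints n → total ν ≡ + sumℕ n
  total-ints [] [] e = ≡.refl
  total-ints (z ∷ ν) (x ∷ n) e with ListP.∷-injective e
  ... | ≡.refl , e′ = ≡.cong (λ t → + x ℤ.+ t) (total-ints ν n e′)

  length-toList : ∀ (ν : Vec ℤ s) n → toList ν ≡ ints n → length n ≡ s
  length-toList ν n e = ≡.trans (≡.sym (ListP.length-map (λ n → + n) n)) (≡.trans (≡.cong length (≡.sym e)) (VecP.length-toList ν))

  dominated-energy : ∀ {mu la} → IsPartition mu → IsPartition la → Dominated mu la → mu ≢ la → energy mu ℤ.< energy la
  dominated-energy {mu} {la} p q d ne = ≡.subst₂ ℤ._<_ (≡.sym (energy-squares mu)) (≡.trans (≡.cong (λ t → squares la ℤ.- (+ t)) (proj₁ d)) (≡.sym (energy-squares la)))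
    (ℤP.+-monoˡ-< (ℤ.- (+ sumℕ mu)) (dominated-squares p q d ne))

  DΛ : Λ → Λ
  DΛ f = f >>= D

  pairTableΛ : ∀ f → PairTable {s} (coeff f)
  pairTableΛ f = record
    { pairs = λ a b ν → ev (λ x → Z a b x ν) f
    ; relation = λ {a} {b} a≢b ν → begin
        ev (λ x → Z a b x (ν ⊕ unit a -1ℤ)) f + - ev (λ x → Z a b x (ν ⊕ unit b -1ℤ)) f
          ≈⟨ difference _ _ ⟨
        ev (λ x → Z a b x (ν ⊕ unit a -1ℤ) + - Z a b x (ν ⊕ unit b -1ℤ)) f
          ≈⟨ ev-cong (λ x → Z-relation a≢b x ν) f ⟩
        ev (λ x → ι (lookup ν a) * M x (ν ⊕ unit b -1ℤ) + - (ι (lookup ν b) * M x (ν ⊕ unit a -1ℤ))) f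
          ≈⟨ trans (difference _ _) (+-cong (ev-* _ _ f) (-‿cong (ev-* _ _ f))) ⟩
        ι (lookup ν a) * coeff f (ν ⊕ unit b -1ℤ) + - (ι (lookup ν b) * coeff f (ν ⊕ unit a -1ℤ)) ∎
    ; pairs-negˡ = λ {a} {b} ν _ lt → ev-zero (λ x → Z-neg a b x (negative a lt)) f
    ; pairs-negʳ = λ {a} {b} ν _ lt → ev-zero (λ x → Z-neg a b x (negative b lt)) f
    ; table-neg = coeff-neg f }
    where
    difference : ∀ (φ ψ : Mono → Carrier) → ev (λ x → φ x + - ψ x) f ≈ ev φ f + - ev ψ f
    difference φ ψ = trans (ev-+ φ (λ x → - ψ x) f) (+-congˡ (ev-neg ψ f))

  coeff-D : ∀ f (ν : Vec ℤ s) → coeff (DΛ f) ν ≈ PairTable.applyD (pairTableΛ f) ν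
  coeff-D f ν = begin
    coeff (DΛ f) ν
      ≈⟨ ev->>= _ f D ⟩
    ev (λ x → ev (λ y → M y ν) (D x)) f
      ≈⟨ ev-cong (λ x → M-D x ν) f ⟩
    ev (λ x → α * ι (quad ν) * M x ν + ∑off (λ a b → Z a b x ν)) f
      ≈⟨ trans (ev-+ _ _ f) (+-cong (ev-* _ _ f) (sym (∑off-ev (λ a b x → Z a b x ν) f))) ⟩
    PairTable.applyD (pairTableΛ f) ν ∎

  D-adjoint : ∀ f g → ⟨ DΛ f ∣ g ⟩ ≈ ⟨ f ∣ DΛ g ⟩
  D-adjoint f g = begin
    ⟨ DΛ f ∣ g ⟩
      ≈⟨ ev->>= _ f D ⟩
    ev (λ x → ev (λ y → ev (pair y) g) (D x)) f
      ≈⟨ ev-cong (λ x → trans (ev-swap pair (D x) g) (ev-cong (λ z → D-self-adjoint x z) g)) f ⟩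
    ev (λ x → ev (λ z → ev (pair x) (D z)) g) f
      ≈⟨ ev-cong (λ x → sym (ev->>= (pair x) g D)) f ⟩
    ⟨ f ∣ DΛ g ⟩ ∎

  ev-∖ : ∀ φ f c (g : Λ) → ev φ (f ++ (- c) ⋆ g) ≈ ev φ f + - (c * ev φ g)
  ev-∖ φ f c g = trans (ev-++ φ f _) (+-congˡ (trans (ev-⋆ φ (- c) g) (sym (-‿distribˡ-* c _))))

  module JackEigen {P : List ℕ → Λ} (isJack : IsJack P) where
    open IsJack isJack public
    open Jack isJack public

    coeff-total : ∀ {la} → IsPartition la → ∀ {s} (ν : Vec ℤ s) → total ν ≢ + sumℕ la → coeff (P la) ν ≈ 0#
    coeff-total {la} p ν ne with sign ν
    ... | neg n = coeff-neg (P la) n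
    ... | nonneg n e = trans (coeff-nonneg (P la) ν n e) (lower-sum p (norm-partition n)
      (λ eq → ne (≡.trans (total-ints ν n e) (≡.cong (λ n → + n) (≡.trans (sum-norm n) eq)))))

    coeff-above : ∀ {la} → IsPartition la → ∀ {s} (ν : Vec ℤ s) → energy la ℤ.< quad ν → coeff (P la) ν ≈ 0#
    coeff-above {la} p ν lt with sign ν
    ... | neg n = coeff-neg (P la) n
    ... | nonneg n e = trans (coeff-nonneg (P la) ν n e) (lower p (norm-partition n) different
        (λ d → ℤP.<-asym higher (dominated-energy (norm-partition n) p d different)))
      where
      higher : energy la ℤ.< energy (norm n)
      higher = ≡.subst (energy la ℤ.<_) (≡.trans (quad-ints ν n e) (energy-norm n)) lt
      different : norm n ≢ la
      different eq = ℤP.<-irrefl (≡.cong energy (≡.sym eq)) higher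

    -- The relation is a parameter because the image of P_la under `D` reaches the energy of `la`,
    -- while after subtraction of the eigenvalue part only smaller energies remain.
    Below : (ℤ → ℤ → Set) → List ℕ → List ℕ → Set
    Below _≺_ la ka = (energy ka ≺ energy la) × sumℕ ka ≡ sumℕ la

    below-closed : ∀ {_≺_ : ℤ → ℤ → Set} → (∀ x y → Dec (x ≺ y)) → (∀ {x y z} → x ℤ.< y → y ≺ z → x ≺ z) →
      ∀ la → Closed (Below _≺_ la)
    below-closed {_≺_} _≺?_ trans-≺ la = record
      { U? = λ ka → (energy ka ≺? energy la) ×-dec (sumℕ ka ℕ.≟ sumℕ la)
      ; closed = λ {ka} {ρ} p q (lt , e) nu → lower p q (λ { ≡.refl → nu (lt , e) })
          (λ d → nu (trans-≺ (dominated-energy q p d (λ { ≡.refl → nu (lt , e) })) lt , ≡.trans (proj₁ d) e)) }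

    quad-vec : ∀ la → quad (vec la) ≡ energy la
    quad-vec la = quad-ints (vec la) la (toList-vec la)

    cf-D : ∀ {la} → IsPartition la → ∀ ka → (sumℕ ka ≡ sumℕ la → energy la ℤ.≤ energy ka) →
      cf (DΛ (P la)) ka ≈ (α * ι (quad (vec ka)) + ι (pairEnergy (vec ka))) * cf (P la) ka
    cf-D {la} p ka le = trans (sym (coeff-vec (DΛ (P la)) ka)) (trans (coeff-D (P la) (vec ka))
      (trans (applyD-leading (pairTableΛ (P la)) (vec ka) above) (*-congˡ (coeff-vec (P la) ka))))
      where
      above : ∀ ξ → total ξ ≡ total (vec ka) → quad (vec ka) ℤ.< quad ξ → coeff (P la) ξ ≈ 0#
      above ξ tξ lt with sumℕ ka ℕ.≟ sumℕ la
      ... | yes e = coeff-above p ξ (ℤP.≤-<-trans (le e) (≡.subst (ℤ._< quad ξ) (quad-vec ka) lt))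
      ... | no ne = coeff-total p ξ (λ e → ne (ℤP.+-injective (≡.trans (≡.sym (total-vec ka)) (≡.trans (≡.sym tξ) e))))

    eigenvalue : List ℕ → Carrier
    eigenvalue la = α * ι (quad (vec la)) + ι (pairEnergy (vec la))

    -- In the degree of `la`, at exponents of larger energy, `cf-D` shows that `D` only multiplies a
    -- coefficient that is already zero; in other degrees it does so as well.
    D-triangular : ∀ {la} → IsPartition la → Expanded (Below ℤ._≤_ la) (DΛ (P la))
    D-triangular {la} p = expand-in (below-closed ℤP._≤?_ (λ x<y y≤z → ℤP.<⇒≤ (ℤP.<-≤-trans x<y y≤z)) la) (DΛ (P la)) outside
      where
      outside : ∀ {ka} → IsPartition ka → ¬ Below ℤ._≤_ la ka → cf (DΛ (P la)) ka ≈ 0#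
      outside {ka} q nu = trans (cf-D p ka (λ e → ℤP.<⇒≤ (ℤP.≰⇒> λ le → nu (le , e)))) (trans (*-congˡ zero-at) (zeroʳ _))
        where
        zero-at : cf (P la) ka ≈ 0#
        zero-at with sumℕ ka ℕ.≟ sumℕ la
        ... | yes e = trans (sym (coeff-vec (P la) ka)) (coeff-above p (vec ka) (≡.subst (energy la ℤ.<_) (≡.sym (quad-vec ka)) (ℤP.≰⇒> λ le → nu (le , e))))
        ... | no ne = lower-sum p q ne

    -- The difference `h` is spanned by Jack functions of energy smaller than that of `la`. It is
    -- orthogonal to each such P_ka: by self-adjointness `D` moves onto P_ka, whose image involves
    -- no energy above that of `ka` and so not P_la. Hence `h` is zero.
    P-eigen : ∀ {la} → IsPartition la → DΛ (P la) ≃ eigenvalue la ⋆ P la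
    P-eigen {la} p = mk≃ λ ν → trans (x∙y⁻¹≈ε⇒x≈y _ _ (trans (sym (ev-∖ _ (DΛ (P la)) E (P la))) (same h≃0 ν))) (sym (ev-⋆ _ E (P la)))
      where
      E = eigenvalue la
      h = DΛ (P la) ++ (- E) ⋆ P la
      outside : ∀ {ka} → IsPartition ka → ¬ Below ℤ._<_ la ka → cf h ka ≈ 0#
      outside {ka} q nu with ka ≟L la
      ... | yes ≡.refl = trans (ev-∖ _ (DΛ (P la)) E (P la)) (x≈y⇒x∙y⁻¹≈ε (cf-D p la (λ _ → ℤP.≤-refl)))
      ... | no ne = trans (ev-∖ _ (DΛ (P la)) E (P la)) (trans (+-cong (trans (cf-D p ka (λ e → ℤP.≮⇒≥ λ lt → nu (lt , e))) (vanish zero-at)) (trans (-‿cong (vanish zero-at)) -0#≈0#)) (+-identityʳ 0#))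
        where
        vanish : ∀ {c x} → x ≈ 0# → c * x ≈ 0#
        vanish e = trans (*-congˡ e) (zeroʳ _)
        zero-at : cf (P la) ka ≈ 0#
        zero-at = lower p q ne (λ d → nu (dominated-energy q p d ne , proj₁ d))
      h≃0 : h ≃ []
      h≃0 = orthogonal⇒≃[] (expand-in (below-closed ℤP._<?_ ℤP.<-trans la) h outside) λ {ka} q (lt , e) →
        trans (ev-∖ (λ x → ev (pair x) (P ka)) (DΛ (P la)) E (P la)) (trans (+-cong
          (trans (D-adjoint (P la) (P ka)) (trans (pairing-sym (P la) (DΛ (P ka))) (pairing-outside (D-triangular q) p λ (le , _) → ℤP.<-irrefl ≡.refl (ℤP.<-≤-trans lt le))))
          (trans (-‿cong (trans (*-congˡ (orthogonal p q λ { ≡.refl → ℤP.<-irrefl ≡.refl lt })) (zeroʳ _))) -0#≈0#)) (+-identityʳ 0#))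

    table : ∀ {la} → IsPartition la → ∀ {s} n → Eigentable {s} (coeff (P la)) n (eigenvalue la)
    table {la} p n = record { pairTable = pairTableΛ (P la)
      ; eigen = λ ν _ → trans (sym (ev-⋆ _ (eigenvalue la) (P la))) (trans (sym (same (P-eigen p) ν)) (coeff-D (P la) ν)) }

  -- Complementary partitions and first rows

  pad : ∀ s → List ℕ → Vec ℤ s
  pad zero la = []
  pad (suc s) [] = 0ℤ ∷ pad s []
  pad (suc s) (x ∷ la) = + x ∷ pad s la

  toList-pad : ∀ s la → length la ℕ.≤ s → toList (pad s la) ≡ ints (padTo s la)
  toList-pad zero [] le = ≡.refl
  toList-pad (suc s) [] le = ≡.cong (0ℤ ∷_) (toList-pad s [] ℕ.z≤n)
  toList-pad (suc s) (x ∷ la) (ℕ.s≤s le) = ≡.cong (+ x ∷_) (toList-pad s la le)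

  padTo-length : ∀ s la → length la ℕ.≤ s → length (padTo s la) ≡ s
  padTo-length s la le = ≡.trans (ListP.length-++ la) (≡.trans (≡.cong (length la ℕ.+_) (ListP.length-replicate (s ℕ.∸ length la))) (ℕP.m+[n∸m]≡n le))

  padTo-norm : ∀ {s} m → length m ≡ s → padTo s (norm m) ↭ m
  padTo-norm m ≡.refl with zeros-norm m
  ... | k , p = ↭.↭-sym (↭.trans p (≡.subst (λ j → List.replicate k 0 ++ norm m ↭ norm m ++ List.replicate j 0) k≡ (↭P.++-comm (List.replicate k 0) (norm m))))
    where
    k≡ : k ≡ length m ℕ.∸ length (norm m)
    k≡ = ≡.sym (≡.trans (≡.cong (ℕ._∸ length (norm m)) (≡.trans (↭P.↭-length p) (≡.trans (ListP.length-++ (List.replicate k 0)) (≡.cong (ℕ._+ length (norm m)) (ListP.length-replicate k))))) (ℕP.m+n∸n≡m k (length (norm m))))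

  norm-length : ∀ m → length (norm m) ℕ.≤ length m
  norm-length m with zeros-norm m
  ... | k , p = ≡.subst (length (norm m) ℕ.≤_) (≡.sym (≡.trans (↭P.↭-length p) (ListP.length-++ (List.replicate k 0)))) (ℕP.m≤n+m (length (norm m)) _)

  norm-padTo : ∀ {s la} → IsPartition la → norm (padTo s la) ≡ la
  norm-padTo {s} {la} p = ≡.trans (norm-cong-↭ {padTo s la} {la} (≡.subst (_↭ positive la) (≡.sym drop) ↭.refl)) (norm-of-partition p)
    where
    positive-zeros : ∀ k → positive (List.replicate k 0) ≡ []
    positive-zeros zero = ≡.refl
    positive-zeros (suc k) = positive-zeros k
    drop : positive (padTo s la) ≡ positive la
    drop = ≡.trans (ListP.filter-++ (1 ℕ.≤?_) la _) (≡.trans (≡.cong (positive la ++_) (positive-zeros (s ℕ.∸ length la))) (ListP.++-identityʳ _))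

  norm-bounded : ∀ {N} m → All (ℕ._≤ N) m → headOr0 (norm m) ℕ.≤ N
  norm-bounded {N} m a with zeros-norm m
  ... | k , p = first (norm m) (AllP.++⁻ʳ (List.replicate k 0) (↭P.All-resp-↭ p a))
    where
    first : ∀ l → All (ℕ._≤ N) l → headOr0 l ℕ.≤ N
    first [] _ = ℕ.z≤n
    first (x ∷ l) (b ∷ _) = b

  bounded-by-head : ∀ {la} → IsPartition la → All (ℕ._≤ headOr0 la) la
  bounded-by-head {[]} p = []
  bounded-by-head {x ∷ la} p = ℕP.≤-refl ∷ partition-head p

  bounded-by-norm : ∀ m → All (ℕ._≤ headOr0 (norm m)) m
  bounded-by-norm m with zeros-norm m
  ... | k , p = ↭P.All-resp-↭ (↭.↭-sym p) (AllP.++⁺ (AllP.replicate⁺ k ℕ.z≤n) (bounded-by-head (norm-partition m)))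

  padTo-bounded : ∀ {N} s {la} → IsPartition la → headOr0 la ℕ.≤ N → All (ℕ._≤ N) (padTo s la)
  padTo-bounded s {la} p h = AllP.++⁺ (All.map (λ le → ℕP.≤-trans le h) (bounded-by-head p)) (AllP.replicate⁺ (s ℕ.∸ length la) ℕ.z≤n)

  Orbit : Vec ℤ s → List ℕ → Set
  Orbit {s} ν la = toList ν ↭ toList (pad s la)

  quadL : List ℤ → ℤ
  quadL [] = 0ℤ
  quadL (z ∷ l) = z ℤ.* (z ℤ.- (+ 1)) ℤ.+ quadL l

  quadL-↭ : ∀ {k l} → k ↭ l → quadL k ≡ quadL l
  quadL-↭ ↭.refl = ≡.refl
  quadL-↭ (↭.prep x p) = ≡.cong (λ t → x ℤ.* (x ℤ.- (+ 1)) ℤ.+ t) (quadL-↭ p)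
  quadL-↭ (↭.swap x y p) = ≡.trans (≡.cong (λ t → x ℤ.* (x ℤ.- (+ 1)) ℤ.+ (y ℤ.* (y ℤ.- (+ 1)) ℤ.+ t)) (quadL-↭ p))
    (ℤS.solve 3 (λ x y t → x ℤS.:+ (y ℤS.:+ t) ℤS.:= y ℤS.:+ (x ℤS.:+ t)) ≡.refl (x ℤ.* (x ℤ.- (+ 1))) (y ℤ.* (y ℤ.- (+ 1))) _)
  quadL-↭ (↭.trans p q) = ≡.trans (quadL-↭ p) (quadL-↭ q)

  quad-toList : ∀ (ν : Vec ℤ s) → quad ν ≡ quadL (toList ν)
  quad-toList [] = ≡.refl
  quad-toList (z ∷ ν) = ≡.cong (λ t → z ℤ.* (z ℤ.- (+ 1)) ℤ.+ t) (quad-toList ν)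

  quad-↭ : ∀ {ν ξ : Vec ℤ s} → toList ν ↭ toList ξ → quad ν ≡ quad ξ
  quad-↭ {ν = ν} {ξ} p = ≡.trans (quad-toList ν) (≡.trans (quadL-↭ p) (≡.sym (quad-toList ξ)))

  quad-pad : ∀ {s la} → IsPartition la → length la ℕ.≤ s → quad (pad s la) ≡ energy la
  quad-pad {s} {la} p le = ≡.trans (quad-ints (pad s la) (padTo s la) (toList-pad s la le)) (≡.trans (energy-norm (padTo s la)) (≡.cong energy (norm-padTo {s} p)))

  total-pad : ∀ {s la} → IsPartition la → length la ℕ.≤ s → total (pad s la) ≡ + sumℕ la
  total-pad {s} {la} p le = ≡.trans (total-ints (pad s la) (padTo s la) (toList-pad s la le)) (≡.cong (λ n → + n) (≡.trans (sum-norm (padTo s la)) (≡.cong sumℕ (norm-padTo {s} p))))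

  -- The complement of la in the rectangle with s rows of length N.
  comp : ℕ → ℕ → List ℕ → List ℕ
  comp N s la = norm (map (N ℕ.∸_) (padTo s la))

  toList-flip : ∀ N (ν : Vec ℤ s) n → All (ℕ._≤ N) n → toList ν ≡ ints n → toList (flip (+ N) ν) ≡ ints (map (N ℕ.∸_) n)
  toList-flip N [] [] _ e = ≡.refl
  toList-flip N (z ∷ ν) (x ∷ n) (x≤N ∷ a) e with ListP.∷-injective e
  ... | ≡.refl , e′ = ≡.cong₂ _∷_ (≡.trans (ℤP.m-n≡m⊖n N x) (ℤP.⊖-≥ x≤N)) (toList-flip N ν n a e′)

  flip-↭ : ∀ N {ν : Vec ℤ s} {ξ : Vec ℤ t} → toList ν ↭ toList ξ → toList (flip N ν) ↭ toList (flip N ξ)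
  flip-↭ N {ν} {ξ} p = ≡.subst₂ _↭_ (≡.sym (VecP.toList-map _ ν)) (≡.sym (VecP.toList-map _ ξ)) (↭P.map⁺ (λ z → N ℤ.- z) p)

  comp-partition : ∀ N s la → IsPartition (comp N s la)
  comp-partition N s la = norm-partition (map (N ℕ.∸_) (padTo s la))

  comp-length : ∀ N {s} la → length la ℕ.≤ s → length (comp N s la) ℕ.≤ s
  comp-length N {s} la le = ℕP.≤-trans (norm-length (map (N ℕ.∸_) (padTo s la))) (ℕP.≤-reflexive (≡.trans (ListP.length-map (N ℕ.∸_) (padTo s la)) (padTo-length s la le)))

  comp-bounded : ∀ N s la → headOr0 (comp N s la) ℕ.≤ N
  comp-bounded N s la = norm-bounded _ (AllP.map⁺ (All.universal (λ x → ℕP.m∸n≤m N x) (padTo s la)))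

  comp-orbit : ∀ {N s la} → IsPartition la → length la ℕ.≤ s → headOr0 la ℕ.≤ N → toList (flip (+ N) (pad s la)) ↭ toList (pad s (comp N s la))
  comp-orbit {N} {s} {la} p le h = ≡.subst₂ _↭_ (≡.sym (toList-flip N (pad s la) (padTo s la) (padTo-bounded s p h) (toList-pad s la le)))
    (≡.sym (toList-pad s (comp N s la) (comp-length N la le)))
    (↭P.map⁺ (λ n → + n) (↭.↭-sym (padTo-norm (map (N ℕ.∸_) (padTo s la)) (≡.trans (ListP.length-map _ (padTo s la)) (padTo-length s la le)))))

  comp-involutive : ∀ {N s la} → IsPartition la → length la ℕ.≤ s → headOr0 la ℕ.≤ N → comp N s (comp N s la) ≡ la
  comp-involutive {N} {s} {la} p le h = ≡.trans (norm-cong-↭ {map (N ℕ.∸_) (padTo s (comp N s la))} {padTo s la} (positive-↭ back)) (norm-padTo {s} p)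
    where
    twice : ∀ {m} → All (ℕ._≤ N) m → map (N ℕ.∸_) (map (N ℕ.∸_) m) ≡ m
    twice [] = ≡.refl
    twice (x≤N ∷ a) = ≡.cong₂ _∷_ (ℕP.m∸[m∸n]≡n x≤N) (twice a)
    back : map (N ℕ.∸_) (padTo s (comp N s la)) ↭ padTo s la
    back = ≡.subst (map (N ℕ.∸_) (padTo s (comp N s la)) ↭_) (twice (padTo-bounded s p h))
      (↭P.map⁺ (N ℕ.∸_) (padTo-norm (map (N ℕ.∸_) (padTo s la)) (≡.trans (ListP.length-map _ (padTo s la)) (padTo-length s la le))))

  module JackTables {P : List ℕ → Λ} (isJack : IsJack P) where
    open JackEigen isJack public

    coeff-head : ∀ {la} → IsPartition la → ∀ {s} (ν : Vec ℤ s) i → + headOr0 la ℤ.< lookup ν i → coeff (P la) ν ≈ 0#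
    coeff-head {la} p ν i lt with sign ν
    ... | neg n = coeff-neg (P la) n
    ... | nonneg n e = trans (coeff-nonneg (P la) ν n e) (lower p (norm-partition n) (λ eq → too-big (ℕP.≤-reflexive (≡.cong headOr0 eq))) (λ d → too-big (dominated-head d)))
      where
      find : ∀ {s N} (ν : Vec ℤ s) n → toList ν ≡ ints n → All (ℕ._≤ N) n → ∀ i → lookup ν i ℤ.≤ + N
      find (z ∷ ν) (x ∷ n) e (b ∷ a) i with ListP.∷-injective e
      find (z ∷ ν) (x ∷ n) e (b ∷ a) zero | ≡.refl , e′ = ℤ.+≤+ b
      find (z ∷ ν) (x ∷ n) e (b ∷ a) (suc i) | ≡.refl , e′ = find ν n e′ a i
      too-big : ¬ (headOr0 (norm n) ℕ.≤ headOr0 la)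
      too-big le = ℤP.<-irrefl ≡.refl (ℤP.<-≤-trans lt (find ν n e (All.map (λ b → ℕP.≤-trans b le) (bounded-by-norm n)) i))

    coeff-short : ∀ {la} → IsPartition la → ∀ {s} (ν : Vec ℤ s) → s ℕ.< length la → coeff (P la) ν ≈ 0#
    coeff-short {la} p ν lt with sign ν
    ... | neg n = coeff-neg (P la) n
    ... | nonneg n e = trans (coeff-nonneg (P la) ν n e) (lower p (norm-partition n) (λ eq → too-short (ℕP.≤-reflexive (≡.cong length (≡.sym eq)))) (λ d → too-short (dominated-length (proj₁ p) d)))
      where
      too-short : ¬ (length la ℕ.≤ length (norm n))
      too-short le = ℕP.<-irrefl ≡.refl (ℕP.<-≤-trans lt (ℕP.≤-trans le (ℕP.≤-trans (norm-length n) (ℕP.≤-reflexive (length-toList ν n e)))))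

    cf-pad : ∀ f {s la} → length la ℕ.≤ s → coeff f (pad s la) ≈ cf f la
    cf-pad f {s} {la} le = trans (coeff-toList f (pad s la)) (trans (reflexive (≡.cong (coeffL f) (toList-pad s la le)))
      (trans (cf-↭ f (↭P.++-comm la (List.replicate (s ℕ.∸ length la) 0))) (cf-zeros f (s ℕ.∸ length la) la)))

    coeff-orbit : ∀ {la} → IsPartition la → ∀ {s} {ν : Vec ℤ s} → length la ℕ.≤ s → Orbit ν la → coeff (P la) ν ≈ 1#
    coeff-orbit {la} p le o = trans (coeff-↭ (P la) o) (trans (cf-pad (P la) le) (monic p))

    -- On the level of `la` and above, a Jack polynomial lives on the rearrangements of `la`, where
    -- it is 1. This settles the vectors of equal `quad` that eigenvalues cannot separate.
    support : ∀ {la} → IsPartition la → ∀ {s} (ν : Vec ℤ s) → length la ℕ.≤ s → energy la ℤ.≤ quad ν → Orbit ν la ⊎ coeff (P la) ν ≈ 0#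
    support {la} p {s} ν le le-quad with sign ν
    ... | neg n = inj₂ (coeff-neg (P la) n)
    ... | nonneg n e with norm n ≟L la
    ...   | yes ≡.refl = inj₁ (≡.subst₂ _↭_ (≡.sym e) (≡.sym (toList-pad s la le)) (↭P.map⁺ (λ n → + n) (↭.↭-sym (padTo-norm n (length-toList ν n e)))))
    ...   | no ne = inj₂ (trans (coeff-nonneg (P la) ν n e) (lower p (norm-partition n) ne
        (λ d → ℤP.<-irrefl ≡.refl (ℤP.<-≤-trans (dominated-energy (norm-partition n) p d ne) (≡.subst (energy la ℤ.≤_) (≡.trans (quad-ints ν n e) (energy-norm n)) le-quad)))))

    total-comp : ∀ {la} → IsPartition la → ∀ {s N} → length la ℕ.≤ s → headOr0 la ℕ.≤ N →
      total (pad s (comp N s la)) ≡ total (flip (+ N) (pad s la))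
    total-comp {la} p {s} {N} le h = ≡.trans (total-pad (comp-partition N s la) (comp-length N la le))
      (≡.trans (≡.cong (λ n → + n) (≡.sym (sum-norm (map (N ℕ.∸_) (padTo s la)))))
      (≡.sym (total-ints (flip (+ N) (pad s la)) _ (toList-flip N (pad s la) (padTo s la) (padTo-bounded s p h) (toList-pad s la le)))))

    module Complement {la} (p : IsPartition la) {s N} (le : length la ℕ.≤ s) (h : headOr0 la ℕ.≤ N) where
      ᶜla : List ℕ
      ᶜla = comp N s la

      q : IsPartition ᶜla
      q = comp-partition N s la

      qle : length ᶜla ℕ.≤ s
      qle = comp-length N la le

      top : Vec ℤ s
      top = pad s ᶜla

      orbit-flip : ∀ (ξ : Vec ℤ s) → Orbit ξ ᶜla → Orbit (flip (+ N) ξ) la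
      orbit-flip ξ o = ≡.subst (toList (flip (+ N) ξ) ↭_) (≡.cong toList (flip-flip (+ N) (pad s la)))
        (flip-↭ (+ N) {ξ} {flip (+ N) (pad s la)} (↭.trans o (↭.↭-sym (comp-orbit p le h))))

      orbit-unflip : ∀ (ξ : Vec ℤ s) → Orbit (flip (+ N) ξ) la → Orbit ξ ᶜla
      orbit-unflip ξ o = ↭.trans (≡.subst (_↭ toList (flip (+ N) (pad s la))) (≡.cong toList (flip-flip (+ N) ξ)) (flip-↭ (+ N) {flip (+ N) ξ} {pad s la} o)) (comp-orbit p le h)

      quad-top : quad top ≡ energy ᶜla
      quad-top = quad-pad q qle

      quad-flip-top : quad (flip (+ N) top) ≡ energy la
      quad-flip-top = ≡.trans (quad-↭ (orbit-flip top ↭.refl)) (quad-pad p le)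

      total-top : total top ≡ (+ s) ℤ.* (+ N) ℤ.- (+ sumℕ la)
      total-top = ≡.trans (total-comp p le h) (≡.trans (total-flip (+ N) (pad s la)) (≡.cong (λ t → (+ s) ℤ.* (+ N) ℤ.- t) (total-pad p le)))

      level : ∀ ξ → total ξ ≡ total top → quad ξ ≡ quad top → coeff (P ᶜla) ξ ≈ coeff (P la) (flip (+ N) ξ)
      level ξ tξ qξ = cases
        (support q ξ qle (ℤP.≤-reflexive (≡.trans (≡.sym quad-top) (≡.sym qξ))))
        (support p (flip (+ N) ξ) le (ℤP.≤-reflexive (≡.trans (≡.sym quad-flip-top) (≡.sym (quad-flip-≡ (+ N) ξ top tξ qξ)))))
        where
        cases : Orbit ξ ᶜla ⊎ coeff (P ᶜla) ξ ≈ 0# → Orbit (flip (+ N) ξ) la ⊎ coeff (P la) (flip (+ N) ξ) ≈ 0# → coeff (P ᶜla) ξ ≈ coeff (P la) (flip (+ N) ξ)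
        cases (inj₁ o) _ = trans (coeff-orbit q qle o) (sym (coeff-orbit p le (orbit-flip ξ o)))
        cases (inj₂ z) (inj₁ o) = trans (coeff-orbit q qle (orbit-unflip ξ o)) (sym (coeff-orbit p le o))
        cases (inj₂ z) (inj₂ z′) = trans z (sym z′)

      flipped : Σ Carrier λ e → Eigentable {s} (λ ν → coeff (P la) (flip (+ N) ν)) ((+ s) ℤ.* (+ N) ℤ.- (+ sumℕ la)) e
      flipped = _ , Eigentable-flip (table p (+ sumℕ la)) (+ N) (λ {ξ} i lt → coeff-head p ξ i (ℤP.≤-<-trans (ℤ.+≤+ h) lt))

      agree : ∀ ν → total ν ≡ total top → coeff (P ᶜla) ν ≈ coeff (P la) (flip (+ N) ν)
      agree = go flipped total-top
        where
        -- The degree of the flipped table equals `total top` only propositionally, so it is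
        -- generalised to a variable before matching. The new eigenvalue stays hidden in the
        -- existential.
        go : ∀ {n} → (Σ Carrier λ e → Eigentable {s} (λ ν → coeff (P la) (flip (+ N) ν)) n e) → total top ≡ n →
          ∀ ν → total ν ≡ total top → coeff (P ᶜla) ν ≈ coeff (P la) (flip (+ N) ν)
        go (e , T) ≡.refl = leading-unique (table q (total top)) T top ≡.refl
          (coeff-orbit q qle ↭.refl) (coeff-orbit p le (orbit-flip top ↭.refl))
          (λ ξ _ lt → coeff-above q ξ (≡.subst (ℤ._< quad ξ) quad-top lt))
          (λ ξ tξ lt → coeff-above p (flip (+ N) ξ) (≡.subst (ℤ._< quad (flip (+ N) ξ)) quad-flip-top (quad-flip-< (+ N) top ξ (≡.sym tξ) lt)))
          level

    -- Inverting the variables sends a Jack polynomial to that of the complementary partition.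
    coeff-comp : ∀ {la} → IsPartition la → ∀ {s N} → length la ℕ.≤ s → headOr0 la ℕ.≤ N → ∀ (ν : Vec ℤ s) → coeff (P (comp N s la)) ν ≈ coeff (P la) (flip (+ N) ν)
    coeff-comp {la} p {s} {N} le h ν = cases (total ν ℤP.≟ total top)
      where
      open Complement p le h
      total-cancel : total (flip (+ N) ν) ≡ + sumℕ la → total ν ≡ total top
      total-cancel e = ≡.trans (≡.sym (≡.cong total (flip-flip (+ N) ν))) (≡.trans (total-flip (+ N) (flip (+ N) ν))
        (≡.trans (≡.cong (λ t → (+ s) ℤ.* (+ N) ℤ.- t) e) (≡.sym total-top)))
      cases : Dec (total ν ≡ total top) → coeff (P ᶜla) ν ≈ coeff (P la) (flip (+ N) ν)
      cases (yes e) = agree ν e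
      cases (no ne) = trans (coeff-total q ν (λ e → ne (≡.trans e (≡.sym (total-pad q qle)))))
        (sym (coeff-total p (flip (+ N) ν) (λ e → ne (total-cancel e))))

    -- The coefficient of the highest power of a variable strips the first row.
    coeff-row : ∀ {r la} → IsPartition (r ∷ la) → ∀ {s} (ν : Vec ℤ s) → coeff (P la) ν ≈ coeff (P (r ∷ la)) (+ r ∷ ν)
    coeff-row {r} {la} p {s} ν = cases (length la ℕ.≤? s)
      where
      q = partition-tail p
      minus-head : ∀ t → t ≡ ((+ r) ℤ.+ t) ℤ.- (+ r)
      minus-head t = ℤS.solve 2 (λ r t → t ℤS.:= (r ℤS.:+ t) ℤS.:- r) ≡.refl (+ r) t
      stripped : Σ Carrier λ e → Eigentable {s} (λ ν → coeff (P (r ∷ la)) (+ r ∷ ν)) (+ sumℕ (r ∷ la) ℤ.- (+ r)) e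
      stripped = _ , Eigentable-∷ (table p (+ sumℕ (r ∷ la))) (+ r) (λ {ξ} i lt → coeff-head p ξ i lt)
      agree : ∀ {n} → (Σ Carrier λ e → Eigentable {s} (λ ν → coeff (P (r ∷ la)) (+ r ∷ ν)) n e) → + sumℕ la ≡ n →
        length la ℕ.≤ s → total ν ≡ + sumℕ la → coeff (P la) ν ≈ coeff (P (r ∷ la)) (+ r ∷ ν)
      agree (e , T) ≡.refl le tν = leading-unique (table q (+ sumℕ la)) T top (total-pad q le)
        (coeff-orbit q le ↭.refl) (coeff-orbit p (ℕ.s≤s le) ↭.refl)
        (λ ξ _ lt → coeff-above q ξ (≡.subst (ℤ._< quad ξ) (quad-pad q le) lt))
        (λ ξ _ lt → coeff-above p (+ r ∷ ξ) (≡.subst (ℤ._< quad (+ r ∷ ξ)) quad-top (ℤP.+-monoʳ-< ((+ r) ℤ.* ((+ r) ℤ.- (+ 1))) lt)))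
        (λ ξ _ qξ → level ξ (support q ξ le (ℤP.≤-reflexive (≡.trans (≡.sym (quad-pad q le)) (≡.sym qξ))))
          (support p (+ r ∷ ξ) (ℕ.s≤s le) (ℤP.≤-reflexive (≡.trans (≡.sym quad-top) (≡.cong (λ t → (+ r) ℤ.* ((+ r) ℤ.- (+ 1)) ℤ.+ t) (≡.sym qξ))))))
        ν tν
        where
        top : Vec ℤ s
        top = pad s la
        quad-top : quad (+ r ∷ top) ≡ energy (r ∷ la)
        quad-top = ≡.cong (λ t → (+ r) ℤ.* ((+ r) ℤ.- (+ 1)) ℤ.+ t) (quad-pad q le)
        level : ∀ ξ → Orbit ξ la ⊎ coeff (P la) ξ ≈ 0# → Orbit (+ r ∷ ξ) (r ∷ la) ⊎ coeff (P (r ∷ la)) (+ r ∷ ξ) ≈ 0# →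
          coeff (P la) ξ ≈ coeff (P (r ∷ la)) (+ r ∷ ξ)
        level ξ (inj₁ o) _ = trans (coeff-orbit q le o) (sym (coeff-orbit p (ℕ.s≤s le) (↭.prep (+ r) o)))
        level ξ (inj₂ z) (inj₁ o) = trans (coeff-orbit q le (↭P.drop-∷ o)) (sym (coeff-orbit p (ℕ.s≤s le) o))
        level ξ (inj₂ z) (inj₂ z′) = trans z (sym z′)
      cases : Dec (length la ℕ.≤ s) → coeff (P la) ν ≈ coeff (P (r ∷ la)) (+ r ∷ ν)
      cases (no gt) = trans (coeff-short q ν (ℕP.≰⇒> gt)) (sym (coeff-short p (+ r ∷ ν) (ℕ.s≤s (ℕP.≰⇒> gt))))
      cases (yes le) = degree-cases (total ν ℤP.≟ + sumℕ la)
        where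
        degree-cases : Dec (total ν ≡ + sumℕ la) → coeff (P la) ν ≈ coeff (P (r ∷ la)) (+ r ∷ ν)
        degree-cases (yes e) = agree stripped (minus-head (+ sumℕ la)) le e
        degree-cases (no ne) = trans (coeff-total q ν ne) (sym (coeff-total p (+ r ∷ ν)
          (λ e → ne (≡.trans (minus-head (total ν)) (≡.trans (≡.cong (ℤ._- (+ r)) e) (≡.sym (minus-head (+ sumℕ la))))))))

  -- Products of Jack functions

  M-mono-↭ : ∀ {μ κ} → μ ↭ κ → (ν : Vec ℤ s) → M μ ν ≈ M κ ν
  M-mono-↭ ↭.refl ν = refl
  M-mono-↭ {s} (↭.prep m p) ν = sum-cong {s} λ i → M-mono-↭ p (ν ⊕ unit i (ℤ.- part m))
  M-mono-↭ {s} (↭.swap {μ} {κ} m n p) ν = trans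
    (sum-cong {s} λ i → sum-cong {s} λ j → trans (M-mono-↭ p _) (M-cong κ (⊕-swap ν (unit i (ℤ.- part m)) (unit j (ℤ.- part n)))))
    (sum-comm {s} {s} λ i j → M κ (ν ⊕ unit j (ℤ.- part n) ⊕ unit i (ℤ.- part m)))
  M-mono-↭ (↭.trans p q) ν = trans (M-mono-↭ p ν) (M-mono-↭ q ν)

  ⊛-comm : ∀ f g → f ⊛ g ≃ g ⊛ f
  ⊛-comm f g = mk≃ λ ν → begin
    coeff (f ⊛ g) ν                            ≈⟨ ev-⊛ (λ x → M x ν) f g ⟩
    ev (λ μ → ev (λ κ → M (μ ++ κ) ν) g) f     ≈⟨ ev-swap (λ μ κ → M (μ ++ κ) ν) f g ⟩
    ev (λ κ → ev (λ μ → M (μ ++ κ) ν) f) g     ≈⟨ ev-cong (λ κ → ev-cong (λ μ → M-mono-↭ (↭P.++-comm μ κ) ν) f) g ⟩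
    ev (λ κ → ev (λ μ → M (κ ++ μ) ν) f) g     ≈⟨ ev-⊛ (λ x → M x ν) g f ⟨
    coeff (g ⊛ f) ν                            ∎

  starΛ : Λ → Λ → Λ
  starΛ f g = f >>= λ μ → g >>= star μ

  pairing-star : ∀ f k g → ⟨ f ⊛ k ∣ g ⟩ ≈ ⟨ k ∣ starΛ f g ⟩
  pairing-star f k g = begin
    ⟨ f ⊛ k ∣ g ⟩
      ≈⟨ ev-⊛ (λ x → ev (pair x) g) f k ⟩
    ev (λ μ → ev (λ κ → ev (pair (μ ++ κ)) g) k) f
      ≈⟨ ev-swap (λ μ κ → ev (pair (μ ++ κ)) g) f k ⟩
    ev (λ κ → ev (λ μ → ev (pair (μ ++ κ)) g) f) k
      ≈⟨ ev-cong (λ κ → ev-cong (λ μ → trans (ev-cong (λ ν → pair-star μ κ ν) g) (sym (ev->>= (pair κ) g (star μ)))) f) k ⟩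
    ev (λ κ → ev (λ μ → ev (pair κ) (g >>= star μ)) f) k
      ≈⟨ ev-cong (λ κ → sym (ev->>= (pair κ) f (λ μ → g >>= star μ))) k ⟩
    ⟨ k ∣ starΛ f g ⟩ ∎

  -- Width zero is treated apart, since a list of zeros is not a partition.
  rect : ℕ → ℕ → List ℕ
  rect s zero = []
  rect s (suc r) = List.replicate s (suc r)

  rect-partition : ∀ s r → IsPartition (rect s r)
  rect-partition s zero = [] , []
  rect-partition zero (suc r) = [] , []
  rect-partition (suc zero) (suc r) = ℕ.s≤s ℕ.z≤n ∷ [] , [-]
  rect-partition (suc (suc s)) (suc r) with rect-partition (suc s) (suc r)
  ... | a , l = ℕ.s≤s ℕ.z≤n ∷ a , ℕP.≤-refl ∷ l

  rect-length : ∀ s r → length (rect s r) ℕ.≤ s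
  rect-length s zero = ℕ.z≤n
  rect-length s (suc r) = ℕP.≤-reflexive (ListP.length-replicate s)

  rect-head : ∀ s r → headOr0 (rect s r) ℕ.≤ r
  rect-head s zero = ℕ.z≤n
  rect-head zero (suc r) = ℕ.z≤n
  rect-head (suc s) (suc r) = ℕP.≤-refl

  norm-replicate : ∀ s r → norm (List.replicate s r) ≡ rect s r
  norm-replicate s zero = drop s
    where
    drop : ∀ s → norm (List.replicate s 0) ≡ []
    drop zero = ≡.refl
    drop (suc s) = drop s
  norm-replicate s (suc r) = norm-of-partition (rect-partition s (suc r))

  padTo-rect : ∀ s r → padTo s (rect s r) ≡ List.replicate s r
  padTo-rect s zero = ≡.refl
  padTo-rect s (suc r) = ≡.trans (≡.cong (λ k → List.replicate s (suc r) ++ List.replicate k 0) (≡.trans (≡.cong (s ℕ.∸_) (ListP.length-replicate s)) (ℕP.n∸n≡0 s))) (ListP.++-identityʳ _)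

  comp-rect : ∀ N s r → comp N s (rect s r) ≡ rect s (N ℕ.∸ r)
  comp-rect N s r = ≡.trans (≡.cong (λ l → norm (map (N ℕ.∸_) l)) (padTo-rect s r)) (≡.trans (≡.cong norm (ListP.map-replicate (N ℕ.∸_) s r)) (norm-replicate s (N ℕ.∸ r)))

  infix 4 _~_
  -- Coefficients of Jack functions are read off by pairings, so different products are comparable
  -- only up to nonzero norms; vanishing is all that has to be tracked.
  record _~_ (x y : Carrier) : Set where
    constructor mk~
    field
      to : x ≈ 0# → y ≈ 0#
      from : y ≈ 0# → x ≈ 0#
  open _~_

  ~-scale : ∀ {x y c d} → ¬ (c ≈ 0#) → ¬ (d ≈ 0#) → x * c ≈ y * d → x ~ y
  ~-scale c≉0 d≉0 e = mk~
    (λ x0 → cancel-nonzero d≉0 (trans (*-comm _ _) (trans (sym e) (trans (*-congʳ x0) (zeroˡ _)))))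
    (λ y0 → cancel-nonzero c≉0 (trans (*-comm _ _) (trans e (trans (*-congʳ y0) (zeroˡ _)))))

  ~-trans : ∀ {x y z} → x ~ y → y ~ z → x ~ z
  ~-trans a b = mk~ (to b ∘ to a) (from a ∘ from b)

  module JackProducts {P : List ℕ → Λ} (isJack : IsJack P) where
    open JackTables isJack public

    -- Up to the norm of P_la, the Littlewood-Richardson coefficients of Jack functions.
    B : List ℕ → List ℕ → List ℕ → Carrier
    B mu ka la = ⟨ P mu ⊛ P ka ∣ P la ⟩

    B-comm : ∀ mu ka la → B mu ka la ≈ B ka mu la
    B-comm mu ka la = pairing-congˡ (P la) (⊛-comm (P mu) (P ka))

    narrow : ∀ r → Closed (λ la → headOr0 la ℕ.≤ r)
    narrow r = record
      { U? = λ la → headOr0 la ℕ.≤? r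
      ; closed = λ p q le nu → lower p q (λ { ≡.refl → nu le }) (λ d → nu (ℕP.≤-trans (dominated-head d) le)) }

    record Exceeds (r : ℕ) {s t} (ν : Vec ℤ s) (ξ : Vec ℤ t) : Set where
      constructor exceeds
      field
        index : Fin s
        above : + r ℤ.< lookup ν index

    -- Having no exponent above `r` is inherited by derivatives. It is phrased as agreement with the
    -- zero function at vectors with an entry above `r`; such an entry persists when variables are
    -- added, so `Transfer` applies.
    star-narrow : ∀ r {R} → IsPartition R → headOr0 R ℕ.≤ r → ∀ f {s} (ν : Vec ℤ s) → Exceeds r ν ν → coeff (starΛ f (P R)) ν ≈ 0#
    star-narrow r {R} p le f ν ex = trans (ev->>= (λ x → M x ν) f _) (ev-zero (λ μ → Agree-star μ {P R} {[]} base ν ν ex) f)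
      where
      longer : ∀ {s t} {ν : Vec ℤ s} {ξ : Vec ℤ t} k → Exceeds r ν ξ → Exceeds r (k ∷ ν) (k ∷ ξ)
      longer k (exceeds i lt) = exceeds (suc i) lt
      open Transfer (Exceeds r) longer
      base : Agree (P R) []
      base ν ξ (exceeds i lt) = coeff-head p ν i (ℤP.≤-<-trans (ℤ.+≤+ le) lt)

    star-expanded : ∀ r {R} → IsPartition R → headOr0 R ℕ.≤ r → ∀ f → Expanded (λ la → headOr0 la ℕ.≤ r) (starΛ f (P R))
    star-expanded r {R} p le f = expand-in (narrow r) (starΛ f (P R)) off-narrow
      where
      off-narrow : ∀ {ka} → IsPartition ka → ¬ (headOr0 ka ℕ.≤ r) → cf (starΛ f (P R)) ka ≈ 0#
      off-narrow {[]} q nu = ⊥-elim (nu ℕ.z≤n)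
      off-narrow {x ∷ ka} q nu = trans (sym (coeff-vec (starΛ f (P R)) (x ∷ ka))) (star-narrow r p le f (vec (x ∷ ka)) (exceeds zero (ℤ.+<+ (ℕP.≰⇒> nu))))

    B-wide : ∀ {mu ka R} → IsPartition ka → IsPartition R → headOr0 R ℕ.< headOr0 ka → B mu ka R ≈ 0#
    B-wide {mu} {ka} {R} q p lt = trans (pairing-star (P mu) (P ka) (P R)) (trans (pairing-sym (P ka) (starΛ (P mu) (P R)))
      (pairing-outside (star-expanded (headOr0 R) p ℕP.≤-refl (P mu)) q (ℕP.<⇒≱ lt)))

    tall : ∀ s → Closed (λ la → s ℕ.< length la)
    tall s = record
      { U? = λ la → s ℕ.<? length la
      ; closed = λ p q lt nu → lower p q (λ { ≡.refl → nu lt }) (λ d → nu (ℕP.<-≤-trans lt (dominated-length (proj₁ p) d))) }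

    coeff-⊛-short : ∀ f {ka} → IsPartition ka → ∀ {s} (ν : Vec ℤ s) → s ℕ.< length ka → coeff (f ⊛ P ka) ν ≈ 0#
    coeff-⊛-short f {ka} q ν lt = trans (coeff-⊛ f (P ka) ν) (ev-zero (λ β → coeff-short q (ν ⊕ β) lt) (f >>= expand))

    -- In fewer than `length ka` variables P_ka vanishes, and the product with it. So all terms of
    -- the product have more than `s` rows, and P_R is not among them.
    B-tall : ∀ {mu ka R s} → IsPartition ka → IsPartition R → length R ℕ.≤ s → s ℕ.< length ka → B mu ka R ≈ 0#
    B-tall {mu} {ka} {R} {s} q p le lt = pairing-outside (expand-in (tall s) (P mu ⊛ P ka) short) p (ℕP.≤⇒≯ le)
      where
      short : ∀ {la} → IsPartition la → ¬ (s ℕ.< length la) → cf (P mu ⊛ P ka) la ≈ 0#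
      short {la} _ nu = trans (sym (coeff-vec (P mu ⊛ P ka) la)) (coeff-⊛-short (P mu) q (vec la) (ℕP.≤-<-trans (ℕP.≮⇒≥ nu) lt))

    -- The function f* · P_(r∷R) has no exponent above `r`. Taking the coefficient of x₁^r commutes
    -- with f*, turns P_(r∷R) into P_R, strips the first row from each term with first part `r` and
    -- kills the other terms. So the coefficient of P_(r∷ka) before is that of P_ka after; the norms
    -- enter because coefficients are read by pairing.
    B-row : ∀ f {r ka R} → IsPartition (r ∷ ka) → IsPartition (r ∷ R) →
      ⟨ f ⊛ P (r ∷ ka) ∣ P (r ∷ R) ⟩ ~ ⟨ f ⊛ P ka ∣ P R ⟩
    B-row f {r} {ka} {R} q p = ~-scale (norm≉0 (partition-tail q)) (norm≉0 q) (begin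
      ⟨ f ⊛ P (r ∷ ka) ∣ P (r ∷ R) ⟩ * ⟨ P ka ∣ P ka ⟩
        ≈⟨ *-congʳ (trans (pairing-star f (P (r ∷ ka)) (P (r ∷ R))) (trans (pairing-sym (P (r ∷ ka)) h) (trans (pairing-congˡ (P (r ∷ ka)) expanded) (pairing->>=ˡ (P (r ∷ ka)) terms P)))) ⟩
      ev (λ la → ⟨ P la ∣ P (r ∷ ka) ⟩) terms * ⟨ P ka ∣ P ka ⟩
        ≈⟨ trans (sym (ev-*ʳ _ (λ la → ⟨ P la ∣ P (r ∷ ka) ⟩) terms)) (trans (ev-names-cong names pointwise) (ev-*ʳ _ (λ la → ⟨ stripped la ∣ P ka ⟩) terms)) ⟩
      ev (λ la → ⟨ stripped la ∣ P ka ⟩) terms * ⟨ P (r ∷ ka) ∣ P (r ∷ ka) ⟩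
        ≈⟨ *-congʳ (trans (sym (pairing->>=ˡ (P ka) terms stripped)) (trans (pairing-congˡ (P ka) (≃-sym h′≃)) (trans (pairing-sym h′ (P ka)) (sym (pairing-star f (P ka) (P R)))))) ⟩
      ⟨ f ⊛ P ka ∣ P R ⟩ * ⟨ P (r ∷ ka) ∣ P (r ∷ ka) ⟩ ∎)
      where
      h h′ : Λ
      h = starΛ f (P (r ∷ R))
      h′ = starΛ f (P R)
      open Expanded (star-expanded r p ℕP.≤-refl f)
      U : List ℕ → Set
      U la = IsPartition la × headOr0 la ℕ.≤ r
      stripped : List ℕ → Λ
      stripped [] = []
      stripped (x ∷ la) with x ℕ.≟ r
      ... | yes _ = P la
      ... | no _ = []
      ev-names-cong : ∀ {L : Lin (List ℕ)} → All (λ t → U (proj₂ t)) L → ∀ {φ ψ} → (∀ {la} → U la → φ la ≈ ψ la) → ev φ L ≈ ev ψ L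
      ev-names-cong [] e = refl
      ev-names-cong (u ∷ us) e = +-cong (*-congˡ (e u)) (ev-names-cong us e)
      1≤r : 1 ℕ.≤ r
      1≤r = All.head (proj₁ q)
      pointwise : ∀ {la} → U la → ⟨ P la ∣ P (r ∷ ka) ⟩ * ⟨ P ka ∣ P ka ⟩ ≈ ⟨ stripped la ∣ P ka ⟩ * ⟨ P (r ∷ ka) ∣ P (r ∷ ka) ⟩
      pointwise {[]} (u , _) = trans (trans (*-congʳ (orthogonal u q λ ())) (zeroˡ _)) (sym (zeroˡ _))
      pointwise {x ∷ la} (u , _) with x ℕ.≟ r
      ... | no ne = trans (trans (*-congʳ (orthogonal u q λ { ≡.refl → ne ≡.refl })) (zeroˡ _)) (sym (zeroˡ _))
      ... | yes ≡.refl with la ≟L ka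
      ...   | yes ≡.refl = *-comm _ _
      ...   | no ne = trans (trans (*-congʳ (orthogonal u q (ne ∘ ListP.∷-injectiveʳ))) (zeroˡ _)) (sym (trans (*-congʳ (orthogonal (partition-tail u) (partition-tail q) ne)) (zeroˡ _)))
      -- The vector `ξ` has one more entry, `r`. A permutation is used because `Transfer` adds its
      -- new variables in front of that entry.
      S : ∀ {s t} → Vec ℤ s → Vec ℤ t → Set
      S ν ξ = toList ξ ↭ + r ∷ toList ν
      S-∷ : ∀ {s t} {ν : Vec ℤ s} {ξ : Vec ℤ t} k → S ν ξ → S (k ∷ ν) (k ∷ ξ)
      S-∷ k o = ↭.trans (↭.prep k o) (↭.swap k (+ r) ↭.refl)
      open Transfer S S-∷
      base : Agree (P R) (P (r ∷ R))
      base ν ξ o = trans (coeff-row p ν) (coeff-↭ (P (r ∷ R)) {+ r ∷ ν} {ξ} (↭.↭-sym o))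
      strip-coeff : ∀ {la} → U la → ∀ {s} (ν : Vec ℤ s) → coeff (P la) (+ r ∷ ν) ≈ coeff (stripped la) ν
      strip-coeff {[]} (u , _) ν = coeff-head u (+ r ∷ ν) zero (ℤ.+<+ 1≤r)
      strip-coeff {x ∷ la} (u , le) ν with x ℕ.≟ r
      ... | yes ≡.refl = sym (coeff-row u ν)
      ... | no ne = coeff-head u (+ r ∷ ν) zero (ℤ.+<+ (ℕP.≤∧≢⇒< le ne))
      h′≃ : h′ ≃ (terms >>= stripped)
      h′≃ = mk≃ λ ν → begin
        coeff h′ ν
          ≈⟨ trans (ev->>= (λ x → M x ν) f _) (ev-cong (λ μ → Agree-star μ {P R} {P (r ∷ R)} base ν (+ r ∷ ν) ↭.refl) f) ⟩
        ev (λ μ → coeff (P (r ∷ R) >>= star μ) (+ r ∷ ν)) f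
          ≈⟨ ev->>= (λ x → M x (+ r ∷ ν)) f _ ⟨
        coeff h (+ r ∷ ν)
          ≈⟨ trans (same expanded (+ r ∷ ν)) (ev->>= (λ x → M x (+ r ∷ ν)) terms P) ⟩
        ev (λ la → coeff (P la) (+ r ∷ ν)) terms
          ≈⟨ ev-names-cong names (λ u → strip-coeff u ν) ⟩
        ev (λ la → coeff (stripped la) ν) terms
          ≈⟨ ev->>= (λ x → M x ν) terms stripped ⟨
        coeff (terms >>= stripped) ν ∎

    module _ {s mu ka la N₁ N₂} (p₁ : IsPartition mu) (l₁ : length mu ℕ.≤ s) (h₁ : headOr0 mu ℕ.≤ N₁)
             (p₂ : IsPartition ka) (l₂ : length ka ℕ.≤ s) (h₂ : headOr0 ka ℕ.≤ N₂)
             (p₃ : IsPartition la) (l₃ : length la ℕ.≤ s) (h₃ : headOr0 la ℕ.≤ N₁ ℕ.+ N₂) where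
      private
        N = N₁ ℕ.+ N₂
        f f′ : Λ
        f = P mu ⊛ P ka
        f′ = P (comp N₁ s mu) ⊛ P (comp N₂ s ka)
        flipped : ∀ (ν : Vec ℤ s) → coeff f′ ν ≈ coeff f (flip (+ N) ν)
        flipped = coeff-⊛-flip (+ N₁) (+ N₂) (P mu) (P (comp N₁ s mu)) (P ka) (P (comp N₂ s ka)) (coeff-comp p₁ l₁ h₁) (coeff-comp p₂ l₂ h₂)
        U : List ℕ → Set
        U rho = s ℕ.< length rho ⊎ headOr0 rho ℕ.≤ N
        U-closed : Closed U
        U-closed = record
          { U? = λ rho → (s ℕ.<? length rho) ⊎-dec (headOr0 rho ℕ.≤? N)
          ; closed = λ p q u nu → lower p q (λ { ≡.refl → nu u })
              (λ d → [ (λ lt → nu (inj₁ (ℕP.<-≤-trans lt (dominated-length (proj₁ p) d)))) , (λ le → nu (inj₂ (ℕP.≤-trans (dominated-head d) le))) ]′ u) }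
        -- A partition with at most `s` rows and a first row longer than `N` flips to a vector with
        -- a negative entry, at which the complementary product `f′` has no coefficient.
        off-U : ∀ {rho} → IsPartition rho → ¬ U rho → cf f rho ≈ 0#
        off-U {[]} p nu = ⊥-elim (nu (inj₂ ℕ.z≤n))
        off-U {x ∷ rho} p nu = trans (sym (cf-pad f {s} {x ∷ rho} short)) (trans (reflexive (≡.cong (coeff f) (≡.sym (flip-flip (+ N) (pad s (x ∷ rho))))))
          (trans (sym (flipped (flip (+ N) (pad s (x ∷ rho))))) (coeff-neg f′ (negated s short))))
          where
          short : length (x ∷ rho) ℕ.≤ s
          short = ℕP.≮⇒≥ (nu ∘ inj₁)
          below : + N ℤ.- + x ℤ.< 0ℤ
          below = ≡.subst (+ N ℤ.- + x ℤ.<_) (ℤP.+-inverseʳ (+ x)) (ℤP.+-monoˡ-< (ℤ.- + x) (ℤ.+<+ (ℕP.≰⇒> (nu ∘ inj₂))))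
          negated : ∀ s → length (x ∷ rho) ℕ.≤ s → Negative (flip (+ N) (pad s (x ∷ rho)))
          negated (suc s) _ = negative zero below
        open Expanded (expand-in U-closed f off-U)
        compP : List ℕ → Λ
        compP rho with length rho ℕ.≤? s
        ... | yes _ = P (comp N s rho)
        ... | no _ = []
        Q : List ℕ → Set
        Q rho = IsPartition rho × U rho
        Q-cong : ∀ {L : Lin (List ℕ)} → All (λ t → Q (proj₂ t)) L → ∀ {φ ψ} → (∀ {rho} → Q rho → φ rho ≈ ψ rho) → ev φ L ≈ ev ψ L
        Q-cong [] e = refl
        Q-cong (u ∷ us) e = +-cong (*-congˡ (e u)) (Q-cong us e)
        comp-coeff : ∀ (ν : Vec ℤ s) {rho} → Q rho → coeff (P rho) (flip (+ N) ν) ≈ coeff (compP rho) ν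
        comp-coeff ν {rho} (p , u) with length rho ℕ.≤? s
        ... | yes le = sym (coeff-comp p le ([ (λ lt → ⊥-elim (ℕP.<⇒≱ lt le)) , (λ h → h) ]′ u) ν)
        ... | no gt = coeff-short p (flip (+ N) ν) (ℕP.≰⇒> gt)
        g : Λ
        g = f′ ++ (- 1#) ⋆ (terms >>= compP)
        ev-g : ∀ φ → ev φ g ≈ ev φ f′ + - ev φ (terms >>= compP)
        ev-g φ = trans (ev-∖ φ f′ 1# (terms >>= compP)) (+-congˡ (-‿cong (*-identityˡ _)))
        coeff-g : ∀ (ν : Vec ℤ s) → coeff g ν ≈ 0#
        coeff-g ν = trans (ev-g _) (x≈y⇒x∙y⁻¹≈ε (begin
          coeff f′ ν                                           ≈⟨ flipped ν ⟩
          coeff f (flip (+ N) ν)                               ≈⟨ trans (same expanded (flip (+ N) ν)) (ev->>= _ terms P) ⟩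
          ev (λ rho → coeff (P rho) (flip (+ N) ν)) terms      ≈⟨ Q-cong names (comp-coeff ν) ⟩
          ev (λ rho → coeff (compP rho) ν) terms               ≈⟨ ev->>= _ terms compP ⟨
          coeff (terms >>= compP) ν                            ∎))
        g-tall : Expanded (λ rho → s ℕ.< length rho) g
        g-tall = expand-in (tall s) g λ {rho} _ nu → trans (sym (cf-pad g (ℕP.≮⇒≥ nu))) (coeff-g (pad s rho))
        ᶜla : List ℕ
        ᶜla = comp N s la
        pᶜ : IsPartition ᶜla
        pᶜ = comp-partition N s la
        pointwise : ∀ {rho} → Q rho → ⟨ P rho ∣ P la ⟩ * ⟨ P ᶜla ∣ P ᶜla ⟩ ≈ ⟨ compP rho ∣ P ᶜla ⟩ * ⟨ P la ∣ P la ⟩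
        pointwise {rho} (p , u) with rho ≟L la | length rho ℕ.≤? s
        ... | yes ≡.refl | yes le = *-comm _ _
        ... | yes ≡.refl | no gt = ⊥-elim (gt l₃)
        ... | no ne | no gt = trans (trans (*-congʳ (orthogonal p p₃ ne)) (zeroˡ _)) (sym (zeroˡ _))
        ... | no ne | yes le = trans (trans (*-congʳ (orthogonal p p₃ ne)) (zeroˡ _)) (sym (trans (*-congʳ (orthogonal (comp-partition N s rho) pᶜ different)) (zeroˡ _)))
          where
          different : comp N s rho ≢ ᶜla
          different e = ne (≡.trans (≡.sym (comp-involutive p le ([ (λ lt → ⊥-elim (ℕP.<⇒≱ lt le)) , (λ h → h) ]′ u))) (≡.trans (≡.cong (comp N s) e) (comp-involutive p₃ l₃ h₃)))

      -- Inverting `s` variables complements every term of the product that has at most `s` rows;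
      -- taller terms vanish there. The complemented expansion therefore agrees with `f′` in `s`
      -- variables only. The discrepancy `g` is spanned by Jack functions with more than `s` rows,
      -- so it is orthogonal to that of the complement of `la`.
      B-comp : B mu ka la ~ B (comp N₁ s mu) (comp N₂ s ka) (comp (N₁ ℕ.+ N₂) s la)
      B-comp = ~-scale (norm≉0 pᶜ) (norm≉0 p₃) (begin
        ⟨ f ∣ P la ⟩ * ⟨ P ᶜla ∣ P ᶜla ⟩
          ≈⟨ *-congʳ (trans (pairing-congˡ (P la) expanded) (pairing->>=ˡ (P la) terms P)) ⟩
        ev (λ rho → ⟨ P rho ∣ P la ⟩) terms * ⟨ P ᶜla ∣ P ᶜla ⟩
          ≈⟨ trans (sym (ev-*ʳ _ _ terms)) (trans (Q-cong names pointwise) (ev-*ʳ _ _ terms)) ⟩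
        ev (λ rho → ⟨ compP rho ∣ P ᶜla ⟩) terms * ⟨ P la ∣ P la ⟩
          ≈⟨ *-congʳ (trans (sym (pairing->>=ˡ (P ᶜla) terms compP)) (sym difference)) ⟩
        ⟨ f′ ∣ P ᶜla ⟩ * ⟨ P la ∣ P la ⟩ ∎)
        where
        difference : ⟨ f′ ∣ P ᶜla ⟩ ≈ ⟨ terms >>= compP ∣ P ᶜla ⟩
        difference = x∙y⁻¹≈ε⇒x≈y _ _ (trans (sym (ev-g (λ x → ev (pair x) (P ᶜla)))) (pairing-outside g-tall pᶜ (ℕP.≤⇒≯ (comp-length N la l₃))))

    P-empty : P [] ≃ single []
    P-empty = ≃-by-partitions go
      where
      nil : IsPartition []
      nil = [] , []
      go : ∀ la → IsPartition la → cf (P []) la ≈ cf (single []) la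
      go [] p = trans (monic nil) (sym (ev-single (λ x → ML x []) []))
      go (zero ∷ la) (() ∷ _ , _)
      go (suc x ∷ la) p = trans (lower-sum nil p λ ()) (sym (trans (ev-single (λ y → ML y (+ suc x ∷ ints la)) []) (zeroˡ _)))

    single-[]-⊛ : ∀ g → single [] ⊛ g ≃ g
    single-[]-⊛ g = mk≃ λ ν → trans (ev-⊛ (λ x → M x ν) (single []) g) (ev-single (λ μ → ev (λ κ → M (μ ++ κ) ν) g) [])

    B-empty : ∀ {ka} → IsPartition ka → ¬ (B [] ka ka ≈ 0#)
    B-empty {ka} p e = norm≉0 p (trans (pairing-congˡ (P ka) (≃-trans (≃-sym (single-[]-⊛ (P ka))) (≃-trans (⊛-comm (single []) (P ka))
      (≃-trans (⊛-congʳ (P ka) (≃-sym P-empty)) (⊛-comm (P ka) (P [])))))) e)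
      where
      ⊛-congʳ : ∀ f {g h} → g ≃ h → f ⊛ g ≃ f ⊛ h
      ⊛-congʳ f {g} {h} e = mk≃ λ ν → trans (coeff-⊛ f g ν) (trans (ev-cong (λ β → same e (ν ⊕ β)) (f >>= expand)) (sym (coeff-⊛ f h ν)))

    -- Complementing twice shrinks the width of the rectangle first to the first part of `ka` and
    -- then to that of `nu`. If these differ, on the way one factor becomes wider than the rectangle
    -- and the product is orthogonal to it. If they agree, both partitions begin with a full row,
    -- `B-row` removes it, and the recursion goes on with one row less, down to the empty
    -- partitions.
    rectangle : ∀ s r nu ka → IsPartition nu → IsPartition ka → length nu ℕ.≤ s → length ka ℕ.≤ s → headOr0 nu ℕ.≤ r →
      (nu ≡ ka → ¬ (B (comp r s nu) ka (rect s r) ≈ 0#)) × (nu ≢ ka → B (comp r s nu) ka (rect s r) ≈ 0#)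
    rectangle s r nu ka pn pk ln lk h = cases (ℕP.<-cmp (headOr0 nu) (headOr0 ka))
      where
      open import Relation.Binary.Definitions using (Tri; tri<; tri≈; tri>)
      r′ = headOr0 nu
      k = headOr0 ka
      Goal : Carrier → Set
      Goal x = (nu ≡ ka → ¬ (x ≈ 0#)) × (nu ≢ ka → x ≈ 0#)
      move : ∀ {x y} → x ~ y → Goal y → Goal x
      move a (g₁ , g₂) = (λ e x0 → g₁ e (to a x0)) , (λ ne → from a (g₂ ne))
      -- B(nu^c, ka; r^s) becomes B(nu, ka^c; k^s), and then B(nu^c, ka; r′^s).
      first : B (comp r s nu) ka (rect s r) ~ B nu (comp k s ka) (rect s k)
      first = ≡.subst₂ (λ x y → B (comp r s nu) ka (rect s r) ~ B x (comp k s ka) y) (comp-involutive pn ln h)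
        (≡.trans (comp-rect (r ℕ.+ k) s r) (≡.cong (rect s) (ℕP.m+n∸m≡n r k)))
        (B-comp {s} {comp r s nu} {ka} {rect s r} {r} {k} (comp-partition r s nu) (comp-length r nu ln) (comp-bounded r s nu) pk lk ℕP.≤-refl
          (rect-partition s r) (rect-length s r) (ℕP.≤-trans (rect-head s r) (ℕP.m≤m+n r k)))
      second : B nu (comp k s ka) (rect s k) ~ B (comp r′ s nu) ka (rect s r′)
      second = ≡.subst₂ (λ x y → B nu (comp k s ka) (rect s k) ~ B (comp r′ s nu) x y) (comp-involutive pk lk ℕP.≤-refl)
        (≡.trans (comp-rect (r′ ℕ.+ k) s k) (≡.cong (rect s) (ℕP.m+n∸n≡m r′ k)))
        (B-comp {s} {nu} {comp k s ka} {rect s k} {r′} {k} pn ln ℕP.≤-refl (comp-partition k s ka) (comp-length k ka lk) (comp-bounded k s ka)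
          (rect-partition s k) (rect-length s k) (ℕP.≤-trans (rect-head s k) (ℕP.m≤n+m k r′)))
      cases : Tri (r′ ℕ.< k) (r′ ≡ k) (k ℕ.< r′) → Goal (B (comp r s nu) ka (rect s r))
      cases (tri< lt ne _) = move (~-trans first second) ((λ e → ⊥-elim (ne (≡.cong headOr0 e))) , λ _ →
        B-wide pk (rect-partition s r′) (ℕP.≤-<-trans (rect-head s r′) lt))
      cases (tri> _ ne gt) = move first ((λ e → ⊥-elim (ne (≡.cong headOr0 e))) , λ _ →
        trans (B-comm nu (comp k s ka) (rect s k)) (B-wide pn (rect-partition s k) (ℕP.≤-<-trans (rect-head s k) gt)))
      cases (tri≈ _ e _) = move (~-trans first second) (strip s nu ka pn pk ln lk e)
        where
        strip : ∀ s nu ka → IsPartition nu → IsPartition ka → length nu ℕ.≤ s → length ka ℕ.≤ s → headOr0 nu ≡ headOr0 ka →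
          (nu ≡ ka → ¬ (B (comp (headOr0 nu) s nu) ka (rect s (headOr0 nu)) ≈ 0#)) × (nu ≢ ka → B (comp (headOr0 nu) s nu) ka (rect s (headOr0 nu)) ≈ 0#)
        strip s [] [] pn pk ln lk e = (λ _ → ≡.subst (λ x → ¬ (B x [] [] ≈ 0#)) (≡.sym (comp-rect 0 s 0)) (B-empty pk)) , (λ ne → ⊥-elim (ne ≡.refl))
        strip s [] (x ∷ ka) pn (p ∷ _ , _) ln lk ≡.refl = ⊥-elim (ℕP.<-irrefl ≡.refl p)
        strip s (x ∷ nu) [] (p ∷ _ , _) pk ln lk ≡.refl = ⊥-elim (ℕP.<-irrefl ≡.refl p)
        strip (suc s) (zero ∷ nu) (y ∷ ka) (() ∷ _ , _)
        -- A full first row of `nu` adds only a zero to its complement, so the first factor stays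
        -- the same while `ka` and the rectangle each lose a row.
        strip (suc s) (suc x ∷ nu) (.(suc x) ∷ ka) pn pk (ℕ.s≤s ln) (ℕ.s≤s lk) ≡.refl =
          ≡.subst (λ m → (suc x ∷ nu ≡ suc x ∷ ka → ¬ (B m (suc x ∷ ka) (rect (suc s) (suc x)) ≈ 0#)) × (suc x ∷ nu ≢ suc x ∷ ka → B m (suc x ∷ ka) (rect (suc s) (suc x)) ≈ 0#))
            (≡.sym comp-strip)
            ((λ eq z → proj₁ ih (ListP.∷-injectiveʳ eq) (to row z)) , (λ ne → from row (proj₂ ih (ne ∘ ≡.cong (suc x ∷_)))))
          where
          comp-strip : comp (suc x) (suc s) (suc x ∷ nu) ≡ comp (suc x) s nu
          comp-strip = ≡.cong (λ z → norm (z ∷ map (suc x ℕ.∸_) (padTo s nu))) (ℕP.n∸n≡0 x)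
          head≤ : ∀ {l} → All (ℕ._≤ suc x) l → headOr0 l ℕ.≤ suc x
          head≤ [] = ℕ.z≤n
          head≤ (b ∷ _) = b
          ih = rectangle s (suc x) nu ka (partition-tail pn) (partition-tail pk) ln lk (head≤ (partition-head pn))
          row : B (comp (suc x) s nu) (suc x ∷ ka) (rect (suc s) (suc x)) ~ B (comp (suc x) s nu) ka (rect s (suc x))
          row = B-row (P (comp (suc x) s nu)) pk (rect-partition (suc s) (suc x))

  -- The scalar product of power-sum products

  ∂-constant : ∀ m ν (φ : Mono → Carrier) v → (∀ ξ → ν ↭ m ∷ ξ → φ ξ ≈ v) → ev φ (∂ m ν) ≈ ι (+ mult m ν) * v
  ∂-constant m [] φ v h = sym (zeroˡ v)
  ∂-constant m (n ∷ ν) φ v h = trans (ev-∂ φ m n ν) (trans (+-congˡ (∂-constant m ν (φ ∘ (n ∷_)) v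
      (λ ξ p → h (n ∷ ξ) (↭.trans (↭.prep n p) (↭.swap n m ↭.refl))))) (count (m ℕ.≟ n)))
    where
    count : Dec (m ≡ n) → δ m n * φ ν + ι (+ mult m ν) * v ≈ ι (+ mult m (n ∷ ν)) * v
    count (yes ≡.refl) = trans (+-cong (trans (*-congʳ (δ-refl m)) (trans (*-identityˡ _) (h ν ↭.refl))) refl)
      (trans (solve 2 (λ k v → v :+ k :* v := (con (+ 1) :+ k) :* v) refl _ _) (*-congʳ (trans (+-congʳ ι-1) (reflexive (≡.cong (λ k → ι (+ k)) (≡.sym (mult-∷-same m ν)))))))
    count (no ne) = trans (+-congʳ (trans (*-congʳ (δ-≢ ne)) (zeroˡ _))) (trans (+-identityˡ _) (*-congʳ (reflexive (≡.cong (λ k → ι (+ k)) (≡.sym (mult-∷-other ν ne))))))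

  pair-off : ∀ μ ν → ¬ (μ ↭ ν) → pair μ ν ≈ 0#
  pair-off [] [] np = ⊥-elim (np ↭.refl)
  pair-off [] (n ∷ ν) np = refl
  pair-off (m ∷ μ) ν np = trans (*-congˡ (trans (∂-constant m ν (pair μ) 0# (λ ξ p → pair-off μ ξ (λ q → np (↭.trans (↭.prep m q) (↭.↭-sym p))))) (zeroʳ _))) (zeroʳ _)

  pair-↭ʳ : ∀ μ {ν ξ} → ν ↭ ξ → pair μ ν ≈ pair μ ξ
  pair-↭ʳ μ {ν} {ξ} p = trans (sym (ev-single (pair μ) ν)) (trans (pair-≃ μ {single ν} {single ξ}
    (mk≃ λ z → trans (ev-single (λ x → M x z) ν) (trans (M-mono-↭ p z) (sym (ev-single (λ x → M x z) ξ))))) (ev-single (pair μ) ξ))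

  pair-↭ : ∀ {μ μ′ ν ν′} → μ ↭ μ′ → ν ↭ ν′ → pair μ ν ≈ pair μ′ ν′
  pair-↭ {μ} {μ′} {ν} {ν′} p q = trans (pair-↭ʳ μ q) (trans (pair-sym μ ν′) (trans (pair-↭ʳ ν′ p) (pair-sym ν′ μ′)))

  infixr 8 _^′_
  _^′_ : Carrier → ℕ → Carrier
  x ^′ zero = 1#
  x ^′ suc n = x * x ^′ n

  mult-suc : ∀ m μ → mult (suc m) (map suc μ) ≡ mult m μ
  mult-suc m [] = ≡.refl
  mult-suc m (n ∷ μ) with m ℕ.≟ n
  ... | yes ≡.refl = ≡.trans (mult-∷-same (suc m) (map suc μ)) (≡.trans (≡.cong suc (mult-suc m μ)) (≡.sym (mult-∷-same m μ)))
  ... | no ne = ≡.trans (mult-∷-other (map suc μ) (ne ∘ ℕP.suc-injective)) (≡.trans (mult-suc m μ) (≡.sym (mult-∷-other μ ne)))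

  pair-diagonal : ∀ μ → pair μ μ ≈ ι (+ weights (map suc μ) (distinct (map suc μ))) * α ^′ length μ
  pair-diagonal [] = sym (trans (*-identityʳ _) ι-1)
  pair-diagonal (m ∷ μ) = begin
    ⟦ m ⟧ * α * ev (pair μ) (∂ m (m ∷ μ))
      ≈⟨ *-congˡ (∂-constant m (m ∷ μ) (pair μ) (pair μ μ) (λ ξ p → pair-↭ʳ μ (↭.↭-sym (↭P.drop-∷ p)))) ⟩
    ⟦ m ⟧ * α * (ι (+ k) * pair μ μ)
      ≈⟨ *-congˡ (*-congˡ (pair-diagonal μ)) ⟩
    ⟦ m ⟧ * α * (ι (+ k) * (ι (+ w) * α ^′ length μ))
      ≈⟨ solve 5 (λ m a k w p → m :* a :* (k :* (w :* p)) := (m :* k) :* w :* (a :* p)) refl _ _ _ _ _ ⟩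
    (⟦ m ⟧ * ι (+ k)) * ι (+ w) * (α * α ^′ length μ)
      ≈⟨ *-congʳ (sym (trans (reflexive (≡.cong (λ n → ι (+ n)) weight≡)) (trans (reflexive (≡.cong ι (ℤP.pos-* (suc m ℕ.* k) w))) (trans (ι-* (+ (suc m ℕ.* k)) (+ w)) (*-congʳ (trans (reflexive (≡.cong ι (ℤP.pos-* (suc m) k))) (ι-* (+ suc m) (+ k)))))))) ⟩
    ι (+ weights (map suc (m ∷ μ)) (distinct (map suc (m ∷ μ)))) * α ^′ length (m ∷ μ) ∎
    where
    k = mult m (m ∷ μ)
    w = weights (map suc μ) (distinct (map suc μ))
    weight≡ : weights (map suc (m ∷ μ)) (distinct (map suc (m ∷ μ))) ≡ suc m ℕ.* k ℕ.* w
    weight≡ = ≡.trans (zee-∷ (suc m) (map suc μ)) (≡.cong (λ j → suc m ℕ.* j ℕ.* w) (mult-suc m (m ∷ μ)))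

  module JackAdjoint {P : List ℕ → Λ} (isJack : IsJack P) where
    open JackProducts isJack public

    rectOf≡rect : ∀ {la} → IsPartition la → rectOf la ≡ rect (length la) (headOr0 la)
    rectOf≡rect {[]} p = ≡.refl
    rectOf≡rect {suc x ∷ la} p = ≡.refl
    rectOf≡rect {zero ∷ la} (() ∷ _ , _)

    -- Q_{R -' la}* applied to Q_R is a nonzero multiple of Q_la.
    adjoint-rectangle : ∀ {la} → IsPartition la →
      Σ Carrier λ b → ¬ (b ≈ 0#) × (∀ k → ⟨ P (comp (headOr0 la) (length la) la) ⊛ k ∣ P (rectOf la) ⟩ ≈ b * ⟨ k ∣ P la ⟩)
    adjoint-rectangle {la} p = b , *-nonzero N⁻¹≉0 (proj₁ (product la p ℕP.≤-refl) ≡.refl) , λ k → begin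
        ⟨ f ⊛ k ∣ g ⟩
          ≈⟨ trans (pairing-star f k g) (trans (pairing-congˡ (starΛ f g) (Expanded.expanded (expand-all k))) (pairing->>=ˡ (starΛ f g) (terms k) P)) ⟩
        ev (λ ka → ⟨ P ka ∣ starΛ f g ⟩) (terms k)
          ≈⟨ names-cong (Expanded.names (expand-all k)) (λ {ka} q → trans (sym (pairing-star f (P ka) g)) (pointwise q)) ⟩
        ev (λ ka → b * ⟨ P ka ∣ P la ⟩) (terms k)
          ≈⟨ trans (ev-* b _ (terms k)) (*-congˡ (trans (sym (pairing->>=ˡ (P la) (terms k) P)) (pairing-congˡ (P la) (≃-sym (Expanded.expanded (expand-all k)))))) ⟩
        b * ⟨ k ∣ P la ⟩ ∎
      where
      n = length la
      r = headOr0 la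
      mu = comp r n la
      f g : Λ
      f = P mu
      g = P (rectOf la)
      terms : Λ → Lin (List ℕ)
      terms k = Expanded.terms (expand-all k)
      N = ⟨ P la ∣ P la ⟩
      N⁻¹ = proj₁ (inverse N (norm≉0 p))
      N⁻¹≉0 : ¬ (N⁻¹ ≈ 0#)
      N⁻¹≉0 e = 1≉0 (trans (sym (proj₂ (inverse N (norm≉0 p)))) (trans (*-congʳ e) (zeroˡ _)))
      -- Forced by the case in which `k` is `P la`; on every other Jack function both sides vanish.
      b = N⁻¹ * ⟨ f ⊛ P la ∣ g ⟩
      product : ∀ ka → IsPartition ka → length ka ℕ.≤ n → (la ≡ ka → ¬ (⟨ f ⊛ P ka ∣ g ⟩ ≈ 0#)) × (la ≢ ka → ⟨ f ⊛ P ka ∣ g ⟩ ≈ 0#)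
      product ka q le = ≡.subst (λ R → (la ≡ ka → ¬ (⟨ f ⊛ P ka ∣ P R ⟩ ≈ 0#)) × (la ≢ ka → ⟨ f ⊛ P ka ∣ P R ⟩ ≈ 0#)) (≡.sym (rectOf≡rect p))
        (rectangle n r la ka p q ℕP.≤-refl le ℕP.≤-refl)
      names-cong : ∀ {Q : List ℕ → Set} {L : Lin (List ℕ)} → All (λ t → IsPartition (proj₂ t) × Q (proj₂ t)) L → ∀ {φ ψ} → (∀ {ka} → IsPartition ka → φ ka ≈ ψ ka) → ev φ L ≈ ev ψ L
      names-cong [] e = refl
      names-cong ((q , _) ∷ qs) e = +-cong (*-congˡ (e q)) (names-cong qs e)
      pointwise : ∀ {ka} → IsPartition ka → ⟨ f ⊛ P ka ∣ g ⟩ ≈ b * ⟨ P ka ∣ P la ⟩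
      pointwise {ka} q = cases (la ≟L ka) (length ka ℕ.≤? n)
        where
        cases : Dec (la ≡ ka) → Dec (length ka ℕ.≤ n) → ⟨ f ⊛ P ka ∣ g ⟩ ≈ b * ⟨ P ka ∣ P la ⟩
        cases (yes ≡.refl) _ = sym (trans (solve 3 (λ i x n → (i :* x) :* n := (i :* n) :* x) refl N⁻¹ ⟨ f ⊛ P la ∣ g ⟩ N)
          (trans (*-congʳ (proj₂ (inverse N (norm≉0 p)))) (*-identityˡ _)))
        cases (no ne) (yes le) = trans (proj₂ (product ka q le) ne) (sym (trans (*-congˡ (orthogonal q p (ne ∘ ≡.sym))) (zeroʳ b)))
        -- With more than `n` rows the reduction in `n` variables does not apply, but the product is
        -- then orthogonal to P_R by height alone.
        cases (no ne) (no gt) = trans (≡.subst (λ R → ⟨ f ⊛ P ka ∣ P R ⟩ ≈ 0#) (≡.sym (rectOf≡rect p)) (B-tall q (rect-partition n r) (rect-length n r) (ℕP.≰⇒> gt)))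
          (sym (trans (*-congˡ (orthogonal q p (ne ∘ ≡.sym))) (zeroʳ b)))

  -- Power sums of the statement

  -- The statement indexes power sums by arbitrary lists in which zeros are ignored; the result is
  -- unsorted, and order is dealt with by permutation invariance.
  enc : List ℕ → Mono
  enc [] = []
  enc (zero ∷ μ) = enc μ
  enc (suc n ∷ μ) = n ∷ enc μ

  enc-++ : ∀ μ ν → enc (μ ++ ν) ≡ enc μ ++ enc ν
  enc-++ [] ν = ≡.refl
  enc-++ (zero ∷ μ) ν = enc-++ μ ν
  enc-++ (suc n ∷ μ) ν = ≡.cong (n ∷_) (enc-++ μ ν)

  suc-enc : ∀ μ → map suc (enc μ) ≡ positive μ
  suc-enc [] = ≡.refl
  suc-enc (zero ∷ μ) = suc-enc μ
  suc-enc (suc n ∷ μ) = ≡.cong (suc n ∷_) (suc-enc μ)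

  enc-↭ : ∀ {μ ν} → μ ↭ ν → enc μ ↭ enc ν
  enc-↭ ↭.refl = ↭.refl
  enc-↭ (↭.prep zero p) = enc-↭ p
  enc-↭ (↭.prep (suc n) p) = ↭.prep n (enc-↭ p)
  enc-↭ (↭.swap zero zero p) = enc-↭ p
  enc-↭ (↭.swap zero (suc n) p) = ↭.prep n (enc-↭ p)
  enc-↭ (↭.swap (suc m) zero p) = ↭.prep m (enc-↭ p)
  enc-↭ (↭.swap (suc m) (suc n) p) = ↭.swap m n (enc-↭ p)
  enc-↭ (↭.trans p q) = ↭.trans (enc-↭ p) (enc-↭ q)

  enc-positive : ∀ μ → enc (positive μ) ≡ enc μ
  enc-positive [] = ≡.refl
  enc-positive (zero ∷ μ) = enc-positive μ
  enc-positive (suc n ∷ μ) = ≡.cong (n ∷_) (enc-positive μ)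

  enc-norm : ∀ μ → enc (norm μ) ↭ enc μ
  enc-norm μ = ≡.subst (enc (norm μ) ↭_) (enc-positive μ) (enc-↭ (norm-↭ μ))

  suc-enc-norm : ∀ μ → map suc (enc (norm μ)) ≡ norm μ
  suc-enc-norm μ = ≡.trans (suc-enc (norm μ)) (positive-partition (norm-partition μ))

  encS : Lin (List ℕ) → Λ
  encS = mapL enc

  total-of : List Carrier → Carrier
  total-of = foldr _+_ 0#

  total-ev : ∀ {A : Set} (φ : A → Carrier) (f : Lin A) → total-of (map (λ t → proj₁ t * φ (proj₂ t)) f) ≡ ev φ f
  total-ev φ [] = ≡.refl
  total-ev φ ((c , a) ∷ f) = ≡.cong (λ x → c * φ a + x) (total-ev φ f)

  total-++ : ∀ a b → total-of (a ++ b) ≈ total-of a + total-of b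
  total-++ [] b = sym (+-identityˡ (total-of b))
  total-++ (x ∷ a) b = trans (+-congˡ (total-++ a b)) (sym (+-assoc x (total-of a) (total-of b)))

  total-bilinear : ∀ {A : Set} (φ : A → A → Carrier) (f g : Lin A) →
    total-of (concatMap (λ t → map (λ u → proj₁ t * proj₁ u * φ (proj₂ t) (proj₂ u)) g) f) ≈ ev (λ x → ev (φ x) g) f
  total-bilinear {A} φ [] g = refl
  total-bilinear {A} φ ((c , x) ∷ f) g = trans (total-++ (row g) _) (+-cong (total-row g) (total-bilinear φ f g))
    where
    row : Lin A → List Carrier
    row = map (λ u → c * proj₁ u * φ x (proj₂ u))
    total-row : ∀ g → total-of (row g) ≈ c * ev (φ x) g
    total-row [] = sym (zeroʳ c)
    total-row ((d , y) ∷ g) = trans (+-cong (*-assoc c d (φ x y)) (total-row g)) (sym (distribˡ c (d * φ x y) (ev (φ x) g)))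

  total-select-⋆ : ∀ {A : Set} (sel : A → Bool) c (f : Lin A) →
    total-of (map (λ t → if sel (proj₂ t) then proj₁ t else 0#) (c ⋆ f)) ≈ c * total-of (map (λ t → if sel (proj₂ t) then proj₁ t else 0#) f)
  total-select-⋆ sel c [] = sym (zeroʳ c)
  total-select-⋆ sel c ((d , a) ∷ f) = trans (+-cong (select (sel a)) (total-select-⋆ sel c f)) (sym (distribˡ c _ _))
    where
    select : ∀ b → (if b then c * d else 0#) ≈ c * (if b then d else 0#)
    select true = refl
    select false = sym (zeroʳ c)

  ev-encS : ∀ φ f → ev φ (encS f) ≈ ev (φ ∘ enc) f
  ev-encS φ f = ev-map φ enc f

  step : ℕ → List ℕ → ℕ → List ℕ → List ℕ → ℕ
  step m μ c after before = if m ≤ᵇ c then countFill μ (reverse before ++ (c ∸ m) ∷ after) else 0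

  -- A top-level copy of the local loop of `countFill`, about which inductions can be stated. The
  -- two recursion equations identify it with the loop.
  fillings : ℕ → List ℕ → List ℕ → List ℕ → ℕ
  fillings m μ [] before = 0
  fillings m μ (c ∷ after) before = step m μ c after before ℕ.+ fillings m μ after (c ∷ before)

  fillings-unique : ∀ m μ (g : List ℕ → List ℕ → ℕ) → (∀ b → g [] b ≡ 0) →
    (∀ c a b → g (c ∷ a) b ≡ step m μ c a b ℕ.+ g a (c ∷ b)) → ∀ a b → g a b ≡ fillings m μ a b
  fillings-unique m μ g h₀ h₁ [] b = h₀ b
  fillings-unique m μ g h₀ h₁ (c ∷ a) b = ≡.trans (h₁ c a b) (≡.cong (step m μ c a b ℕ.+_) (fillings-unique m μ g h₀ h₁ a (c ∷ b)))

  -- The local loop of countFill has no name, but unification can supply it once its arguments are variables.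
  mutual
    loop : ℕ → List ℕ → List ℕ → List ℕ → List ℕ → ℕ
    loop = _

    countFill-fillings : ∀ m μ caps → countFill (m ∷ μ) caps ≡ fillings m μ caps []
    countFill-fillings m μ [] = ≡.refl
    countFill-fillings m μ (c ∷ after) with c ∷ after | List ℕ ∋ c ∷ []
    ... | whole | before = ≡.cong (step m μ c after [] ℕ.+_) (fillings-unique m μ (loop m μ whole) (λ b → ≡.refl) (λ c a b → ≡.refl) after before)

  ints-++ : ∀ a b → ints (a ++ b) ≡ ints a ++ ints b
  ints-++ a b = ListP.map-++ (λ n → + n) a b

  ML-neg : ∀ κ l n r → ML κ (l ++ -[1+ n ] ∷ r) ≈ 0#
  ML-neg κ l n r = ≡.subst (λ k → ML κ k ≈ 0#) (VecP.toList∘fromList (l ++ -[1+ n ] ∷ r))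
    (trans (sym (M-toList κ (Vec.fromList (l ++ -[1+ n ] ∷ r)))) (M-neg κ (negated l)))
    where
    negated : ∀ l → Negative (Vec.fromList (l ++ -[1+ n ] ∷ r))
    negated [] = negative zero ℤ.-<+
    negated (z ∷ l) with negated l
    ... | negative i lt = negative (suc i) lt

  -- Both sides take one part away from one exponent. Where the test in `step` fails and contributes
  -- zero, the exponent on the other side becomes negative and `ML` vanishes.
  countFill-ML : ∀ κ caps → ι (+ countFill (map suc κ) caps) ≈ ML κ (ints caps)
  fillings-ML : ∀ m κ after before → ι (+ fillings (suc m) (map suc κ) after before) ≈ ev (λ x → ML κ (ints (reverse before) ++ x)) (shifts (ℤ.- part m) (ints after))
  countFill-ML [] caps = base (all? (ℕ._≟ 0) caps) caps ≡.refl
    where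
    base : ∀ {caps′} (d : Dec (All (_≡ 0) caps′)) caps → caps′ ≡ caps → ι (+ (if does d then 1 else 0)) ≈ ML [] (ints caps)
    base (yes a) caps ≡.refl = trans ι-1 (sym (ones a))
      where
      ones : ∀ {caps} → All (_≡ 0) caps → ML [] (ints caps) ≈ 1#
      ones [] = refl
      ones (≡.refl ∷ a) = trans (*-identityˡ _) (ones a)
    base (no na) caps ≡.refl = sym (zeros caps na)
      where
      zeros : ∀ caps → ¬ All (_≡ 0) caps → ML [] (ints caps) ≈ 0#
      zeros [] na = ⊥-elim (na [])
      zeros (zero ∷ caps) na = trans (*-identityˡ _) (zeros caps (λ a → na (≡.refl ∷ a)))
      zeros (suc c ∷ caps) na = zeroˡ _
  countFill-ML (m ∷ κ) caps = trans (reflexive (≡.cong (λ n → ι (+ n)) (countFill-fillings (suc m) (map suc κ) caps))) (fillings-ML m κ caps [])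
  fillings-ML m κ [] before = refl
  fillings-ML m κ (c ∷ after) before = trans (ι-+ (+ step (suc m) (map suc κ) c after before) (+ fillings (suc m) (map suc κ) after (c ∷ before)))
    (+-cong (trans (one (suc m ≤ᵇ c) ≡.refl) (sym (*-identityˡ _)))
      (trans (fillings-ML m κ after (c ∷ before)) (trans (ev-cong (λ x → reflexive (≡.cong (ML κ) (≡.trans (≡.cong (λ l → ints l ++ x) (ListP.unfold-reverse c before))
        (≡.trans (≡.cong (_++ x) (ints-++ (reverse before) (c ∷ []))) (ListP.++-assoc (ints (reverse before)) (+ c ∷ []) x))))) (shifts (ℤ.- part m) (ints after)))
        (sym (ev-map (λ x → ML κ (ints (reverse before) ++ x)) (+ c ∷_) (shifts (ℤ.- part m) (ints after)))))))
    where
    one : ∀ b → (suc m ≤ᵇ c) ≡ b → ι (+ (if b then countFill (map suc κ) (reverse before ++ (c ∸ suc m) ∷ after) else 0)) ≈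
      ML κ (ints (reverse before) ++ (+ c ℤ.+ (ℤ.- part m)) ∷ ints after)
    one true e = trans (countFill-ML κ (reverse before ++ (c ∸ suc m) ∷ after)) (reflexive (≡.cong (ML κ) (≡.trans (ints-++ (reverse before) _)
      (≡.cong (λ z → ints (reverse before) ++ z ∷ ints after) (≡.sym (≡.trans (ℤP.m-n≡m⊖n c (suc m)) (ℤP.⊖-≥ (ℕP.≤ᵇ⇒≤ (suc m) c (≡.subst Bool.T (≡.sym e) tt)))))))))
    one false e = sym (trans (reflexive (≡.cong (λ z → ML κ (ints (reverse before) ++ z ∷ ints after)) (below c m (ℕP.≰⇒> λ le → ≡.subst Bool.T e (ℕP.≤⇒≤ᵇ le)))))
      (ML-neg κ (ints (reverse before)) (m ∸ c) (ints after)))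
      where
      below : ∀ c m → c ℕ.< suc m → + c ℤ.+ (ℤ.- part m) ≡ -[1+ m ∸ c ]
      below c m lt = ≡.trans (ℤP.m-n≡m⊖n c (suc m)) (≡.trans (ℤP.⊖-< lt) (≡.cong (λ k → ℤ.- (+ k)) (ℕP.+-∸-assoc 1 (ℕ.s≤s⁻¹ lt))))

  ML-mono : ∀ {κ κ′} la → κ ↭ κ′ → ML κ (ints la) ≈ ML κ′ (ints la)
  ML-mono {κ} {κ′} la p = ≡.subst (λ l → ML κ l ≈ ML κ′ l) (toList-vec la) (trans (sym (M-toList κ (vec la))) (trans (M-mono-↭ p (vec la)) (M-toList κ′ (vec la))))

  countFill-norm : ∀ μ la → ι (+ countFill (norm μ) la) ≈ ML (enc μ) (ints la)
  countFill-norm μ la = begin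
    ι (+ countFill (norm μ) la)                    ≡⟨ ≡.cong (λ k → ι (+ countFill k la)) (≡.sym (suc-enc-norm μ)) ⟩
    ι (+ countFill (map suc (enc (norm μ))) la)    ≈⟨ countFill-ML (enc (norm μ)) la ⟩
    ML (enc (norm μ)) (ints la)                    ≈⟨ ML-mono la (enc-norm μ) ⟩
    ML (enc μ) (ints la)                           ∎

  pair-same : ∀ μ ν → norm μ ≡ norm ν → pair (enc μ) (enc ν) ≈ ι (+ zee (norm μ)) * α ^′ length (norm μ)
  pair-same μ ν e = begin
    pair (enc μ) (enc ν)
      ≈⟨ pair-↭ (↭.↭-sym (enc-norm μ)) (↭.↭-sym (≡.subst (_↭ enc ν) (≡.cong enc (≡.sym e)) (enc-norm ν))) ⟩
    pair σ σ
      ≈⟨ pair-diagonal σ ⟩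
    ι (+ weights (map suc σ) (distinct (map suc σ))) * α ^′ length σ
      ≡⟨ ≡.cong₂ (λ k n → ι (+ k) * α ^′ n) (≡.trans (≡.cong (λ l → weights l (distinct l)) (suc-enc-norm μ)) (≡.sym (zee-partition (norm-partition μ))))
           (≡.trans (≡.sym (ListP.length-map suc σ)) (≡.cong length (suc-enc-norm μ))) ⟩
    ι (+ zee (norm μ)) * α ^′ length (norm μ) ∎
    where
    σ : Mono
    σ = enc (norm μ)

  pair-different : ∀ μ ν → norm μ ≢ norm ν → pair (enc μ) (enc ν) ≈ 0#
  pair-different μ ν ne = pair-off (enc μ) (enc ν) λ p → ne (norm-cong-↭ {μ} {ν} (≡.subst₂ _↭_ (suc-enc μ) (suc-enc ν) (↭P.map⁺ suc p)))

  encS-⋆ : ∀ c f → encS (c ⋆ f) ≡ c ⋆ encS f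
  encS-⋆ c [] = ≡.refl
  encS-⋆ c (t ∷ f) = ≡.cong (_ ∷_) (encS-⋆ c f)

  encS-product : ∀ f g → encS (concatMap (λ t → map (λ u → proj₁ t * proj₁ u , proj₂ t ++ proj₂ u) g) f) ≡ encS f ⊛ encS g
  encS-product [] g = ≡.refl
  encS-product ((c , μ) ∷ f) g = ≡.trans (ListP.map-++ _ (map (λ u → c * proj₁ u , μ ++ proj₂ u) g) _) (≡.cong₂ _++_ (row g) (encS-product f g))
    where
    row : ∀ g → encS (map (λ u → c * proj₁ u , μ ++ proj₂ u) g) ≡ c ⋆ mapL (enc μ ++_) (encS g)
    row [] = ≡.refl
    row ((d , ν) ∷ g) = ≡.cong₂ _∷_ (≡.cong (c * d ,_) (enc-++ μ ν)) (row g)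

  pairing-scale : ∀ a b f k g → ⟨ (a ⋆ f) ⊛ k ∣ b ⋆ g ⟩ ≈ a * (b * ⟨ f ⊛ k ∣ g ⟩)
  pairing-scale a b f k g = begin
    ⟨ (a ⋆ f) ⊛ k ∣ b ⋆ g ⟩
      ≈⟨ ev->>= (λ x → ev (pair x) (b ⋆ g)) (a ⋆ f) _ ⟩
    ev (λ μ → ev (λ x → ev (pair x) (b ⋆ g)) (mapL (μ ++_) k)) (a ⋆ f)
      ≈⟨ ev-⋆ _ a f ⟩
    a * ev (λ μ → ev (λ x → ev (pair x) (b ⋆ g)) (mapL (μ ++_) k)) f
      ≈⟨ *-congˡ (ev->>= (λ x → ev (pair x) (b ⋆ g)) f _) ⟨
    a * ⟨ f ⊛ k ∣ b ⋆ g ⟩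
      ≈⟨ *-congˡ (trans (ev-cong (λ x → ev-⋆ (pair x) b g) (f ⊛ k)) (ev-* b (λ x → ev (pair x) g) (f ⊛ k))) ⟩
    a * (b * ⟨ f ⊛ k ∣ g ⟩) ∎

  ⋆-⋆ : ∀ φ a b (f : Λ) → ev φ (a ⋆ b ⋆ f) ≈ (a * b) * ev φ f
  ⋆-⋆ φ a b f = trans (ev-⋆ φ a (b ⋆ f)) (trans (*-congˡ (ev-⋆ φ b f)) (sym (*-assoc a b (ev φ f))))

  module JackScaled {P : List ℕ → Λ} (isJack : IsJack P) where
    open JackAdjoint isJack public

    -- The scalars `m`, `r` and `n` turn P into Q for the complement, the rectangle and `la`; `a` is
    -- the multiple inherited from the inner part of the nested expression.
    adjoint-scaled : ∀ {la} → IsPartition la → ∀ {a m r n} → ¬ (a ≈ 0#) → ¬ (m ≈ 0#) → ¬ (r ≈ 0#) → n * ⟨ P la ∣ P la ⟩ ≈ 1# →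
      Σ Carrier λ b → ¬ (b ≈ 0#) × (∀ k → ⟨ (a ⋆ m ⋆ P (compl la)) ⊛ k ∣ r ⋆ P (rectOf la) ⟩ ≈ ⟨ k ∣ b ⋆ n ⋆ P la ⟩)
    adjoint-scaled {la} p {a} {m} {r} {n} a≉0 m≉0 r≉0 inv = b , *-nonzero (*-nonzero (*-nonzero a≉0 m≉0) (*-nonzero r≉0 β≉0)) (norm≉0 p) , λ k → begin
        ⟨ (a ⋆ m ⋆ P mu) ⊛ k ∣ r ⋆ P R ⟩
          ≈⟨ pairing-scale a r (m ⋆ P mu) k (P R) ⟩
        a * (r * ⟨ (m ⋆ P mu) ⊛ k ∣ P R ⟩)
          ≈⟨ *-congˡ (*-congˡ (trans (trans (trans (ev->>= (λ x → ev (pair x) (P R)) (m ⋆ P mu) _) (ev-⋆ _ m (P mu))) (*-congˡ (sym (ev->>= (λ x → ev (pair x) (P R)) (P mu) _)))) (*-congˡ (rectangular k)))) ⟩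
        a * (r * (m * (β * x k)))
          ≈⟨ solve 5 (λ a q m b x → a :* (q :* (m :* (b :* x))) := (a :* m :* (q :* b)) :* x) refl a r m β (x k) ⟩
        (a * m * (r * β)) * x k
          ≈⟨ *-congˡ (trans (sym (*-identityˡ (x k))) (*-congʳ (sym inv))) ⟩
        (a * m * (r * β)) * ((n * N) * x k)
          ≈⟨ solve 4 (λ c q n x → c :* ((q :* n) :* x) := ((c :* n) :* q) :* x) refl (a * m * (r * β)) n N (x k) ⟩
        (b * n) * x k
          ≈⟨ sym (trans (ev-cong (λ y → ⋆-⋆ (pair y) b n (P la)) k) (ev-* (b * n) _ k)) ⟩
        ⟨ k ∣ b ⋆ n ⋆ P la ⟩ ∎
      where
      mu R : List ℕ
      mu = compl la
      R = rectOf la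
      N β b : Carrier
      N = ⟨ P la ∣ P la ⟩
      β = proj₁ (adjoint-rectangle p)
      b = a * m * (r * β) * N
      β≉0 : ¬ (β ≈ 0#)
      β≉0 = proj₁ (proj₂ (adjoint-rectangle p))
      x : Λ → Carrier
      x k = ⟨ k ∣ P la ⟩
      rectangular : ∀ k → ⟨ P mu ⊛ k ∣ P R ⟩ ≈ β * ⟨ k ∣ P la ⟩
      rectangular k = ≡.subst (λ m → ⟨ P m ⊛ k ∣ P R ⟩ ≈ β * ⟨ k ∣ P la ⟩) (≡.sym (complementIn-norm (headOr0 la) (length la) p)) (proj₂ (proj₂ (adjoint-rectangle p)) k)

  record Conventions : Set where
    field
      nat : ℕ → Carrier
      nat-ι : ∀ n → ι (+ n) ≈ nat n
      power : ℕ → Carrier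
      power-^ : ∀ n → power n ≡ α ^′ n
      inv : Carrier → Carrier
      inv-inverse : ∀ x → ¬ (x ≈ 0#) → inv x * x ≈ 1#

  -- The notions of the statement over an arbitrary field, with nat, power and inv in place of ℕtoF, powF αF and invF.
  module PowerSums (conventions : Conventions) where

    open Conventions conventions

    PSum : Set
    PSum = Lin (List ℕ)

    coefficientM : List ℕ → PSum → Carrier
    coefficientM la f = total-of (map (λ t → proj₁ t * nat (countFill (norm (proj₂ t)) la)) f)

    coefficientP : List ℕ → PSum → Carrier
    coefficientP ν f = total-of (map (λ t → if does (ListP.≡-dec ℕ._≟_ (norm (proj₂ t)) ν) then proj₁ t else 0#) f)

    pairPS : List ℕ → List ℕ → Carrier
    pairPS μ ν = if does (ListP.≡-dec ℕ._≟_ (norm μ) (norm ν)) then nat (zee (norm μ)) * power (length (norm μ)) else 0#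

    ⟪_,_⟫ : PSum → PSum → Carrier
    ⟪ f , g ⟫ = total-of (concatMap (λ t → map (λ u → proj₁ t * proj₁ u * pairPS (proj₂ t) (proj₂ u)) g) f)

    infixl 7 _⊠_
    _⊠_ : PSum → PSum → PSum
    f ⊠ g = concatMap (λ t → map (λ u → proj₁ t * proj₁ u , proj₂ t ++ proj₂ u) g) f

    JackFamily : (List ℕ → PSum) → Set
    JackFamily P =
      (∀ la → IsPartition la → coefficientM la (P la) ≈ 1#) ×
      (∀ la μ → IsPartition la → IsPartition μ → μ ≢ la → ¬ Dominated μ la → coefficientM μ (P la) ≈ 0#) ×
      (∀ la μ → IsPartition la → IsPartition μ → la ≢ μ → ⟪ P la , P μ ⟫ ≈ 0#)

    dual : (List ℕ → PSum) → List ℕ → PSum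
    dual P la = inv ⟪ P la , P la ⟫ ⋆ P la

    AdjointApp : PSum → PSum → PSum → Set
    AdjointApp f g h = ∀ k → ⟪ f ⊠ k , g ⟫ ≈ ⟪ k , h ⟫

    infix 4 _≈ᴾ_
    _≈ᴾ_ : PSum → PSum → Set
    f ≈ᴾ g = ∀ ν → coefficientP ν f ≈ coefficientP ν g

    Nested : List PSum → PSum → Set
    Nested [] g = ⊥
    Nested (f ∷ []) g = g ≈ᴾ f
    Nested (f ∷ f′ ∷ fs) g = Σ PSum λ g′ → Nested (f′ ∷ fs) g′ × AdjointApp g′ f g

    coefficientM-cf : ∀ la f → coefficientM la f ≈ cf (encS f) la
    coefficientM-cf la f = trans (reflexive (total-ev (λ μ → nat (countFill (norm μ) la)) f))
      (trans (ev-cong (λ μ → trans (sym (nat-ι (countFill (norm μ) la))) (countFill-norm μ la)) f)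
      (sym (ev-encS (λ x → ML x (ints la)) f)))

    pairPS-pair : ∀ μ ν → pairPS μ ν ≈ pair (enc μ) (enc ν)
    pairPS-pair μ ν with ListP.≡-dec ℕ._≟_ (norm μ) (norm ν)
    ... | yes e = sym (trans (pair-same μ ν e) (*-cong (nat-ι (zee (norm μ))) (reflexive (≡.sym (power-^ (length (norm μ)))))))
    ... | no ne = sym (pair-different μ ν ne)

    pairing-encS : ∀ f g → ⟪ f , g ⟫ ≈ ⟨ encS f ∣ encS g ⟩
    pairing-encS f g = trans (total-bilinear pairPS f g) (sym (trans (ev-encS (λ x → ev (pair x) (encS g)) f)
      (ev-cong (λ μ → trans (ev-encS (pair (enc μ)) g) (ev-cong (λ ν → sym (pairPS-pair μ ν)) g)) f)))

    encoded : (P : List ℕ → PSum) → JackFamily P → IsJack (λ la → encS (P la))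
    encoded P (monic , lower , orthogonal) = record
      { monic = λ {la} p → trans (sym (coefficientM-cf la (P la))) (monic la p)
      ; lower = λ {la} {mu} p q ne nd → trans (sym (coefficientM-cf mu (P la))) (lower la mu p q ne nd)
      ; orthogonal = λ {la} {mu} p q ne → trans (sym (pairing-encS (P la) (P mu))) (orthogonal la mu p q ne) }

    coefficientP-⋆ : ∀ c f ν → coefficientP ν (c ⋆ f) ≈ c * coefficientP ν f
    coefficientP-⋆ c f ν = total-select-⋆ (λ μ → does (ListP.≡-dec ℕ._≟_ (norm μ) ν)) c f

    module Filtration (P : List ℕ → PSum) (jack : JackFamily P) where

      open JackScaled (encoded P jack)

      N⁻¹ : List ℕ → Carrier
      N⁻¹ la = inv ⟪ P la , P la ⟫

      N⁻¹-inverse : ∀ {la} → IsPartition la → N⁻¹ la * ⟨ encS (P la) ∣ encS (P la) ⟩ ≈ 1#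
      N⁻¹-inverse {la} p = trans (*-congˡ (sym (pairing-encS (P la) (P la)))) (inv-inverse ⟪ P la , P la ⟫
        (λ e → norm≉0 p (trans (sym (pairing-encS (P la) (P la))) e)))

      N⁻¹≉0 : ∀ {la} → IsPartition la → ¬ (N⁻¹ la ≈ 0#)
      N⁻¹≉0 p e = 1≉0 (trans (sym (N⁻¹-inverse p)) (trans (*-congʳ e) (zeroˡ _)))

      adjoint : ∀ {la} → IsPartition la → ∀ a → ¬ (a ≈ 0#) →
        Σ Carrier λ b → ¬ (b ≈ 0#) × AdjointApp (a ⋆ dual P (compl la)) (dual P (rectOf la)) (b ⋆ dual P la)
      adjoint {la} p a a≉0 = finish (adjoint-scaled p a≉0 (N⁻¹≉0 p-mu) (N⁻¹≉0 p-R) (N⁻¹-inverse p))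
        where
        mu R : List ℕ
        mu = compl la
        R = rectOf la
        p-mu : IsPartition mu
        p-mu = complementIn-partition (headOr0 la) (length la) p
        p-R : IsPartition R
        p-R = ≡.subst IsPartition (≡.sym (rectOf≡rect p)) (rect-partition (length la) (headOr0 la))
        scaled : ∀ c ka → encS (c ⋆ dual P ka) ≡ c ⋆ N⁻¹ ka ⋆ encS (P ka)
        scaled c ka = ≡.trans (encS-⋆ c (dual P ka)) (≡.cong (c ⋆_) (encS-⋆ (N⁻¹ ka) (P ka)))
        finish : (Σ Carrier λ b → ¬ (b ≈ 0#) × (∀ k → ⟨ (a ⋆ N⁻¹ mu ⋆ encS (P mu)) ⊛ k ∣ N⁻¹ R ⋆ encS (P R) ⟩ ≈ ⟨ k ∣ b ⋆ N⁻¹ la ⋆ encS (P la) ⟩)) →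
          Σ Carrier λ b → ¬ (b ≈ 0#) × AdjointApp (a ⋆ dual P mu) (dual P R) (b ⋆ dual P la)
        finish (b , b≉0 , h) = b , b≉0 , λ k →
          trans (pairing-encS ((a ⋆ dual P mu) ⊠ k) (dual P R))
          (trans (reflexive (≡.cong₂ ⟨_∣_⟩ (≡.trans (encS-product (a ⋆ dual P mu) k) (≡.cong (_⊛ encS k) (scaled a mu))) (encS-⋆ (N⁻¹ R) (P R))))
          (trans (h (encS k))
          (trans (reflexive (≡.cong (⟨ encS k ∣_⟩) (≡.sym (scaled b la))))
          (sym (pairing-encS k (b ⋆ dual P la))))))

      -- The induction carries a nonzero multiple of Q_la, because every adjoint step introduces a
      -- further factor; the factor is inverted only at the end.
      NestedMultiple : List PSum → List ℕ → Set
      NestedMultiple fs la = Σ Carrier λ a → ¬ (a ≈ 0#) × Nested fs (a ⋆ dual P la)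

      rectangular : ∀ {la R} → la ≡ R → NestedMultiple (dual P R ∷ []) la
      rectangular {la} ≡.refl = 1# , 1≉0 , λ ν → trans (coefficientP-⋆ 1# (dual P la) ν) (*-identityˡ _)

      -- The inner value of the nested expression is a multiple of Q for the complement of `la`; its
      -- adjoint applied to Q of the rectangle of `la` yields a multiple of Q_la.
      extend : ∀ {f fs la} → IsPartition la → NestedMultiple (f ∷ fs) (compl la) → NestedMultiple (dual P (rectOf la) ∷ f ∷ fs) la
      extend {f} {fs} {la} p (a , a≉0 , below) = finish (adjoint p a a≉0)
        where
        finish : (Σ Carrier λ b → ¬ (b ≈ 0#) × AdjointApp (a ⋆ dual P (compl la)) (dual P (rectOf la)) (b ⋆ dual P la)) →
          NestedMultiple (dual P (rectOf la) ∷ f ∷ fs) la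
        finish (b , b≉0 , above) = b , b≉0 , a ⋆ dual P (compl la) , below , above

      nested-scaled : ∀ k la → IsPartition la → length (distinctParts la) ≡ suc k →
        NestedMultiple (map (dual P) (filtrationAux (suc k) la)) la
      nested-scaled k [] p ()
      nested-scaled zero la@(_ ∷ _) p e = rectangular {la} {rectOf la} (one-distinctPart⇒rectangle p e)
      nested-scaled (suc k) la@(_ ∷ _) p e = extend {dual P (rectOf (compl la))} {map (dual P) (filtrationAux k (compl (compl la)))} {la} p
        (nested-scaled k (compl la) (complementIn-partition (headOr0 la) (length la) p)
          (ℕP.suc-injective (≡.trans (≡.sym (distinctParts-compl-suc p)) e)))

      dual-nested : ∀ la → IsPartition la → la ≢ [] →
        Σ Carrier λ c → ¬ (c ≈ 0#) × Σ PSum λ g → Nested (map (dual P) (rectFiltration la)) g × dual P la ≈ᴾ c ⋆ g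
      dual-nested [] p ne = ⊥-elim (ne ≡.refl)
      dual-nested (r ∷ la) p ne = result (length (distinctParts (r ∷ la))) ≡.refl
        where
        Q : PSum
        Q = dual P (r ∷ la)
        result : ∀ n → length (distinctParts (r ∷ la)) ≡ n →
          Σ Carrier λ c → ¬ (c ≈ 0#) × Σ PSum λ g → Nested (map (dual P) (filtrationAux n (r ∷ la))) g × Q ≈ᴾ c ⋆ g
        result zero e with ≡.trans (≡.sym e) (≡.cong length (distinctParts-∷ p))
        ... | ()
        result (suc k) e with nested-scaled k (r ∷ la) p e
        ... | a , a≉0 , nest with inverse a a≉0
        -- The nested expression has the value a · Q_la, so the constant of the theorem is the
        -- inverse of `a`.
        ... | a⁻¹ , a⁻¹a = a⁻¹ , (λ z → 1≉0 (trans (sym a⁻¹a) (trans (*-congʳ z) (zeroˡ a)))) , a ⋆ Q , nest ,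
          λ ν → sym (trans (coefficientP-⋆ a⁻¹ (a ⋆ Q) ν)
            (trans (*-congˡ (coefficientP-⋆ a Q ν)) (trans (sym (*-assoc a⁻¹ a (coefficientP ν Q))) (trans (*-congʳ a⁻¹a) (*-identityˡ _)))))

-- Specialisation to ℚ(α)

open JackFunctions ratFunField using (Conventions; module PowerSums; _^′_)

powF-^ : ∀ n → powF αF n ≡ αF ^′ n
powF-^ zero = ≡.refl
powF-^ (suc n) = ≡.cong (αF *F_) (powF-^ n)

conventions : Conventions
conventions = record
  { nat = ℕtoF ; nat-ι = ι-ℕ ; power = powF αF ; power-^ = powF-^ ; inv = invF ; inv-inverse = invF-inverse }

open PowerSums conventions

JackFamily-from : ∀ P → IsJackFamily P → JackFamily P
JackFamily-from P (monic , lower , orthogonal) =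
  (λ la p → ≈F⇒ᶜ {coeffM la (P la)} {1F} (monic la p)) ,
  (λ la μ p q ne nd → ≈F⇒ᶜ {coeffM μ (P la)} {0F} (lower la μ p q ne nd)) ,
  (λ la μ p q ne → ≈F⇒ᶜ {⟨ P la , P μ ⟩} {0F} (orthogonal la μ p q ne))

Nested-to : ∀ fs g → Nested fs g → NestedAdj fs g
Nested-to (f ∷ []) g h = λ ν → ᶜ⇒≈F {coeffP ν g} {coeffP ν f} (h ν)
Nested-to (f ∷ f′ ∷ fs) g (g′ , h , adj) =
  g′ , Nested-to (f′ ∷ fs) g′ h , λ k → ᶜ⇒≈F {⟨ g′ *S k , f ⟩} {⟨ k , g ⟩} (adj k)

theorem4p21 : (P : List ℕ → Sym) → IsJackFamily P →
    (la : List ℕ) → IsPartition la → la ≢ [] →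
    Σ RatFun λ c → (¬ (c ≈F 0F)) ×
      Σ Sym λ g → NestedAdj (map (Qof P) (rectFiltration la)) g × (Qof P la ≈S c ·S g)
theorem4p21 P jack la p ne = transport (Filtration.dual-nested P (JackFamily-from P jack) la p ne)
  where
  transport : (Σ RatFun λ c → ¬ (c ≈ᶜ 0F) × Σ Sym λ g → Nested (map (dual P) (rectFiltration la)) g × dual P la ≈ᴾ c ·S g) →
    Σ RatFun λ c → ¬ (c ≈F 0F) × Σ Sym λ g → NestedAdj (map (Qof P) (rectFiltration la)) g × Qof P la ≈S c ·S g
  transport (c , c≉0 , g , nest , e) =
    c , (λ z → c≉0 (≈F⇒ᶜ {c} {0F} z)) , g , Nested-to (map (Qof P) (rectFiltration la)) g nest ,
    λ ν → ᶜ⇒≈F {coeffP ν (Qof P la)} {coeffP ν (c ·S g)} (e ν)
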